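{- The cusp forms $C_{(r,s)}(z)$ defined in the context are expressed in terms of eta quotients as follows. $$C_{(1,2)}(z)=0,\qquad C_{(1,3)}(z)=0,\qquad C_{(1,5)}(z)=\tfrac{576}{13}\,\eta[1^4,5^4](z),$$ $$C_{(1,7)}(z)=\tfrac{576}{5}\,\eta[1^5,2^{ -1},7^5,14^{ -1}](z)+\tfrac{2304}{5}\,\eta[1^2,2^2,7^2,14^2](z),$$ $$\begin{aligned}C_{(1,11)}(z)=&\tfrac{17280}{61}\,\eta[1^6,2^{ -2},11^6,22^{ -2}](z)+\tfrac{118656}{61}\,\eta[1^4,11^4](z)\\&+\tfrac{276480}{61}\,\eta[1^2,2^2,11^2,22^2](z)+\tfrac{276480}{61}\,\eta[2^4,22^4](z),\end{aligned}$$ $$C_{(2,3)}(z)=-\tfrac{144}{5}\,\eta[1^2,2^2,3^2,6^2](z),$$ $$C_{(2,5)}(z)=\tfrac{48}{13}\,\eta[1^{ -2},2^8,5^2](z)-\tfrac{6000}{13}\,\eta[1^2,5^{ -2},10^8](z),$$ $$\begin{aligned}C_{(2,7)}(z)=&\tfrac{288}{5}\,\eta[1^5,2^{ -1},7^5,14^{ -1}](z)-\tfrac{336}{25}\,\eta[1^{ -2},2^6,7^6,14^{ -2}](z)\\&+\tfrac{8064}{25}\,\eta[1^2,2^2,7^2,14^2](z)-\tfrac{5136}{25}\,\eta[1^6,2^{ -2},7^{ -2},14^6](z),\end{aligned}$$ $$\begin{aligned}C_{(3,5)}(z)=&\tfrac{108}{13}\,\eta[1^{11},2^{ -5},3^{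 -5},5^{ -5},6^{3},10^{3},15^{11},30^{ -5}](z)\\ &-\tfrac{1584}{13}\,\eta[1^{2},2^{ -3},3^{ -4},5^{ -3},6^{9},10^{4},15^{7},30^{ -4}](z)\\ &-\tfrac{2376}{13}\,\eta[1^{4},2^{ -3},3^{ -2},5^{2},6^{5},10^{1},15^{0},30^{1}](z)\\ &-\tfrac{5832}{13}\,\eta[1^{1},2^{ -2},3^{ -3},5^{2},6^{8},10^{ -1},15^{2},30^{1}](z)\\ &+\tfrac{11448}{13}\,\eta[1^{2},2^{ -2},3^{0},5^{ -2},6^{2},10^{6},15^{0},30^{2}](z)\\ &+\tfrac{33264}{13}\,\eta[1^{1},2^{2},3^{4},5^{3},6^{ -3},10^{ -2},15^{ -4},30^{7}](z)\\ &+\tfrac{10080}{13}\,\eta[1^{1},2^{0},3^{ -1},5^{ -3},6^{0},10^{2},15^{7},30^{2}](z)\\ &+\tfrac{83520}{13}\,\eta[1^{1},2^{ -1},3^{ -2},5^{1},6^{4},10^{ -1},15^{0},30^{6}](z)\\ &+\tfrac{145584}{13}\,\eta[1^{0},2^{1},3^{0},5^{2},6^{ -1},10^{ -3},15^{2},30^{7}](z)\\ &-\tfrac{117720}{13}\,\eta[1^{ -2},2^{3},3^{5},5^{3},6^{ -4},10^{ -4},15^{ -4},30^{11}](z)\\ &-1944\,\eta[1^{1},2^{0},3^{1},5^{3},6^{0},10^{ -4},15^{ -5},30^{12}](z)\\ &+\tfrac{158688}{13}\,\eta[1^{0},2^{1},3^{1},5^{2},6^{ -2},10^{ -3},15^{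 -3},30^{12}](z)\\ &+\tfrac{216000}{13}\,\eta[1^{ -1},2^{3},3^{1},5^{3},6^{ -1},10^{ -5},15^{ -7},30^{15}](z)\\ &+\tfrac{316224}{13}\,\eta[1^{0},2^{1},3^{2},5^{2},6^{ -3},10^{ -3},15^{ -8},30^{17}](z),\end{aligned}$$ $$C_{(1,6)}(z)=\tfrac{288}{5}\,\eta[1^2,2^2,3^2,6^2](z),$$ $$C_{(1,10)}(z)=\tfrac{2976}{13}\,\eta[1^{ -1},2^5,5^5,10^{ -1}](z)-\tfrac{480}{13}\,\eta[1^5,2^{ -1},5^{ -1},10^5](z),$$ $$\begin{aligned}C_{(1,14)}(z)=&\tfrac{10272}{25}\,\eta[1^{ -2},2^6,7^6,14^{ -2}](z)-\tfrac{4608}{25}\,\eta[1^2,2^2,7^2,14^2](z)\\&+\tfrac{672}{25}\,\eta[1^6,2^{ -2},7^{ -2},14^6](z),\end{aligned}$$ $$\begin{aligned}C_{(1,15)}(z)=&\tfrac{5976}{13}\,\eta[1^{11},2^{ -5},3^{ -5},5^{ -5},6^{3},10^{3},15^{11},30^{ -5}](z)\\ &+\tfrac{74592}{13}\,\eta[1^{2},2^{ -3},3^{ -4},5^{ -3},6^{9},10^{4},15^{7},30^{ -4}](z)\\ &-\tfrac{137808}{13}\,\eta[1^{4},2^{ -3},3^{ -2},5^{2},6^{5},10^{1},15^{0},30^{1}](z)\\ &-\tfrac{85968}{13}\,\eta[1^{1},2^{ -2},3^{ -3},5^{2},6^{8},10^{ -1},15^{2},30^{1}](z)\\ &+\tfrac{153072}{13}\,\eta[1^{2},2^{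 -2},3^{0},5^{ -2},6^{2},10^{6},15^{0},30^{2}](z)\\ &-\tfrac{617184}{13}\,\eta[1^{1},2^{2},3^{4},5^{3},6^{ -3},10^{ -2},15^{ -4},30^{7}](z)\\ &+\tfrac{1513728}{13}\,\eta[1^{1},2^{0},3^{ -1},5^{ -3},6^{0},10^{2},15^{7},30^{2}](z)\\ &-\tfrac{2807424}{13}\,\eta[1^{1},2^{ -1},3^{ -2},5^{1},6^{4},10^{ -1},15^{0},30^{6}](z)\\ &-\tfrac{943200}{13}\,\eta[1^{0},2^{1},3^{0},5^{2},6^{ -1},10^{ -3},15^{2},30^{7}](z)\\ &+135504\,\eta[1^{ -2},2^{3},3^{5},5^{3},6^{ -4},10^{ -4},15^{ -4},30^{11}](z)\\ &+\tfrac{3255696}{13}\,\eta[1^{1},2^{0},3^{1},5^{3},6^{0},10^{ -4},15^{ -5},30^{12}](z)\\ &-\tfrac{3409344}{13}\,\eta[1^{0},2^{1},3^{1},5^{2},6^{ -2},10^{ -3},15^{ -3},30^{12}](z)\\ &+\tfrac{586368}{13}\,\eta[1^{ -1},2^{3},3^{1},5^{3},6^{ -1},10^{ -5},15^{ -7},30^{15}](z)\\ &-\tfrac{10461312}{13}\,\eta[1^{0},2^{1},3^{2},5^{2},6^{ -3},10^{ -3},15^{ -8},30^{17}](z).\end{aligned}$$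
   Context: Here $z$ lies in the upper half plane and $q=e^{2\pi i z}$. The Dedekind eta function is $\eta(z)=e^{\pi i z/12}\prod_{n=1}^{\infty}(1-e^{2\pi i n z})$. Eta quotients are written $\eta[\delta_1^{r_1},\dots,\delta_m^{r_m}](z)=\prod_{j=1}^m\eta(\delta_jz)^{r_j}$, where inside the brackets $\delta^{r}$ is formal notation (base $\delta$ a positive integer, exponent $r\in\mathbb{Z}$), not a power to be evaluated. With $\sigma_k(n)=\sum_{d\mid n}d^k$ and $\sigma=\sigma_1$, let $E_2(z)=1-24\sum_{n\ge1}\sigma(n)q^n$, $E_4(z)=1+240\sum_{n\ge1}\sigma_3(n)q^n$, and $L_d(z)=E_2(z)-d\,E_2(dz)$ for $d\in\mathbb{N}$. For $p$ prime and $p_1\neq p_2$ primes, the cusp forms $C_{(1,p)}\in S_4(\Gamma_0(p))$ and $C_{(p_1,p_2)},C_{(1,p_1p_2)}\in S_4(\Gamma_0(p_1p_2))$ (weight 4 cusp forms) are those determined by $$(L_p(z))^2=\frac{(p-1)^2}{p^2+1}E_4(z)+\frac{p^2(p-1)^2}{p^2+1}E_4(pz)+C_{(1,p)}(z),$$ $$\begin{aligned}L_{p_1}(z)L_{p_2}(z)=&\frac{(p_1^2-p_1+1)(p_2^2-p_2+1)}{(p_1^2+1)(p_2^2+1)}E_4(z)-\frac{p_1^3(p_2^2-p_2+1)}{(p_1^2+1)(p_2^2+1)}E_4(p_1z)\\&-\frac{p_2^3(p_1^2-p_1+1)}{(p_1^2+1)(p_2^2+1)}E_4(p_2z)+\frac{p_1^3p_2^3}{(p_1^2+1)(p_2^2+1)}E_4(p_1p_2z)+C_{(p_1,p_2)}(z),\end{aligned}$$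 $$\begin{aligned}(L_{p_1p_2}(z))^2=&\left(1-\frac{2p_1p_2}{(p_1^2+1)(p_2^2+1)}\right)E_4(z)-\frac{2p_1^3p_2}{(p_1^2+1)(p_2^2+1)}E_4(p_1z)\\&-\frac{2p_1p_2^3}{(p_1^2+1)(p_2^2+1)}E_4(p_2z)+\left(p_1^2p_2^2-\frac{2p_1^3p_2^3}{(p_1^2+1)(p_2^2+1)}\right)E_4(p_1p_2z)+C_{(1,p_1p_2)}(z).\end{aligned}$$ (So $C_{(1,6)},C_{(1,10)},C_{(1,14)},C_{(1,15)}$ come from the third identity with $\{p_1,p_2\}=\{2,3\},\{2,5\},\{2,7\},\{3,5\}$, respectively.) -}

module Defs where

open import Data.Integer.Base as ℤ using (ℤ; +_; -[1+_])
open import Data.List.Base using (List; []; _∷_; map; filter; upTo)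
open import Data.Nat.Base as ℕ using (ℕ; zero; suc; _≥_; _⊔_; _!; NonZero)
open import Data.Nat.Divisibility using (_∣?_)
open import Data.Nat.ListAction using (sum)
import Data.Nat.Properties as ℕₚ
open import Data.Product.Base using (∃; _×_; _,_)
open import Data.Rational.Base as ℚ using (ℚ; 0ℚ; 1ℚ; ½; _/_; ∣_∣; Positive)
import Data.Rational.Properties as ℚₚ
open import Data.Rational.Solver using (module +-*-Solver)
open import Relation.Binary.PropositionalEquality using (_≡_; refl; sym; trans; cong; cong₂; subst)

IsCauchy : (ℕ → ℚ) → Set
IsCauchy x = ∀ ε → 0ℚ ℚ.< ε → ∃ λ N → ∀ m n → m ≥ N → n ≥ N → ∣ x m ℚ.- x n ∣ ℚ.< ε

-- Elements are representatives; equality of reals is _≈ℝ_ below.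
record ℝ : Set where
  constructor mkℝ
  field
    seq    : ℕ → ℚ
    cauchy : IsCauchy seq

open ℝ public

infix 4 _≈ℝ_ _<ℝ_

_≈ℝ_ : ℝ → ℝ → Set
x ≈ℝ y = ∀ ε → 0ℚ ℚ.< ε → ∃ λ N → ∀ n → n ≥ N → ∣ seq x n ℚ.- seq y n ∣ ℚ.< ε

_<ℝ_ : ℝ → ℝ → Set
x <ℝ y = ∃ λ ε → 0ℚ ℚ.< ε × ∃ λ N → ∀ n → n ≥ N → seq x n ℚ.+ ε ℚ.≤ seq y n

private
  open +-*-Solver using (solve; _:+_; _:*_; _:-_; _:=_)

  halves : ∀ ε → ½ ℚ.* ε ℚ.+ ½ ℚ.* ε ≡ ε
  halves ε = trans (sym (ℚₚ.*-distribʳ-+ ε ½ ½)) (ℚₚ.*-identityˡ ε)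

  half-pos : ∀ {ε} → 0ℚ ℚ.< ε → 0ℚ ℚ.< ½ ℚ.* ε
  half-pos {ε} 0<ε = subst (ℚ._< ½ ℚ.* ε) (ℚₚ.*-zeroʳ ½) (ℚₚ.*-monoʳ-<-pos ½ 0<ε)

  self-diff : ∀ x → x ℚ.- x ≡ 0ℚ
  self-diff = ℚₚ.+-inverseʳ

  const-cauchy : ∀ q → IsCauchy (λ _ → q)
  const-cauchy q ε 0<ε =
    0 , λ _ _ _ _ → subst (λ d → ∣ d ∣ ℚ.< ε) (sym (self-diff q)) 0<ε

  +-cauchy : ∀ x y → IsCauchy x → IsCauchy y → IsCauchy (λ n → x n ℚ.+ y n)
  +-cauchy x y cx cy ε 0<ε
    with cx (½ ℚ.* ε) (half-pos 0<ε) | cy (½ ℚ.* ε) (half-pos 0<ε)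
  ... | M , hx | N , hy = M ⊔ N , λ m n m≥ n≥ →
    let open ℚₚ.≤-Reasoning in begin-strict
    ∣ (x m ℚ.+ y m) ℚ.- (x n ℚ.+ y n) ∣
      ≡⟨ cong ∣_∣ (solve 4 (λ a b c d → (a :+ b) :- (c :+ d) := (a :- c) :+ (b :- d))
                     refl (x m) (y m) (x n) (y n)) ⟩
    ∣ (x m ℚ.- x n) ℚ.+ (y m ℚ.- y n) ∣
      ≤⟨ ℚₚ.∣p+q∣≤∣p∣+∣q∣ (x m ℚ.- x n) (y m ℚ.- y n) ⟩
    ∣ x m ℚ.- x n ∣ ℚ.+ ∣ y m ℚ.- y n ∣
      <⟨ ℚₚ.+-mono-< (hx m n (ℕₚ.m⊔n≤o⇒m≤o M N m≥) (ℕₚ.m⊔n≤o⇒m≤o M N n≥))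
                     (hy m n (ℕₚ.m⊔n≤o⇒n≤o M N m≥) (ℕₚ.m⊔n≤o⇒n≤o M N n≥)) ⟩
    ½ ℚ.* ε ℚ.+ ½ ℚ.* ε
      ≡⟨ halves ε ⟩
    ε ∎

  neg-cauchy : ∀ x → IsCauchy x → IsCauchy (λ n → ℚ.- x n)
  neg-cauchy x cx ε 0<ε with cx ε 0<ε
  ... | N , h = N , λ m n m≥ n≥ →
    subst (ℚ._< ε)
      (trans (sym (ℚₚ.∣-p∣≡∣p∣ (x m ℚ.- x n)))
             (cong ∣_∣ (ℚₚ.neg-distrib-+ (x m) (ℚ.- x n))))
      (h m n m≥ n≥)

  bounded : ∀ x → IsCauchy x →
            ∃ λ B → Positive B × ∃ λ N → ∀ n → n ≥ N → ∣ x n ∣ ℚ.≤ B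
  bounded x cx with cx 1ℚ (ℚₚ.positive⁻¹ 1ℚ)
  ... | N , h =
    1ℚ ℚ.+ ∣ x N ∣
    , ℚ.positive (ℚₚ.+-mono-<-≤ (ℚₚ.positive⁻¹ 1ℚ) (ℚₚ.0≤∣p∣ (x N)))
    , N , λ n n≥ → let open ℚₚ.≤-Reasoning in begin
    ∣ x n ∣
      ≡⟨ cong ∣_∣ (solve 2 (λ a b → a := (a :- b) :+ b) refl (x n) (x N)) ⟩
    ∣ (x n ℚ.- x N) ℚ.+ x N ∣
      ≤⟨ ℚₚ.∣p+q∣≤∣p∣+∣q∣ (x n ℚ.- x N) (x N) ⟩
    ∣ x n ℚ.- x N ∣ ℚ.+ ∣ x N ∣
      ≤⟨ ℚₚ.+-monoˡ-≤ ∣ x N ∣ (ℚₚ.<⇒≤ (h n N n≥ ℕₚ.≤-refl)) ⟩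
    1ℚ ℚ.+ ∣ x N ∣ ∎

  share : ∀ {ε B} → 0ℚ ℚ.< ε → Positive B →
          ∃ λ δ → 0ℚ ℚ.< δ × B ℚ.* δ ≡ ½ ℚ.* ε
  share {ε} {B} 0<ε B>0 =
    ½ε ℚ.* B⁻¹
    , ℚₚ.positive⁻¹ (½ε ℚ.* B⁻¹) ⦃ ℚₚ.pos*pos⇒pos ½ε ⦃ ℚ.positive (half-pos 0<ε) ⦄ B⁻¹ ⦃ ℚₚ.1/pos⇒pos B ⦃ B>0 ⦄ ⦄ ⦄
    , trans (solve 3 (λ b e c → b :* (e :* c) := e :* (b :* c)) refl B ½ε B⁻¹)
        (trans (cong (½ε ℚ.*_) (ℚₚ.*-inverseʳ B ⦃ ℚₚ.pos⇒nonZero B ⦃ B>0 ⦄ ⦄))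
          (ℚₚ.*-identityʳ ½ε))
    where
    ½ε = ½ ℚ.* ε
    B⁻¹ = (ℚ.1/ B) ⦃ ℚₚ.pos⇒nonZero B ⦃ B>0 ⦄ ⦄

  mul-< : ∀ {a b δ B} → Positive B → a ℚ.≤ B → 0ℚ ℚ.≤ b → b ℚ.< δ →
          a ℚ.* b ℚ.< B ℚ.* δ
  mul-< {a} {b} {δ} {B} B>0 a≤B 0≤b b<δ = ℚₚ.≤-<-trans
    (ℚₚ.*-monoʳ-≤-nonNeg b ⦃ ℚ.nonNegative 0≤b ⦄ a≤B)
    (ℚₚ.*-monoʳ-<-pos B ⦃ B>0 ⦄ b<δ)

  *-diff : ∀ a b c d → a ℚ.* b ℚ.- c ℚ.* d ≡ a ℚ.* (b ℚ.- d) ℚ.+ d ℚ.* (a ℚ.- c)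
  *-diff = solve 4 (λ a b c d → a :* b :- c :* d := a :* (b :- d) :+ d :* (a :- c)) refl

  *-close : ∀ {ε A B α β} a b c d → Positive A → Positive B →
            A ℚ.* α ≡ ½ ℚ.* ε → B ℚ.* β ≡ ½ ℚ.* ε →
            ∣ a ∣ ℚ.≤ A → ∣ d ∣ ℚ.≤ B → ∣ b ℚ.- d ∣ ℚ.< α → ∣ a ℚ.- c ∣ ℚ.< β →
            ∣ a ℚ.* b ℚ.- c ℚ.* d ∣ ℚ.< ε
  *-close {ε} {A} {B} {α} {β} a b c d A>0 B>0 Aα≡ Bβ≡ a≤A d≤B bd<α ac<β = begin-strict
    ∣ a ℚ.* b ℚ.- c ℚ.* d ∣
      ≡⟨ cong ∣_∣ (*-diff a b c d) ⟩
    ∣ a ℚ.* (b ℚ.- d) ℚ.+ d ℚ.* (a ℚ.- c) ∣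
      ≤⟨ ℚₚ.∣p+q∣≤∣p∣+∣q∣ (a ℚ.* (b ℚ.- d)) (d ℚ.* (a ℚ.- c)) ⟩
    ∣ a ℚ.* (b ℚ.- d) ∣ ℚ.+ ∣ d ℚ.* (a ℚ.- c) ∣
      ≡⟨ cong₂ ℚ._+_ (ℚₚ.∣p*q∣≡∣p∣*∣q∣ a (b ℚ.- d)) (ℚₚ.∣p*q∣≡∣p∣*∣q∣ d (a ℚ.- c)) ⟩
    ∣ a ∣ ℚ.* ∣ b ℚ.- d ∣ ℚ.+ ∣ d ∣ ℚ.* ∣ a ℚ.- c ∣
      <⟨ ℚₚ.+-mono-< (mul-< A>0 a≤A (ℚₚ.0≤∣p∣ (b ℚ.- d)) bd<α)
                     (mul-< B>0 d≤B (ℚₚ.0≤∣p∣ (a ℚ.- c)) ac<β) ⟩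
    A ℚ.* α ℚ.+ B ℚ.* β
      ≡⟨ cong₂ ℚ._+_ Aα≡ Bβ≡ ⟩
    ½ ℚ.* ε ℚ.+ ½ ℚ.* ε
      ≡⟨ halves ε ⟩
    ε ∎
    where open ℚₚ.≤-Reasoning

  *-cauchy : ∀ x y → IsCauchy x → IsCauchy y → IsCauchy (λ n → x n ℚ.* y n)
  *-cauchy x y cx cy ε 0<ε =
    let A , A>0 , Nx , bx = bounded x cx
        B , B>0 , Ny , by = bounded y cy
        α , 0<α , Aα≡     = share {ε} {A} 0<ε A>0
        β , 0<β , Bβ≡     = share {ε} {B} 0<ε B>0
        Mx , hx           = cx β 0<β
        My , hy           = cy α 0<α
    in (Nx ⊔ Ny) ⊔ (Mx ⊔ My) , λ m n m≥ n≥ →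
    *-close {ε} {A} {B} {α} {β} (x m) (y m) (x n) (y n) A>0 B>0 Aα≡ Bβ≡
      (bx m (ℕₚ.m⊔n≤o⇒m≤o Nx Ny (ℕₚ.m⊔n≤o⇒m≤o (Nx ⊔ Ny) (Mx ⊔ My) m≥)))
      (by n (ℕₚ.m⊔n≤o⇒n≤o Nx Ny (ℕₚ.m⊔n≤o⇒m≤o (Nx ⊔ Ny) (Mx ⊔ My) n≥)))
      (hy m n (ℕₚ.m⊔n≤o⇒n≤o Mx My (ℕₚ.m⊔n≤o⇒n≤o (Nx ⊔ Ny) (Mx ⊔ My) m≥))
              (ℕₚ.m⊔n≤o⇒n≤o Mx My (ℕₚ.m⊔n≤o⇒n≤o (Nx ⊔ Ny) (Mx ⊔ My) n≥)))
      (hx m n (ℕₚ.m⊔n≤o⇒m≤o Mx My (ℕₚ.m⊔n≤o⇒n≤o (Nx ⊔ Ny) (Mx ⊔ My) m≥))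
              (ℕₚ.m⊔n≤o⇒m≤o Mx My (ℕₚ.m⊔n≤o⇒n≤o (Nx ⊔ Ny) (Mx ⊔ My) n≥)))

infixl 6 _+ℝ_ _-ℝ_
infixl 7 _*ℝ_
infix  8 -ℝ_

fromℚ : ℚ → ℝ
fromℚ q .seq _  = q
fromℚ q .cauchy = const-cauchy q

_+ℝ_ : ℝ → ℝ → ℝ
(x +ℝ y) .seq n  = seq x n ℚ.+ seq y n
(x +ℝ y) .cauchy = +-cauchy (seq x) (seq y) (cauchy x) (cauchy y)

-ℝ_ : ℝ → ℝ
(-ℝ x) .seq n  = ℚ.- seq x n
(-ℝ x) .cauchy = neg-cauchy (seq x) (cauchy x)

_-ℝ_ : ℝ → ℝ → ℝ
x -ℝ y = x +ℝ (-ℝ y)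

_*ℝ_ : ℝ → ℝ → ℝ
(x *ℝ y) .seq n  = seq x n ℚ.* seq y n
(x *ℝ y) .cauchy = *-cauchy (seq x) (seq y) (cauchy x) (cauchy y)

record ℂ : Set where
  constructor _+i_
  field
    re : ℝ
    im : ℝ

open ℂ public

infix  4 _≈_ _⟶_
infixl 6 _+_ _-_
infixl 7 _*_ _·_
infixr 8 _^_

_≈_ : ℂ → ℂ → Set
w ≈ v = re w ≈ℝ re v × im w ≈ℝ im v

_+_ _-_ _*_ : ℂ → ℂ → ℂ
(a +i b) + (c +i d) = (a +ℝ c) +i (b +ℝ d)
(a +i b) - (c +i d) = (a -ℝ c) +i (b -ℝ d)
(a +i b) * (c +i d) = (a *ℝ c -ℝ b *ℝ d) +i (a *ℝ d +ℝ b *ℝ c)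

0ℂ 1ℂ 𝕚 : ℂ
0ℂ = fromℚ 0ℚ +i fromℚ 0ℚ
1ℂ = fromℚ 1ℚ +i fromℚ 0ℚ
𝕚  = fromℚ 0ℚ +i fromℚ 1ℚ

ofReal : ℝ → ℂ
ofReal x = x +i fromℚ 0ℚ

_·_ : ℚ → ℂ → ℂ
c · (a +i b) = (fromℚ c *ℝ a) +i (fromℚ c *ℝ b)

_^_ : ℂ → ℕ → ℂ
w ^ zero  = 1ℂ
w ^ suc n = w * w ^ n

∣_∣² : ℂ → ℝ
∣ a +i b ∣² = a *ℝ a +ℝ b *ℝ b

_⟶_ : (ℕ → ℂ) → ℂ → Set
a ⟶ l = ∀ ε → 0ℚ ℚ.< ε → ∃ λ N → ∀ n → n ≥ N → ∣ a n - l ∣² <ℝ fromℚ (ε ℚ.* ε)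

-- ∑ N a = a 0 + ⋯ + a (N - 1), and similarly for ∏.
∑ ∏ : ℕ → (ℕ → ℂ) → ℂ
∑ zero    a = 0ℂ
∑ (suc N) a = ∑ N a + a N
∏ zero    a = 1ℂ
∏ (suc N) a = ∏ N a * a N

record ℂˣ : Set where
  field
    value     : ℂ
    inverse   : ℂ
    isInverse : value * inverse ≈ 1ℂ

open ℂˣ public

_^ᶻ_ : ℂˣ → ℤ → ℂ
w ^ᶻ (+ n)    = value w ^ n
w ^ᶻ -[1+ n ] = inverse w ^ suc n

record ℍ : Set where
  constructor mkℍ
  field
    point  : ℂ
    im-pos : fromℚ 0ℚ <ℝ im point

open ℍ public using (point)

private
  scale-pos : ∀ d .⦃ _ : NonZero d ⦄ y → fromℚ 0ℚ <ℝ y → fromℚ 0ℚ <ℝ fromℚ (+ d / 1) *ℝ y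
  scale-pos d y (ε , 0<ε , N , h) =
    c ℚ.* ε
    , ℚₚ.positive⁻¹ (c ℚ.* ε) ⦃ ℚₚ.pos*pos⇒pos c ε ⦃ ℚ.positive 0<ε ⦄ ⦄
    , N , λ n n≥ → subst (ℚ._≤ c ℚ.* seq y n) (sym (ℚₚ.+-identityˡ (c ℚ.* ε)))
        (ℚₚ.*-monoˡ-≤-nonNeg c ⦃ ℚₚ.pos⇒nonNeg c ⦄
          (subst (ℚ._≤ seq y n) (ℚₚ.+-identityˡ ε) (h n n≥)))
    where
    c = + d / 1
    instance
      c>0 : Positive c
      c>0 = ℚₚ.normalize-pos d 1

infixr 8 _⊙_

_⊙_ : (d : ℕ) .⦃ _ : NonZero d ⦄ → ℍ → ℍ
d ⊙ mkℍ z 0<y = mkℍ ((+ d / 1) · z) (scale-pos d (im z) 0<y)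

σ : ℕ → ℕ → ℕ
σ k n = sum (map (ℕ._^ k) (filter (_∣? n) (map suc (upTo n))))

-- Limits are relations here, so π, exp, E₂, E₄ and η are given as values or
-- functions together with the limit that defines them; each field of data is
-- thereby unique up to _≈_.  Negative powers of η make sense because η has no
-- zero on ℍ, which is recorded by letting η take values in ℂˣ.
record ModularFunctions : Set where
  field
    π    : ℝ
    isπ  : (λ N → ∑ N (λ k → (+ 4 ℤ.* ℤ.-1ℤ ℤ.^ k / suc (2 ℕ.* k)) · 1ℂ)) ⟶ ofReal π

    exp   : ℂ → ℂ
    isExp : ∀ w → (λ N → ∑ N (λ k → ((+ 1 / (k !)) ⦃ ℕₚ._!≢0 k ⦄) · w ^ k)) ⟶ exp w

  πi : ℂ
  πi = ofReal π * 𝕚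

  q : ℍ → ℂ
  q z = exp ((+ 2 / 1) · (πi * point z))

  field
    E₂   : ℍ → ℂ
    isE₂ : ∀ z → (λ N → 1ℂ - (+ 24 / 1) · ∑ N (λ k → (+ σ 1 (suc k) / 1) · q z ^ suc k)) ⟶ E₂ z

    E₄   : ℍ → ℂ
    isE₄ : ∀ z → (λ N → 1ℂ + (+ 240 / 1) · ∑ N (λ k → (+ σ 3 (suc k) / 1) · q z ^ suc k)) ⟶ E₄ z

    η    : ℍ → ℂˣ
    isη  : ∀ z → (λ N → exp ((+ 1 / 12) · (πi * point z)) *
                        ∏ N (λ k → 1ℂ - exp ((+ (2 ℕ.* suc k) / 1) · (πi * point z))))
                 ⟶ value (η z)

infix 9 _↑_

-- The formal symbol δʳ inside the brackets of an eta quotient.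
record EtaFactor : Set where
  constructor _↑_
  field
    δ       : ℕ
    .⦃ δ≢0 ⦄ : NonZero δ
    r       : ℤ

module Forms (F : ModularFunctions) where
  open ModularFunctions F public

  η[_] : List EtaFactor → ℍ → ℂ
  η[ [] ]         z = 1ℂ
  η[ δ ↑ r ∷ fs ] z = (η (δ ⊙ z) ^ᶻ r) * η[ fs ] z

  L : (d : ℕ) .⦃ _ : NonZero d ⦄ → ℍ → ℂ
  L d z = E₂ z - (+ d / 1) · E₂ (d ⊙ z)

  -- C[1, p ], C[ p₁ , p₂ ] and C[1, p₁ ∙ p₂ ] are C₍₁,p₎, C₍p₁,p₂₎ and C₍₁,p₁p₂₎.
  -- Each is the difference that its defining identity prescribes, meant for p
  -- prime and p₁ ≠ p₂ primes; the formulas themselves do not need primality.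

  C[1,_] : (p : ℕ) .⦃ _ : NonZero p ⦄ → ℍ → ℂ
  C[1, p ] z =
    L p z ^ 2
    - ( c ((P ℤ.- + 1) ℤ.^ 2) · E₄ z
      + c (P ℤ.^ 2 ℤ.* (P ℤ.- + 1) ℤ.^ 2) · E₄ (p ⊙ z) )
    where
    P = + p
    c : ℤ → ℚ
    c n = n / suc (p ℕ.^ 2)

  module _ (p₁ p₂ : ℕ) .⦃ _ : NonZero p₁ ⦄ .⦃ _ : NonZero p₂ ⦄ where
    private
      P₁ = + p₁
      P₂ = + p₂

      c : ℤ → ℚ
      c n = n / (suc (p₁ ℕ.^ 2) ℕ.* suc (p₂ ℕ.^ 2))

      E₄₁ E₄₂ E₄₁₂ : ℍ → ℂ
      E₄₁  z = E₄ (p₁ ⊙ z)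
      E₄₂  z = E₄ (p₂ ⊙ z)
      E₄₁₂ z = E₄ ((p₁ ℕ.* p₂) ⊙ z) where instance _ = ℕₚ.m*n≢0 p₁ p₂

    C[_,_] : ℍ → ℂ
    C[_,_] z =
      L p₁ z * L p₂ z
      - ( c ((P₁ ℤ.^ 2 ℤ.- P₁ ℤ.+ + 1) ℤ.* (P₂ ℤ.^ 2 ℤ.- P₂ ℤ.+ + 1)) · E₄ z
        - c (P₁ ℤ.^ 3 ℤ.* (P₂ ℤ.^ 2 ℤ.- P₂ ℤ.+ + 1)) · E₄₁ z
        - c (P₂ ℤ.^ 3 ℤ.* (P₁ ℤ.^ 2 ℤ.- P₁ ℤ.+ + 1)) · E₄₂ z
        + c (P₁ ℤ.^ 3 ℤ.* P₂ ℤ.^ 3) · E₄₁₂ z )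

    C[1,_∙_] : ℍ → ℂ
    C[1,_∙_] z =
      L (p₁ ℕ.* p₂) z ^ 2
      - ( (1ℚ ℚ.- c (+ 2 ℤ.* P₁ ℤ.* P₂)) · E₄ z
        - c (+ 2 ℤ.* P₁ ℤ.^ 3 ℤ.* P₂) · E₄₁ z
        - c (+ 2 ℤ.* P₁ ℤ.* P₂ ℤ.^ 3) · E₄₂ z
        + ((P₁ ℤ.^ 2 ℤ.* P₂ ℤ.^ 2 / 1) ℚ.- c (+ 2 ℤ.* P₁ ℤ.^ 3 ℤ.* P₂ ℤ.^ 3)) · E₄₁₂ z )
      where instance _ = ℕₚ.m*n≢0 p₁ p₂

-- Numerals are overloaded only from here on: above, overloading would leave the
-- denominators of rationals unresolved when NonZero instances are searched for.
open import Agda.Builtin.FromNat using (Number; fromNat) public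
open import Agda.Builtin.FromNeg using (Negative; fromNeg) public
import Data.Integer.Literals as ℤLit
import Data.Nat.Literals as ℕLit
open import Data.Unit.Base using (tt) public

instance
  ℕ-number : Number ℕ
  ℕ-number = ℕLit.number

  ℤ-number : Number ℤ
  ℤ-number = ℤLit.number

  ℤ-negative : Negative ℤ
  ℤ-negative = ℤLit.negative

-- Fix a level N among 14, 22 and 30.  The proof needs no modular forms, only q-expansions
-- and the operator θ = q d/dq.  On a model Z² = W² f(t) of X₀(N), with t and W eta
-- quotients of weights 0 and 2, the series E₂(δz), E₄(δz), E₆(δz) for δ ∣ N and the
-- eta quotients are given by explicit polynomials in E₂(z), t, W and Z.  Ramanujan's
-- differential equations, which follow from elementary identities between sums over
-- the solutions of ax + by = n, express θ of the errors of these formulas as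
-- polynomials in E₂(z), t, W, Z and the errors, and every term contains an error.
-- Comparing lowest coefficients, n times the vector of n-th coefficients is a fixed
-- matrix times this vector, which for large n forces it to be 0.  So agreement of
-- finitely many coefficients, found by evaluation, proves the formulas, and from
-- them each identity of the theorem between q-expansions follows by arithmetic on
-- the curve.
--
-- It remains to sum the q-expansions at q = exp(2πi z).  That |q| < 1 is a
-- consequence of the convergence of the series of E₂(z), whose coefficients do not
-- tend to 0.  A radius g < 1 with |q| < g⁶ then makes all series absolutely
-- summable, so that Cauchy products, inverses and infinite products of series are
-- respected by summation.  An eta quotient of integral order ν is q^ν times the sum
-- of its power series because exp(πi z / 12) ^ 24 = q.
module Submission where

module PowerSeries where
  import Data.Integer.Properties as ℤₚ
  import Data.Nat.Properties as ℕₚ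
  import Data.Nat.Solver as ℕSolver
  open import Data.Bool.Base using (Bool; true; false; if_then_else_; _∧_; T)
  open import Data.Bool.ListAction using (all)
  open import Data.Empty using (⊥-elim)
  open import Data.Integer.Base using (ℤ; +_; -[1+_]; +0; 0ℤ; 1ℤ; -1ℤ; _+_; _*_; -_; _-_; ∣_∣)
  open import Data.Integer.Solver using (module +-*-Solver)
  open import Data.List.Base using (List; []; _∷_; length; foldr; map)
  open import Data.List.Properties using (∷-injective)
  open import Data.List.Relation.Binary.Pointwise using (Pointwise; []; _∷_)
  open import Data.List.Relation.Unary.All using (All; []; _∷_)
  open import Data.Nat.Base as ℕ using (ℕ; zero; suc; pred; _≡ᵇ_; _<ᵇ_; s≤s; z≤n)
  open import Data.Nat.DivMod using () renaming (_/_ to _div_)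
  open import Data.Nat.Induction using (<-rec)
  open import Data.Product.Base using (_×_; _,_; ∃; proj₁; proj₂)
  open import Data.Sum.Base using (inj₁; inj₂; [_,_]′)
  open import Data.Unit.Base using (⊤; tt)
  open import Function.Base using (_∘_)
  open import Relation.Binary.PropositionalEquality
  open import Relation.Nullary using (yes; no)
  open +-*-Solver using (solve; _:+_; _:*_; _:-_; :-_; _:=_; Polynomial) renaming (con to :con)

  infixl 6 _⊕_ _⊖_
  infixl 7 _⊛_

  Series : Set
  Series = ℕ → ℤ

  tail : Series → Series
  tail f = f ∘ suc

  const : ℤ → Series
  const c zero    = c
  const c (suc _) = 0ℤ

  shift : Series → Series
  shift f zero    = 0ℤ
  shift f (suc n) = f n

  _⊕_ _⊖_ _⊛_ : Series → Series → Series
  (f ⊕ g) n = f n + g n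
  (f ⊖ g) n = f n - g n
  (f ⊛ g) zero    = f 0 * g 0
  (f ⊛ g) (suc n) = f 0 * g (suc n) + (tail f ⊛ g) n

  θ : Series → Series
  θ f n = + n * f n

  ⊛-cong : ∀ {f f′ g g′} → f ≗ f′ → g ≗ g′ → f ⊛ g ≗ f′ ⊛ g′
  ⊛-cong p r zero    = cong₂ _*_ (p 0) (r 0)
  ⊛-cong p r (suc n) = cong₂ _+_ (cong₂ _*_ (p 0) (r (suc n))) (⊛-cong (p ∘ suc) r n)

  θ-cong : ∀ {f g} → f ≗ g → θ f ≗ θ g
  θ-cong p n = cong (+ n *_) (p n)

  ⊛-distribˡ-⊕ : ∀ f g h → f ⊛ (g ⊕ h) ≗ (f ⊛ g) ⊕ (f ⊛ h)
  ⊛-distribˡ-⊕ f g h zero    = ℤₚ.*-distribˡ-+ (f 0) (g 0) (h 0)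
  ⊛-distribˡ-⊕ f g h (suc n) = trans
    (cong (_+_ (f 0 * (g (suc n) + h (suc n)))) (⊛-distribˡ-⊕ (tail f) g h n))
    (solve 5 (λ a b c d e → a :* (b :+ c) :+ (d :+ e) := (a :* b :+ d) :+ (a :* c :+ e)) refl
      (f 0) (g (suc n)) (h (suc n)) ((tail f ⊛ g) n) ((tail f ⊛ h) n))

  ⊛-distribʳ-⊕ : ∀ h f g → (f ⊕ g) ⊛ h ≗ (f ⊛ h) ⊕ (g ⊛ h)
  ⊛-distribʳ-⊕ h f g zero    = ℤₚ.*-distribʳ-+ (h 0) (f 0) (g 0)
  ⊛-distribʳ-⊕ h f g (suc n) = trans
    (cong (_+_ ((f 0 + g 0) * h (suc n))) (⊛-distribʳ-⊕ h (tail f) (tail g) n))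
    (solve 5 (λ a b c d e → (a :+ b) :* c :+ (d :+ e) := (a :* c :+ d) :+ (b :* c :+ e)) refl
      (f 0) (g 0) (h (suc n)) ((tail f ⊛ h) n) ((tail g ⊛ h) n))

  0⊛ : ∀ g n → ((λ _ → 0ℤ) ⊛ g) n ≡ 0ℤ
  0⊛ g zero    = refl
  0⊛ g (suc n) = trans (ℤₚ.+-identityˡ _) (0⊛ g n)

  scale-⊛ : ∀ c f g n → ((λ k → c * f k) ⊛ g) n ≡ c * (f ⊛ g) n
  scale-⊛ c f g zero    = ℤₚ.*-assoc c (f 0) (g 0)
  scale-⊛ c f g (suc n) = trans
    (cong (_+_ ((c * f 0) * g (suc n))) (scale-⊛ c (tail f) g n))
    (solve 4 (λ a b d e → (a :* b) :* d :+ a :* e := a :* (b :* d :+ e)) refl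
      c (f 0) (g (suc n)) ((tail f ⊛ g) n))

  const-⊛ : ∀ c g n → (const c ⊛ g) n ≡ c * g n
  const-⊛ c g zero    = refl
  const-⊛ c g (suc n) = trans (cong (_+_ (c * g (suc n))) (0⊛ g n)) (ℤₚ.+-identityʳ _)

  ⊛-identityˡ : ∀ f → const 1ℤ ⊛ f ≗ f
  ⊛-identityˡ f n = trans (const-⊛ 1ℤ f n) (ℤₚ.*-identityˡ (f n))

  shift-⊛ : ∀ f g → shift f ⊛ g ≗ shift (f ⊛ g)
  shift-⊛ f g zero    = refl
  shift-⊛ f g (suc n) = ℤₚ.+-identityˡ _

  ⊛-suc : ∀ f g n → (f ⊛ g) (suc n) ≡ f (suc n) * g 0 + (f ⊛ tail g) n
  ⊛-suc f g zero    = ℤₚ.+-comm (f 0 * g 1) (f 1 * g 0)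
  ⊛-suc f g (suc n) = trans
    (cong (_+_ (f 0 * g (suc (suc n)))) (⊛-suc (tail f) g n))
    (solve 3 (λ a b c → a :+ (b :+ c) := b :+ (a :+ c)) refl
      (f 0 * g (suc (suc n))) (f (suc (suc n)) * g 0) ((tail f ⊛ tail g) n))

  ⊛-comm : ∀ f g → f ⊛ g ≗ g ⊛ f
  ⊛-comm f g zero    = ℤₚ.*-comm (f 0) (g 0)
  ⊛-comm f g (suc n) = trans (⊛-suc f g n)
    (cong₂ _+_ (ℤₚ.*-comm (f (suc n)) (g 0)) (⊛-comm f (tail g) n))

  ⊛-assoc : ∀ f g h → (f ⊛ g) ⊛ h ≗ f ⊛ (g ⊛ h)
  ⊛-assoc f g h zero    = ℤₚ.*-assoc (f 0) (g 0) (h 0)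
  ⊛-assoc f g h (suc n) = begin
    (f 0 * g 0) * h (suc n) + (((λ k → f 0 * g (suc k)) ⊕ (tail f ⊛ g)) ⊛ h) n
      ≡⟨ cong (_+_ ((f 0 * g 0) * h (suc n))) (⊛-distribʳ-⊕ h (λ k → f 0 * g (suc k)) (tail f ⊛ g) n) ⟩
    (f 0 * g 0) * h (suc n) + (((λ k → f 0 * g (suc k)) ⊛ h) n + ((tail f ⊛ g) ⊛ h) n)
      ≡⟨ cong (_+_ ((f 0 * g 0) * h (suc n))) (cong₂ _+_ (scale-⊛ (f 0) (tail g) h n) (⊛-assoc (tail f) g h n)) ⟩
    (f 0 * g 0) * h (suc n) + (f 0 * (tail g ⊛ h) n + (tail f ⊛ (g ⊛ h)) n)
      ≡⟨ solve 5 (λ a b c d e → (a :* b) :* c :+ (a :* d :+ e) := a :* (b :* c :+ d) :+ e) refl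
           (f 0) (g 0) (h (suc n)) ((tail g ⊛ h) n) ((tail f ⊛ (g ⊛ h)) n) ⟩
    f 0 * (g 0 * h (suc n) + (tail g ⊛ h) n) + (tail f ⊛ (g ⊛ h)) n ∎
    where open ≡-Reasoning

  θ-⊛ : ∀ f g → θ (f ⊛ g) ≗ (θ f ⊛ g) ⊕ (f ⊛ θ g)
  θ-⊛ f g zero    = sym (solve 2 (λ a b → (:con 0ℤ :* a) :* b :+ a :* (:con 0ℤ :* b) := :con 0ℤ :* (a :* b)) refl (f 0) (g 0))
  θ-⊛ f g (suc n) = begin
    + suc n * (f 0 * g (suc n) + (tail f ⊛ g) n)
      ≡⟨ cong (λ s → s * (f 0 * g (suc n) + (tail f ⊛ g) n)) (ℤₚ.pos-+ 1 n) ⟩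
    (1ℤ + + n) * (f 0 * g (suc n) + (tail f ⊛ g) n)
      ≡⟨ solve 4 (λ s a b c → (:con 1ℤ :+ s) :* (a :* b :+ c) := a :* ((:con 1ℤ :+ s) :* b) :+ (c :+ s :* c)) refl
           (+ n) (f 0) (g (suc n)) ((tail f ⊛ g) n) ⟩
    f 0 * ((1ℤ + + n) * g (suc n)) + ((tail f ⊛ g) n + θ (tail f ⊛ g) n)
      ≡⟨ cong (λ s → f 0 * ((1ℤ + + n) * g (suc n)) + ((tail f ⊛ g) n + s)) (θ-⊛ (tail f) g n) ⟩
    f 0 * ((1ℤ + + n) * g (suc n)) + ((tail f ⊛ g) n + ((θ (tail f) ⊛ g) n + (tail f ⊛ θ g) n))
      ≡⟨ solve 5 (λ x y c d e → x :+ (c :+ (d :+ e)) := ((:con 0ℤ :* y) :+ (c :+ d)) :+ (x :+ e)) refl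
           (f 0 * ((1ℤ + + n) * g (suc n))) (g (suc n)) ((tail f ⊛ g) n) ((θ (tail f) ⊛ g) n) ((tail f ⊛ θ g) n) ⟩
    (0ℤ * g (suc n) + ((tail f ⊛ g) n + (θ (tail f) ⊛ g) n)) + (f 0 * ((1ℤ + + n) * g (suc n)) + (tail f ⊛ θ g) n)
      ≡⟨ cong (λ s → (0ℤ * g (suc n) + s) + (f 0 * θ g (suc n) + (tail f ⊛ θ g) n)) (sym tail-θ) ⟩
    (0ℤ * g (suc n) + (tail (θ f) ⊛ g) n) + (f 0 * θ g (suc n) + (tail f ⊛ θ g) n)
      ∎
    where
    open ≡-Reasoning
    tail-θ : (tail (θ f) ⊛ g) n ≡ (tail f ⊛ g) n + (θ (tail f) ⊛ g) n
    tail-θ = trans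
      (⊛-cong (λ k → trans (cong (_* f (suc k)) (ℤₚ.pos-+ 1 k))
         (solve 2 (λ s a → (:con 1ℤ :+ s) :* a := a :+ s :* a) refl (+ k) (f (suc k)))) (λ _ → refl) n)
      (⊛-distribʳ-⊕ g (tail f) (θ (tail f)) n)

  -- node i p q is p + xᵢ q.
  data Poly : Set where
    con  : ℤ → Poly
    node : ℕ → Poly → Poly → Poly

  infixl 6 _⊞_
  infixl 7 _⊠_

  Env : Set
  Env = ℕ → Series

  ⟦_⟧ : Poly → Env → Series
  ⟦ con c ⟧      v = const c
  ⟦ node i p q ⟧ v = ⟦ p ⟧ v ⊕ (v i ⊛ ⟦ q ⟧ v)

  ⟦_⟧₀ : Poly → (ℕ → ℤ) → ℤ
  ⟦ con c ⟧₀      v = c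
  ⟦ node i p q ⟧₀ v = ⟦ p ⟧₀ v + v i * ⟦ q ⟧₀ v

  isZero : Poly → Bool
  isZero (con +0)     = true
  isZero (con _)      = false
  isZero (node i p q) = isZero p ∧ isZero q

  mk : ℕ → Poly → Poly → Poly
  mk i p q = if isZero q then p else node i p q

  _⊞_ : Poly → Poly → Poly
  con a ⊞ con b = con (a + b)
  con a ⊞ node j r s = node j (con a ⊞ r) s
  node i p q ⊞ con b = node i (p ⊞ con b) q
  node i p q ⊞ node j r s =
    if i ≡ᵇ j then mk i (p ⊞ r) (q ⊞ s)
    else if j <ᵇ i then node i (p ⊞ node j r s) q
    else node j (node i p q ⊞ r) s

  scale : ℤ → Poly → Poly
  scale c (con a)      = con (c * a)
  scale c (node i p q) = node i (scale c p) (scale c q)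

  mulVar : ℕ → Poly → Poly
  mulVar i (con +0)         = con +0
  mulVar i (con c)          = node i (con +0) (con c)
  mulVar i (node j p q) = if i <ᵇ j then node j (mulVar i p) (mulVar i q)
                                    else node i (con +0) (node j p q)

  _⊠_ : Poly → Poly → Poly
  con +0     ⊠ r = con +0
  con c      ⊠ r = scale c r
  node i p q ⊠ r = (p ⊠ r) ⊞ mulVar i (q ⊠ r)

  var : ℕ → Poly
  var i = node i (con 0ℤ) (con 1ℤ)

  open +-*-Solver using (solve; _:+_; _:*_; _:=_)

  private
    ≗-trans : ∀ {f g h : Series} → f ≗ g → g ≗ h → f ≗ h
    ≗-trans p q n = trans (p n) (q n)

    ≗-sym : ∀ {f g : Series} → f ≗ g → g ≗ f
    ≗-sym p n = sym (p n)

    ≗-refl : ∀ {f : Series} → f ≗ f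
    ≗-refl n = refl

  const-+ : ∀ a b → const (a + b) ≗ const a ⊕ const b
  const-+ a b zero    = refl
  const-+ a b (suc n) = refl

  const-0 : ∀ n → const 0ℤ n ≡ 0ℤ
  const-0 zero    = refl
  const-0 (suc n) = refl

  ⊛-const-0 : ∀ f n → (f ⊛ const 0ℤ) n ≡ 0ℤ
  ⊛-const-0 f n = trans (⊛-comm f (const 0ℤ) n) (const-⊛ 0ℤ f n)

  ∧-split : ∀ a b → a ∧ b ≡ true → a ≡ true × b ≡ true
  ∧-split true true _ = refl , refl

  isZero-sound : ∀ p v → isZero p ≡ true → ∀ n → ⟦ p ⟧ v n ≡ 0ℤ
  isZero-sound (con +0) v _ n = const-0 n
  isZero-sound (node i p q) v z n with ∧-split (isZero p) (isZero q) z
  ... | zp , zq = cong₂ _+_ (isZero-sound p v zp n)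
    (trans (⊛-cong ≗-refl (λ m → trans (isZero-sound q v zq m) (sym (const-0 m))) n) (⊛-const-0 (v i) n))

  mk-sound : ∀ i p q v → ⟦ mk i p q ⟧ v ≗ ⟦ node i p q ⟧ v
  mk-sound i p q v n with isZero q in eq
  ... | false = refl
  ... | true  = sym (trans (cong (_+_ (⟦ p ⟧ v n)) (trans
      (⊛-cong (≗-refl {v i}) (λ m → trans (isZero-sound q v eq m) (sym (const-0 m))) n) (⊛-const-0 (v i) n)))
      (ℤₚ.+-identityʳ _))

  private
    ⊞-node : ∀ i p q j r s v →
      ⟦ p ⊞ r ⟧ v ≗ ⟦ p ⟧ v ⊕ ⟦ r ⟧ v → ⟦ q ⊞ s ⟧ v ≗ ⟦ q ⟧ v ⊕ ⟦ s ⟧ v →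
      ⟦ p ⊞ node j r s ⟧ v ≗ ⟦ p ⟧ v ⊕ ⟦ node j r s ⟧ v →
      ⟦ node i p q ⊞ r ⟧ v ≗ ⟦ node i p q ⟧ v ⊕ ⟦ r ⟧ v →
      ⟦ node i p q ⊞ node j r s ⟧ v ≗ ⟦ node i p q ⟧ v ⊕ ⟦ node j r s ⟧ v
    ⊞-node i p q j r s v pr qs ps qr n with i ≡ᵇ j in eq | j <ᵇ i
    ... | true  | _ with refl ← ℕₚ.≡ᵇ⇒≡ i j (subst T (sym eq) tt) = trans (mk-sound i (p ⊞ r) (q ⊞ s) v n) (trans
      (cong₂ _+_ (pr n) (trans (⊛-cong (≗-refl {v i}) qs n) (⊛-distribˡ-⊕ (v i) (⟦ q ⟧ v) (⟦ s ⟧ v) n)))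
      (solve 4 (λ a b c d → (a :+ b) :+ (c :+ d) := (a :+ c) :+ (b :+ d)) refl
        (⟦ p ⟧ v n) (⟦ r ⟧ v n) ((v i ⊛ ⟦ q ⟧ v) n) ((v i ⊛ ⟦ s ⟧ v) n)))
    ... | false | true  = trans (cong (_+ (v i ⊛ ⟦ q ⟧ v) n) (ps n))
      (solve 3 (λ x y z → (x :+ y) :+ z := (x :+ z) :+ y) refl (⟦ p ⟧ v n) (⟦ node j r s ⟧ v n) ((v i ⊛ ⟦ q ⟧ v) n))
    ... | false | false = trans (cong (_+ (v j ⊛ ⟦ s ⟧ v) n) (qr n))
      (ℤₚ.+-assoc (⟦ node i p q ⟧ v n) _ _)

  ⊞-sound : ∀ p q v → ⟦ p ⊞ q ⟧ v ≗ ⟦ p ⟧ v ⊕ ⟦ q ⟧ v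
  ⊞-sound (con a) (con b) v n = const-+ a b n
  ⊞-sound (con a) (node j r s) v n = trans
    (cong (_+ (v j ⊛ ⟦ s ⟧ v) n) (⊞-sound (con a) r v n)) (ℤₚ.+-assoc (const a n) _ _)
  ⊞-sound (node i p q) (con b) v n = trans
    (cong (_+ (v i ⊛ ⟦ q ⟧ v) n) (⊞-sound p (con b) v n))
    (solve 3 (λ x y z → (x :+ y) :+ z := (x :+ z) :+ y) refl (⟦ p ⟧ v n) (const b n) ((v i ⊛ ⟦ q ⟧ v) n))
  ⊞-sound (node i p q) (node j r s) v = ⊞-node i p q j r s v (⊞-sound p r v) (⊞-sound q s v)
    (⊞-sound p (node j r s) v) (⊞-sound (node i p q) r v)

  ⊛-scale : ∀ c f g n → (f ⊛ (λ k → c * g k)) n ≡ c * (f ⊛ g) n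
  ⊛-scale c f g n = trans (⊛-comm f _ n) (trans (scale-⊛ c g f n) (cong (c *_) (⊛-comm g f n)))

  scale-sound : ∀ c p v n → ⟦ scale c p ⟧ v n ≡ c * ⟦ p ⟧ v n
  scale-sound c (con a) v zero    = refl
  scale-sound c (con a) v (suc n) = sym (ℤₚ.*-zeroʳ c)
  scale-sound c (node i p q) v n = trans
    (cong₂ _+_ (scale-sound c p v n) (trans (⊛-cong (≗-refl {v i}) (scale-sound c q v) n) (⊛-scale c (v i) (⟦ q ⟧ v) n)))
    (sym (ℤₚ.*-distribˡ-+ c _ _))

  ⊛-swap : ∀ f g h → f ⊛ (g ⊛ h) ≗ g ⊛ (f ⊛ h)
  ⊛-swap f g h = ≗-trans (≗-sym (⊛-assoc f g h)) (≗-trans (⊛-cong (⊛-comm f g) ≗-refl) (⊛-assoc g f h))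

  0⊕-node : ∀ i p v n → ⟦ node i (con +0) p ⟧ v n ≡ (v i ⊛ ⟦ p ⟧ v) n
  0⊕-node i p v n = trans (cong (_+ (v i ⊛ ⟦ p ⟧ v) n) (const-0 n)) (ℤₚ.+-identityˡ _)

  mulVar-sound : ∀ i p v → ⟦ mulVar i p ⟧ v ≗ v i ⊛ ⟦ p ⟧ v
  mulVar-sound i (con +0) v n = trans (const-0 n) (sym (⊛-const-0 (v i) n))
  mulVar-sound i (con (+ suc c)) v n = 0⊕-node i (con (+ suc c)) v n
  mulVar-sound i (con (-[1+ c ])) v n = 0⊕-node i (con (-[1+ c ])) v n
  mulVar-sound i (node j p q) v n with i <ᵇ j
  ... | true  = trans (cong₂ _+_ (mulVar-sound i p v n)
      (trans (⊛-cong (≗-refl {v j}) (mulVar-sound i q v) n) (⊛-swap (v j) (v i) (⟦ q ⟧ v) n)))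
      (sym (⊛-distribˡ-⊕ (v i) (⟦ p ⟧ v) (v j ⊛ ⟦ q ⟧ v) n))
  ... | false = 0⊕-node i (node j p q) v n

  ⊠-sound : ∀ p q v → ⟦ p ⊠ q ⟧ v ≗ ⟦ p ⟧ v ⊛ ⟦ q ⟧ v
  ⊠-sound (con +0) r v n = trans (const-0 n) (sym (const-⊛ 0ℤ (⟦ r ⟧ v) n))
  ⊠-sound (con (+ suc c)) r v n = trans (scale-sound (+ suc c) r v n) (sym (const-⊛ (+ suc c) (⟦ r ⟧ v) n))
  ⊠-sound (con (-[1+ c ])) r v n = trans (scale-sound (-[1+ c ]) r v n) (sym (const-⊛ (-[1+ c ]) (⟦ r ⟧ v) n))
  ⊠-sound (node i p q) r v n = trans (⊞-sound (p ⊠ r) (mulVar i (q ⊠ r)) v n) (trans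
    (cong₂ _+_ (⊠-sound p r v n) (trans (mulVar-sound i (q ⊠ r) v n)
      (trans (⊛-cong (≗-refl {v i}) (⊠-sound q r v) n) (sym (⊛-assoc (v i) (⟦ q ⟧ v) (⟦ r ⟧ v) n)))))
    (sym (⊛-distribʳ-⊕ (⟦ r ⟧ v) (⟦ p ⟧ v) (v i ⊛ ⟦ q ⟧ v) n)))

  var-sound : ∀ i v → ⟦ var i ⟧ v ≗ v i
  var-sound i v n = trans (0⊕-node i (con 1ℤ) v n) (trans (⊛-comm (v i) (const 1ℤ) n) (⊛-identityˡ (v i) n))

  Vars : (ℕ → Set) → Poly → Set
  Vars P (con c)      = Data.Unit.Base.⊤
  Vars P (node i p q) = P i × Vars P p × Vars P q

  ⟦⟧-cong : ∀ p {v w} → Vars (λ i → v i ≗ w i) p → ⟦ p ⟧ v ≗ ⟦ p ⟧ w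
  ⟦⟧-cong (con c) _ n = refl
  ⟦⟧-cong (node i p q) (e , vp , vq) n = cong₂ _+_ (⟦⟧-cong p vp n) (⊛-cong e (⟦⟧-cong q vq) n)

  ⟦⟧-zero : ∀ p v → ⟦ p ⟧ v 0 ≡ ⟦ p ⟧₀ (λ i → v i 0)
  ⟦⟧-zero (con c) v = refl
  ⟦⟧-zero (node i p q) v = cong₂ (λ a b → a + v i 0 * b) (⟦⟧-zero p v) (⟦⟧-zero q v)

  deriv : (ℕ → Poly) → Poly → Poly
  deriv D (con c)      = con +0
  deriv D (node i p q) = deriv D p ⊞ ((D i ⊠ q) ⊞ mulVar i (deriv D q))

  deriv-sound : ∀ c D p v → Vars (λ i → ∀ n → c * θ (v i) n ≡ ⟦ D i ⟧ v n) p →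
                ∀ n → c * θ (⟦ p ⟧ v) n ≡ ⟦ deriv D p ⟧ v n
  deriv-sound c D (con a) v _ zero    = ℤₚ.*-zeroʳ c
  deriv-sound c D (con a) v _ (suc n) = trans (cong (c *_) (ℤₚ.*-zeroʳ (+ suc n))) (ℤₚ.*-zeroʳ c)
  deriv-sound c D (node i p q) v (e , vp , vq) n = begin
    c * (+ n * (⟦ p ⟧ v n + (v i ⊛ ⟦ q ⟧ v) n))
      ≡⟨ solve 4 (λ c n a b → c :* (n :* (a :+ b)) := c :* (n :* a) :+ c :* (n :* b)) refl c (+ n) (⟦ p ⟧ v n) ((v i ⊛ ⟦ q ⟧ v) n) ⟩
    c * θ (⟦ p ⟧ v) n + c * θ (v i ⊛ ⟦ q ⟧ v) n
      ≡⟨ cong (_+_ (c * θ (⟦ p ⟧ v) n)) (trans (cong (c *_) (θ-⊛ (v i) (⟦ q ⟧ v) n)) (ℤₚ.*-distribˡ-+ c _ _)) ⟩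
    c * θ (⟦ p ⟧ v) n + (c * (θ (v i) ⊛ ⟦ q ⟧ v) n + c * (v i ⊛ θ (⟦ q ⟧ v)) n)
      ≡⟨ cong₂ _+_ (deriv-sound c D p v vp n) (cong₂ _+_
          (trans (sym (scale-⊛ c (θ (v i)) (⟦ q ⟧ v) n)) (⊛-cong e (λ _ → refl) n))
          (trans (sym (⊛-scale c (v i) (θ (⟦ q ⟧ v)) n)) (⊛-cong (λ _ → refl) (deriv-sound c D q v vq) n))) ⟩
    ⟦ deriv D p ⟧ v n + ((⟦ D i ⟧ v ⊛ ⟦ q ⟧ v) n + (v i ⊛ ⟦ deriv D q ⟧ v) n)
      ≡⟨ cong (_+_ (⟦ deriv D p ⟧ v n)) (sym (trans (⊞-sound (D i ⊠ q) (mulVar i (deriv D q)) v n)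
          (cong₂ _+_ (⊠-sound (D i) q v n) (mulVar-sound i (deriv D q) v n)))) ⟩
    ⟦ deriv D p ⟧ v n + ⟦ (D i ⊠ q) ⊞ mulVar i (deriv D q) ⟧ v n
      ≡⟨ sym (⊞-sound (deriv D p) _ v n) ⟩
    ⟦ deriv D (node i p q) ⟧ v n ∎
    where open ≡-Reasoning

  -- A polynomial modulo z² = r is a pair (p₀ , p₁) standing for p₀ + z p₁.
  reduce : ℕ → Poly → Poly → Poly × Poly
  reduce z r (con c) = con c , con +0
  reduce z r (node i p q) with i ≡ᵇ z | reduce z r p | reduce z r q
  ... | true  | p₀ , p₁ | q₀ , q₁ = p₀ ⊞ (r ⊠ q₁) , p₁ ⊞ q₀
  ... | false | p₀ , p₁ | q₀ , q₁ = p₀ ⊞ mulVar i q₀ , p₁ ⊞ mulVar i q₁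

  reduce-sound : ∀ z r p v → v z ⊛ v z ≗ ⟦ r ⟧ v →
    ⟦ p ⟧ v ≗ ⟦ proj₁ (reduce z r p) ⟧ v ⊕ (v z ⊛ ⟦ proj₂ (reduce z r p) ⟧ v)
  reduce-sound z r (con c) v h n = sym (trans (cong (_+_ (const c n)) (⊛-const-0 (v z) n)) (ℤₚ.+-identityʳ _))
  reduce-sound z r (node i p q) v h n
    with i ≡ᵇ z in eq | reduce z r p | reduce z r q | reduce-sound z r p v h | reduce-sound z r q v h
  ... | true | p₀ , p₁ | q₀ , q₁ | hp | hq with refl ← ℕₚ.≡ᵇ⇒≡ i z (subst T (sym eq) tt) = begin
    ⟦ p ⟧ v n + (v i ⊛ ⟦ q ⟧ v) n
      ≡⟨ cong₂ _+_ (hp n) (trans (⊛-cong (≗-refl {v i}) hq n) (⊛-distribˡ-⊕ (v i) (⟦ q₀ ⟧ v) (v i ⊛ ⟦ q₁ ⟧ v) n)) ⟩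
    (⟦ p₀ ⟧ v n + (v i ⊛ ⟦ p₁ ⟧ v) n) + ((v i ⊛ ⟦ q₀ ⟧ v) n + (v i ⊛ (v i ⊛ ⟦ q₁ ⟧ v)) n)
      ≡⟨ cong (λ s → (⟦ p₀ ⟧ v n + (v i ⊛ ⟦ p₁ ⟧ v) n) + ((v i ⊛ ⟦ q₀ ⟧ v) n + s))
          (trans (sym (⊛-assoc (v i) (v i) (⟦ q₁ ⟧ v) n)) (⊛-cong h ≗-refl n)) ⟩
    (⟦ p₀ ⟧ v n + (v i ⊛ ⟦ p₁ ⟧ v) n) + ((v i ⊛ ⟦ q₀ ⟧ v) n + (⟦ r ⟧ v ⊛ ⟦ q₁ ⟧ v) n)
      ≡⟨ solve 4 (λ a b c d → (a :+ b) :+ (c :+ d) := (a :+ d) :+ (b :+ c)) refl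
          (⟦ p₀ ⟧ v n) ((v i ⊛ ⟦ p₁ ⟧ v) n) ((v i ⊛ ⟦ q₀ ⟧ v) n) ((⟦ r ⟧ v ⊛ ⟦ q₁ ⟧ v) n) ⟩
    (⟦ p₀ ⟧ v n + (⟦ r ⟧ v ⊛ ⟦ q₁ ⟧ v) n) + ((v i ⊛ ⟦ p₁ ⟧ v) n + (v i ⊛ ⟦ q₀ ⟧ v) n)
      ≡⟨ sym (cong₂ _+_ (trans (⊞-sound p₀ (r ⊠ q₁) v n) (cong (_+_ (⟦ p₀ ⟧ v n)) (⊠-sound r q₁ v n)))
          (trans (⊛-cong (≗-refl {v i}) (⊞-sound p₁ q₀ v) n) (⊛-distribˡ-⊕ (v i) (⟦ p₁ ⟧ v) (⟦ q₀ ⟧ v) n))) ⟩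
    ⟦ p₀ ⊞ (r ⊠ q₁) ⟧ v n + (v i ⊛ ⟦ p₁ ⊞ q₀ ⟧ v) n ∎
    where open ≡-Reasoning
  ... | false | p₀ , p₁ | q₀ , q₁ | hp | hq = begin
    ⟦ p ⟧ v n + (v i ⊛ ⟦ q ⟧ v) n
      ≡⟨ cong₂ _+_ (hp n) (trans (⊛-cong (≗-refl {v i}) hq n) (trans (⊛-distribˡ-⊕ (v i) (⟦ q₀ ⟧ v) (v z ⊛ ⟦ q₁ ⟧ v) n)
          (cong (_+_ ((v i ⊛ ⟦ q₀ ⟧ v) n)) (⊛-swap (v i) (v z) (⟦ q₁ ⟧ v) n)))) ⟩
    (⟦ p₀ ⟧ v n + (v z ⊛ ⟦ p₁ ⟧ v) n) + ((v i ⊛ ⟦ q₀ ⟧ v) n + (v z ⊛ (v i ⊛ ⟦ q₁ ⟧ v)) n)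
      ≡⟨ solve 4 (λ a b c d → (a :+ b) :+ (c :+ d) := (a :+ c) :+ (b :+ d)) refl
          (⟦ p₀ ⟧ v n) ((v z ⊛ ⟦ p₁ ⟧ v) n) ((v i ⊛ ⟦ q₀ ⟧ v) n) ((v z ⊛ (v i ⊛ ⟦ q₁ ⟧ v)) n) ⟩
    (⟦ p₀ ⟧ v n + (v i ⊛ ⟦ q₀ ⟧ v) n) + ((v z ⊛ ⟦ p₁ ⟧ v) n + (v z ⊛ (v i ⊛ ⟦ q₁ ⟧ v)) n)
      ≡⟨ sym (cong₂ _+_
          (trans (⊞-sound p₀ (mulVar i q₀) v n) (cong (_+_ (⟦ p₀ ⟧ v n)) (mulVar-sound i q₀ v n)))
          (trans (⊛-cong (≗-refl {v z}) (λ m → trans (⊞-sound p₁ (mulVar i q₁) v m) (cong (_+_ (⟦ p₁ ⟧ v m)) (mulVar-sound i q₁ v m))) n)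
            (⊛-distribˡ-⊕ (v z) (⟦ p₁ ⟧ v) (v i ⊛ ⟦ q₁ ⟧ v) n))) ⟩
    ⟦ p₀ ⊞ mulVar i q₀ ⟧ v n + (v z ⊛ ⟦ p₁ ⊞ mulVar i q₁ ⟧ v) n ∎
    where open ≡-Reasoning

  sumTo : ℕ → (ℕ → ℤ) → ℤ
  sumTo zero    f = 0ℤ
  sumTo (suc n) f = sumTo n f + f n

  sumToℕ : ℕ → (ℕ → ℕ) → ℕ
  sumToℕ zero    f = 0
  sumToℕ (suc n) f = sumToℕ n f ℕ.+ f n

  sumTo-cong : ∀ n {f g} → (∀ i → i ℕ.< n → f i ≡ g i) → sumTo n f ≡ sumTo n g
  sumTo-cong zero    h = refl
  sumTo-cong (suc n) h = cong₂ _+_ (sumTo-cong n (λ i i<n → h i (ℕₚ.m<n⇒m<1+n i<n))) (h n ℕₚ.≤-refl)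

  sumTo-0 : ∀ n → sumTo n (λ _ → 0ℤ) ≡ 0ℤ
  sumTo-0 zero    = refl
  sumTo-0 (suc n) = trans (ℤₚ.+-identityʳ _) (sumTo-0 n)

  open +-*-Solver using (solve; _:+_; _:*_; _:=_)

  sumTo-+ : ∀ n f g → sumTo n (λ i → f i + g i) ≡ sumTo n f + sumTo n g
  sumTo-+ zero    f g = refl
  sumTo-+ (suc n) f g = trans (cong (_+ (f n + g n)) (sumTo-+ n f g))
    (solve 4 (λ a b c d → (a :+ b) :+ (c :+ d) := (a :+ c) :+ (b :+ d)) refl (sumTo n f) (sumTo n g) (f n) (g n))

  sumTo-*ˡ : ∀ n c f → sumTo n (λ i → c * f i) ≡ c * sumTo n f
  sumTo-*ˡ zero    c f = sym (ℤₚ.*-zeroʳ c)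
  sumTo-*ˡ (suc n) c f = trans (cong (_+ c * f n) (sumTo-*ˡ n c f)) (sym (ℤₚ.*-distribˡ-+ c _ _))

  sumToℕ-mono : ∀ n {f g} → (∀ i → i ℕ.< n → f i ℕ.≤ g i) → sumToℕ n f ℕ.≤ sumToℕ n g
  sumToℕ-mono zero    h = z≤n
  sumToℕ-mono (suc n) h = ℕₚ.+-mono-≤ (sumToℕ-mono n (λ i i<n → h i (ℕₚ.m<n⇒m<1+n i<n))) (h n ℕₚ.≤-refl)

  sumToℕ-*ʳ : ∀ n c f → sumToℕ n (λ i → f i ℕ.* c) ≡ sumToℕ n f ℕ.* c
  sumToℕ-*ʳ zero    c f = refl
  sumToℕ-*ʳ (suc n) c f = trans (cong (ℕ._+ f n ℕ.* c) (sumToℕ-*ʳ n c f)) (sym (ℕₚ.*-distribʳ-+ c (sumToℕ n f) (f n)))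

  ∣sumTo∣ : ∀ n f → ∣ sumTo n f ∣ ℕ.≤ sumToℕ n (λ i → ∣ f i ∣)
  ∣sumTo∣ zero    f = z≤n
  ∣sumTo∣ (suc n) f = ℕₚ.≤-trans (ℤₚ.∣i+j∣≤∣i∣+∣j∣ (sumTo n f) (f n)) (ℕₚ.+-monoˡ-≤ _ (∣sumTo∣ n f))

  sumTo-indicator : ∀ n j c (x : ℕ → ℤ) → (n ℕ.≤ j → x j ≡ 0ℤ) →
    sumTo n (λ k → (if j ≡ᵇ k then c else 0ℤ) * x k) ≡ c * x j
  sumTo-indicator zero    j c x h = sym (trans (cong (c *_) (h z≤n)) (ℤₚ.*-zeroʳ c))
  sumTo-indicator (suc n) j c x h with j ≡ᵇ n in eq
  ... | false = trans (ℤₚ.+-identityʳ _) (sumTo-indicator n j c x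
    (λ n≤j → h (ℕₚ.≤∧≢⇒< n≤j (λ n≡j → subst T eq (ℕₚ.≡⇒≡ᵇ j n (sym n≡j))))))
  ... | true with refl ← ℕₚ.≡ᵇ⇒≡ j n (subst T (sym eq) tt) =
    trans (cong (_+ c * x j) (trans (sumTo-cong j below) (sumTo-0 j))) (ℤₚ.+-identityˡ _)
    where
    below : ∀ i → i ℕ.< j → (if j ≡ᵇ i then c else 0ℤ) * x i ≡ 0ℤ
    below i i<j with j ≡ᵇ i in eq′
    ... | false = refl
    ... | true  = ⊥-elim (ℕₚ.<-irrefl (sym (ℕₚ.≡ᵇ⇒≡ j i (subst T (sym eq′) tt))) i<j)

  private
    argmax : ∀ (y lam : ℕ → ℕ) → (∀ k → 1 ℕ.≤ lam k) → ∀ d →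
      ∃ λ j → j ℕ.≤ d × (∀ k → k ℕ.≤ d → y k ℕ.* lam j ℕ.≤ y j ℕ.* lam k)
    argmax y lam pos zero = 0 , z≤n , λ { zero _ → ℕₚ.≤-refl }
    argmax y lam pos (suc d) with argmax y lam pos d
    ... | j , j≤d , h with ℕₚ.≤-total (y (suc d) ℕ.* lam j) (y j ℕ.* lam (suc d))
    ... | inj₁ p = j , ℕₚ.m≤n⇒m≤1+n j≤d , λ k k≤ → [ (λ k<s → h k (ℕ.s≤s⁻¹ k<s)) , (λ { refl → p }) ]′ (ℕₚ.m≤n⇒m<n∨m≡n k≤)
    ... | inj₂ p = suc d , ℕₚ.≤-refl , λ k k≤ → [ (λ k<s → old k (ℕ.s≤s⁻¹ k<s)) , (λ { refl → ℕₚ.≤-refl }) ]′ (ℕₚ.m≤n⇒m<n∨m≡n k≤)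
      where
      old : ∀ k → k ℕ.≤ d → y k ℕ.* lam (suc d) ℕ.≤ y (suc d) ℕ.* lam k
      old k k≤d = ℕₚ.*-cancelʳ-≤ _ _ (lam j) ⦃ ℕ.>-nonZero (pos j) ⦄ (begin
        y k ℕ.* lam (suc d) ℕ.* lam j   ≡⟨ ℕₚ.*-assoc (y k) _ _ ⟩
        y k ℕ.* (lam (suc d) ℕ.* lam j) ≡⟨ cong (y k ℕ.*_) (ℕₚ.*-comm (lam (suc d)) (lam j)) ⟩
        y k ℕ.* (lam j ℕ.* lam (suc d)) ≡⟨ sym (ℕₚ.*-assoc (y k) _ _) ⟩
        y k ℕ.* lam j ℕ.* lam (suc d)   ≤⟨ ℕₚ.*-monoˡ-≤ (lam (suc d)) (h k k≤d) ⟩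
        y j ℕ.* lam k ℕ.* lam (suc d)   ≡⟨ ℕₚ.*-assoc (y j) _ _ ⟩
        y j ℕ.* (lam k ℕ.* lam (suc d)) ≡⟨ cong (y j ℕ.*_) (ℕₚ.*-comm (lam k) (lam (suc d))) ⟩
        y j ℕ.* (lam (suc d) ℕ.* lam k) ≡⟨ sym (ℕₚ.*-assoc (y j) _ _) ⟩
        y j ℕ.* lam (suc d) ℕ.* lam k   ≤⟨ ℕₚ.*-monoˡ-≤ (lam k) p ⟩
        y (suc d) ℕ.* lam j ℕ.* lam k   ≡⟨ ℕₚ.*-assoc (y (suc d)) _ _ ⟩
        y (suc d) ℕ.* (lam j ℕ.* lam k) ≡⟨ cong (y (suc d) ℕ.*_) (ℕₚ.*-comm (lam j) (lam k)) ⟩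
        y (suc d) ℕ.* (lam k ℕ.* lam j) ≡⟨ sym (ℕₚ.*-assoc (y (suc d)) _ _) ⟩
        y (suc d) ℕ.* lam k ℕ.* lam j   ∎)
        where open ℕₚ.≤-Reasoning

  -- A weighted diagonal dominance argument: at an index j maximising |xⱼ|/λⱼ the
  -- equation for xⱼ forces xⱼ = 0.
  dominant⇒0 : ∀ E N (l : ℕ → ℕ → ℤ) (lam : ℕ → ℕ) (x : ℕ → ℤ) →
    (∀ k → 1 ℕ.≤ lam k) →
    (∀ j → j ℕ.< E → + N * x j ≡ sumTo E (λ k → l j k * x k)) →
    (∀ j → j ℕ.< E → sumToℕ E (λ k → ∣ l j k ∣ ℕ.* lam k) ℕ.< N ℕ.* lam j) →
    ∀ k → k ℕ.< E → x k ≡ 0ℤ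
  dominant⇒0 (suc d) N l lam x pos eqn dom k k<E
    with argmax (λ i → ∣ x i ∣) lam pos d
  ... | j , j≤d , h with ∣ x j ∣ ℕₚ.≟ 0
  ... | yes xj≡0 = ℤₚ.∣i∣≡0⇒i≡0 (ℕₚ.m*n≡0⇒m≡0 ∣ x k ∣ (lam j) ⦃ ℕ.>-nonZero (pos j) ⦄
    (ℕₚ.n≤0⇒n≡0 (ℕₚ.≤-trans (h k (ℕ.s≤s⁻¹ k<E)) (ℕₚ.≤-reflexive (cong (ℕ._* lam k) xj≡0)))))
  ... | no xj≢0 = ⊥-elim (ℕₚ.<-irrefl refl (begin-strict
      N ℕ.* ∣ x j ∣ ℕ.* lam j
        ≡⟨ cong (ℕ._* lam j) (trans (sym (ℤₚ.abs-* (+ N) (x j))) (cong ∣_∣ (eqn j (s≤s j≤d)))) ⟩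
      ∣ sumTo (suc d) (λ k → l j k * x k) ∣ ℕ.* lam j
        ≤⟨ ℕₚ.*-monoˡ-≤ (lam j) (∣sumTo∣ (suc d) (λ k → l j k * x k)) ⟩
      sumToℕ (suc d) (λ k → ∣ l j k * x k ∣) ℕ.* lam j
        ≡⟨ sym (sumToℕ-*ʳ (suc d) (lam j) (λ k → ∣ l j k * x k ∣)) ⟩
      sumToℕ (suc d) (λ k → ∣ l j k * x k ∣ ℕ.* lam j)
        ≤⟨ sumToℕ-mono (suc d) step ⟩
      sumToℕ (suc d) (λ k → ∣ l j k ∣ ℕ.* lam k ℕ.* ∣ x j ∣)
        ≡⟨ sumToℕ-*ʳ (suc d) ∣ x j ∣ (λ k → ∣ l j k ∣ ℕ.* lam k) ⟩
      sumToℕ (suc d) (λ k → ∣ l j k ∣ ℕ.* lam k) ℕ.* ∣ x j ∣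
        <⟨ ℕₚ.*-monoˡ-< ∣ x j ∣ ⦃ ℕ.≢-nonZero xj≢0 ⦄ (dom j (s≤s j≤d)) ⟩
      N ℕ.* lam j ℕ.* ∣ x j ∣
        ≡⟨ trans (ℕₚ.*-assoc N _ _) (trans (cong (N ℕ.*_) (ℕₚ.*-comm (lam j) ∣ x j ∣)) (sym (ℕₚ.*-assoc N _ _))) ⟩
      N ℕ.* ∣ x j ∣ ℕ.* lam j ∎))
    where
    open ℕₚ.≤-Reasoning
    step : ∀ i → i ℕ.< suc d → ∣ l j i * x i ∣ ℕ.* lam j ℕ.≤ ∣ l j i ∣ ℕ.* lam i ℕ.* ∣ x j ∣
    step i i<E = begin
      ∣ l j i * x i ∣ ℕ.* lam j           ≡⟨ cong (ℕ._* lam j) (ℤₚ.abs-* (l j i) (x i)) ⟩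
      ∣ l j i ∣ ℕ.* ∣ x i ∣ ℕ.* lam j     ≡⟨ ℕₚ.*-assoc ∣ l j i ∣ _ _ ⟩
      ∣ l j i ∣ ℕ.* (∣ x i ∣ ℕ.* lam j)   ≤⟨ ℕₚ.*-monoʳ-≤ ∣ l j i ∣ (h i (ℕ.s≤s⁻¹ i<E)) ⟩
      ∣ l j i ∣ ℕ.* (∣ x j ∣ ℕ.* lam i)   ≡⟨ cong (∣ l j i ∣ ℕ.*_) (ℕₚ.*-comm ∣ x j ∣ (lam i)) ⟩
      ∣ l j i ∣ ℕ.* (lam i ℕ.* ∣ x j ∣)   ≡⟨ sym (ℕₚ.*-assoc ∣ l j i ∣ _ _) ⟩
      ∣ l j i ∣ ℕ.* lam i ℕ.* ∣ x j ∣     ∎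

  gronwall : ∀ E c K (l : ℕ → ℕ → ℤ) (lam : ℕ → ℕ) (r : ℕ → ℕ → ℤ) →
    (∀ k → 1 ℕ.≤ lam k) →
    (∀ n → (∀ k m → k ℕ.< E → m ℕ.< n → r k m ≡ 0ℤ) → ∀ j → j ℕ.< E →
      + c * (+ n * r j n) ≡ sumTo E (λ k → l j k * r k n)) →
    (∀ j → j ℕ.< E → sumToℕ E (λ k → ∣ l j k ∣ ℕ.* lam k) ℕ.< c ℕ.* K ℕ.* lam j) →
    (∀ k n → k ℕ.< E → n ℕ.< K → r k n ≡ 0ℤ) →
    ∀ n k → k ℕ.< E → r k n ≡ 0ℤ
  gronwall E c K l lam r pos eqn dom init = <-rec _ step
    where
    step : ∀ n → (∀ {m} → m ℕ.< n → ∀ k → k ℕ.< E → r k m ≡ 0ℤ) → ∀ k → k ℕ.< E → r k n ≡ 0ℤ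
    step n below k k<E with n ℕₚ.<? K
    ... | yes n<K = init k n k<E n<K
    ... | no  n≮K = dominant⇒0 E (c ℕ.* n) l lam (λ i → r i n) pos
      (λ j j<E → trans (trans (cong (_* r j n) (ℤₚ.pos-* c n)) (ℤₚ.*-assoc (+ c) (+ n) (r j n)))
        (eqn n (λ i m i<E m<n → below m<n i i<E) j j<E))
      (λ j j<E → ℕₚ.<-≤-trans (dom j j<E) (ℕₚ.*-monoˡ-≤ (lam j) (ℕₚ.*-monoʳ-≤ c (ℕₚ.≮⇒≥ n≮K))))
      k k<E

  nth : ∀ {A : Set} → A → List A → ℕ → A
  nth d []       _       = d
  nth d (x ∷ xs) zero    = x
  nth d (x ∷ xs) (suc n) = nth d xs n

  zeros : Series
  zeros _ = 0ℤ

  -- A table (p , q) of weight 2k stands for Wᵏ p(t) + Wᵏ⁻¹ Z q(t).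
  Table : Set
  Table = List ℤ × List ℤ

  -- An eta quotient is given by pairs (i , r) with i the position of δ in δs.
  Factors : Set
  Factors = List (ℕ × ℤ)

  record Form : Set where
    constructor form
    field
      multiple : ℤ
      factors  : Factors
      table    : Table
  open Form

  -- With aᵢ, bᵢ, cᵢ for δᵢ E₂(δᵢz), δᵢ² E₄(δᵢz), δᵢ³ E₆(δᵢz) and a for a₀, the data
  -- stand for 48 Z = Σ eᵢ aᵢ, Z² = W² f(t), for the tables of aᵢ - a, bᵢ, cᵢ, and for
  -- the tables of multiples of further eta quotients.  The coefficients z are
  -- those of Z - 1 in terms of Σ σ(n) qⁿᵟ.  The errors of these formulas vanish once
  -- they do below the order K, by diagonal dominance with the given weights.
  record Level : Set where
    field
      δs        : List ℕ
      Wf tf     : Factors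
      e z f     : List ℤ
      as bs cs  : List Table
      forms     : List Form
      weights   : List ℕ
      K         : ℕ

  triple : ℕ → ℕ
  triple zero    = 0
  triple (suc n) = 3 ℕ.+ triple n

  -- The variables 0, 1, 2, 3 are a, t, W, Z; from 4 on they are error variables,
  -- which are to be proved zero.
  pure : Poly → Bool
  pure (con c) = isZero (con c)
  pure (node (suc (suc (suc (suc _)))) p q) = pure p
  pure (node i p q) = isZero p ∧ isZero q

  coeff : (ℕ → ℤ) → Poly → ℕ → ℤ
  coeff v (con c) k = 0ℤ
  coeff v (node (suc (suc (suc (suc j)))) p q) k = (if j ≡ᵇ k then ⟦ q ⟧₀ v else 0ℤ) + coeff v p k
  coeff v (node i p q) k = 0ℤ

  start : ℕ → ℤ
  start 1 = 0ℤ
  start (suc (suc (suc (suc _)))) = 0ℤ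
  start _ = 1ℤ

  module Engine (L : Level) where
    open Level L

    m : ℕ
    m = length δs

    horner : List ℤ → Poly
    horner = foldr (λ c p → node 1 (con c) p) (con 0ℤ)

    W^ : ℕ → Poly → Poly
    W^ zero    p = p
    W^ (suc k) p = node 2 (con 0ℤ) (W^ k p)

    table# : ℕ → Table → Poly
    table# k (p , q) = node 3 (W^ (suc k) (horner p)) (W^ k (horner q))

    W²f : Poly
    W²f = W^ 2 (horner f)

    tab : List Table → ℕ → Table
    tab = nth ([] , [])

    A B C : ℕ → Poly
    A i = var (5 ℕ.+ triple i) ⊞ (var 0 ⊞ table# 0 (tab as i))
    B i = var (6 ℕ.+ triple i) ⊞ table# 1 (tab bs i)
    C i = var (7 ℕ.+ triple i) ⊞ table# 2 (tab cs i)

    infixl 6 _⊟_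
    _⊟_ : Poly → Poly → Poly
    p ⊟ q = p ⊞ scale -1ℤ q

    dA dB dC : ℕ → Poly
    dA i = A i ⊠ A i ⊟ B i
    dB i = scale (+ 192) (A i ⊠ B i ⊟ C i)
    dC i = scale (+ 288) (A i ⊠ C i ⊟ B i ⊠ B i)

    logDeriv : Factors → Poly
    logDeriv []             = con 0ℤ
    logDeriv ((i , r) ∷ fs) = scale (+ 24 * r) (A i) ⊞ logDeriv fs

    dComb : List ℤ → ℕ → Poly
    dComb []       _ = con 0ℤ
    dComb (c ∷ cs) i = scale c (dA i) ⊞ dComb cs (suc i)

    D : ℕ → Poly
    D 0 = scale (+ 48) (dA 0)
    D 1 = mulVar 1 (logDeriv tf)
    D 2 = mulVar 2 (logDeriv Wf)
    D 3 = dComb e 0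
    D _ = con 0ℤ

    formRows : List Form → ℕ → List Poly
    formRows []       _ = []
    formRows (g ∷ gs) k =
      ((var k ⊞ table# 1 (table g)) ⊠ logDeriv (factors g) ⊟ deriv D (table# 1 (table g))) ∷ formRows gs (suc k)

    tripleRows : ℕ → ℕ → List Poly
    tripleRows zero    _ = formRows forms (5 ℕ.+ triple m)
    tripleRows (suc n) i =
        (scale (+ 48) (dA i) ⊟ (D 0 ⊞ deriv D (table# 0 (tab as i))))
      ∷ (dB i ⊟ deriv D (table# 1 (tab bs i)))
      ∷ (dC i ⊟ deriv D (table# 2 (tab cs i)))
      ∷ tripleRows n (suc i)

    φ : Poly
    φ = var 3 ⊠ var 3 ⊟ W²f

    rows : List Poly
    rows = deriv D φ ∷ tripleRows m 0

    E : ℕ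
    E = length rows

    normal : Poly → Poly × Poly
    normal = reduce 3 (var 4 ⊞ W²f)

    vanishes : Poly → Bool
    vanishes p = pure (proj₁ (normal p)) ∧ pure (proj₂ (normal p))

    entry : Poly × Poly → ℕ → ℤ
    entry (p , q) k = coeff start p k + coeff start q k

    weight : ℕ → ℕ
    weight = nth 1 weights

    okRow : ℕ → Poly × Poly → Bool
    okRow j pq = pure (proj₁ pq) ∧ (pure (proj₂ pq) ∧
      (sumToℕ E (λ k → ∣ entry pq k ∣ ℕ.* weight k) <ᵇ 576 ℕ.* K ℕ.* weight j))

    okRows : ℕ → List Poly → Bool
    okRows j []       = true
    okRows j (p ∷ ps) = okRow j (normal p) ∧ okRows (suc j) ps

    below : Factors → Bool
    below = all (λ x → proj₁ x <ᵇ m)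

    formAt : ℕ → Form
    formAt = nth (form 1ℤ [] ([] , [])) forms

    okForms : List Form → Bool
    okForms = all (λ g → below (factors g))

    record Checked : Set where
      field
        K-pos       : (0 <ᵇ K) ≡ true
        weights-pos : all (0 <ᵇ_) weights ≡ true
        tf-below    : below tf ≡ true
        Wf-below    : below Wf ≡ true
        forms-below : okForms forms ≡ true
        e-length    : length e ≡ m
        rows-ok     : okRows 0 rows ≡ true

  <ᵇ-true : ∀ i j → (i <ᵇ j) ≡ true → i ℕ.< j
  <ᵇ-true i j eq = ℕₚ.<ᵇ⇒< i j (subst T (sym eq) tt)

  ⊛-leading : ∀ f g n → (∀ i → i ℕ.< n → f i ≡ 0ℤ) → (f ⊛ g) n ≡ f n * g 0
  ⊛-leading f g zero    h = refl
  ⊛-leading f g (suc n) h = trans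
    (cong₂ _+_ (cong (_* g (suc n)) (h 0 (s≤s z≤n))) (⊛-leading (tail f) g n (λ i i<n → h (suc i) (s≤s i<n))))
    (ℤₚ.+-identityˡ _)

  ⟦⟧₀-cong : ∀ p {v w} → v ≗ w → ⟦ p ⟧₀ v ≡ ⟦ p ⟧₀ w
  ⟦⟧₀-cong (con c) h = refl
  ⟦⟧₀-cong (node i p q) h = cong₂ _+_ (⟦⟧₀-cong p h) (cong₂ _*_ (h i) (⟦⟧₀-cong q h))

  -- The error-free part of a pure polynomial vanishes, so at the first order at
  -- which the errors may be non-zero only its linear part contributes.
  pure-leading : ∀ E p v n → pure p ≡ true → (∀ k → E ℕ.≤ k → v (4 ℕ.+ k) n ≡ 0ℤ) →
    (∀ k i → i ℕ.< n → v (4 ℕ.+ k) i ≡ 0ℤ) → (∀ i → v i 0 ≡ start i) →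
    ⟦ p ⟧ v n ≡ sumTo E (λ k → coeff start p k * v (4 ℕ.+ k) n)
  pure-leading E (con c) v n pp _ _ _ = trans (isZero-sound (con c) v pp n) (sym (sumTo-0 E))
  pure-leading E (node 0 p q) v n pp _ _ _ = trans (isZero-sound (node 0 p q) v pp n) (sym (sumTo-0 E))
  pure-leading E (node 1 p q) v n pp _ _ _ = trans (isZero-sound (node 1 p q) v pp n) (sym (sumTo-0 E))
  pure-leading E (node 2 p q) v n pp _ _ _ = trans (isZero-sound (node 2 p q) v pp n) (sym (sumTo-0 E))
  pure-leading E (node 3 p q) v n pp _ _ _ = trans (isZero-sound (node 3 p q) v pp n) (sym (sumTo-0 E))
  pure-leading E (node (suc (suc (suc (suc j)))) p q) v n pp out low s = begin
    ⟦ p ⟧ v n + (v (4 ℕ.+ j) ⊛ ⟦ q ⟧ v) n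
      ≡⟨ cong₂ _+_ (pure-leading E p v n pp out low s) (⊛-leading (v (4 ℕ.+ j)) (⟦ q ⟧ v) n (low j)) ⟩
    rest + v (4 ℕ.+ j) n * ⟦ q ⟧ v 0
      ≡⟨ cong (λ x → rest + v (4 ℕ.+ j) n * x) (trans (⟦⟧-zero q v) (⟦⟧₀-cong q s)) ⟩
    rest + v (4 ℕ.+ j) n * c
      ≡⟨ trans (cong (_+_ rest) (ℤₚ.*-comm (v (4 ℕ.+ j) n) c)) (ℤₚ.+-comm rest _) ⟩
    c * v (4 ℕ.+ j) n + rest
      ≡⟨ cong (_+ rest) (sym (sumTo-indicator E j c (λ k → v (4 ℕ.+ k) n) (out j))) ⟩
    sumTo E (λ k → (if j ≡ᵇ k then c else 0ℤ) * v (4 ℕ.+ k) n) + rest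
      ≡⟨ sym (sumTo-+ E _ _) ⟩
    sumTo E (λ k → (if j ≡ᵇ k then c else 0ℤ) * v (4 ℕ.+ k) n + coeff start p k * v (4 ℕ.+ k) n)
      ≡⟨ sumTo-cong E (λ k _ → sym (ℤₚ.*-distribʳ-+ (v (4 ℕ.+ k) n) (if j ≡ᵇ k then c else 0ℤ) (coeff start p k))) ⟩
    sumTo E (λ k → coeff start (node (4 ℕ.+ j) p q) k * v (4 ℕ.+ k) n) ∎
    where
    open ≡-Reasoning
    c rest : ℤ
    c = ⟦ q ⟧₀ start
    rest = sumTo E (λ k → coeff start p k * v (4 ℕ.+ k) n)

  module Model (L : Level) (a b c : ℕ → Series) (t W Z : Series) (F : ℕ → Series) where
    open Level L
    open Engine L

    base : Env
    base 0 = a 0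
    base 1 = t
    base 2 = W
    base 3 = Z
    base _ = zeros

    approx : ℕ → Table → Series
    approx k x = ⟦ table# k x ⟧ base

    formErrors : List Form → ℕ → List Series
    formErrors []       _ = []
    formErrors (g ∷ gs) j = ((λ n → Form.multiple g * F j n) ⊖ approx 1 (Form.table g)) ∷ formErrors gs (suc j)

    tripleErrors : ℕ → ℕ → List Series
    tripleErrors zero    _ = formErrors forms 0
    tripleErrors (suc n) i =
        (a i ⊖ (a 0 ⊕ approx 0 (tab as i)))
      ∷ (b i ⊖ approx 1 (tab bs i))
      ∷ (c i ⊖ approx 2 (tab cs i))
      ∷ tripleErrors n (suc i)

    errors : List Series
    errors = ((Z ⊛ Z) ⊖ ⟦ W²f ⟧ base) ∷ tripleErrors m 0

    combine : List ℤ → ℕ → Series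
    combine []       _ = zeros
    combine (x ∷ xs) i = (λ n → x * a i n) ⊕ combine xs (suc i)

    logSeries : Factors → Series
    logSeries []             = zeros
    logSeries ((i , r) ∷ fs) = (λ n → r * a i n) ⊕ logSeries fs

    record Laws : Set where
      field
        θa : ∀ i → i ℕ.< m → ∀ n → + 12 * θ (a i) n ≡ (a i ⊛ a i) n - b i n
        θb : ∀ i → i ℕ.< m → ∀ n → + 3 * θ (b i) n ≡ (a i ⊛ b i) n - c i n
        θc : ∀ i → i ℕ.< m → ∀ n → + 2 * θ (c i) n ≡ (a i ⊛ c i) n - (b i ⊛ b i) n
        θt : ∀ n → + 24 * θ t n ≡ (t ⊛ logSeries tf) n
        θW : ∀ n → + 24 * θ W n ≡ (W ⊛ logSeries Wf) n
        θF : ∀ j d → j ℕ.< length forms → ∀ n → + 24 * θ (F j) n ≡ (F j ⊛ logSeries (Form.factors (nth d forms j))) n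
        48Z : ∀ n → + 48 * Z n ≡ combine e 0 n
        a₀ : a 0 0 ≡ 1ℤ
        t₀ : t 0 ≡ 0ℤ
        W₀ : W 0 ≡ 1ℤ
        Z₀ : Z 0 ≡ 1ℤ
        0<m : 0 ℕ.< m

    module Soundness (laws : Laws) (checked : Checked)
      (initial : All (λ s → ∀ n → n ℕ.< K → s n ≡ 0ℤ) errors) where
      open Laws laws
      open Checked checked

      err : ℕ → Series
      err = nth zeros errors

      env : Env
      env 0 = a 0
      env 1 = t
      env 2 = W
      env 3 = Z
      env (suc (suc (suc (suc k)))) = err k

      Law : ℕ → Set
      Law i = ∀ n → + 576 * θ (env i) n ≡ ⟦ D i ⟧ env n

      horner-vars : ∀ {P : ℕ → Set} → P 1 → ∀ xs → Vars P (horner xs)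
      horner-vars p []       = tt
      horner-vars p (x ∷ xs) = p , tt , horner-vars p xs

      W^-vars : ∀ {P : ℕ → Set} → P 2 → ∀ k {p} → Vars P p → Vars P (W^ k p)
      W^-vars p zero    v = v
      W^-vars p (suc k) v = p , tt , W^-vars p k v

      table-vars : ∀ {P : ℕ → Set} → P 1 → P 2 → P 3 → ∀ k x → Vars P (table# k x)
      table-vars p₁ p₂ p₃ k (p , q) =
        p₃ , W^-vars p₂ (suc k) (horner-vars p₁ p) , W^-vars p₂ k (horner-vars p₁ q)

      table-env : ∀ k x → ⟦ table# k x ⟧ env ≗ approx k x
      table-env k x = ⟦⟧-cong (table# k x) (table-vars (λ _ → refl) (λ _ → refl) (λ _ → refl) k x)

      W²f-env : ⟦ W²f ⟧ env ≗ ⟦ W²f ⟧ base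
      W²f-env = ⟦⟧-cong W²f (W^-vars (λ _ → refl) 2 (horner-vars (λ _ → refl) f))

      ⊟-sound : ∀ p q v n → ⟦ p ⊟ q ⟧ v n ≡ ⟦ p ⟧ v n - ⟦ q ⟧ v n
      ⊟-sound p q v n = trans (⊞-sound p (scale -1ℤ q) v n)
        (cong (_+_ (⟦ p ⟧ v n)) (trans (scale-sound -1ℤ q v n) (ℤₚ.-1*i≡-i _)))

      triple-at : ∀ n i j → j ℕ.< n →
        (nth zeros (tripleErrors n i) (triple j) ≡ a (i ℕ.+ j) ⊖ (a 0 ⊕ approx 0 (tab as (i ℕ.+ j)))) ×
        (nth zeros (tripleErrors n i) (1 ℕ.+ triple j) ≡ b (i ℕ.+ j) ⊖ approx 1 (tab bs (i ℕ.+ j))) ×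
        (nth zeros (tripleErrors n i) (2 ℕ.+ triple j) ≡ c (i ℕ.+ j) ⊖ approx 2 (tab cs (i ℕ.+ j)))
      triple-at (suc n) i zero    _ rewrite ℕₚ.+-identityʳ i = refl , refl , refl
      triple-at (suc n) i (suc j) j<n rewrite ℕₚ.+-suc i j = triple-at n (suc i) j (ℕ.s≤s⁻¹ j<n)

      form-at : ∀ n i j → nth zeros (tripleErrors n i) (triple n ℕ.+ j) ≡ nth zeros (formErrors forms 0) j
      form-at zero    i j = refl
      form-at (suc n) i j = form-at n (suc i) j

      A-sound : ∀ i → i ℕ.< m → ⟦ A i ⟧ env ≗ a i
      A-sound i i<m n = begin
        ⟦ A i ⟧ env n
          ≡⟨ ⊞-sound (var (5 ℕ.+ triple i)) (var 0 ⊞ table# 0 (tab as i)) env n ⟩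
        ⟦ var (5 ℕ.+ triple i) ⟧ env n + ⟦ var 0 ⊞ table# 0 (tab as i) ⟧ env n
          ≡⟨ cong₂ _+_ (trans (var-sound (5 ℕ.+ triple i) env n) (cong (λ s → s n) (proj₁ (triple-at m 0 i i<m))))
               (trans (⊞-sound (var 0) (table# 0 (tab as i)) env n) (cong₂ _+_ (var-sound 0 env n) (table-env 0 (tab as i) n))) ⟩
        (a i n - (a 0 n + approx 0 (tab as i) n)) + (a 0 n + approx 0 (tab as i) n)
          ≡⟨ solve 2 (λ x y → x :- y :+ y := x) refl (a i n) (a 0 n + approx 0 (tab as i) n) ⟩
        a i n ∎
        where open ≡-Reasoning

      hat-sound : ∀ v k x (s : Series) n → env v n ≡ s n - approx k x n → ⟦ var v ⊞ table# k x ⟧ env n ≡ s n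
      hat-sound v k x s n h = trans (⊞-sound (var v) (table# k x) env n) (trans
        (cong₂ _+_ (trans (var-sound v env n) h) (table-env k x n))
        (solve 2 (λ x y → x :- y :+ y := x) refl (s n) (approx k x n)))

      B-sound : ∀ i → i ℕ.< m → ⟦ B i ⟧ env ≗ b i
      B-sound i i<m n = hat-sound (6 ℕ.+ triple i) 1 (tab bs i) (b i) n (cong (λ s → s n) (proj₁ (proj₂ (triple-at m 0 i i<m))))

      C-sound : ∀ i → i ℕ.< m → ⟦ C i ⟧ env ≗ c i
      C-sound i i<m n = hat-sound (7 ℕ.+ triple i) 2 (tab cs i) (c i) n (cong (λ s → s n) (proj₂ (proj₂ (triple-at m 0 i i<m))))

      product-sound : ∀ p q {f g} → ⟦ p ⟧ env ≗ f → ⟦ q ⟧ env ≗ g → ⟦ p ⊠ q ⟧ env ≗ f ⊛ g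
      product-sound p q hp hq n = trans (⊠-sound p q env n) (⊛-cong hp hq n)

      dA-sound : ∀ i → i ℕ.< m → ∀ n → ⟦ dA i ⟧ env n ≡ + 12 * θ (a i) n
      dA-sound i i<m n = trans (⊟-sound (A i ⊠ A i) (B i) env n) (trans
        (cong₂ _-_ (product-sound (A i) (A i) (A-sound i i<m) (A-sound i i<m) n) (B-sound i i<m n))
        (sym (θa i i<m n)))

      rescale : ∀ k l {x y} → + l * x ≡ y → + k * y ≡ + (k ℕ.* l) * x
      rescale k l refl = trans (sym (ℤₚ.*-assoc (+ k) (+ l) _)) (cong (_* _) (sym (ℤₚ.pos-* k l)))

      dB-sound : ∀ i → i ℕ.< m → ∀ n → ⟦ dB i ⟧ env n ≡ + 576 * θ (b i) n
      dB-sound i i<m n = trans (scale-sound (+ 192) (A i ⊠ B i ⊟ C i) env n) (trans (cong (+ 192 *_) (trans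
        (⊟-sound (A i ⊠ B i) (C i) env n)
        (cong₂ _-_ (product-sound (A i) (B i) (A-sound i i<m) (B-sound i i<m) n) (C-sound i i<m n))))
        (rescale 192 3 (θb i i<m n)))

      dC-sound : ∀ i → i ℕ.< m → ∀ n → ⟦ dC i ⟧ env n ≡ + 576 * θ (c i) n
      dC-sound i i<m n = trans (scale-sound (+ 288) (A i ⊠ C i ⊟ B i ⊠ B i) env n) (trans (cong (+ 288 *_) (trans
        (⊟-sound (A i ⊠ C i) (B i ⊠ B i) env n)
        (cong₂ _-_ (product-sound (A i) (C i) (A-sound i i<m) (C-sound i i<m) n)
                   (product-sound (B i) (B i) (B-sound i i<m) (B-sound i i<m) n))))
        (rescale 288 2 (θc i i<m n)))

      logDeriv-sound : ∀ fs → below fs ≡ true → ∀ n → ⟦ logDeriv fs ⟧ env n ≡ + 24 * logSeries fs n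
      logDeriv-sound [] _ n = trans (const-0 n) refl
      logDeriv-sound ((i , r) ∷ fs) ok n = trans (⊞-sound (scale (+ 24 * r) (A i)) (logDeriv fs) env n) (trans
        (cong₂ _+_ (trans (scale-sound (+ 24 * r) (A i) env n)
            (cong (+ 24 * r *_) (A-sound i (<ᵇ-true i m (proj₁ (∧-split (i <ᵇ m) (below fs) ok))) n)))
          (logDeriv-sound fs (proj₂ (∧-split (i <ᵇ m) (below fs) ok)) n))
        (solve 3 (λ r x y → (:con (+ 24) :* r) :* x :+ :con (+ 24) :* y := :con (+ 24) :* (r :* x :+ y)) refl
          r (a i n) (logSeries fs n)))

      logDeriv-law : ∀ fs → below fs ≡ true → ∀ s → (∀ n → + 24 * θ s n ≡ (s ⊛ logSeries fs) n) →
        ∀ n → (s ⊛ ⟦ logDeriv fs ⟧ env) n ≡ + 576 * θ s n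
      logDeriv-law fs ok s law n = trans (⊛-cong {s} (λ _ → refl) (logDeriv-sound fs ok) n)
        (trans (⊛-scale (+ 24) s (logSeries fs) n) (rescale 24 24 (law n)))

      dComb-sound : ∀ xs i → length xs ℕ.+ i ≡ m → ∀ n → ⟦ dComb xs i ⟧ env n ≡ + 12 * θ (combine xs i) n
      dComb-sound [] i _ n = trans (const-0 n) (sym (cong (+ 12 *_) (ℤₚ.*-zeroʳ (+ n))))
      dComb-sound (x ∷ xs) i len n = trans (⊞-sound (scale x (dA i)) (dComb xs (suc i)) env n) (trans
        (cong₂ _+_ (trans (scale-sound x (dA i) env n) (cong (x *_) (dA-sound i i<m n)))
          (dComb-sound xs (suc i) (trans (ℕₚ.+-suc (length xs) i) len) n))
        (solve 4 (λ x k u v → x :* (:con (+ 12) :* (k :* u)) :+ :con (+ 12) :* (k :* v) := :con (+ 12) :* (k :* (x :* u :+ v))) refl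
          x (+ n) (a i n) (combine xs (suc i) n)))
        where
        i<m : i ℕ.< m
        i<m = subst (suc i ℕ.≤_) len (s≤s (ℕₚ.m≤n+m i (length xs)))

      D₀-law : Law 0
      D₀-law n = sym (trans (scale-sound (+ 48) (dA 0) env n)
        (trans (cong (+ 48 *_) (dA-sound 0 0<m n)) (rescale 48 12 refl)))

      D₁-law : Law 1
      D₁-law n = sym (trans (mulVar-sound 1 (logDeriv tf) env n) (logDeriv-law tf tf-below t θt n))

      D₂-law : Law 2
      D₂-law n = sym (trans (mulVar-sound 2 (logDeriv Wf) env n) (logDeriv-law Wf Wf-below W θW n))

      D₃-law : Law 3
      D₃-law n = sym (trans (dComb-sound e 0 len n) (trans
        (cong (+ 12 *_) (trans (cong (+ n *_) (sym (48Z n)))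
          (solve 2 (λ k z → k :* (:con (+ 48) :* z) := :con (+ 48) :* (k :* z)) refl (+ n) (Z n))))
        (rescale 12 48 refl)))
        where
        len : length e ℕ.+ 0 ≡ m
        len = trans (ℕₚ.+-identityʳ _) e-length

      table-law : ∀ k x n → + 576 * θ (approx k x) n ≡ ⟦ deriv D (table# k x) ⟧ env n
      table-law k x n = trans (cong (+ 576 *_) (θ-cong (λ i → sym (table-env k x i)) n))
        (deriv-sound (+ 576) D (table# k x) env (table-vars D₁-law D₂-law D₃-law k x) n)

      ErrorLaw : Series → Poly → Set
      ErrorLaw s p = ∀ n → + 576 * θ s n ≡ ⟦ p ⟧ env n

      difference-law : ∀ s u p q → ErrorLaw s p → ErrorLaw u q → ErrorLaw (s ⊖ u) (p ⊟ q)
      difference-law s u p q hs hu n = trans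
        (solve 3 (λ k x y → :con (+ 576) :* (k :* (x :- y)) := :con (+ 576) :* (k :* x) :- :con (+ 576) :* (k :* y)) refl (+ n) (s n) (u n))
        (trans (cong₂ _-_ (hs n) (hu n)) (sym (⊟-sound p q env n)))

      sum-law : ∀ s u p q → ErrorLaw s p → ErrorLaw u q → ErrorLaw (s ⊕ u) (p ⊞ q)
      sum-law s u p q hs hu n = trans
        (solve 3 (λ k x y → :con (+ 576) :* (k :* (x :+ y)) := :con (+ 576) :* (k :* x) :+ :con (+ 576) :* (k :* y)) refl (+ n) (s n) (u n))
        (trans (cong₂ _+_ (hs n) (hu n)) (sym (⊞-sound p q env n)))

      formRows-law : ∀ gs j →
        (∀ k d → k ℕ.< length gs → ∀ n → + 24 * θ (F (j ℕ.+ k)) n ≡ (F (j ℕ.+ k) ⊛ logSeries (Form.factors (nth d gs k))) n) →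
        (∀ k → nth zeros (formErrors gs j) k ≡ err (1 ℕ.+ triple m ℕ.+ (j ℕ.+ k))) →
        okForms gs ≡ true →
        Pointwise ErrorLaw (formErrors gs j) (formRows gs (5 ℕ.+ triple m ℕ.+ j))
      formRows-law [] j laws at ok = []
      formRows-law (g ∷ gs) j laws at ok =
        difference-law (λ n → Form.multiple g * F j n) (approx 1 (Form.table g))
          ((var (5 ℕ.+ triple m ℕ.+ j) ⊞ table# 1 x) ⊠ logDeriv (Form.factors g)) (deriv D (table# 1 x)) main (table-law 1 (Form.table g))
        ∷ subst (λ i → Pointwise ErrorLaw (formErrors gs (suc j)) (formRows gs i)) (ℕₚ.+-suc (5 ℕ.+ triple m) j)
            (formRows-law gs (suc j)
              (λ k d k< → subst (λ i → ∀ n → + 24 * θ (F i) n ≡ (F i ⊛ logSeries (Form.factors (nth d gs k))) n) (ℕₚ.+-suc j k) (laws (suc k) d (s≤s k<)))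
              (λ k → trans (at (suc k)) (cong (λ i → err (1 ℕ.+ triple m ℕ.+ i)) (ℕₚ.+-suc j k)))
              (proj₂ (∧-split (below (Form.factors g)) (okForms gs) ok)))
        where
        k = Form.multiple g
        x = Form.table g
        law : ∀ n → + 24 * θ (F j) n ≡ (F j ⊛ logSeries (Form.factors g)) n
        law = subst (λ i → ∀ n → + 24 * θ (F i) n ≡ (F i ⊛ logSeries (Form.factors g)) n) (ℕₚ.+-identityʳ j) (laws 0 g (s≤s z≤n))
        hat : ⟦ var (5 ℕ.+ triple m ℕ.+ j) ⊞ table# 1 x ⟧ env ≗ (λ n → k * F j n)
        hat n = hat-sound (5 ℕ.+ triple m ℕ.+ j) 1 x (λ n → k * F j n) n
          (cong (λ s → s n) (sym (trans (at 0) (cong (λ i → err (1 ℕ.+ triple m ℕ.+ i)) (ℕₚ.+-identityʳ j)))))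
        main : ErrorLaw (λ n → k * F j n) ((var (5 ℕ.+ triple m ℕ.+ j) ⊞ table# 1 x) ⊠ logDeriv (Form.factors g))
        main n = begin
          + 576 * (+ n * (k * F j n))
            ≡⟨ solve 3 (λ n k u → :con (+ 576) :* (n :* (k :* u)) := k :* (:con (+ 576) :* (n :* u))) refl (+ n) k (F j n) ⟩
          k * (+ 576 * θ (F j) n)
            ≡⟨ cong (k *_) (sym (logDeriv-law (Form.factors g) (proj₁ (∧-split (below (Form.factors g)) (okForms gs) ok)) (F j) law n)) ⟩
          k * (F j ⊛ ⟦ logDeriv (Form.factors g) ⟧ env) n
            ≡⟨ sym (scale-⊛ k (F j) (⟦ logDeriv (Form.factors g) ⟧ env) n) ⟩
          ((λ n → k * F j n) ⊛ ⟦ logDeriv (Form.factors g) ⟧ env) n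
            ≡⟨ sym (product-sound (var (5 ℕ.+ triple m ℕ.+ j) ⊞ table# 1 x) (logDeriv (Form.factors g)) hat (λ _ → refl) n) ⟩
          ⟦ (var (5 ℕ.+ triple m ℕ.+ j) ⊞ table# 1 x) ⊠ logDeriv (Form.factors g) ⟧ env n ∎
          where open ≡-Reasoning

      tripleRows-law : ∀ n i → n ℕ.+ i ≡ m → Pointwise ErrorLaw (tripleErrors n i) (tripleRows n i)
      tripleRows-law zero i _ = subst (λ k → Pointwise ErrorLaw (formErrors forms 0) (formRows forms k))
        (ℕₚ.+-identityʳ (5 ℕ.+ triple m))
        (formRows-law forms 0 θF (λ k → sym (form-at m 0 k)) forms-below)
      tripleRows-law (suc n) i len =
          difference-law (a i) (a 0 ⊕ approx 0 (tab as i)) (scale (+ 48) (dA i)) (D 0 ⊞ deriv D (table# 0 (tab as i)))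
            (λ k → sym (trans (scale-sound (+ 48) (dA i) env k) (trans (cong (+ 48 *_) (dA-sound i i<m k)) (rescale 48 12 refl))))
            (sum-law (a 0) (approx 0 (tab as i)) (D 0) (deriv D (table# 0 (tab as i))) D₀-law (table-law 0 (tab as i)))
        ∷ difference-law (b i) (approx 1 (tab bs i)) (dB i) (deriv D (table# 1 (tab bs i))) (λ k → sym (dB-sound i i<m k)) (table-law 1 (tab bs i))
        ∷ difference-law (c i) (approx 2 (tab cs i)) (dC i) (deriv D (table# 2 (tab cs i))) (λ k → sym (dC-sound i i<m k)) (table-law 2 (tab cs i))
        ∷ tripleRows-law n (suc i) (trans (ℕₚ.+-suc n i) len)
        where
        i<m : i ℕ.< m
        i<m = subst (suc i ℕ.≤_) len (s≤s (ℕₚ.m≤n+m i n))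

      φ-sound : ⟦ φ ⟧ env ≗ err 0
      φ-sound n = trans (⊟-sound (var 3 ⊠ var 3) W²f env n)
        (cong₂ _-_ (product-sound (var 3) (var 3) (var-sound 3 env) (var-sound 3 env) n) (W²f-env n))

      vars-scale : ∀ {P : ℕ → Set} x p → Vars P p → Vars P (scale x p)
      vars-scale x (con _) _ = tt
      vars-scale x (node i p q) (v , vp , vq) = v , vars-scale x p vp , vars-scale x q vq

      vars-⊞ : ∀ {P : ℕ → Set} p q → Vars P p → Vars P q → Vars P (p ⊞ q)
      vars-⊞ (con _) (con _) _ _ = tt
      vars-⊞ (con x) (node j r s) vp (v , vr , vs) = v , vars-⊞ (con x) r vp vr , vs
      vars-⊞ (node i p q) (con x) (v , vp , vq) _ = v , vars-⊞ p (con x) vp tt , vq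
      vars-⊞ {P} (node i p q) (node j r s) v@(vi , vp , vq) w@(vj , vr , vs)
        = cases (i ≡ᵇ j) (j <ᵇ i) (vars-⊞ p r vp vr) (vars-⊞ q s vq vs) (vars-⊞ p (node j r s) vp w) (vars-⊞ (node i p q) r v vr)
        where
        vars-mk : ∀ i p q → P i → Vars P p → Vars P q → Vars P (mk i p q)
        vars-mk i p q v vp vq with isZero q
        ... | true  = vp
        ... | false = v , vp , vq
        cases : ∀ x y → Vars P (p ⊞ r) → Vars P (q ⊞ s) → Vars P (p ⊞ node j r s) → Vars P (node i p q ⊞ r) →
          Vars P (if x then mk i (p ⊞ r) (q ⊞ s) else if y then node i (p ⊞ node j r s) q else node j (node i p q ⊞ r) s)
        cases true  _     pr qs _ _ = vars-mk i (p ⊞ r) (q ⊞ s) vi pr qs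
        cases false true  _ _ ps _ = vi , ps , vq
        cases false false _ _ _ qr = vj , qr , vs

      rows-law : Pointwise ErrorLaw errors rows
      rows-law = (λ n → trans (cong (+ 576 *_) (θ-cong (λ i → sym (φ-sound i)) n))
          (deriv-sound (+ 576) D φ env (vars-⊞ (var 3 ⊠ var 3) (scale -1ℤ W²f)
            (D₃-law , tt , D₃-law , tt , tt)
            (vars-scale -1ℤ W²f (W^-vars D₂-law 2 (horner-vars D₁-law f)))) n))
        ∷ tripleRows-law m 0 (ℕₚ.+-identityʳ m)

      nth-law : ∀ {ss ps} → Pointwise ErrorLaw ss ps → ∀ j → j ℕ.< length ps → ErrorLaw (nth zeros ss j) (nth (con 0ℤ) ps j)
      nth-law (h ∷ _)  zero    _ = h
      nth-law (_ ∷ hs) (suc j) j< = nth-law hs j (ℕ.s≤s⁻¹ j<)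

      nth-beyond : ∀ {ss ps} → Pointwise ErrorLaw ss ps → ∀ j → length ps ℕ.≤ j → nth zeros ss j ≡ zeros
      nth-beyond []       j       _ = refl
      nth-beyond (_ ∷ hs) (suc j) j≥ = nth-beyond hs j (ℕ.s≤s⁻¹ j≥)

      nth-row : ∀ i ps → okRows i ps ≡ true → ∀ j → j ℕ.< length ps → okRow (i ℕ.+ j) (normal (nth (con 0ℤ) ps j)) ≡ true
      nth-row i (p ∷ ps) ok zero    _ rewrite ℕₚ.+-identityʳ i = proj₁ (∧-split (okRow i (normal p)) (okRows (suc i) ps) ok)
      nth-row i (p ∷ ps) ok (suc j) j< rewrite ℕₚ.+-suc i j = nth-row (suc i) ps (proj₂ (∧-split (okRow i (normal p)) (okRows (suc i) ps) ok)) j (ℕ.s≤s⁻¹ j<)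

      nth-initial : ∀ {ss} → All (λ s → ∀ n → n ℕ.< K → s n ≡ 0ℤ) ss → ∀ j n → n ℕ.< K → nth zeros ss j n ≡ 0ℤ
      nth-initial []       j       n n<K = refl
      nth-initial (h ∷ _)  zero    n n<K = h n n<K
      nth-initial (_ ∷ hs) (suc j) n n<K = nth-initial hs j n n<K

      start-env : ∀ i → env i 0 ≡ start i
      start-env 0 = a₀
      start-env 1 = t₀
      start-env 2 = W₀
      start-env 3 = Z₀
      start-env (suc (suc (suc (suc k)))) = nth-initial initial k 0 (<ᵇ-true 0 K K-pos)

      Z² : env 3 ⊛ env 3 ≗ ⟦ var 4 ⊞ W²f ⟧ env
      Z² n = sym (trans (⊞-sound (var 4) W²f env n) (trans
        (cong₂ _+_ (var-sound 4 env n) (W²f-env n))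
        (solve 2 (λ x y → x :- y :+ y := x) refl ((Z ⊛ Z) n) (⟦ W²f ⟧ base n))))

      beyond : ∀ k n → E ℕ.≤ k → err k n ≡ 0ℤ
      beyond k n E≤k = cong (λ s → s n) (nth-beyond rows-law k E≤k)

      leading : ∀ p → pure (proj₁ (normal p)) ≡ true → pure (proj₂ (normal p)) ≡ true →
        ∀ n → (∀ k i → i ℕ.< n → err k i ≡ 0ℤ) → ⟦ p ⟧ env n ≡ sumTo E (λ k → entry (normal p) k * err k n)
      leading p pu pv n low = begin
        ⟦ p ⟧ env n
          ≡⟨ reduce-sound 3 (var 4 ⊞ W²f) p env Z² n ⟩
        ⟦ u ⟧ env n + (Z ⊛ ⟦ v ⟧ env) n
          ≡⟨ cong (_+_ (⟦ u ⟧ env n)) (trans (⊛-comm Z (⟦ v ⟧ env) n) (⊛-leading (⟦ v ⟧ env) Z n v-low)) ⟩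
        ⟦ u ⟧ env n + ⟦ v ⟧ env n * Z 0
          ≡⟨ cong (λ x → ⟦ u ⟧ env n + x) (trans (cong (⟦ v ⟧ env n *_) Z₀) (ℤₚ.*-identityʳ _)) ⟩
        ⟦ u ⟧ env n + ⟦ v ⟧ env n
          ≡⟨ cong₂ _+_ (pure-leading E u env n pu (λ k → beyond k n) low start-env) (pure-leading E v env n pv (λ k → beyond k n) low start-env) ⟩
        sumTo E (λ k → coeff start u k * err k n) + sumTo E (λ k → coeff start v k * err k n)
          ≡⟨ sym (sumTo-+ E _ _) ⟩
        sumTo E (λ k → coeff start u k * err k n + coeff start v k * err k n)
          ≡⟨ sumTo-cong E (λ k _ → sym (ℤₚ.*-distribʳ-+ (err k n) (coeff start u k) (coeff start v k))) ⟩
        sumTo E (λ k → entry (normal p) k * err k n) ∎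
        where
        open ≡-Reasoning
        u = proj₁ (normal p)
        v = proj₂ (normal p)
        v-low : ∀ i → i ℕ.< n → ⟦ v ⟧ env i ≡ 0ℤ
        v-low i i<n = trans (pure-leading E v env i pv (λ k → beyond k i) (λ k l l<i → low k l (ℕₚ.<-trans l<i i<n)) start-env)
          (trans (sumTo-cong E (λ k _ → trans (cong (coeff start v k *_) (low k i i<n)) (ℤₚ.*-zeroʳ (coeff start v k)))) (sumTo-0 E))

      weight-pos : ∀ ws → all (0 <ᵇ_) ws ≡ true → ∀ k → 1 ℕ.≤ nth 1 ws k
      weight-pos []       _  k       = s≤s z≤n
      weight-pos (w ∷ ws) ok zero    = <ᵇ-true 0 w (proj₁ (∧-split (0 <ᵇ w) (all (0 <ᵇ_) ws) ok))
      weight-pos (w ∷ ws) ok (suc k) = weight-pos ws (proj₂ (∧-split (0 <ᵇ w) (all (0 <ᵇ_) ws) ok)) k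

      all-below : ∀ n → (∀ k i → k ℕ.< E → i ℕ.< n → err k i ≡ 0ℤ) → ∀ k i → i ℕ.< n → err k i ≡ 0ℤ
      all-below n h k i i<n with k ℕₚ.<? E
      ... | yes k<E = h k i k<E i<n
      ... | no  k≮E = beyond k i (ℕₚ.≮⇒≥ k≮E)

      row : ℕ → Poly × Poly
      row j = normal (nth (con 0ℤ) rows j)

      dominated : ℕ → Poly × Poly → Bool
      dominated j pq = sumToℕ E (λ k → ∣ entry pq k ∣ ℕ.* weight k) <ᵇ 576 ℕ.* K ℕ.* weight j

      row-ok : ∀ j → j ℕ.< E →
        pure (proj₁ (row j)) ≡ true × pure (proj₂ (row j)) ≡ true × dominated j (row j) ≡ true
      row-ok j j<E with ∧-split (pure (proj₁ (row j))) (pure (proj₂ (row j)) ∧ dominated j (row j)) (nth-row 0 rows rows-ok j j<E)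
      ... | x , yz = x , ∧-split (pure (proj₂ (row j))) (dominated j (row j)) yz

      errors-vanish : ∀ n k → k ℕ.< E → err k n ≡ 0ℤ
      errors-vanish = gronwall E 576 K (λ j → entry (row j)) weight err
        (weight-pos weights weights-pos)
        (λ n low j j<E → trans (nth-law rows-law j j<E n)
          (leading (nth (con 0ℤ) rows j) (proj₁ (row-ok j j<E)) (proj₁ (proj₂ (row-ok j j<E))) n (all-below n low)))
        (λ j j<E → <ᵇ-true (sumToℕ E (λ k → ∣ entry (row j) k ∣ ℕ.* weight k)) (576 ℕ.* K ℕ.* weight j) (proj₂ (proj₂ (row-ok j j<E))))
        (λ k n _ n<K → nth-initial initial k n n<K)

      vanishes-sound : ∀ p → vanishes p ≡ true → ⟦ p ⟧ env ≗ zeros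
      vanishes-sound p ok n = trans (leading p (proj₁ split) (proj₂ split) n (λ k i _ → zero-err k i))
        (trans (sumTo-cong E (λ k _ → trans (cong (entry (normal p) k *_) (zero-err k n)) (ℤₚ.*-zeroʳ (entry (normal p) k)))) (sumTo-0 E))
        where
        split = ∧-split (pure (proj₁ (normal p))) (pure (proj₂ (normal p))) ok
        zero-err : ∀ k i → err k i ≡ 0ℤ
        zero-err k i with k ℕₚ.<? E
        ... | yes k<E = errors-vanish i k k<E
        ... | no  k≮E = beyond k i (ℕₚ.≮⇒≥ k≮E)

  -- gap d k f is qᵏ f(qᵈ⁺¹).
  gap : ℕ → ℕ → Series → Series
  gap d zero    f zero    = f 0
  gap d zero    f (suc n) = gap d d (tail f) n
  gap d (suc k) f zero    = 0ℤ
  gap d (suc k) f (suc n) = gap d k f n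

  gap-cong : ∀ d k {f g} → f ≗ g → gap d k f ≗ gap d k g
  gap-cong d zero    h zero    = h 0
  gap-cong d zero    h (suc n) = gap-cong d d (h ∘ suc) n
  gap-cong d (suc k) h zero    = refl
  gap-cong d (suc k) h (suc n) = gap-cong d k h n

  gap-⊕ : ∀ d k f g → gap d k (f ⊕ g) ≗ gap d k f ⊕ gap d k g
  gap-⊕ d zero    f g zero    = refl
  gap-⊕ d zero    f g (suc n) = gap-⊕ d d (tail f) (tail g) n
  gap-⊕ d (suc k) f g zero    = refl
  gap-⊕ d (suc k) f g (suc n) = gap-⊕ d k f g n

  gap-scale : ∀ d k c f n → gap d k (λ i → c * f i) n ≡ c * gap d k f n
  gap-scale d zero    c f zero    = refl
  gap-scale d zero    c f (suc n) = gap-scale d d c (tail f) n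
  gap-scale d (suc k) c f zero    = sym (ℤₚ.*-zeroʳ c)
  gap-scale d (suc k) c f (suc n) = gap-scale d k c f n

  gap-⊖ : ∀ d k f g → gap d k (f ⊖ g) ≗ gap d k f ⊖ gap d k g
  gap-⊖ d k f g n = trans (gap-cong d k (λ i → cong (_+_ (f i)) (sym (ℤₚ.-1*i≡-i (g i)))) n)
    (trans (gap-⊕ d k f (λ i → -1ℤ * g i) n) (cong (_+_ (gap d k f n)) (trans (gap-scale d k -1ℤ g n) (ℤₚ.-1*i≡-i _))))

  gap-⊛ : ∀ d k f g → gap d k f ⊛ gap d 0 g ≗ gap d k (f ⊛ g)
  gap-⊛ d zero    f g zero    = refl
  gap-⊛ d zero    f g (suc n) = trans
    (cong₂ _+_ (sym (gap-scale d d (f 0) (tail g) n)) (gap-⊛ d d (tail f) g n))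
    (sym (gap-⊕ d d (λ i → f 0 * g (suc i)) (tail f ⊛ g) n))
  gap-⊛ d (suc k) f g zero    = refl
  gap-⊛ d (suc k) f g (suc n) = trans (ℤₚ.+-identityˡ _) (gap-⊛ d k f g n)

  θ-gap : ∀ d k f → θ (gap d k f) ≗ gap d k (λ j → + (j ℕ.* suc d ℕ.+ k) * f j)
  θ-gap d zero    f zero    = refl
  θ-gap d zero    f (suc n) = begin
    + suc n * gap d d (tail f) n
      ≡⟨ trans (cong (_* gap d d (tail f) n) (ℤₚ.pos-+ 1 n)) (ℤₚ.*-distribʳ-+ (gap d d (tail f) n) 1ℤ (+ n)) ⟩
    1ℤ * gap d d (tail f) n + θ (gap d d (tail f)) n
      ≡⟨ cong₂ _+_ (sym (gap-scale d d 1ℤ (tail f) n)) (θ-gap d d (tail f) n) ⟩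
    gap d d (λ j → 1ℤ * f (suc j)) n + gap d d (λ j → + (j ℕ.* suc d ℕ.+ d) * f (suc j)) n
      ≡⟨ sym (gap-⊕ d d _ _ n) ⟩
    gap d d (λ j → 1ℤ * f (suc j) + + (j ℕ.* suc d ℕ.+ d) * f (suc j)) n
      ≡⟨ gap-cong d d (λ j → trans (sym (ℤₚ.*-distribʳ-+ (f (suc j)) 1ℤ (+ (j ℕ.* suc d ℕ.+ d))))
           (cong (λ x → + x * f (suc j)) (exponent j))) n ⟩
    gap d d (λ j → + (suc j ℕ.* suc d ℕ.+ 0) * f (suc j)) n ∎
    where
    open ≡-Reasoning
    exponent : ∀ j → 1 ℕ.+ (j ℕ.* suc d ℕ.+ d) ≡ suc j ℕ.* suc d ℕ.+ 0
    exponent j = trans (cong suc (ℕₚ.+-comm (j ℕ.* suc d) d)) (sym (ℕₚ.+-identityʳ _))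
  θ-gap d (suc k) f zero    = refl
  θ-gap d (suc k) f (suc n) = begin
    + suc n * gap d k f n
      ≡⟨ trans (cong (_* gap d k f n) (ℤₚ.pos-+ 1 n)) (ℤₚ.*-distribʳ-+ (gap d k f n) 1ℤ (+ n)) ⟩
    1ℤ * gap d k f n + θ (gap d k f) n
      ≡⟨ cong₂ _+_ (sym (gap-scale d k 1ℤ f n)) (θ-gap d k f n) ⟩
    gap d k (λ j → 1ℤ * f j) n + gap d k (λ j → + (j ℕ.* suc d ℕ.+ k) * f j) n
      ≡⟨ sym (gap-⊕ d k _ _ n) ⟩
    gap d k (λ j → 1ℤ * f j + + (j ℕ.* suc d ℕ.+ k) * f j) n
      ≡⟨ gap-cong d k (λ j → trans (sym (ℤₚ.*-distribʳ-+ (f j) 1ℤ (+ (j ℕ.* suc d ℕ.+ k))))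
           (cong (λ x → + x * f j) (sym (ℕₚ.+-suc (j ℕ.* suc d) k)))) n ⟩
    gap d k (λ j → + (j ℕ.* suc d ℕ.+ suc k) * f j) n ∎
    where open ≡-Reasoning

  gap-low : ∀ d k f n → n ℕ.< k → gap d k f n ≡ 0ℤ
  gap-low d (suc k) f zero    _ = refl
  gap-low d (suc k) f (suc n) n<k = gap-low d k f n (ℕ.s≤s⁻¹ n<k)

  V : ℕ → Series → Series
  V d = gap d 0

  V-const : ∀ d c → V d (const c) ≗ const c
  V-const d c zero    = refl
  V-const d c (suc n) = go d n
    where
    go : ∀ k n → gap d k (λ _ → 0ℤ) n ≡ 0ℤ
    go zero    zero    = refl
    go zero    (suc n) = go d n
    go (suc k) zero    = refl
    go (suc k) (suc n) = go k n

  V-low : ∀ d f n → n ℕ.≤ d → V d f n ≡ const (f 0) n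
  V-low d f zero    _   = refl
  V-low d f (suc n) n<d = gap-low d d (tail f) n n<d

  θ-V : ∀ d f n → θ (V d f) n ≡ + suc d * V d (θ f) n
  θ-V d f n = trans (θ-gap d 0 f n) (trans
    (gap-cong d 0 (λ j → trans (cong (_* f j) (trans (cong +_ (trans (ℕₚ.+-identityʳ _) (ℕₚ.*-comm j (suc d)))) (ℤₚ.pos-* (suc d) j)))
      (ℤₚ.*-assoc (+ suc d) (+ j) (f j))) n)
    (gap-scale d 0 (+ suc d) (θ f) n))

  ⊛-cong-upto : ∀ n {f f′ g g′} → (∀ i → i ℕ.≤ n → f i ≡ f′ i) → (∀ i → i ℕ.≤ n → g i ≡ g′ i) →
    (f ⊛ g) n ≡ (f′ ⊛ g′) n
  ⊛-cong-upto zero    p r = cong₂ _*_ (p 0 z≤n) (r 0 z≤n)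
  ⊛-cong-upto (suc n) p r = cong₂ _+_ (cong₂ _*_ (p 0 z≤n) (r (suc n) ℕₚ.≤-refl))
    (⊛-cong-upto n (λ i i≤n → p (suc i) (s≤s i≤n)) (λ i i≤n → r i (ℕₚ.m≤n⇒m≤1+n i≤n)))

  -- LogDeriv f g says that g is 24 times the logarithmic derivative of f.
  LogDeriv : Series → Series → Set
  LogDeriv f g = ∀ n → + 24 * θ f n ≡ (f ⊛ g) n

  logDeriv-cong : ∀ {f f′ g g′} → f ≗ f′ → g ≗ g′ → LogDeriv f g → LogDeriv f′ g′
  logDeriv-cong p r h n = trans (cong (+ 24 *_) (sym (θ-cong p n))) (trans (h n) (⊛-cong p r n))

  logDeriv-⊛ : ∀ f f′ g g′ → LogDeriv f g → LogDeriv f′ g′ → LogDeriv (f ⊛ f′) (g ⊕ g′)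
  logDeriv-⊛ f f′ g g′ h h′ n = begin
    + 24 * θ (f ⊛ f′) n
      ≡⟨ trans (cong (+ 24 *_) (θ-⊛ f f′ n)) (ℤₚ.*-distribˡ-+ (+ 24) ((θ f ⊛ f′) n) ((f ⊛ θ f′) n)) ⟩
    + 24 * (θ f ⊛ f′) n + + 24 * (f ⊛ θ f′) n
      ≡⟨ cong₂ _+_ (trans (sym (scale-⊛ (+ 24) (θ f) f′ n)) (⊛-cong h (λ _ → refl) n))
                   (trans (sym (⊛-scale (+ 24) f (θ f′) n)) (⊛-cong {f} (λ _ → refl) h′ n)) ⟩
    ((f ⊛ g) ⊛ f′) n + (f ⊛ (f′ ⊛ g′)) n
      ≡⟨ cong₂ _+_ (trans (⊛-assoc f g f′ n) (trans (⊛-cong {f} (λ _ → refl) (⊛-comm g f′) n) (sym (⊛-assoc f f′ g n))))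
                   (sym (⊛-assoc f f′ g′ n)) ⟩
    ((f ⊛ f′) ⊛ g) n + ((f ⊛ f′) ⊛ g′) n
      ≡⟨ sym (⊛-distribˡ-⊕ (f ⊛ f′) g g′ n) ⟩
    ((f ⊛ f′) ⊛ (g ⊕ g′)) n ∎
    where open ≡-Reasoning

  logDeriv-const : ∀ c → LogDeriv (const c) zeros
  logDeriv-const c zero    = sym (ℤₚ.*-zeroʳ c)
  logDeriv-const c (suc n) = trans (cong (+ 24 *_) (ℤₚ.*-zeroʳ (+ suc n))) (sym (trans (const-⊛ c zeros (suc n)) (ℤₚ.*-zeroʳ c)))

  logDeriv-V : ∀ d f g → LogDeriv f g → LogDeriv (V d f) (λ n → + suc d * V d g n)
  logDeriv-V d f g h n = begin
    + 24 * θ (V d f) n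
      ≡⟨ cong (+ 24 *_) (θ-V d f n) ⟩
    + 24 * (+ suc d * V d (θ f) n)
      ≡⟨ solve 3 (λ a b c → a :* (b :* c) := b :* (a :* c)) refl (+ 24) (+ suc d) (V d (θ f) n) ⟩
    + suc d * (+ 24 * V d (θ f) n)
      ≡⟨ cong (+ suc d *_) (trans (sym (gap-scale d 0 (+ 24) (θ f) n)) (trans (gap-cong d 0 h n) (sym (gap-⊛ d 0 f g n)))) ⟩
    + suc d * (V d f ⊛ V d g) n
      ≡⟨ sym (⊛-scale (+ suc d) (V d f) (V d g) n) ⟩
    (V d f ⊛ (λ n → + suc d * V d g n)) n ∎
    where open ≡-Reasoning

  negate : Series → Series
  negate f n = - f n

  logDeriv-inverse : ∀ f h g → f ⊛ h ≗ const 1ℤ → LogDeriv f g → LogDeriv h (negate g)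
  logDeriv-inverse f h g fh≡1 law n = begin
    + 24 * θ h n
      ≡⟨ sym (⊛-scale-1 n) ⟩
    (h ⊛ (f ⊛ k)) n
      ≡⟨ ⊛-cong {h} (λ _ → refl) fk n ⟩
    (h ⊛ negate g) n ∎
    where
    open ≡-Reasoning
    k : Series
    k n = + 24 * θ h n
    hf≡1 : h ⊛ f ≗ const 1ℤ
    hf≡1 n = trans (⊛-comm h f n) (fh≡1 n)
    ⊛-scale-1 : ∀ n → (h ⊛ (f ⊛ k)) n ≡ k n
    ⊛-scale-1 n = trans (sym (⊛-assoc h f k n)) (trans (⊛-cong hf≡1 (λ _ → refl) n) (⊛-identityˡ k n))
    fg⊛h : ∀ n → ((f ⊛ g) ⊛ h) n ≡ g n
    fg⊛h n = trans (⊛-cong (⊛-comm f g) (λ _ → refl) n) (trans (⊛-assoc g f h n)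
      (trans (⊛-cong {g} (λ _ → refl) fh≡1 n) (trans (⊛-comm g (const 1ℤ) n) (⊛-identityˡ g n))))
    θ-const : ∀ n → θ (const 1ℤ) n ≡ 0ℤ
    θ-const zero    = refl
    θ-const (suc n) = ℤₚ.*-zeroʳ (+ suc n)
    total : ∀ n → g n + (f ⊛ k) n ≡ 0ℤ
    total n = begin
      g n + (f ⊛ k) n
        ≡⟨ cong₂ _+_ (sym (trans (⊛-cong law (λ _ → refl) n) (fg⊛h n))) (⊛-scale (+ 24) f (θ h) n) ⟩
      ((λ i → + 24 * θ f i) ⊛ h) n + + 24 * (f ⊛ θ h) n
        ≡⟨ cong (_+ + 24 * (f ⊛ θ h) n) (scale-⊛ (+ 24) (θ f) h n) ⟩
      + 24 * (θ f ⊛ h) n + + 24 * (f ⊛ θ h) n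
        ≡⟨ sym (ℤₚ.*-distribˡ-+ (+ 24) ((θ f ⊛ h) n) ((f ⊛ θ h) n)) ⟩
      + 24 * ((θ f ⊛ h) n + (f ⊛ θ h) n)
        ≡⟨ cong (+ 24 *_) (trans (sym (θ-⊛ f h n)) (trans (θ-cong fh≡1 n) (θ-const n))) ⟩
      0ℤ ∎
    fk : f ⊛ k ≗ negate g
    fk n = begin
      (f ⊛ k) n                    ≡⟨ solve 2 (λ a b → b := (a :+ b) :- a) refl (g n) ((f ⊛ k) n) ⟩
      (g n + (f ⊛ k) n) - g n      ≡⟨ cong (_- g n) (total n) ⟩
      0ℤ - g n                     ≡⟨ ℤₚ.+-identityˡ _ ⟩
      - g n                        ∎

  logDeriv-shift : ∀ f g → LogDeriv f g → LogDeriv (shift f) (g ⊕ const (+ 24))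
  logDeriv-shift f g h zero    = refl
  logDeriv-shift f g h (suc n) = begin
    + 24 * (+ suc n * f n)
      ≡⟨ cong (λ x → + 24 * (x * f n)) (ℤₚ.pos-+ 1 n) ⟩
    + 24 * ((1ℤ + + n) * f n)
      ≡⟨ solve 2 (λ n f → :con (+ 24) :* ((:con 1ℤ :+ n) :* f) := :con (+ 24) :* (n :* f) :+ :con (+ 24) :* f) refl (+ n) (f n) ⟩
    + 24 * θ f n + + 24 * f n
      ≡⟨ cong₂ _+_ (h n) (sym (trans (⊛-comm f (const (+ 24)) n) (const-⊛ (+ 24) f n))) ⟩
    (f ⊛ g) n + (f ⊛ const (+ 24)) n
      ≡⟨ sym (⊛-distribˡ-⊕ f g (const (+ 24)) n) ⟩
    (f ⊛ (g ⊕ const (+ 24))) n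
      ≡⟨ sym (ℤₚ.+-identityˡ _) ⟩
    (shift f ⊛ (g ⊕ const (+ 24))) (suc n) ∎
    where open ≡-Reasoning

  positive : Series
  positive zero    = 0ℤ
  positive (suc _) = 1ℤ

  1-q : Series
  1-q = const 1ℤ ⊖ shift (const 1ℤ)

  -- V j positive n is 1 if j + 1 divides n > 0, and 0 otherwise.
  divisorSum : (ℕ → ℤ) → ℕ → Series
  divisorSum w N n = sumTo N (λ j → w j * V j positive n)

  divisorSeries : (ℕ → ℤ) → Series
  divisorSeries w n = divisorSum w n n

  V-positive-low : ∀ j n → n ℕ.≤ j → V j positive n ≡ 0ℤ
  V-positive-low j n n≤j = trans (V-low j positive n n≤j) (const-0 n)

  divisorSum-stable : ∀ w n k → divisorSum w (k ℕ.+ n) n ≡ divisorSeries w n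
  divisorSum-stable w n zero    = refl
  divisorSum-stable w n (suc k) = trans
    (cong₂ _+_ (divisorSum-stable w n k)
      (trans (cong (w (k ℕ.+ n) *_) (V-positive-low (k ℕ.+ n) n (ℕₚ.m≤n+m n k))) (ℤₚ.*-zeroʳ (w (k ℕ.+ n)))))
    (ℤₚ.+-identityʳ _)

  divisorSum-≤ : ∀ w {n N} → n ℕ.≤ N → divisorSum w N n ≡ divisorSeries w n
  divisorSum-≤ w {n} {N} n≤N = trans (cong (λ N → divisorSum w N n) (sym (ℕₚ.m∸n+n≡m n≤N))) (divisorSum-stable w n (N ℕ.∸ n))

  eulerProduct : ℕ → Series
  eulerProduct zero    = const 1ℤ
  eulerProduct (suc N) = eulerProduct N ⊛ V N 1-q

  euler : Series
  euler n = eulerProduct n n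

  eulerProduct-stable : ∀ n k → eulerProduct (k ℕ.+ n) n ≡ euler n
  eulerProduct-stable n zero    = refl
  eulerProduct-stable n (suc k) = begin
    (eulerProduct (k ℕ.+ n) ⊛ V (k ℕ.+ n) 1-q) n
      ≡⟨ ⊛-cong-upto n {eulerProduct (k ℕ.+ n)} (λ _ _ → refl) (λ i i≤n → V-low (k ℕ.+ n) 1-q i (ℕₚ.≤-trans i≤n (ℕₚ.m≤n+m n k))) ⟩
    (eulerProduct (k ℕ.+ n) ⊛ const 1ℤ) n
      ≡⟨ trans (⊛-comm (eulerProduct (k ℕ.+ n)) (const 1ℤ) n) (⊛-identityˡ _ n) ⟩
    eulerProduct (k ℕ.+ n) n
      ≡⟨ eulerProduct-stable n k ⟩
    euler n ∎
    where open ≡-Reasoning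

  eulerProduct-≤ : ∀ {n N} → n ℕ.≤ N → eulerProduct N n ≡ euler n
  eulerProduct-≤ {n} {N} n≤N = trans (cong (λ N → eulerProduct N n) (sym (ℕₚ.m∸n+n≡m n≤N))) (eulerProduct-stable n (N ℕ.∸ n))

  successor : ℕ → ℤ
  successor j = + suc j

  -24[_] : Series → Series
  -24[ f ] n = - (+ 24 * f n)

  logDeriv-1-q : LogDeriv 1-q -24[ positive ]
  logDeriv-1-q n = sym (trans (⊛-cong {1-q} (λ _ → refl) (λ i → ℤₚ.neg-distribˡ-* (+ 24) (positive i)) n)
    (trans (⊛-scale -[1+ 23 ] 1-q positive n) (trans (cong (-[1+ 23 ] *_) (product n)) (value n))))
    where
    product : 1-q ⊛ positive ≗ shift (const 1ℤ)
    product zero          = refl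
    product (suc zero)    = refl
    product (suc (suc n)) = cong (λ x → 1ℤ + (-1ℤ + x)) (trans (⊛-cong {tail (tail 1-q)} {zeros} (λ _ → refl) (λ _ → refl) n) (0⊛ positive n))
    value : ∀ n → -[1+ 23 ] * shift (const 1ℤ) n ≡ + 24 * θ 1-q n
    value zero          = refl
    value (suc zero)    = refl
    value (suc (suc n)) = sym (trans (cong (+ 24 *_) (ℤₚ.*-zeroʳ (+ suc (suc n)))) refl)

  logDeriv-eulerProduct : ∀ N → LogDeriv (eulerProduct N) -24[ divisorSum successor N ]
  logDeriv-eulerProduct zero    = logDeriv-const 1ℤ
  logDeriv-eulerProduct (suc N) = logDeriv-cong (λ _ → refl) combine
    (logDeriv-⊛ (eulerProduct N) (V N 1-q) -24[ divisorSum successor N ] (λ n → + suc N * V N -24[ positive ] n)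
      (logDeriv-eulerProduct N) (logDeriv-V N 1-q -24[ positive ] logDeriv-1-q))
    where
    V-24 : ∀ n → V N -24[ positive ] n ≡ - (+ 24 * V N positive n)
    V-24 n = trans (gap-cong N 0 (λ i → ℤₚ.neg-distribˡ-* (+ 24) (positive i)) n)
      (trans (gap-scale N 0 -[1+ 23 ] positive n) (sym (ℤₚ.neg-distribˡ-* (+ 24) (V N positive n))))
    combine : ∀ n → -24[ divisorSum successor N ] n + + suc N * V N -24[ positive ] n ≡ -24[ divisorSum successor (suc N) ] n
    combine n = trans (cong (λ x → -24[ divisorSum successor N ] n + + suc N * x) (V-24 n))
      (solve 3 (λ s w v → :- (:con (+ 24) :* s) :+ w :* (:- (:con (+ 24) :* v)) := :- (:con (+ 24) :* (s :+ w :* v))) refl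
        (divisorSum successor N n) (+ suc N) (V N positive n))

  σ₁-series : Series
  σ₁-series = divisorSeries successor

  logDeriv-euler : LogDeriv euler -24[ σ₁-series ]
  logDeriv-euler n = trans (logDeriv-eulerProduct n n)
    (⊛-cong-upto n (λ i i≤n → eulerProduct-≤ i≤n) (λ i i≤n → cong (λ x → - (+ 24 * x)) (divisorSum-≤ successor i≤n)))

  -- The power series inverse of f when f has constant term 1, as the limit of
  -- h ↦ 1 - (f - 1) h.
  inverseStep : ℕ → Series → Series
  inverseStep zero    f = zeros
  inverseStep (suc N) f zero    = 1ℤ
  inverseStep (suc N) f (suc n) = - (tail f ⊛ inverseStep N f) n

  inverseSeries : Series → Series
  inverseSeries f n = inverseStep (suc n) f n

  inverseStep-stable : ∀ f N M n → n ℕ.< N → n ℕ.< M → inverseStep N f n ≡ inverseStep M f n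
  inverseStep-stable f (suc N) (suc M) zero    _ _ = refl
  inverseStep-stable f (suc N) (suc M) (suc n) (s≤s n<N) (s≤s n<M) = cong -_ (⊛-cong-upto n {tail f} (λ _ _ → refl)
    (λ i i≤n → inverseStep-stable f N M i (ℕₚ.≤-<-trans i≤n n<N) (ℕₚ.≤-<-trans i≤n n<M)))

  inverseSeries-suc : ∀ f n → inverseSeries f (suc n) ≡ - (tail f ⊛ inverseSeries f) n
  inverseSeries-suc f n = cong -_ (⊛-cong-upto n {tail f} (λ _ _ → refl)
    (λ i i≤n → inverseStep-stable f (suc n) (suc i) i (s≤s i≤n) ℕₚ.≤-refl))

  ⊛-inverse : ∀ f → f 0 ≡ 1ℤ → f ⊛ inverseSeries f ≗ const 1ℤ
  ⊛-inverse f f₀ zero    = cong (_* 1ℤ) f₀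
  ⊛-inverse f f₀ (suc n) = trans
    (cong₂ (λ a b → a * b + (tail f ⊛ inverseSeries f) n) f₀ (inverseSeries-suc f n))
    (solve 1 (λ x → :con 1ℤ :* (:- x) :+ x := :con 0ℤ) refl ((tail f ⊛ inverseSeries f) n))

  partitions : Series
  partitions = inverseSeries euler

  power : Series → ℕ → Series
  power f zero    = const 1ℤ
  power f (suc n) = f ⊛ power f n

  -- eulerPower d r is the r-th power of ∏ (1 - qⁿ⁽ᵈ⁺¹⁾).
  eulerPower : ℕ → ℤ → Series
  eulerPower d (+ n)    = power (V d euler) n
  eulerPower d -[1+ n ] = power (V d partitions) (suc n)

  E₂-series E₄-series : Series
  E₂-series = const 1ℤ ⊖ (λ n → + 24 * σ₁-series n)
  E₄-series = const 1ℤ ⊕ (λ n → + 240 * divisorSeries (λ j → successor j * (successor j * successor j)) n)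

  logDeriv-power : ∀ f g n → LogDeriv f g → LogDeriv (power f n) (λ i → + n * g i)
  logDeriv-power f g zero    h = logDeriv-cong (λ _ → refl) (λ i → refl) (logDeriv-const 1ℤ)
  logDeriv-power f g (suc n) h = logDeriv-cong (λ _ → refl)
    (λ i → trans (solve 2 (λ n g → g :+ n :* g := (:con 1ℤ :+ n) :* g) refl (+ n) (g i)) (cong (_* g i) (sym (ℤₚ.pos-+ 1 n))))
    (logDeriv-⊛ f (power f n) g (λ i → + n * g i) h (logDeriv-power f g n h))

  E₂-at : ℕ → Series
  E₂-at d n = + suc d * V d E₂-series n

  P-log : ℕ → Series
  P-log d = E₂-at d ⊖ const (+ suc d)

  logDeriv-V-euler : ∀ d → LogDeriv (V d euler) (P-log d)
  logDeriv-V-euler d = logDeriv-cong (λ _ → refl) eq (logDeriv-V d euler -24[ σ₁-series ] logDeriv-euler)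
    where
    open ≡-Reasoning
    eq : ∀ n → + suc d * V d -24[ σ₁-series ] n ≡ P-log d n
    eq n = begin
      + suc d * V d -24[ σ₁-series ] n
        ≡⟨ cong (+ suc d *_) (trans (gap-cong d 0 (λ i → solve 2 (λ c x → :- x := (c :- x) :- c) refl (const 1ℤ i) (+ 24 * σ₁-series i)) n)
             (trans (gap-⊖ d 0 E₂-series (const 1ℤ) n) (cong (_-_ (V d E₂-series n)) (V-const d 1ℤ n)))) ⟩
      + suc d * (V d E₂-series n - const 1ℤ n)
        ≡⟨ solve 3 (λ d v c → d :* (v :- c) := d :* v :- d :* c) refl (+ suc d) (V d E₂-series n) (const 1ℤ n) ⟩
      E₂-at d n - + suc d * const 1ℤ n
        ≡⟨ cong (λ x → E₂-at d n - x) (scaled n) ⟩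
      P-log d n ∎
      where
      scaled : ∀ n → + suc d * const 1ℤ n ≡ const (+ suc d) n
      scaled zero    = ℤₚ.*-identityʳ (+ suc d)
      scaled (suc n) = ℤₚ.*-zeroʳ (+ suc d)

  V-inverse : ∀ d → V d euler ⊛ V d partitions ≗ const 1ℤ
  V-inverse d n = trans (gap-⊛ d 0 euler partitions n) (trans (gap-cong d 0 (⊛-inverse euler refl) n) (V-const d 1ℤ n))

  logDeriv-P : ∀ d r → LogDeriv (eulerPower d r) (λ n → r * P-log d n)
  logDeriv-P d (+ n)    = logDeriv-power (V d euler) (P-log d) n (logDeriv-V-euler d)
  logDeriv-P d -[1+ n ] = logDeriv-cong (λ _ → refl)
    (λ i → trans (sym (ℤₚ.neg-distribʳ-* (+ suc n) (P-log d i))) (ℤₚ.neg-distribˡ-* (+ suc n) (P-log d i)))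
    (logDeriv-power (V d partitions) (negate (P-log d)) (suc n)
      (logDeriv-inverse (V d euler) (V d partitions) (P-log d) (V-inverse d) (logDeriv-V-euler d)))

  -- An eta quotient without its power of q; δ is stored as its predecessor.
  etaProduct : List (ℕ × ℤ) → Series
  etaProduct []             = const 1ℤ
  etaProduct ((d , r) ∷ fs) = eulerPower d r ⊛ etaProduct fs

  shifts : ℕ → Series → Series
  shifts zero    f = f
  shifts (suc k) f = shift (shifts k f)

  degree : List (ℕ × ℤ) → ℤ
  degree []             = 0ℤ
  degree ((d , r) ∷ fs) = r * + suc d + degree fs

  E₂-sum : List (ℕ × ℤ) → Series
  E₂-sum []             = zeros
  E₂-sum ((d , r) ∷ fs) = (λ n → r * E₂-at d n) ⊕ E₂-sum fs

  logDeriv-etaProduct : ∀ fs → LogDeriv (etaProduct fs) (E₂-sum fs ⊖ const (degree fs))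
  logDeriv-etaProduct []             = logDeriv-cong (λ _ → refl) (λ n → sym (trans (ℤₚ.+-identityˡ _) (cong -_ (const-0 n)))) (logDeriv-const 1ℤ)
  logDeriv-etaProduct ((d , r) ∷ fs) = logDeriv-cong (λ _ → refl) eq
    (logDeriv-⊛ (eulerPower d r) (etaProduct fs) (λ n → r * P-log d n) (E₂-sum fs ⊖ const (degree fs)) (logDeriv-P d r) (logDeriv-etaProduct fs))
    where
    constants : ∀ n → const (r * + suc d + degree fs) n ≡ r * const (+ suc d) n + const (degree fs) n
    constants zero    = refl
    constants (suc n) = sym (trans (ℤₚ.+-identityʳ _) (ℤₚ.*-zeroʳ r))
    eq : ∀ n → r * P-log d n + (E₂-sum fs n - const (degree fs) n) ≡ (r * E₂-at d n + E₂-sum fs n) - const (r * + suc d + degree fs) n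
    eq n = trans
      (solve 5 (λ r a c s k → r :* (a :- c) :+ (s :- k) := (r :* a :+ s) :- (r :* c :+ k)) refl
        r (E₂-at d n) (const (+ suc d) n) (E₂-sum fs n) (const (degree fs) n))
      (cong (λ x → (r * E₂-at d n + E₂-sum fs n) - x) (sym (constants n)))

  logDeriv-shifts : ∀ k f g → LogDeriv f g → LogDeriv (shifts k f) (g ⊕ const (+ (k ℕ.* 24)))
  logDeriv-shifts zero    f g h = logDeriv-cong (λ _ → refl) (λ n → sym (trans (cong (_+_ (g n)) (const-0 n)) (ℤₚ.+-identityʳ _))) h
  logDeriv-shifts (suc k) f g h = logDeriv-cong (λ _ → refl) eq
    (logDeriv-shift (shifts k f) (g ⊕ const (+ (k ℕ.* 24))) (logDeriv-shifts k f g h))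
    where
    eq : ∀ n → (g n + const (+ (k ℕ.* 24)) n) + const (+ 24) n ≡ g n + const (+ (suc k ℕ.* 24)) n
    eq zero    = trans (ℤₚ.+-assoc (g 0) _ _) (cong (λ x → g 0 + + x) (ℕₚ.+-comm (k ℕ.* 24) 24))
    eq (suc n) = ℤₚ.+-identityʳ _

  logDeriv-etaQuotient : ∀ k fs → degree fs ≡ + (k ℕ.* 24) → LogDeriv (shifts k (etaProduct fs)) (E₂-sum fs)
  logDeriv-etaQuotient k fs deg = logDeriv-cong (λ _ → refl)
    (λ n → trans (cong (λ x → (E₂-sum fs n - const x n) + const (+ (k ℕ.* 24)) n) deg)
      (solve 2 (λ a b → (a :- b) :+ b := a) refl (E₂-sum fs n) (const (+ (k ℕ.* 24)) n)))
    (logDeriv-shifts k (etaProduct fs) (E₂-sum fs ⊖ const (degree fs)) (logDeriv-etaProduct fs))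

  infixl 6 _+ᴸ_
  infixl 7 _*ᴸ_

  Agree : List ℤ → Series → Set
  Agree []       f = ⊤
  Agree (x ∷ xs) f = x ≡ f 0 × Agree xs (tail f)

  agree-cong : ∀ xs {f g} → f ≗ g → Agree xs f → Agree xs g
  agree-cong []       h _       = tt
  agree-cong (x ∷ xs) h (p , r) = trans p (h 0) , agree-cong xs (h ∘ suc) r

  _+ᴸ_ _*ᴸ_ : List ℤ → List ℤ → List ℤ
  []       +ᴸ _        = []
  _        +ᴸ []       = []
  (x ∷ xs) +ᴸ (y ∷ ys) = x + y ∷ xs +ᴸ ys

  scaleᴸ : ℤ → List ℤ → List ℤ
  scaleᴸ c []       = []
  scaleᴸ c (x ∷ xs) = c * x ∷ scaleᴸ c xs

  [] *ᴸ _ = []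
  _ *ᴸ [] = []
  (+0 ∷ xs) *ᴸ (y ∷ ys) = 0ℤ ∷ xs *ᴸ (y ∷ ys)
  (x  ∷ xs) *ᴸ (y ∷ ys) = x * y ∷ scaleᴸ x ys +ᴸ xs *ᴸ (y ∷ ys)

  agree-+ : ∀ xs ys {f g} → Agree xs f → Agree ys g → Agree (xs +ᴸ ys) (f ⊕ g)
  agree-+ []       _        _ _ = tt
  agree-+ (_ ∷ _)  []       _ _ = tt
  agree-+ (x ∷ xs) (y ∷ ys) (p , ps) (r , rs) = cong₂ _+_ p r , agree-+ xs ys ps rs

  agree-scale : ∀ c xs {f} → Agree xs f → Agree (scaleᴸ c xs) (λ n → c * f n)
  agree-scale c []       _        = tt
  agree-scale c (x ∷ xs) (p , ps) = cong (c *_) p , agree-scale c xs ps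

  agree-* : ∀ xs ys {f g} → Agree xs f → Agree ys g → Agree (xs *ᴸ ys) (f ⊛ g)
  agree-* []         _        _ _ = tt
  agree-* (+0 ∷ _)         [] _ _ = tt
  agree-* (+ suc _ ∷ _)    [] _ _ = tt
  agree-* (-[1+ _ ] ∷ _)   [] _ _ = tt
  agree-* (+0 ∷ xs) (y ∷ ys) {f} {g} (p , ps) (r , rs) =
    cong (_* g 0) p , agree-cong (xs *ᴸ (y ∷ ys)) (λ n → sym (trans (cong (λ x → x * g (suc n) + (tail f ⊛ g) n) (sym p)) (ℤₚ.+-identityˡ _)))
      (agree-* xs (y ∷ ys) ps (r , rs))
  agree-* (x@(+ suc _) ∷ xs) (y ∷ ys) {f} {g} (p , ps) (r , rs) =
    cong₂ _*_ p r , agree-cong (scaleᴸ x ys +ᴸ xs *ᴸ (y ∷ ys)) (λ n → cong (λ x → x * g (suc n) + (tail f ⊛ g) n) p)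
      (agree-+ (scaleᴸ x ys) (xs *ᴸ (y ∷ ys)) (agree-scale x ys rs) (agree-* xs (y ∷ ys) ps (r , rs)))
  agree-* (x@(-[1+ _ ]) ∷ xs) (y ∷ ys) {f} {g} (p , ps) (r , rs) =
    cong₂ _*_ p r , agree-cong (scaleᴸ x ys +ᴸ xs *ᴸ (y ∷ ys)) (λ n → cong (λ x → x * g (suc n) + (tail f ⊛ g) n) p)
      (agree-+ (scaleᴸ x ys) (xs *ᴸ (y ∷ ys)) (agree-scale x ys rs) (agree-* xs (y ∷ ys) ps (r , rs)))

  segment : ℕ → Series → List ℤ
  segment zero    f = []
  segment (suc n) f = f 0 ∷ segment n (tail f)

  agree-segment : ∀ n f → Agree (segment n f) f
  agree-segment zero    f = tt
  agree-segment (suc n) f = refl , agree-segment n (tail f)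

  gapᴸ : ℕ → ℕ → ℕ → List ℤ → List ℤ
  gapᴸ zero    d k       xs       = []
  gapᴸ (suc n) d zero    []       = []
  gapᴸ (suc n) d zero    (x ∷ xs) = x ∷ gapᴸ n d d xs
  gapᴸ (suc n) d (suc k) xs       = 0ℤ ∷ gapᴸ n d k xs

  agree-gap : ∀ n d k xs {f} → Agree xs f → Agree (gapᴸ n d k xs) (gap d k f)
  agree-gap zero    d k       xs       _        = tt
  agree-gap (suc n) d zero    []       _        = tt
  agree-gap (suc n) d zero    (x ∷ xs) (p , ps) = p , agree-gap n d d xs ps
  agree-gap (suc n) d (suc k) xs       ps       = refl , agree-gap n d k xs ps

  θᴸ : ℕ → List ℤ → List ℤ
  θᴸ i []       = []
  θᴸ i (x ∷ xs) = + i * x ∷ θᴸ (suc i) xs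

  agree-θ : ∀ i xs {f} → Agree xs f → Agree (θᴸ i xs) (λ n → + (i ℕ.+ n) * f n)
  agree-θ i []       _ = tt
  agree-θ i (x ∷ xs) {f} (p , ps) = cong₂ (λ k y → + k * y) (sym (ℕₚ.+-identityʳ i)) p ,
    agree-cong (θᴸ (suc i) xs) (λ n → cong (λ k → + k * f (suc n)) (sym (ℕₚ.+-suc i n))) (agree-θ (suc i) xs ps)

  eulerProductᴸ : ℕ → ℕ → List ℤ
  eulerProductᴸ n zero    = segment n (const 1ℤ)
  eulerProductᴸ n (suc N) = gapᴸ n N 0 (segment n 1-q) *ᴸ eulerProductᴸ n N

  agree-eulerProduct : ∀ n N → Agree (eulerProductᴸ n N) (eulerProduct N)
  agree-eulerProduct n zero    = agree-segment n (const 1ℤ)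
  agree-eulerProduct n (suc N) = agree-cong (eulerProductᴸ n (suc N)) (⊛-comm (V N 1-q) (eulerProduct N))
    (agree-* (gapᴸ n N 0 (segment n 1-q)) (eulerProductᴸ n N) (agree-gap n N 0 (segment n 1-q) (agree-segment n 1-q)) (agree-eulerProduct n N))

  agree-upto : ∀ n xs {f g} → length xs ℕ.≤ n → (∀ i → i ℕ.< n → f i ≡ g i) → Agree xs f → Agree xs g
  agree-upto n       []       _       _ _        = tt
  agree-upto (suc n) (x ∷ xs) (s≤s l) h (p , ps) = trans p (h 0 (s≤s z≤n)) , agree-upto n xs l (λ i i<n → h (suc i) (s≤s i<n)) ps

  truncate : ℕ → List ℤ → List ℤ
  truncate zero    xs       = []
  truncate (suc n) []       = []
  truncate (suc n) (x ∷ xs) = x ∷ truncate n xs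

  truncate-length : ∀ n xs → length (truncate n xs) ℕ.≤ n
  truncate-length zero    xs       = z≤n
  truncate-length (suc n) []       = z≤n
  truncate-length (suc n) (x ∷ xs) = s≤s (truncate-length n xs)

  agree-truncate : ∀ n xs {f} → Agree xs f → Agree (truncate n xs) f
  agree-truncate zero    xs       _        = tt
  agree-truncate (suc n) []       _        = tt
  agree-truncate (suc n) (x ∷ xs) (p , ps) = p , agree-truncate n xs ps

  eulerᴸ : ℕ → List ℤ
  eulerᴸ n = truncate n (eulerProductᴸ n n)

  agree-euler : ∀ n → Agree (eulerᴸ n) euler
  agree-euler n = agree-upto n (eulerᴸ n) (truncate-length n (eulerProductᴸ n n)) (λ i i<n → eulerProduct-≤ (ℕₚ.<⇒≤ i<n))
    (agree-truncate n (eulerProductᴸ n n) (agree-eulerProduct n n))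

  inverseᴸ : ℕ → List ℤ → List ℤ
  inverseᴸ (suc n) (x ∷ xs) = 1ℤ ∷ scaleᴸ -1ℤ (xs *ᴸ inverseᴸ n (x ∷ xs))
  inverseᴸ _       _        = []

  agree-inverse : ∀ n xs f → Agree xs f → Agree (inverseᴸ n xs) (inverseSeries f)
  agree-inverse zero    xs       f _ = tt
  agree-inverse (suc n) []       f _ = tt
  agree-inverse (suc n) (x ∷ xs) f (p , ps) = refl , agree-cong (scaleᴸ -1ℤ (xs *ᴸ inverseᴸ n (x ∷ xs)))
    (λ i → trans (ℤₚ.-1*i≡-i _) (sym (inverseSeries-suc f i)))
    (agree-scale -1ℤ (xs *ᴸ inverseᴸ n (x ∷ xs)) (agree-* xs (inverseᴸ n (x ∷ xs)) ps (agree-inverse n (x ∷ xs) f (p , ps))))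

  powerᴸ : ℕ → List ℤ → ℕ → List ℤ
  powerᴸ n xs zero    = segment n (const 1ℤ)
  powerᴸ n xs (suc k) = xs *ᴸ powerᴸ n xs k

  agree-power : ∀ n xs k {f} → Agree xs f → Agree (powerᴸ n xs k) (power f k)
  agree-power n xs zero    h = agree-segment n (const 1ℤ)
  agree-power n xs (suc k) h = agree-* xs (powerᴸ n xs k) h (agree-power n xs k h)

  shiftᴸ : ℕ → List ℤ → List ℤ
  shiftᴸ zero    xs = xs
  shiftᴸ (suc k) xs = 0ℤ ∷ shiftᴸ k xs

  agree-shift : ∀ k xs {f} → Agree xs f → Agree (shiftᴸ k xs) (shifts k f)
  agree-shift zero    xs h = h
  agree-shift (suc k) xs h = refl , agree-shift k xs h

  evalᴸ : ℕ → (ℕ → List ℤ) → Poly → List ℤ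
  evalᴸ n v (con c)      = segment n (const c)
  evalᴸ n v (node i p q) = evalᴸ n v p +ᴸ v i *ᴸ evalᴸ n v q

  agree-eval : ∀ n v w p → (∀ i → Agree (v i) (w i)) → Agree (evalᴸ n v p) (⟦ p ⟧ w)
  agree-eval n v w (con c)      h = agree-segment n (const c)
  agree-eval n v w (node i p q) h = agree-+ (evalᴸ n v p) (v i *ᴸ evalᴸ n v q) (agree-eval n v w p h)
    (agree-* (v i) (evalᴸ n v q) (h i) (agree-eval n v w q h))

  vanishing : ℕ → List ℤ → Bool
  vanishing zero    _         = true
  vanishing (suc n) []        = false
  vanishing (suc n) (+0 ∷ xs) = vanishing n xs
  vanishing (suc n) (_  ∷ xs) = false

  vanishing-sound : ∀ n xs {f} → Agree xs f → vanishing n xs ≡ true → ∀ i → i ℕ.< n → f i ≡ 0ℤ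
  vanishing-sound (suc n) (+0 ∷ xs) (p , ps) v zero    _   = sym p
  vanishing-sound (suc n) (+0 ∷ xs) (p , ps) v (suc i) i<n = vanishing-sound n xs ps v i (ℕ.s≤s⁻¹ i<n)

  monomial : ℕ → Series
  monomial zero    = const 1ℤ
  monomial (suc s) = shift (monomial s)

  monomial-⊛ : ∀ s t → monomial s ⊛ monomial t ≗ monomial (s ℕ.+ t)
  monomial-⊛ zero    t n = ⊛-identityˡ (monomial t) n
  monomial-⊛ (suc s) t n = trans (shift-⊛ (monomial s) (monomial t) n) (shift-cong (monomial-⊛ s t) n)
    where
    shift-cong : ∀ {f g} → f ≗ g → shift f ≗ shift g
    shift-cong h zero    = refl
    shift-cong h (suc n) = h n

  monomial-low : ∀ s n → n ℕ.< s → monomial s n ≡ 0ℤ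
  monomial-low (suc s) zero    _   = refl
  monomial-low (suc s) (suc n) n<s = monomial-low s n (ℕ.s≤s⁻¹ n<s)

  θ-monomial : ∀ s n → θ (monomial s) n ≡ + s * monomial s n
  θ-monomial zero    zero    = refl
  θ-monomial zero    (suc n) = ℤₚ.*-zeroʳ (+ suc n)
  θ-monomial (suc s) zero    = sym (ℤₚ.*-zeroʳ (+ suc s))
  θ-monomial (suc s) (suc n) = begin
    + suc n * monomial s n            ≡⟨ trans (cong (_* monomial s n) (ℤₚ.pos-+ 1 n)) (ℤₚ.*-distribʳ-+ (monomial s n) 1ℤ (+ n)) ⟩
    1ℤ * monomial s n + θ (monomial s) n ≡⟨ cong (_+_ (1ℤ * monomial s n)) (θ-monomial s n) ⟩
    1ℤ * monomial s n + + s * monomial s n ≡⟨ sym (trans (cong (_* monomial s n) (ℤₚ.pos-+ 1 s)) (ℤₚ.*-distribʳ-+ (monomial s n) 1ℤ (+ s))) ⟩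
    + suc s * monomial s n ∎
    where open ≡-Reasoning

  sumTo-suc : ∀ n f → sumTo (suc n) f ≡ f 0 + sumTo n (f ∘ suc)
  sumTo-suc zero    f = ℤₚ.+-comm 0ℤ (f 0)
  sumTo-suc (suc n) f = trans (cong (_+ f (suc n)) (sumTo-suc n f)) (ℤₚ.+-assoc (f 0) _ _)

  sumTo-swap : ∀ m n (F : ℕ → ℕ → ℤ) → sumTo m (λ i → sumTo n (F i)) ≡ sumTo n (λ j → sumTo m (λ i → F i j))
  sumTo-swap zero    n F = sym (sumTo-0 n)
  sumTo-swap (suc m) n F = trans (cong (_+ sumTo n (F m)) (sumTo-swap m n F)) (sym (sumTo-+ n _ _))

  sumTo-extend : ∀ k m f → (∀ i → m ℕ.≤ i → f i ≡ 0ℤ) → sumTo (k ℕ.+ m) f ≡ sumTo m f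
  sumTo-extend zero    m f h = refl
  sumTo-extend (suc k) m f h = trans (cong₂ _+_ (sumTo-extend k m f h) (h (k ℕ.+ m) (ℕₚ.m≤n+m m k))) (ℤₚ.+-identityʳ _)

  sumTo-*ʳ : ∀ n c f → sumTo n (λ i → f i * c) ≡ sumTo n f * c
  sumTo-*ʳ n c f = trans (sumTo-cong n (λ i _ → ℤₚ.*-comm (f i) c)) (trans (sumTo-*ˡ n c f) (ℤₚ.*-comm c _))

  ⊛-sumˡ : ∀ m (f : ℕ → Series) g n → ((λ k → sumTo m (λ i → f i k)) ⊛ g) n ≡ sumTo m (λ i → (f i ⊛ g) n)
  ⊛-sumˡ zero    f g n = 0⊛ g n
  ⊛-sumˡ (suc m) f g n = trans (⊛-distribʳ-⊕ g (λ k → sumTo m (λ i → f i k)) (f m) n) (cong (_+ (f m ⊛ g) n) (⊛-sumˡ m f g n))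

  ⊛-sumʳ : ∀ m f (g : ℕ → Series) n → (f ⊛ (λ k → sumTo m (λ i → g i k))) n ≡ sumTo m (λ i → (f ⊛ g i) n)
  ⊛-sumʳ m f g n = trans (⊛-comm f _ n) (trans (⊛-sumˡ m g f n) (sumTo-cong m (λ i _ → ⊛-comm (g i) f n)))

  when : Bool → ℤ → ℤ
  when b x = if b then x else 0ℤ

  private
    false-<ᵇ : ∀ i j → j ℕ.≤ i → (i <ᵇ j) ≡ false
    false-<ᵇ i       zero    _   = refl
    false-<ᵇ (suc i) (suc j) j≤i = false-<ᵇ i j (ℕ.s≤s⁻¹ j≤i)

    true-<ᵇ : ∀ i j → i ℕ.< j → (i <ᵇ j) ≡ true
    true-<ᵇ zero    (suc j) _   = refl
    true-<ᵇ (suc i) (suc j) i<j = true-<ᵇ i j (ℕ.s≤s⁻¹ i<j)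

  sumTo-above : ∀ y n (f : ℕ → ℤ) → sumTo (n ℕ.+ suc y) (λ x → when (y <ᵇ x) (f x)) ≡ sumTo n (λ d → f (suc (d ℕ.+ y)))
  sumTo-above y zero    f = trans (sumTo-cong (suc y) (λ x x≤y → cong (λ b → when b (f x)) (false-<ᵇ y x (ℕ.s≤s⁻¹ x≤y)))) (sumTo-0 (suc y))
  sumTo-above y (suc n) f = cong₂ _+_ (sumTo-above y n f)
    (trans (cong (λ b → when b (f (n ℕ.+ suc y))) (true-<ᵇ y (n ℕ.+ suc y) (ℕₚ.m≤n+m (suc y) n))) (cong f (ℕₚ.+-suc n y)))

  sumTo-above′ : ∀ M y (f : ℕ → ℤ) → (∀ x → M ℕ.≤ x → f x ≡ 0ℤ) → sumTo M (λ x → when (y <ᵇ x) (f x)) ≡ sumTo M (λ d → f (suc (d ℕ.+ y)))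
  sumTo-above′ M y f h = trans (sym (sumTo-extend (suc y) M _ (λ x M≤x → below x (h x M≤x))))
    (trans (cong (λ k → sumTo k (λ x → when (y <ᵇ x) (f x))) (ℕₚ.+-comm (suc y) M)) (sumTo-above y M f))
    where
    below : ∀ x → f x ≡ 0ℤ → when (y <ᵇ x) (f x) ≡ 0ℤ
    below x fx≡0 with y <ᵇ x
    ... | true  = fx≡0
    ... | false = refl

  trichotomy : ∀ x y (u : ℤ) → u ≡ when (y <ᵇ x) u + (when (x <ᵇ y) u + when (x ≡ᵇ y) u)
  trichotomy zero    zero    u = sym (trans (ℤₚ.+-identityˡ _) (ℤₚ.+-identityˡ _))
  trichotomy zero    (suc y) u = sym (trans (ℤₚ.+-identityˡ _) (ℤₚ.+-identityʳ _))
  trichotomy (suc x) zero    u = sym (ℤₚ.+-identityʳ _)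
  trichotomy (suc x) (suc y) u = trichotomy x y u

  sumTo-diagonal : ∀ M x (f : ℕ → ℤ) → x ℕ.< M → sumTo M (λ y → when (x ≡ᵇ y) (f y)) ≡ f x
  sumTo-diagonal M x f x<M = trans
    (sumTo-cong M (λ y _ → step y))
    (trans (sumTo-indicator M x 1ℤ f (λ M≤x → ⊥-elim (ℕₚ.<⇒≱ x<M M≤x))) (ℤₚ.*-identityˡ (f x)))
    where
    step : ∀ y → when (x ≡ᵇ y) (f y) ≡ (if x ≡ᵇ y then 1ℤ else 0ℤ) * f y
    step y with x ≡ᵇ y
    ... | true  = sym (ℤₚ.*-identityˡ (f y))
    ... | false = refl

  sumTo-triangles : ∀ M (F : ℕ → ℕ → ℤ) → (∀ x y → M ℕ.≤ x → F x y ≡ 0ℤ) → (∀ x y → M ℕ.≤ y → F x y ≡ 0ℤ) →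
    sumTo M (λ x → sumTo M (F x)) ≡
    sumTo M (λ y → sumTo M (λ d → F (suc (d ℕ.+ y)) y)) +
    (sumTo M (λ x → sumTo M (λ d → F x (suc (d ℕ.+ x)))) + sumTo M (λ x → F x x))
  sumTo-triangles M F hx hy = begin
    sumTo M (λ x → sumTo M (F x))
      ≡⟨ sumTo-cong M (λ x _ → trans (sumTo-cong M (λ y _ → trichotomy x y (F x y)))
           (trans (sumTo-+ M _ _) (cong (_+_ (sumTo M (λ y → when (y <ᵇ x) (F x y)))) (sumTo-+ M _ _)))) ⟩
    sumTo M (λ x → sumTo M (λ y → when (y <ᵇ x) (F x y)) + (sumTo M (λ y → when (x <ᵇ y) (F x y)) + sumTo M (λ y → when (x ≡ᵇ y) (F x y))))
      ≡⟨ trans (sumTo-+ M _ _) (cong (_+_ (sumTo M (λ x → sumTo M (λ y → when (y <ᵇ x) (F x y))))) (sumTo-+ M _ _)) ⟩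
    sumTo M (λ x → sumTo M (λ y → when (y <ᵇ x) (F x y))) +
    (sumTo M (λ x → sumTo M (λ y → when (x <ᵇ y) (F x y))) + sumTo M (λ x → sumTo M (λ y → when (x ≡ᵇ y) (F x y))))
      ≡⟨ cong₂ _+_
           (trans (sumTo-swap M M _) (sumTo-cong M (λ y _ → sumTo-above′ M y (λ x → F x y) (λ x → hx x y))))
           (cong₂ _+_ (sumTo-cong M (λ x _ → sumTo-above′ M x (F x) (hy x))) (sumTo-cong M (λ x x<M → sumTo-diagonal M x (F x) x<M))) ⟩
    sumTo M (λ y → sumTo M (λ d → F (suc (d ℕ.+ y)) y)) +
    (sumTo M (λ x → sumTo M (λ d → F x (suc (d ℕ.+ x)))) + sumTo M (λ x → F x x)) ∎
    where open ≡-Reasoning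

  sumTo-below : ∀ M m (f : ℕ → ℤ) → m ℕ.≤ M → sumTo M (λ y → when (y <ᵇ m) (f y)) ≡ sumTo m f
  sumTo-below M m f m≤M = trans
    (trans (cong (λ k → sumTo k (λ y → when (y <ᵇ m) (f y))) (sym (ℕₚ.m∸n+n≡m m≤M)))
      (sumTo-extend (M ℕ.∸ m) m _ (λ i m≤i → cong (λ b → when b (f i)) (false-<ᵇ i m m≤i))))
    (sumTo-cong m (λ i i<m → cong (λ b → when b (f i)) (true-<ᵇ i m i<m)))

  gap-sum : ∀ d k f n M → n ℕ.< M → gap d k f n ≡ sumTo M (λ x → f x * monomial (x ℕ.* suc d ℕ.+ k) n)
  gap-sum d zero f zero (suc M) _ = sym (trans (sumTo-suc M _) (trans
    (cong₂ _+_ (ℤₚ.*-identityʳ (f 0)) (trans (sumTo-cong M (λ x _ → ℤₚ.*-zeroʳ (f (suc x)))) (sumTo-0 M)))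
    (ℤₚ.+-identityʳ (f 0))))
  gap-sum d zero f (suc n) (suc M) n<M = trans (gap-sum d d (tail f) n M (ℕ.s≤s⁻¹ n<M)) (sym (trans (sumTo-suc M _) (trans
    (cong₂ _+_ (ℤₚ.*-zeroʳ (f 0)) (sumTo-cong M (λ x _ → cong (λ e → f (suc x) * monomial e (suc n)) (exponent x))))
    (ℤₚ.+-identityˡ _))))
    where
    exponent : ∀ x → suc x ℕ.* suc d ℕ.+ 0 ≡ suc (x ℕ.* suc d ℕ.+ d)
    exponent x = trans (ℕₚ.+-identityʳ _) (cong suc (ℕₚ.+-comm d (x ℕ.* suc d)))
  gap-sum d (suc k) f zero M _ = sym (trans
    (sumTo-cong M (λ x _ → trans (cong (λ e → f x * monomial e 0) (ℕₚ.+-suc (x ℕ.* suc d) k)) (ℤₚ.*-zeroʳ (f x)))) (sumTo-0 M))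
  gap-sum d (suc k) f (suc n) M n<M = trans (gap-sum d k f n M (ℕₚ.<-trans (ℕₚ.n<1+n n) n<M))
    (sumTo-cong M (λ x _ → cong (λ e → f x * monomial e (suc n)) (sym (ℕₚ.+-suc (x ℕ.* suc d) k))))

  Weight₂ Weight₄ : Set
  Weight₂ = ℤ → ℤ → ℤ
  Weight₄ = ℤ → ℤ → ℤ → ℤ → ℤ

  ι : ℕ → ℤ
  ι k = + suc k

  -- Below the order M, the sums Σ h(a,x) q^(ax) over a, x > 0, and
  -- Σ g(a,b,x,y) q^(ax+by) over a, b, x, y > 0.
  pairs : ℕ → Weight₂ → Series
  pairs M h n = sumTo M λ a → sumTo M λ x → h (ι a) (ι x) * monomial (suc a ℕ.* suc x) n

  quadruples : ℕ → Weight₄ → Series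
  quadruples M g n = sumTo M λ a → sumTo M λ b → sumTo M λ x → sumTo M λ y →
    g (ι a) (ι b) (ι x) (ι y) * monomial (suc a ℕ.* suc x ℕ.+ suc b ℕ.* suc y) n

  pairs-cong : ∀ M (h k : Weight₂) n → (∀ a x → h a x ≡ k a x) → pairs M h n ≡ pairs M k n
  pairs-cong M h k n e = sumTo-cong M (λ a _ → sumTo-cong M (λ x _ → cong (_* monomial (suc a ℕ.* suc x) n) (e (ι a) (ι x))))

  pairs-+ : ∀ M h k n → pairs M (λ a x → h a x + k a x) n ≡ pairs M h n + pairs M k n
  pairs-+ M h k n = trans (sumTo-cong M (λ a _ → trans
    (sumTo-cong M (λ x _ → ℤₚ.*-distribʳ-+ (monomial (suc a ℕ.* suc x) n) (h (ι a) (ι x)) (k (ι a) (ι x)))) (sumTo-+ M _ _)))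
    (sumTo-+ M _ _)

  pairs-scale : ∀ M c h n → pairs M (λ a x → c * h a x) n ≡ c * pairs M h n
  pairs-scale M c h n = trans (sumTo-cong M (λ a _ → trans
    (sumTo-cong M (λ x _ → ℤₚ.*-assoc c (h (ι a) (ι x)) (monomial (suc a ℕ.* suc x) n))) (sumTo-*ˡ M c _)))
    (sumTo-*ˡ M c _)

  θ-pairs : ∀ M h n → θ (pairs M h) n ≡ pairs M (λ a x → h a x * (a * x)) n
  θ-pairs M h n = trans (sym (sumTo-*ˡ M (+ n) _)) (sumTo-cong M (λ a _ → trans (sym (sumTo-*ˡ M (+ n) _)) (sumTo-cong M (λ x _ → begin
    + n * (h (ι a) (ι x) * monomial (suc a ℕ.* suc x) n)
      ≡⟨ solve 3 (λ k u v → k :* (u :* v) := u :* (k :* v)) refl (+ n) (h (ι a) (ι x)) (monomial (suc a ℕ.* suc x) n) ⟩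
    h (ι a) (ι x) * θ (monomial (suc a ℕ.* suc x)) n
      ≡⟨ cong (h (ι a) (ι x) *_) (trans (θ-monomial (suc a ℕ.* suc x) n) (cong (_* monomial (suc a ℕ.* suc x) n) (ℤₚ.pos-* (suc a) (suc x)))) ⟩
    h (ι a) (ι x) * (ι a * ι x * monomial (suc a ℕ.* suc x) n)
      ≡⟨ sym (ℤₚ.*-assoc (h (ι a) (ι x)) (ι a * ι x) _) ⟩
    h (ι a) (ι x) * (ι a * ι x) * monomial (suc a ℕ.* suc x) n ∎))))
    where open ≡-Reasoning

  divisorSeries-pairs : ∀ (w : ℤ → ℤ) M n → n ℕ.≤ M → divisorSeries (w ∘ ι) n ≡ pairs M (λ a _ → w a) n
  divisorSeries-pairs w M n n≤M = trans (sym (divisorSum-≤ (w ∘ ι) n≤M))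
    (sumTo-cong M (λ a _ → trans (cong (w (ι a) *_) (trans (gap-sum a 0 positive n (suc M) (s≤s n≤M)) (trans (sumTo-suc M _)
      (trans (ℤₚ.+-identityˡ _) (sumTo-cong M (λ x _ → trans (ℤₚ.*-identityˡ _)
        (cong (λ e → monomial e n) (trans (ℕₚ.+-identityʳ _) (ℕₚ.*-comm (suc x) (suc a)))))))))) (sym (sumTo-*ˡ M (w (ι a)) _))))

  pairs-⊛ : ∀ M h k n → (pairs M h ⊛ pairs M k) n ≡ quadruples M (λ a b x y → h a x * k b y) n
  pairs-⊛ M h k n = begin
    (pairs M h ⊛ pairs M k) n
      ≡⟨ trans (⊛-sumˡ M _ (pairs M k) n) (sumTo-cong M (λ a _ → trans (⊛-sumˡ M _ (pairs M k) n) (sumTo-cong M (λ x _ →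
           trans (⊛-sumʳ M (term h a x) _ n) (sumTo-cong M (λ b _ → trans (⊛-sumʳ M (term h a x) _ n) (sumTo-cong M (λ y _ → product a b x y)))))))) ⟩
    (sumTo M λ a → sumTo M λ x → sumTo M λ b → sumTo M λ y → summand a b x y)
      ≡⟨ sumTo-cong M (λ a _ → sumTo-swap M M _) ⟩
    quadruples M (λ a b x y → h a x * k b y) n ∎
    where
    open ≡-Reasoning
    term : Weight₂ → ℕ → ℕ → Series
    term h a x n = h (ι a) (ι x) * monomial (suc a ℕ.* suc x) n
    summand : ℕ → ℕ → ℕ → ℕ → ℤ
    summand a b x y = h (ι a) (ι x) * k (ι b) (ι y) * monomial (suc a ℕ.* suc x ℕ.+ suc b ℕ.* suc y) n
    product : ∀ a b x y → (term h a x ⊛ term k b y) n ≡ summand a b x y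
    product a b x y = begin
      (term h a x ⊛ term k b y) n
        ≡⟨ trans (scale-⊛ (h (ι a) (ι x)) (monomial (suc a ℕ.* suc x)) (term k b y) n)
             (cong (h (ι a) (ι x) *_) (⊛-scale (k (ι b) (ι y)) (monomial (suc a ℕ.* suc x)) (monomial (suc b ℕ.* suc y)) n)) ⟩
      h (ι a) (ι x) * (k (ι b) (ι y) * (monomial (suc a ℕ.* suc x) ⊛ monomial (suc b ℕ.* suc y)) n)
        ≡⟨ trans (sym (ℤₚ.*-assoc (h (ι a) (ι x)) _ _)) (cong (h (ι a) (ι x) * k (ι b) (ι y) *_) (monomial-⊛ (suc a ℕ.* suc x) (suc b ℕ.* suc y) n)) ⟩
      summand a b x y ∎

  quadruples-+ : ∀ M g h n → quadruples M (λ a b x y → g a b x y + h a b x y) n ≡ quadruples M g n + quadruples M h n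
  quadruples-+ M g h n = trans (sumTo-cong M (λ a _ → trans (sumTo-cong M (λ b _ → trans (sumTo-cong M (λ x _ → trans
    (sumTo-cong M (λ y _ → ℤₚ.*-distribʳ-+ (monomial (suc a ℕ.* suc x ℕ.+ suc b ℕ.* suc y) n) (g (ι a) (ι b) (ι x) (ι y)) (h (ι a) (ι b) (ι x) (ι y))))
    (sumTo-+ M _ _))) (sumTo-+ M _ _))) (sumTo-+ M _ _))) (sumTo-+ M _ _)

  quadruples-scale : ∀ M c g n → quadruples M (λ a b x y → c * g a b x y) n ≡ c * quadruples M g n
  quadruples-scale M c g n = trans (sumTo-cong M (λ a _ → trans (sumTo-cong M (λ b _ → trans (sumTo-cong M (λ x _ → trans
    (sumTo-cong M (λ y _ → ℤₚ.*-assoc c (g (ι a) (ι b) (ι x) (ι y)) (monomial (suc a ℕ.* suc x ℕ.+ suc b ℕ.* suc y) n)))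
    (sumTo-*ˡ M c _))) (sumTo-*ˡ M c _))) (sumTo-*ˡ M c _))) (sumTo-*ˡ M c _)

  -- The sum of G(a,b,d,y) q^(ad+ay+by) over a, b, d, y > 0: both ax + by with
  -- x = y + d and ad + (a + b)y have this shape, which is the whole trick.
  staircase : ℕ → Weight₄ → Series
  staircase M G n = sumTo M λ a → sumTo M λ b → sumTo M λ y → sumTo M λ d →
    G (ι a) (ι b) (ι d) (ι y) * monomial (suc a ℕ.* suc d ℕ.+ suc a ℕ.* suc y ℕ.+ suc b ℕ.* suc y) n

  staircase-cong : ∀ M {G H : Weight₄} n → (∀ a b d y → G a b d y ≡ H a b d y) → staircase M G n ≡ staircase M H n
  staircase-cong M n e = sumTo-cong M (λ a _ → sumTo-cong M (λ b _ → sumTo-cong M (λ y _ → sumTo-cong M (λ d _ →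
    cong (_* monomial (suc a ℕ.* suc d ℕ.+ suc a ℕ.* suc y ℕ.+ suc b ℕ.* suc y) n) (e (ι a) (ι b) (ι d) (ι y))))))

  staircase-+ : ∀ M G H n → staircase M (λ a b d y → G a b d y + H a b d y) n ≡ staircase M G n + staircase M H n
  staircase-+ M G H n = trans (sumTo-cong M (λ a _ → trans (sumTo-cong M (λ b _ → trans (sumTo-cong M (λ y _ → trans
    (sumTo-cong M (λ d _ → ℤₚ.*-distribʳ-+ (monomial (suc a ℕ.* suc d ℕ.+ suc a ℕ.* suc y ℕ.+ suc b ℕ.* suc y) n) (G (ι a) (ι b) (ι d) (ι y)) (H (ι a) (ι b) (ι d) (ι y))))
    (sumTo-+ M _ _))) (sumTo-+ M _ _))) (sumTo-+ M _ _))) (sumTo-+ M _ _)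

  ι-+ : ∀ d y → ι (suc (d ℕ.+ y)) ≡ ι y + ι d
  ι-+ d y = trans (cong +_ (trans (cong suc (sym (ℕₚ.+-suc d y))) (ℕₚ.+-comm (suc d) (suc y)))) (ℤₚ.pos-+ (suc y) (suc d))

  diagonal-x diagonal-a : ℕ → Weight₄ → Series
  diagonal-x M g n = sumTo M λ a → sumTo M λ b → sumTo M λ x →
    g (ι a) (ι b) (ι x) (ι x) * monomial (suc a ℕ.* suc x ℕ.+ suc b ℕ.* suc x) n
  diagonal-a M g n = sumTo M λ x → sumTo M λ y → sumTo M λ a →
    g (ι a) (ι a) (ι x) (ι y) * monomial (suc a ℕ.* suc x ℕ.+ suc a ℕ.* suc y) n

  private
    open ℕSolver.+-*-Solver using () renaming (solve to ℕsolve; _:+_ to _⊹_; _:*_ to _⊗_; _:=_ to _≔_; con to ℕcon)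

    vanish : ∀ (c : ℤ) s n → n ℕ.< s → c * monomial s n ≡ 0ℤ
    vanish c s n n<s = trans (cong (c *_) (monomial-low s n n<s)) (ℤₚ.*-zeroʳ c)

    big₁ : ∀ M n a x k → n ℕ.≤ M → M ℕ.≤ x → n ℕ.< suc a ℕ.* suc x ℕ.+ k
    big₁ M n a x k n≤M M≤x = ℕₚ.≤-trans (s≤s (ℕₚ.≤-trans n≤M M≤x)) (ℕₚ.≤-trans (ℕₚ.m≤m+n (suc x) (a ℕ.* suc x)) (ℕₚ.m≤m+n _ k))

    big₂ : ∀ M n a x k → n ℕ.≤ M → M ℕ.≤ x → n ℕ.< k ℕ.+ suc a ℕ.* suc x
    big₂ M n a x k n≤M M≤x = ℕₚ.<-≤-trans (big₁ M n a x k n≤M M≤x) (ℕₚ.≤-reflexive (ℕₚ.+-comm _ k))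

  split-x : ∀ M g n → n ℕ.≤ M →
    quadruples M g n ≡ staircase M (λ a b d y → g a b (y + d) y + g b a y (y + d)) n + diagonal-x M g n
  split-x M g n n≤M = begin
    quadruples M g n
      ≡⟨ sumTo-cong M (λ a _ → sumTo-cong M (λ b _ → sumTo-triangles M
           (λ x y → g (ι a) (ι b) (ι x) (ι y) * monomial (suc a ℕ.* suc x ℕ.+ suc b ℕ.* suc y) n)
           (λ x y M≤x → vanish (g (ι a) (ι b) (ι x) (ι y)) (suc a ℕ.* suc x ℕ.+ suc b ℕ.* suc y) n (big₁ M n a x (suc b ℕ.* suc y) n≤M M≤x)) (λ x y M≤y → vanish (g (ι a) (ι b) (ι x) (ι y)) (suc a ℕ.* suc x ℕ.+ suc b ℕ.* suc y) n (big₂ M n b y (suc a ℕ.* suc x) n≤M M≤y)))) ⟩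
    (sumTo M λ a → sumTo M λ b → P a b + (Q a b + R a b))
      ≡⟨ trans (sumTo-cong M (λ a _ → trans (sumTo-+ M _ _) (cong (_+_ (sumTo M (P a))) (sumTo-+ M _ _))))
           (trans (sumTo-+ M _ _) (cong (_+_ ((sumTo M λ a → sumTo M (P a)))) (sumTo-+ M _ _))) ⟩
    (sumTo M λ a → sumTo M (P a)) + ((sumTo M λ a → sumTo M (Q a)) + diagonal-x M g n)
      ≡⟨ cong₂ (λ u v → u + (v + diagonal-x M g n))
           (sumTo-cong M (λ a _ → sumTo-cong M (λ b _ → sumTo-cong M (λ y _ → sumTo-cong M (λ d _ →
             cong₂ (λ u e → g (ι a) (ι b) u (ι y) * monomial e n) (ι-+ d y)
               (ℕsolve 4 (λ a b d y → (ℕcon 1 ⊹ a) ⊗ (ℕcon 2 ⊹ (d ⊹ y)) ⊹ (ℕcon 1 ⊹ b) ⊗ (ℕcon 1 ⊹ y) ≔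
                 (ℕcon 1 ⊹ a) ⊗ (ℕcon 1 ⊹ d) ⊹ (ℕcon 1 ⊹ a) ⊗ (ℕcon 1 ⊹ y) ⊹ (ℕcon 1 ⊹ b) ⊗ (ℕcon 1 ⊹ y)) refl a b d y))))))
           (trans (sumTo-swap M M Q) (sumTo-cong M (λ a _ → sumTo-cong M (λ b _ → sumTo-cong M (λ y _ → sumTo-cong M (λ d _ →
             cong₂ (λ u e → g (ι b) (ι a) (ι y) u * monomial e n) (ι-+ d y)
               (ℕsolve 4 (λ a b d y → (ℕcon 1 ⊹ b) ⊗ (ℕcon 1 ⊹ y) ⊹ (ℕcon 1 ⊹ a) ⊗ (ℕcon 2 ⊹ (d ⊹ y)) ≔
                 (ℕcon 1 ⊹ a) ⊗ (ℕcon 1 ⊹ d) ⊹ (ℕcon 1 ⊹ a) ⊗ (ℕcon 1 ⊹ y) ⊹ (ℕcon 1 ⊹ b) ⊗ (ℕcon 1 ⊹ y)) refl a b d y)))))))  ⟩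
    staircase M (λ a b d y → g a b (y + d) y) n + (staircase M (λ a b d y → g b a y (y + d)) n + diagonal-x M g n)
      ≡⟨ trans (sym (ℤₚ.+-assoc (staircase M (λ a b d y → g a b (y + d) y) n) _ _)) (cong (_+ diagonal-x M g n) (sym (staircase-+ M (λ a b d y → g a b (y + d) y) (λ a b d y → g b a y (y + d)) n))) ⟩
    staircase M (λ a b d y → g a b (y + d) y + g b a y (y + d)) n + diagonal-x M g n ∎
    where
    open ≡-Reasoning
    P Q R : ℕ → ℕ → ℤ
    P a b = sumTo M λ y → sumTo M λ d → g (ι a) (ι b) (ι (suc (d ℕ.+ y))) (ι y) * monomial (suc a ℕ.* suc (suc (d ℕ.+ y)) ℕ.+ suc b ℕ.* suc y) n
    Q a b = sumTo M λ x → sumTo M λ d → g (ι a) (ι b) (ι x) (ι (suc (d ℕ.+ x))) * monomial (suc a ℕ.* suc x ℕ.+ suc b ℕ.* suc (suc (d ℕ.+ x))) n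
    R a b = sumTo M λ x → g (ι a) (ι b) (ι x) (ι x) * monomial (suc a ℕ.* suc x ℕ.+ suc b ℕ.* suc x) n

  split-a : ∀ M g n → n ℕ.≤ M →
    quadruples M g n ≡ staircase M (λ a b d y → g a (a + b) d y + g (a + b) a y d) n + diagonal-a M g n
  split-a M g n n≤M = begin
    quadruples M g n
      ≡⟨ reorder (λ a b x y → g (ι a) (ι b) (ι x) (ι y) * monomial (suc a ℕ.* suc x ℕ.+ suc b ℕ.* suc y) n) ⟩
    (sumTo M λ x → sumTo M λ y → sumTo M λ a → sumTo M λ b → g (ι a) (ι b) (ι x) (ι y) * monomial (suc a ℕ.* suc x ℕ.+ suc b ℕ.* suc y) n)
      ≡⟨ sumTo-cong M (λ x _ → sumTo-cong M (λ y _ → sumTo-triangles M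
           (λ a b → g (ι a) (ι b) (ι x) (ι y) * monomial (suc a ℕ.* suc x ℕ.+ suc b ℕ.* suc y) n)
           (λ a b M≤a → vanish (g (ι a) (ι b) (ι x) (ι y)) (suc a ℕ.* suc x ℕ.+ suc b ℕ.* suc y) n (subst (λ e → n ℕ.< e ℕ.+ suc b ℕ.* suc y) (ℕₚ.*-comm (suc x) (suc a)) (big₁ M n x a (suc b ℕ.* suc y) n≤M M≤a)))
           (λ a b M≤b → vanish (g (ι a) (ι b) (ι x) (ι y)) (suc a ℕ.* suc x ℕ.+ suc b ℕ.* suc y) n (subst (λ e → n ℕ.< suc a ℕ.* suc x ℕ.+ e) (ℕₚ.*-comm (suc y) (suc b)) (big₂ M n y b (suc a ℕ.* suc x) n≤M M≤b))))) ⟩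
    (sumTo M λ x → sumTo M λ y → P x y + (Q x y + R x y))
      ≡⟨ trans (sumTo-cong M (λ x _ → trans (sumTo-+ M _ _) (cong (_+_ (sumTo M (P x))) (sumTo-+ M _ _))))
           (trans (sumTo-+ M _ _) (cong (_+_ ((sumTo M λ x → sumTo M (P x)))) (sumTo-+ M _ _))) ⟩
    (sumTo M λ x → sumTo M (P x)) + ((sumTo M λ x → sumTo M (Q x)) + diagonal-a M g n)
      ≡⟨ cong₂ (λ u v → u + (v + diagonal-a M g n))
           (trans (sym (reorder _)) (sumTo-cong M (λ a _ → sumTo-cong M (λ b _ → sumTo-cong M (λ y _ → sumTo-cong M (λ d _ →
             cong₂ (λ u e → g u (ι a) (ι y) (ι d) * monomial e n) (ι-+ b a)
               (ℕsolve 4 (λ a b d y → (ℕcon 2 ⊹ (b ⊹ a)) ⊗ (ℕcon 1 ⊹ y) ⊹ (ℕcon 1 ⊹ a) ⊗ (ℕcon 1 ⊹ d) ≔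
                 (ℕcon 1 ⊹ a) ⊗ (ℕcon 1 ⊹ d) ⊹ (ℕcon 1 ⊹ a) ⊗ (ℕcon 1 ⊹ y) ⊹ (ℕcon 1 ⊹ b) ⊗ (ℕcon 1 ⊹ y)) refl a b d y)))))))
           (trans (sumTo-swap M M Q) (trans (sym (reorder _)) (sumTo-cong M (λ a _ → sumTo-cong M (λ b _ → sumTo-cong M (λ y _ → sumTo-cong M (λ d _ →
             cong₂ (λ u e → g (ι a) u (ι d) (ι y) * monomial e n) (ι-+ b a)
               (ℕsolve 4 (λ a b d y → (ℕcon 1 ⊹ a) ⊗ (ℕcon 1 ⊹ d) ⊹ (ℕcon 2 ⊹ (b ⊹ a)) ⊗ (ℕcon 1 ⊹ y) ≔
                 (ℕcon 1 ⊹ a) ⊗ (ℕcon 1 ⊹ d) ⊹ (ℕcon 1 ⊹ a) ⊗ (ℕcon 1 ⊹ y) ⊹ (ℕcon 1 ⊹ b) ⊗ (ℕcon 1 ⊹ y)) refl a b d y)))))))) ⟩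
    staircase M (λ a b d y → g (a + b) a y d) n + (staircase M (λ a b d y → g a (a + b) d y) n + diagonal-a M g n)
      ≡⟨ trans (solve 3 (λ u v w → u :+ (v :+ w) := (v :+ u) :+ w) refl
           (staircase M (λ a b d y → g (a + b) a y d) n) (staircase M (λ a b d y → g a (a + b) d y) n) (diagonal-a M g n))
           (cong (_+ diagonal-a M g n) (sym (staircase-+ M (λ a b d y → g a (a + b) d y) (λ a b d y → g (a + b) a y d) n))) ⟩
    staircase M (λ a b d y → g a (a + b) d y + g (a + b) a y d) n + diagonal-a M g n ∎
    where
    open ≡-Reasoning
    reorder : ∀ (F : ℕ → ℕ → ℕ → ℕ → ℤ) →
      (sumTo M λ a → sumTo M λ b → sumTo M λ x → sumTo M λ y → F a b x y) ≡
      (sumTo M λ x → sumTo M λ y → sumTo M λ a → sumTo M λ b → F a b x y)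
    reorder F = trans (sumTo-cong M (λ a _ → sumTo-swap M M _)) (trans (sumTo-swap M M _) (sumTo-cong M (λ x _ →
      trans (sumTo-cong M (λ a _ → sumTo-swap M M _)) (sumTo-swap M M _))))
    P Q R : ℕ → ℕ → ℤ
    P x y = sumTo M λ b → sumTo M λ d → g (ι (suc (d ℕ.+ b))) (ι b) (ι x) (ι y) * monomial (suc (suc (d ℕ.+ b)) ℕ.* suc x ℕ.+ suc b ℕ.* suc y) n
    Q x y = sumTo M λ a → sumTo M λ d → g (ι a) (ι (suc (d ℕ.+ a))) (ι x) (ι y) * monomial (suc a ℕ.* suc x ℕ.+ suc (suc (d ℕ.+ a)) ℕ.* suc y) n
    R x y = sumTo M λ a → g (ι a) (ι a) (ι x) (ι y) * monomial (suc a ℕ.* suc x ℕ.+ suc a ℕ.* suc y) n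

  antidiagonal : ∀ M n x (u : Weight₂) → n ℕ.≤ M →
    (sumTo M λ a → sumTo M λ b → u (ι a) (ι b) * monomial (suc a ℕ.* suc x ℕ.+ suc b ℕ.* suc x) n) ≡
    sumTo M (λ m → sumTo m (λ y → u (ι y) (ι m - ι y)) * monomial (suc m ℕ.* suc x) n)
  antidiagonal M n x u n≤M = begin
    (sumTo M λ a → sumTo M λ b → u (ι a) (ι b) * monomial (suc a ℕ.* suc x ℕ.+ suc b ℕ.* suc x) n)
      ≡⟨ sumTo-cong M (λ a _ → trans (sumTo-cong M (λ b _ → cong₂ (λ v e → u (ι a) v * monomial e n) (difference a b)
           (ℕsolve 3 (λ a b x → (ℕcon 1 ⊹ a) ⊗ (ℕcon 1 ⊹ x) ⊹ (ℕcon 1 ⊹ b) ⊗ (ℕcon 1 ⊹ x) ≔ (ℕcon 2 ⊹ (b ⊹ a)) ⊗ (ℕcon 1 ⊹ x)) refl a b x)))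
           (sym (sumTo-above′ M a (λ m → F m a) (λ m M≤m → vanish (u (ι a) (ι m - ι a)) (suc m ℕ.* suc x) n
             (ℕₚ.≤-trans (s≤s (ℕₚ.≤-trans n≤M M≤m)) (ℕₚ.m≤m*n (suc m) (suc x))))))) ⟩
    (sumTo M λ a → sumTo M λ m → when (a <ᵇ m) (F m a))
      ≡⟨ sumTo-swap M M _ ⟩
    (sumTo M λ m → sumTo M λ a → when (a <ᵇ m) (F m a))
      ≡⟨ sumTo-cong M (λ m m<M → trans (sumTo-below M m (F m) (ℕₚ.<⇒≤ m<M)) (sumTo-*ʳ m (monomial (suc m ℕ.* suc x) n) (λ y → u (ι y) (ι m - ι y)))) ⟩
    sumTo M (λ m → sumTo m (λ y → u (ι y) (ι m - ι y)) * monomial (suc m ℕ.* suc x) n) ∎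
    where
    open ≡-Reasoning
    F : ℕ → ℕ → ℤ
    F m a = u (ι a) (ι m - ι a) * monomial (suc m ℕ.* suc x) n
    difference : ∀ a b → ι b ≡ ι (suc (b ℕ.+ a)) - ι a
    difference a b = trans (solve 2 (λ a b → b := (a :+ b) :- a) refl (ι a) (ι b)) (cong (_- ι a) (sym (ι-+ b a)))

  diagonal-x-pairs : ∀ M g H n → n ℕ.≤ M →
    (∀ m x → sumTo m (λ y → g (ι y) (ι m - ι y) (ι x) (ι x)) ≡ H (ι m) (ι x)) →
    diagonal-x M g n ≡ pairs M H n
  diagonal-x-pairs M g H n n≤M h = begin
    diagonal-x M g n
      ≡⟨ trans (sumTo-cong M (λ a _ → sumTo-swap M M _)) (sumTo-swap M M _) ⟩
    (sumTo M λ x → sumTo M λ a → sumTo M λ b → g (ι a) (ι b) (ι x) (ι x) * monomial (suc a ℕ.* suc x ℕ.+ suc b ℕ.* suc x) n)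
      ≡⟨ sumTo-cong M (λ x _ → trans (antidiagonal M n x (λ a b → g a b (ι x) (ι x)) n≤M)
           (sumTo-cong M (λ m _ → cong (_* monomial (suc m ℕ.* suc x) n) (h m x)))) ⟩
    (sumTo M λ x → sumTo M λ m → H (ι m) (ι x) * monomial (suc m ℕ.* suc x) n)
      ≡⟨ sumTo-swap M M _ ⟩
    pairs M H n ∎
    where open ≡-Reasoning

  diagonal-a-pairs : ∀ M g H n → n ℕ.≤ M →
    (∀ m a → sumTo m (λ y → g (ι a) (ι a) (ι y) (ι m - ι y)) ≡ H (ι a) (ι m)) →
    diagonal-a M g n ≡ pairs M H n
  diagonal-a-pairs M g H n n≤M h = begin
    diagonal-a M g n
      ≡⟨ trans (sumTo-cong M (λ x _ → sumTo-swap M M _)) (sumTo-swap M M _) ⟩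
    (sumTo M λ a → sumTo M λ x → sumTo M λ y → g (ι a) (ι a) (ι x) (ι y) * monomial (suc a ℕ.* suc x ℕ.+ suc a ℕ.* suc y) n)
      ≡⟨ sumTo-cong M (λ a _ → trans (sumTo-cong M (λ x _ → sumTo-cong M (λ y _ → cong (λ e → g (ι a) (ι a) (ι x) (ι y) * monomial e n)
           (cong₂ ℕ._+_ (ℕₚ.*-comm (suc a) (suc x)) (ℕₚ.*-comm (suc a) (suc y))))))
           (trans (antidiagonal M n a (λ x y → g (ι a) (ι a) x y) n≤M)
             (sumTo-cong M (λ m _ → cong₂ (λ v e → v * monomial e n) (h m a) (ℕₚ.*-comm (suc m) (suc a)))))) ⟩
    pairs M H n ∎
    where open ≡-Reasoning

  -- The two ways of splitting the quadruple sum of g turn the staircase sum of p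
  -- into diagonal terms.
  quadruples-diagonal : ∀ M n (p g : Weight₄) → n ℕ.≤ M →
    (∀ a b d y → p a b (y + d) y + p b a y (y + d) + (g a (a + b) d y + g (a + b) a y d) ≡ g a b (y + d) y + g b a y (y + d)) →
    quadruples M p n ≡ diagonal-a M g n - diagonal-x M g n + diagonal-x M p n
  quadruples-diagonal M n p g n≤M h = begin
    quadruples M p n
      ≡⟨ split-x M p n n≤M ⟩
    P + diagonal-x M p n
      ≡⟨ cong (_+ diagonal-x M p n) (solve 4 (λ P G d e → P := (P :+ (G :+ d)) :- (G :+ d)) refl P A (diagonal-a M g n) (diagonal-x M g n)) ⟩
    (P + (A + diagonal-a M g n)) - (A + diagonal-a M g n) + diagonal-x M p n
      ≡⟨ cong (λ v → (P + (A + diagonal-a M g n)) - v + diagonal-x M p n) (trans (sym (split-a M g n n≤M)) (split-x M g n n≤M)) ⟩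
    (P + (A + diagonal-a M g n)) - (X + diagonal-x M g n) + diagonal-x M p n
      ≡⟨ cong (_+ diagonal-x M p n) (trans
           (solve 5 (λ P A d X e → (P :+ (A :+ d)) :- (X :+ e) := ((P :+ A) :- X) :+ (d :- e)) refl P A (diagonal-a M g n) X (diagonal-x M g n))
           (trans (cong (λ v → (v - X) + (diagonal-a M g n - diagonal-x M g n)) P+A≡X)
             (solve 2 (λ X u → (X :- X) :+ u := u) refl X (diagonal-a M g n - diagonal-x M g n)))) ⟩
    diagonal-a M g n - diagonal-x M g n + diagonal-x M p n ∎
    where
    open ≡-Reasoning
    p-x g-x g-a : Weight₄
    p-x a b d y = p a b (y + d) y + p b a y (y + d)
    g-x a b d y = g a b (y + d) y + g b a y (y + d)
    g-a a b d y = g a (a + b) d y + g (a + b) a y d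
    P X A : ℤ
    P = staircase M p-x n
    X = staircase M g-x n
    A = staircase M g-a n
    P+A≡X : P + A ≡ X
    P+A≡X = trans (sym (staircase-+ M p-x g-a n)) (staircase-cong M n h)

  closed-form : ∀ (e : ℤ → ℤ → ℤ) (H : ℤ → ℤ → ℤ) → (∀ t → H 0ℤ t ≡ 0ℤ) →
    (∀ m t → H m t + e (1ℤ + m) t ≡ H (1ℤ + m) t) → ∀ m t → sumTo m (λ y → e (ι y) t) ≡ H (+ m) t
  closed-form e H z s zero    t = sym (z t)
  closed-form e H z s (suc m) t = trans
    (cong₂ (λ u v → u + e v t) (closed-form e H z s m t) (ℤₚ.pos-+ 1 m)) (trans (s (+ m) t) (cong (λ v → H v t) (sym (ℤₚ.pos-+ 1 m))))

  ι-1 : ∀ m → + m ≡ ι m - 1ℤ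
  ι-1 m = trans (solve 1 (λ m → m := (:con 1ℤ :+ m) :- :con 1ℤ) refl (+ m)) (cong (_- 1ℤ) (sym (ℤₚ.pos-+ 1 m)))

  private
    s₁ s₂ s₃ s₄ : ∀ {k} → Polynomial k → Polynomial k
    s₁ m = m :* (:con 1ℤ :+ m)
    s₂ m = s₁ m :* (:con 1ℤ :+ :con (+ 2) :* m)
    s₃ m = s₁ m :* s₁ m
    s₄ m = s₂ m :* (:con (+ 3) :* s₁ m :- :con 1ℤ)

  σ₃-series : Series
  σ₃-series = divisorSeries (λ j → ι j * (ι j * ι j))

  private
    k : ∀ {m} → ℕ → Polynomial m
    k c = :con (+ c)

  12σ₁⊛σ₁ : ∀ n → + 12 * (σ₁-series ⊛ σ₁-series) n ≡ + 5 * σ₃-series n + σ₁-series n - + 6 * θ σ₁-series n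
  12σ₁⊛σ₁ n = begin
    + 12 * (σ₁-series ⊛ σ₁-series) n
      ≡⟨ cong (+ 12 *_) (⊛-cong-upto n {σ₁-series} (λ i → divisorSeries-pairs (λ a → a) n i) (λ i → divisorSeries-pairs (λ a → a) n i)) ⟩
    + 12 * (pairs n (λ a _ → a) ⊛ pairs n (λ a _ → a)) n
      ≡⟨ trans (sym (scale-⊛ (+ 12) (pairs n (λ a _ → a)) (pairs n (λ a _ → a)) n))
           (⊛-cong {g = pairs n (λ a _ → a)} (λ i → sym (pairs-scale n (+ 12) (λ a _ → a) i)) (λ _ → refl) n) ⟩
    (pairs n (λ a _ → + 12 * a) ⊛ pairs n (λ a _ → a)) n
      ≡⟨ pairs-⊛ n (λ a _ → + 12 * a) (λ a _ → a) n ⟩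
    quadruples n p n
      ≡⟨ quadruples-diagonal n n p g ℕₚ.≤-refl
           (solve 4 (λ a b d y → k 12 :* a :* b :+ k 12 :* b :* a :+
               ((k 6 :* a :* (a :+ b) :- k 12 :* (a :+ b) :* (a :+ b)) :+ (k 6 :* (a :+ b) :* a :- k 12 :* a :* a)) :=
             (k 6 :* a :* b :- k 12 :* b :* b) :+ (k 6 :* b :* a :- k 12 :* a :* a)) refl) ⟩
    diagonal-a n g n - diagonal-x n g n + diagonal-x n p n
      ≡⟨ cong₂ _+_ (cong₂ _-_
           (diagonal-a-pairs n g Ha n ℕₚ.≤-refl (λ m a → trans
             (closed-form (λ _ t → + 6 * t * t - + 12 * t * t) (λ m t → (+ 6 * t * t - + 12 * t * t) * m)
               (solve 1 (λ t → (k 6 :* t :* t :- k 12 :* t :* t) :* k 0 := k 0) refl)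
               (solve 2 (λ m t → (k 6 :* t :* t :- k 12 :* t :* t) :* m :+ (k 6 :* t :* t :- k 12 :* t :* t) :=
                 (k 6 :* t :* t :- k 12 :* t :* t) :* (k 1 :+ m)) refl) m (ι a))
             (cong ((+ 6 * ι a * ι a - + 12 * ι a * ι a) *_) (ι-1 m))))
           (diagonal-x-pairs n g Hg n ℕₚ.≤-refl (λ m x → trans
             (closed-form (λ y t → + 6 * y * (t - y) - + 12 * (t - y) * (t - y)) Cg
               (solve 1 (λ t → k 15 :* t :* s₁ (k 0) :- k 3 :* s₂ (k 0) :- k 12 :* t :* t :* k 0 := k 0) refl)
               (solve 2 (λ m t → (k 15 :* t :* s₁ m :- k 3 :* s₂ m :- k 12 :* t :* t :* m) :+
                   (k 6 :* (k 1 :+ m) :* (t :- (k 1 :+ m)) :- k 12 :* (t :- (k 1 :+ m)) :* (t :- (k 1 :+ m))) :=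
                 k 15 :* t :* s₁ (k 1 :+ m) :- k 3 :* s₂ (k 1 :+ m) :- k 12 :* t :* t :* (k 1 :+ m)) refl) m (ι m))
             (cong (λ v → Cg v (ι m)) (ι-1 m)))))
           (diagonal-x-pairs n p Hp n ℕₚ.≤-refl (λ m x → trans
             (closed-form (λ y t → + 12 * y * (t - y)) Cp
               (solve 1 (λ t → k 6 :* t :* s₁ (k 0) :- k 2 :* s₂ (k 0) := k 0) refl)
               (solve 2 (λ m t → (k 6 :* t :* s₁ m :- k 2 :* s₂ m) :+ k 12 :* (k 1 :+ m) :* (t :- (k 1 :+ m)) :=
                 k 6 :* t :* s₁ (k 1 :+ m) :- k 2 :* s₂ (k 1 :+ m)) refl) m (ι m))
             (cong (λ v → Cp v (ι m)) (ι-1 m)))) ⟩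
    pairs n Ha n - pairs n Hg n + pairs n Hp n
      ≡⟨ solve 5 (λ A G P u v → A :- G :+ P := (A :+ P) :+ (:- k 1) :* G) refl (pairs n Ha n) (pairs n Hg n) (pairs n Hp n) 0ℤ 0ℤ ⟩
    (pairs n Ha n + pairs n Hp n) + -1ℤ * pairs n Hg n
      ≡⟨ sym (trans (pairs-+ n (λ a x → Ha a x + Hp a x) (λ a x → -1ℤ * Hg a x) n) (cong₂ _+_ (pairs-+ n Ha Hp n) (pairs-scale n -1ℤ Hg n))) ⟩
    pairs n (λ a x → (Ha a x + Hp a x) + -1ℤ * Hg a x) n
      ≡⟨ pairs-cong n (λ a x → (Ha a x + Hp a x) + -1ℤ * Hg a x) (λ a x → (+ 5 * (a * (a * a)) + a) + - + 6 * (a * (a * x))) n (λ a x → solve 2 (λ t x →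
           ((k 6 :* t :* t :- k 12 :* t :* t) :* (x :- k 1) :+ (k 6 :* t :* s₁ (t :- k 1) :- k 2 :* s₂ (t :- k 1))) :+
           (:- k 1) :* (k 15 :* t :* s₁ (t :- k 1) :- k 3 :* s₂ (t :- k 1) :- k 12 :* t :* t :* (t :- k 1)) :=
           (k 5 :* (t :* (t :* t)) :+ t) :+ (:- k 6) :* (t :* (t :* x))) refl a x) ⟩
    pairs n (λ a x → (+ 5 * (a * (a * a)) + a) + - + 6 * (a * (a * x))) n
      ≡⟨ trans (pairs-+ n (λ a x → + 5 * (a * (a * a)) + a) (λ a x → - + 6 * (a * (a * x))) n)
           (cong₂ _+_ (trans (pairs-+ n (λ a x → + 5 * (a * (a * a))) (λ a x → a) n) (cong (_+ pairs n (λ a _ → a) n) (pairs-scale n (+ 5) (λ a x → a * (a * a)) n)))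
             (trans (pairs-scale n (- + 6) (λ a x → a * (a * x)) n) (sym (ℤₚ.neg-distribˡ-* (+ 6) _)))) ⟩
    + 5 * pairs n (λ a _ → a * (a * a)) n + pairs n (λ a _ → a) n - + 6 * pairs n (λ a x → a * (a * x)) n
      ≡⟨ cong₂ _-_ (cong₂ (λ u v → + 5 * u + v) (sym (divisorSeries-pairs (λ a → a * (a * a)) n n ℕₚ.≤-refl)) (sym (divisorSeries-pairs (λ a → a) n n ℕₚ.≤-refl)))
           (cong (+ 6 *_) (trans (sym (θ-pairs n (λ a _ → a) n)) (cong (+ n *_) (sym (divisorSeries-pairs (λ a → a) n n ℕₚ.≤-refl))))) ⟩
    + 5 * σ₃-series n + σ₁-series n - + 6 * θ σ₁-series n ∎
    where
    open ≡-Reasoning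
    p g : Weight₄
    p a b x y = + 12 * a * b
    g a b x y = + 6 * a * b - + 12 * b * b
    Cp Cg Hp Hg Ha : Weight₂
    Cp m t = + 6 * t * (m * (1ℤ + m)) - + 2 * (m * (1ℤ + m) * (1ℤ + + 2 * m))
    Cg m t = + 15 * t * (m * (1ℤ + m)) - + 3 * (m * (1ℤ + m) * (1ℤ + + 2 * m)) - + 12 * t * t * m
    Hp t x = Cp (t - 1ℤ) t
    Hg t x = Cg (t - 1ℤ) t
    Ha a x = (+ 6 * a * a - + 12 * a * a) * (x - 1ℤ)

  touchard : ∀ n → + 36 * (θ σ₁-series ⊛ θ σ₁-series) n - + 24 * (σ₁-series ⊛ θ (θ σ₁-series)) n ≡
    θ (θ (θ σ₁-series)) n - θ (θ σ₁-series) n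
  touchard n = begin
    + 36 * (θ σ₁-series ⊛ θ σ₁-series) n - + 24 * (σ₁-series ⊛ θ (θ σ₁-series)) n
      ≡⟨ solve 2 (λ u v → k 36 :* u :- k 24 :* v := k 36 :* u :+ (:- k 12 :* v :+ :- k 12 :* v)) refl ((θ σ₁-series ⊛ θ σ₁-series) n) ((σ₁-series ⊛ θ (θ σ₁-series)) n) ⟩
    + 36 * (θ σ₁-series ⊛ θ σ₁-series) n + (- + 12 * (σ₁-series ⊛ θ (θ σ₁-series)) n + - + 12 * (σ₁-series ⊛ θ (θ σ₁-series)) n)
      ≡⟨ cong₂ (λ u v → + 36 * u + v) (product U₁ U₁ (λ i i≤n → pairs₁ i i≤n) (λ i i≤n → pairs₁ i i≤n))
           (cong₂ (λ u v → - + 12 * u + - + 12 * v)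
             (trans (⊛-comm σ₁-series (θ (θ σ₁-series)) n) (product U₂ U₀ (λ i i≤n → pairs₂ i i≤n) (λ i i≤n → pairs₀ i i≤n)))
             (product U₀ U₂ (λ i i≤n → pairs₀ i i≤n) (λ i i≤n → pairs₂ i i≤n))) ⟩
    + 36 * quadruples n (λ a b x y → U₁ a x * U₁ b y) n +
      (- + 12 * quadruples n (λ a b x y → U₂ a x * U₀ b y) n + - + 12 * quadruples n (λ a b x y → U₀ a x * U₂ b y) n)
      ≡⟨ sym (trans (quadruples-+ n (λ a b x y → + 36 * (U₁ a x * U₁ b y)) (λ a b x y → - + 12 * (U₂ a x * U₀ b y) + - + 12 * (U₀ a x * U₂ b y)) n)
           (cong₂ _+_ (quadruples-scale n (+ 36) (λ a b x y → U₁ a x * U₁ b y) n)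
             (trans (quadruples-+ n (λ a b x y → - + 12 * (U₂ a x * U₀ b y)) (λ a b x y → - + 12 * (U₀ a x * U₂ b y)) n)
               (cong₂ _+_ (quadruples-scale n (- + 12) (λ a b x y → U₂ a x * U₀ b y) n) (quadruples-scale n (- + 12) (λ a b x y → U₀ a x * U₂ b y) n))))) ⟩
    quadruples n p n
      ≡⟨ quadruples-diagonal n n p g ℕₚ.≤-refl (solve 4 (λ a b d y →
           (pᴾ a b (y :+ d) y :+ pᴾ b a y (y :+ d)) :+ (gᴾ a (a :+ b) d y :+ gᴾ (a :+ b) a y d) :=
           gᴾ a b (y :+ d) y :+ gᴾ b a y (y :+ d)) refl) ⟩
    diagonal-a n g n - diagonal-x n g n + diagonal-x n p n
      ≡⟨ cong₂ _+_ (cong₂ _-_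
           (diagonal-a-pairs n g Ha n ℕₚ.≤-refl (λ m a → trans
             (closed-form (λ y t → g (ι a) (ι a) y (t - y)) (Ca (ι a))
               (λ t → solve 2 (λ t a → Caᴾ a (k 0) t := k 0) refl t (ι a))
               (λ m t → solve 3 (λ m t a → Caᴾ a m t :+ gᴾ a a (k 1 :+ m) (t :- (k 1 :+ m)) := Caᴾ a (k 1 :+ m) t) refl m t (ι a)) m (ι m))
             (cong (λ v → Ca (ι a) v (ι m)) (ι-1 m))))
           (diagonal-x-pairs n g Hg n ℕₚ.≤-refl (λ m x → trans
             (closed-form (λ y t → g y (t - y) (ι x) (ι x)) (Cg (ι x))
               (λ t → solve 2 (λ t x → Cgᴾ x (k 0) t := k 0) refl t (ι x))
               (λ m t → solve 3 (λ m t x → Cgᴾ x m t :+ gᴾ (k 1 :+ m) (t :- (k 1 :+ m)) x x := Cgᴾ x (k 1 :+ m) t) refl m t (ι x)) m (ι m))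
             (cong (λ v → Cg (ι x) v (ι m)) (ι-1 m)))))
           (diagonal-x-pairs n p Hp n ℕₚ.≤-refl (λ m x → trans
             (closed-form (λ y t → p y (t - y) (ι x) (ι x)) (Cp (ι x))
               (λ t → solve 2 (λ t x → Cpᴾ x (k 0) t := k 0) refl t (ι x))
               (λ m t → solve 3 (λ m t x → Cpᴾ x m t :+ pᴾ (k 1 :+ m) (t :- (k 1 :+ m)) x x := Cpᴾ x (k 1 :+ m) t) refl m t (ι x)) m (ι m))
             (cong (λ v → Cp (ι x) v (ι m)) (ι-1 m)))) ⟩
    pairs n Ha n - pairs n Hg n + pairs n Hp n
      ≡⟨ solve 3 (λ A G P → A :- G :+ P := (A :+ P) :+ (:- k 1) :* G) refl (pairs n Ha n) (pairs n Hg n) (pairs n Hp n) ⟩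
    (pairs n Ha n + pairs n Hp n) + -1ℤ * pairs n Hg n
      ≡⟨ sym (trans (pairs-+ n (λ a x → Ha a x + Hp a x) (λ a x → -1ℤ * Hg a x) n) (cong₂ _+_ (pairs-+ n Ha Hp n) (pairs-scale n -1ℤ Hg n))) ⟩
    pairs n (λ a x → (Ha a x + Hp a x) + -1ℤ * Hg a x) n
      ≡⟨ pairs-cong n (λ a x → (Ha a x + Hp a x) + -1ℤ * Hg a x) (λ a x → U₃ a x + -1ℤ * U₂ a x) n (solve 2 (λ a x →
           (Caᴾ a (x :- k 1) x :+ Cpᴾ x (a :- k 1) a) :+ (:- k 1) :* Cgᴾ x (a :- k 1) a :=
           a :* (a :* x) :* (a :* x) :* (a :* x) :+ (:- k 1) :* (a :* (a :* x) :* (a :* x))) refl) ⟩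
    pairs n (λ a x → U₃ a x + -1ℤ * U₂ a x) n
      ≡⟨ trans (pairs-+ n U₃ (λ a x → -1ℤ * U₂ a x) n) (cong (_+_ (pairs n U₃ n)) (trans (pairs-scale n -1ℤ U₂ n) (ℤₚ.-1*i≡-i _))) ⟩
    pairs n U₃ n - pairs n U₂ n
      ≡⟨ sym (cong₂ _-_ (trans (cong (+ n *_) (pairs₂ n ℕₚ.≤-refl)) (θ-pairs n U₂ n)) (pairs₂ n ℕₚ.≤-refl)) ⟩
    θ (θ (θ σ₁-series)) n - θ (θ σ₁-series) n ∎
    where
    open ≡-Reasoning
    U₀ U₁ U₂ U₃ Hp Hg Ha : Weight₂
    U₀ a x = a
    U₁ a x = a * (a * x)
    U₂ a x = U₁ a x * (a * x)
    U₃ a x = U₂ a x * (a * x)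
    p g : Weight₄
    p a b x y = + 36 * (U₁ a x * U₁ b y) + (- + 12 * (U₂ a x * U₀ b y) + - + 12 * (U₀ a x * U₂ b y))
    g a b x y = b * b * (+ 2 * b * b * y * y - + 12 * a * b * y * y - + 16 * a * b * x * y + + 12 * a * a * y * y + + 18 * a * a * x * y)
    Ca Cg Cp : ℤ → ℤ → ℤ → ℤ
    Ca a m t = a * a * a * a * (+ 2 * t * t * m - t * (m * (1ℤ + m)))
    Cp x m t = x * x * (+ 12 * t * t * (m * (1ℤ + m) * (1ℤ + + 2 * m)) - + 6 * t * t * t * (m * (1ℤ + m)) - + 30 * t * (m * (1ℤ + m) * (m * (1ℤ + m)))
      + + 2 * (m * (1ℤ + m) * (1ℤ + + 2 * m) * (+ 3 * (m * (1ℤ + m)) - 1ℤ)))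
    Cg x m t = x * x * (+ 2 * t * t * t * t * m - + 18 * t * t * t * (m * (1ℤ + m)) + + 21 * t * t * (m * (1ℤ + m) * (1ℤ + + 2 * m))
      - + 38 * t * (m * (1ℤ + m) * (m * (1ℤ + m))) + + 2 * (m * (1ℤ + m) * (1ℤ + + 2 * m) * (+ 3 * (m * (1ℤ + m)) - 1ℤ)))
    Ha a x = Ca a (x - 1ℤ) x
    Hg a x = Cg x (a - 1ℤ) a
    Hp a x = Cp x (a - 1ℤ) a
    pᴾ gᴾ : ∀ {j} → Polynomial j → Polynomial j → Polynomial j → Polynomial j → Polynomial j
    pᴾ a b x y = k 36 :* (a :* (a :* x) :* (b :* (b :* y))) :+ (:- k 12 :* (a :* (a :* x) :* (a :* x) :* b) :+ :- k 12 :* (a :* (b :* (b :* y) :* (b :* y))))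
    gᴾ a b x y = b :* b :* (k 2 :* b :* b :* y :* y :- k 12 :* a :* b :* y :* y :- k 16 :* a :* b :* x :* y :+ k 12 :* a :* a :* y :* y :+ k 18 :* a :* a :* x :* y)
    Caᴾ Cgᴾ Cpᴾ : ∀ {j} → Polynomial j → Polynomial j → Polynomial j → Polynomial j
    Caᴾ a m t = a :* a :* a :* a :* (k 2 :* t :* t :* m :- t :* s₁ m)
    Cpᴾ x m t = x :* x :* (k 12 :* t :* t :* s₂ m :- k 6 :* t :* t :* t :* s₁ m :- k 30 :* t :* s₃ m :+ k 2 :* s₄ m)
    Cgᴾ x m t = x :* x :* (k 2 :* t :* t :* t :* t :* m :- k 18 :* t :* t :* t :* s₁ m :+ k 21 :* t :* t :* s₂ m :- k 38 :* t :* s₃ m :+ k 2 :* s₄ m)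
    pairs₀ : ∀ i → i ℕ.≤ n → σ₁-series i ≡ pairs n U₀ i
    pairs₀ i i≤n = divisorSeries-pairs (λ a → a) n i i≤n
    pairs₁ : ∀ i → i ℕ.≤ n → θ σ₁-series i ≡ pairs n U₁ i
    pairs₁ i i≤n = trans (cong (+ i *_) (pairs₀ i i≤n)) (θ-pairs n U₀ i)
    pairs₂ : ∀ i → i ℕ.≤ n → θ (θ σ₁-series) i ≡ pairs n U₂ i
    pairs₂ i i≤n = trans (cong (+ i *_) (pairs₁ i i≤n)) (θ-pairs n U₁ i)
    product : ∀ h l {f f′} → (∀ i → i ℕ.≤ n → f i ≡ pairs n h i) → (∀ i → i ℕ.≤ n → f′ i ≡ pairs n l i) →
      (f ⊛ f′) n ≡ quadruples n (λ a b x y → h a x * l b y) n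
    product h l e e′ = trans (⊛-cong-upto n e e′) (pairs-⊛ n h l n)

  iterate : ℕ → Series
  iterate zero    = σ₁-series
  iterate (suc i) = θ (iterate i)

  Vars-all : ∀ {P : ℕ → Set} → (∀ i → P i) → ∀ p → Vars P p
  Vars-all h (con c)      = tt
  Vars-all h (node i p q) = h i , Vars-all h p , Vars-all h q

  -- The Eisenstein series in terms of σ₁ and its derivatives θⁱσ₁, the variables i.
  E₂ᴾ E₄ᴾ E₆ᴾ touchardᴾ : Poly
  E₂ᴾ = con 1ℤ ⊞ scale (- + 24) (var 0)
  E₄ᴾ = (E₂ᴾ ⊠ E₂ᴾ) ⊞ scale (+ 288) (var 1)
  E₆ᴾ = (E₂ᴾ ⊠ E₄ᴾ) ⊞ scale (- + 3) (deriv (λ i → var (suc i)) E₄ᴾ)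
  touchardᴾ = (var 3 ⊞ scale -1ℤ (var 2)) ⊞ scale -1ℤ (scale (+ 36) (var 1 ⊠ var 1) ⊞ scale (- + 24) (var 0 ⊠ var 2))

  ramanujanᴾ : Poly
  ramanujanᴾ = (scale (+ 2) (deriv (λ i → var (suc i)) E₆ᴾ) ⊞ scale -1ℤ ((E₂ᴾ ⊠ E₆ᴾ) ⊞ scale -1ℤ (E₄ᴾ ⊠ E₄ᴾ))) ⊞ scale (+ 1728) touchardᴾ

  E₆-series : Series
  E₆-series = (E₂-series ⊛ E₄-series) ⊖ (λ n → + 3 * θ E₄-series n)

  sub-sound : ∀ p q v n → ⟦ p ⊞ scale -1ℤ q ⟧ v n ≡ ⟦ p ⟧ v n - ⟦ q ⟧ v n
  sub-sound p q v n = trans (⊞-sound p (scale -1ℤ q) v n)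
    (cong (_+_ (⟦ p ⟧ v n)) (trans (scale-sound -1ℤ q v n) (ℤₚ.-1*i≡-i _)))

  E₂ᴾ-sound : ⟦ E₂ᴾ ⟧ iterate ≗ E₂-series
  E₂ᴾ-sound n = trans (⊞-sound (con 1ℤ) (scale (- + 24) (var 0)) iterate n)
    (cong (_+_ (const 1ℤ n)) (trans (scale-sound (- + 24) (var 0) iterate n)
      (trans (cong (- + 24 *_) (var-sound 0 iterate n)) (sym (ℤₚ.neg-distribˡ-* (+ 24) (σ₁-series n))))))

  E₂⊛E₂ : ∀ n → (E₂-series ⊛ E₂-series) n ≡ const 1ℤ n - + 48 * σ₁-series n + + 576 * (σ₁-series ⊛ σ₁-series) n
  E₂⊛E₂ n = begin
    (E₂-series ⊛ E₂-series) n
      ≡⟨ sym (trans (⊠-sound E₂ᴾ E₂ᴾ iterate n) (⊛-cong E₂ᴾ-sound E₂ᴾ-sound n)) ⟩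
    ⟦ E₂ᴾ ⊠ E₂ᴾ ⟧ iterate n
      ≡⟨ cong (λ p → ⟦ p ⟧ iterate n) {x = E₂ᴾ ⊠ E₂ᴾ} {y = (con 1ℤ ⊞ scale (- + 48) (var 0)) ⊞ scale (+ 576) (var 0 ⊠ var 0)} refl ⟩
    ⟦ (con 1ℤ ⊞ scale (- + 48) (var 0)) ⊞ scale (+ 576) (var 0 ⊠ var 0) ⟧ iterate n
      ≡⟨ trans (⊞-sound (con 1ℤ ⊞ scale (- + 48) (var 0)) (scale (+ 576) (var 0 ⊠ var 0)) iterate n)
           (cong₂ _+_ (trans (⊞-sound (con 1ℤ) (scale (- + 48) (var 0)) iterate n)
               (cong (_+_ (const 1ℤ n)) (trans (scale-sound (- + 48) (var 0) iterate n)
                 (trans (cong (- + 48 *_) (var-sound 0 iterate n)) (sym (ℤₚ.neg-distribˡ-* (+ 48) (σ₁-series n)))))))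
             (trans (scale-sound (+ 576) (var 0 ⊠ var 0) iterate n)
               (cong (+ 576 *_) (trans (⊠-sound (var 0) (var 0) iterate n) (⊛-cong (var-sound 0 iterate) (var-sound 0 iterate) n))))) ⟩
    const 1ℤ n - + 48 * σ₁-series n + + 576 * (σ₁-series ⊛ σ₁-series) n ∎
    where open ≡-Reasoning

  θ-const : ∀ c n → θ (const c) n ≡ 0ℤ
  θ-const c zero    = refl
  θ-const c (suc n) = ℤₚ.*-zeroʳ (+ suc n)

  θ-E₂ : ∀ n → θ E₂-series n ≡ - + 24 * θ σ₁-series n
  θ-E₂ n = trans
    (solve 3 (λ n c s → n :* (c :- k 24 :* s) := n :* c :+ (:- k 24) :* (n :* s)) refl (+ n) (const 1ℤ n) (σ₁-series n))
    (trans (cong (_+ - + 24 * θ σ₁-series n) (θ-const 1ℤ n)) (ℤₚ.+-identityˡ _))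

  θE₂ : ∀ n → + 12 * θ E₂-series n ≡ (E₂-series ⊛ E₂-series) n - E₄-series n
  θE₂ n = begin
    + 12 * θ E₂-series n
      ≡⟨ cong (+ 12 *_) (θ-E₂ n) ⟩
    + 12 * (- + 24 * θ σ₁-series n)
      ≡⟨ solve 4 (λ c s t u → k 12 :* (:- k 24 :* t) := (c :- k 48 :* s :+ k 48 :* (k 5 :* u :+ s :- k 6 :* t)) :- (c :+ k 240 :* u)) refl
           (const 1ℤ n) (σ₁-series n) (θ σ₁-series n) (σ₃-series n) ⟩
    (const 1ℤ n - + 48 * σ₁-series n + + 48 * (+ 5 * σ₃-series n + σ₁-series n - + 6 * θ σ₁-series n)) - E₄-series n
      ≡⟨ cong (λ x → (const 1ℤ n - + 48 * σ₁-series n + x) - E₄-series n) (trans (cong (+ 48 *_) (sym (12σ₁⊛σ₁ n)))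
           (sym (ℤₚ.*-assoc (+ 48) (+ 12) ((σ₁-series ⊛ σ₁-series) n)))) ⟩
    (const 1ℤ n - + 48 * σ₁-series n + + 576 * (σ₁-series ⊛ σ₁-series) n) - E₄-series n
      ≡⟨ cong (_- E₄-series n) (sym (E₂⊛E₂ n)) ⟩
    (E₂-series ⊛ E₂-series) n - E₄-series n ∎
    where open ≡-Reasoning

  E₄ᴾ-sound : ⟦ E₄ᴾ ⟧ iterate ≗ E₄-series
  E₄ᴾ-sound n = begin
    ⟦ E₄ᴾ ⟧ iterate n
      ≡⟨ trans (⊞-sound (E₂ᴾ ⊠ E₂ᴾ) (scale (+ 288) (var 1)) iterate n)
           (cong₂ _+_ (trans (⊠-sound E₂ᴾ E₂ᴾ iterate n) (⊛-cong E₂ᴾ-sound E₂ᴾ-sound n))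
             (trans (scale-sound (+ 288) (var 1) iterate n) (cong (+ 288 *_) (var-sound 1 iterate n)))) ⟩
    (E₂-series ⊛ E₂-series) n + + 288 * θ σ₁-series n
      ≡⟨ solve 3 (λ s b t → s :+ k 288 :* t := (s :- b) :+ b :+ k 288 :* t) refl ((E₂-series ⊛ E₂-series) n) (E₄-series n) (θ σ₁-series n) ⟩
    ((E₂-series ⊛ E₂-series) n - E₄-series n) + E₄-series n + + 288 * θ σ₁-series n
      ≡⟨ cong (λ x → x + E₄-series n + + 288 * θ σ₁-series n) (trans (sym (θE₂ n)) (cong (+ 12 *_) (θ-E₂ n))) ⟩
    + 12 * (- + 24 * θ σ₁-series n) + E₄-series n + + 288 * θ σ₁-series n
      ≡⟨ solve 2 (λ b t → k 12 :* (:- k 24 :* t) :+ b :+ k 288 :* t := b) refl (E₄-series n) (θ σ₁-series n) ⟩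
    E₄-series n ∎
    where open ≡-Reasoning

  derivative : ∀ p n → ⟦ deriv (λ i → var (suc i)) p ⟧ iterate n ≡ θ (⟦ p ⟧ iterate) n
  derivative p n = trans (sym (deriv-sound 1ℤ (λ i → var (suc i)) p iterate
    (Vars-all (λ i n → trans (ℤₚ.*-identityˡ _) (sym (var-sound (suc i) iterate n))) p) n)) (ℤₚ.*-identityˡ _)

  E₆ᴾ-sound : ⟦ E₆ᴾ ⟧ iterate ≗ E₆-series
  E₆ᴾ-sound n = trans (⊞-sound (E₂ᴾ ⊠ E₄ᴾ) (scale (- + 3) (deriv (λ i → var (suc i)) E₄ᴾ)) iterate n) (cong₂ _+_
    (trans (⊠-sound E₂ᴾ E₄ᴾ iterate n) (⊛-cong E₂ᴾ-sound E₄ᴾ-sound n))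
    (trans (scale-sound (- + 3) (deriv (λ i → var (suc i)) E₄ᴾ) iterate n)
      (trans (cong (- + 3 *_) (trans (derivative E₄ᴾ n) (θ-cong E₄ᴾ-sound n))) (sym (ℤₚ.neg-distribˡ-* (+ 3) (θ E₄-series n))))))

  θE₄ : ∀ n → + 3 * θ E₄-series n ≡ (E₂-series ⊛ E₄-series) n - E₆-series n
  θE₄ n = solve 2 (λ x y → y := x :- (x :- y)) refl ((E₂-series ⊛ E₄-series) n) (+ 3 * θ E₄-series n)

  touchardᴾ-sound : ∀ n → ⟦ touchardᴾ ⟧ iterate n ≡ 0ℤ
  touchardᴾ-sound n = begin
    ⟦ touchardᴾ ⟧ iterate n
      ≡⟨ trans (sub-sound (var 3 ⊞ scale -1ℤ (var 2)) (scale (+ 36) (var 1 ⊠ var 1) ⊞ scale (- + 24) (var 0 ⊠ var 2)) iterate n)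
           (cong₂ _-_ (trans (sub-sound (var 3) (var 2) iterate n) (cong₂ _-_ (var-sound 3 iterate n) (var-sound 2 iterate n)))
             (trans (⊞-sound (scale (+ 36) (var 1 ⊠ var 1)) (scale (- + 24) (var 0 ⊠ var 2)) iterate n)
               (cong₂ _+_
                 (trans (scale-sound (+ 36) (var 1 ⊠ var 1) iterate n) (cong (+ 36 *_) (trans (⊠-sound (var 1) (var 1) iterate n) (⊛-cong (var-sound 1 iterate) (var-sound 1 iterate) n))))
                 (trans (scale-sound (- + 24) (var 0 ⊠ var 2) iterate n) (trans (cong (- + 24 *_) (trans (⊠-sound (var 0) (var 2) iterate n) (⊛-cong (var-sound 0 iterate) (var-sound 2 iterate) n)))
                   (sym (ℤₚ.neg-distribˡ-* (+ 24) _))))))) ⟩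
    (iterate 3 n - iterate 2 n) - (+ 36 * (iterate 1 ⊛ iterate 1) n - + 24 * (iterate 0 ⊛ iterate 2) n)
      ≡⟨ cong (_-_ (iterate 3 n - iterate 2 n)) (touchard n) ⟩
    (iterate 3 n - iterate 2 n) - (iterate 3 n - iterate 2 n)
      ≡⟨ ℤₚ.+-inverseʳ (iterate 3 n - iterate 2 n) ⟩
    0ℤ ∎
    where open ≡-Reasoning

  θE₆ : ∀ n → + 2 * θ E₆-series n ≡ (E₂-series ⊛ E₆-series) n - (E₄-series ⊛ E₄-series) n
  θE₆ n = begin
    + 2 * θ E₆-series n
      ≡⟨ sym (trans (scale-sound (+ 2) (deriv (λ i → var (suc i)) E₆ᴾ) iterate n) (cong (+ 2 *_) (trans (derivative E₆ᴾ n) (θ-cong E₆ᴾ-sound n)))) ⟩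
    ⟦ L ⟧ iterate n
      ≡⟨ solve 2 (λ l r → l := (l :- r) :+ k 1728 :* k 0 :+ r) refl (⟦ L ⟧ iterate n) (⟦ R ⟧ iterate n) ⟩
    (⟦ L ⟧ iterate n - ⟦ R ⟧ iterate n) + + 1728 * 0ℤ + ⟦ R ⟧ iterate n
      ≡⟨ cong (_+ ⟦ R ⟧ iterate n) (trans
           (cong₂ _+_ (sym (sub-sound L R iterate n)) (sym (trans (scale-sound (+ 1728) touchardᴾ iterate n) (cong (+ 1728 *_) (touchardᴾ-sound n)))))
           (trans (sym (⊞-sound (L ⊞ scale -1ℤ R) (scale (+ 1728) touchardᴾ) iterate n)) (isZero-sound ramanujanᴾ iterate refl n))) ⟩
    0ℤ + ⟦ R ⟧ iterate n
      ≡⟨ trans (ℤₚ.+-identityˡ _) (trans (sub-sound (E₂ᴾ ⊠ E₆ᴾ) (E₄ᴾ ⊠ E₄ᴾ) iterate n) (cong₂ _-_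
           (trans (⊠-sound E₂ᴾ E₆ᴾ iterate n) (⊛-cong E₂ᴾ-sound E₆ᴾ-sound n))
           (trans (⊠-sound E₄ᴾ E₄ᴾ iterate n) (⊛-cong E₄ᴾ-sound E₄ᴾ-sound n)))) ⟩
    (E₂-series ⊛ E₆-series) n - (E₄-series ⊛ E₄-series) n ∎
    where
    open ≡-Reasoning
    L R : Poly
    L = scale (+ 2) (deriv (λ i → var (suc i)) E₆ᴾ)
    R = (E₂ᴾ ⊠ E₆ᴾ) ⊞ scale -1ℤ (E₄ᴾ ⊠ E₄ᴾ)

  -- The series of δᵏ f(δz), with d = δ - 1.
  at : ℕ → ℕ → Series → Series
  at zero    d f = V d f
  at (suc k) d f n = + suc d * at k d f n

  at-cong : ∀ k d {f g} → f ≗ g → at k d f ≗ at k d g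
  at-cong zero    d h n = gap-cong d 0 h n
  at-cong (suc k) d h n = cong (+ suc d *_) (at-cong k d h n)

  at-⊖ : ∀ k d f g → at k d (f ⊖ g) ≗ at k d f ⊖ at k d g
  at-⊖ zero    d f g n = gap-⊖ d 0 f g n
  at-⊖ (suc k) d f g n = trans (cong (+ suc d *_) (at-⊖ k d f g n))
    (solve 3 (λ c x y → c :* (x :- y) := c :* x :- c :* y) refl (+ suc d) (at k d f n) (at k d g n))

  at-scale : ∀ k d c f n → at k d (λ i → c * f i) n ≡ c * at k d f n
  at-scale zero    d c f n = gap-scale d 0 c f n
  at-scale (suc k) d c f n = trans (cong (+ suc d *_) (at-scale k d c f n))
    (solve 3 (λ e c x → e :* (c :* x) := c :* (e :* x)) refl (+ suc d) c (at k d f n))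

  at-⊛ : ∀ k l d f g → at k d f ⊛ at l d g ≗ at (k ℕ.+ l) d (f ⊛ g)
  at-⊛ zero    zero    d f g n = gap-⊛ d 0 f g n
  at-⊛ zero    (suc l) d f g n = trans (⊛-scale (+ suc d) (V d f) (at l d g) n) (cong (+ suc d *_) (at-⊛ zero l d f g n))
  at-⊛ (suc k) l       d f g n = trans (scale-⊛ (+ suc d) (at k d f) (at l d g) n) (cong (+ suc d *_) (at-⊛ k l d f g n))

  θ-at : ∀ k d f n → θ (at k d f) n ≡ at (suc k) d (θ f) n
  θ-at zero    d f n = θ-V d f n
  θ-at (suc k) d f n = trans (solve 3 (λ n c x → n :* (c :* x) := c :* (n :* x)) refl (+ n) (+ suc d) (at k d f n))
    (cong (+ suc d *_) (θ-at k d f n))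

  transfer : ∀ c k l d f g h j → (∀ n → c * θ f n ≡ (g ⊛ h) n - j n) → k ℕ.+ l ≡ suc (pred (k ℕ.+ l)) →
    ∀ n → c * θ (at (pred (k ℕ.+ l)) d f) n ≡ (at k d g ⊛ at l d h) n - at (k ℕ.+ l) d j n
  transfer c k l d f g h j eqn suc-pred n = begin
    c * θ (at (pred (k ℕ.+ l)) d f) n
      ≡⟨ cong (c *_) (trans (θ-at (pred (k ℕ.+ l)) d f n) (cong (λ e → at e d (θ f) n) (sym suc-pred))) ⟩
    c * at (k ℕ.+ l) d (θ f) n
      ≡⟨ sym (at-scale (k ℕ.+ l) d c (θ f) n) ⟩
    at (k ℕ.+ l) d (λ i → c * θ f i) n
      ≡⟨ at-cong (k ℕ.+ l) d eqn n ⟩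
    at (k ℕ.+ l) d ((g ⊛ h) ⊖ j) n
      ≡⟨ at-⊖ (k ℕ.+ l) d (g ⊛ h) j n ⟩
    at (k ℕ.+ l) d (g ⊛ h) n - at (k ℕ.+ l) d j n
      ≡⟨ cong (_- at (k ℕ.+ l) d j n) (sym (at-⊛ k l d g h n)) ⟩
    (at k d g ⊛ at l d h) n - at (k ℕ.+ l) d j n ∎
    where open ≡-Reasoning

  etaProduct-0 : ∀ fs → etaProduct fs 0 ≡ 1ℤ
  etaProduct-0 []             = refl
  etaProduct-0 ((d , r) ∷ fs) = cong₂ _*_ (power-0 r) (etaProduct-0 fs)
    where
    pow : ∀ f k → f 0 ≡ 1ℤ → power f k 0 ≡ 1ℤ
    pow f zero    h = refl
    pow f (suc k) h = cong₂ _*_ h (pow f k h)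
    power-0 : ∀ r → eulerPower d r 0 ≡ 1ℤ
    power-0 (+ k)    = pow (V d euler) k refl
    power-0 -[1+ k ] = pow (V d partitions) (suc k) refl

  nth-map : ∀ {A B : Set} (f g : A → B) xs → map f xs ≡ map g xs → ∀ d j → j ℕ.< length xs → f (nth d xs j) ≡ g (nth d xs j)
  nth-map f g (x ∷ xs) eq d zero    _  = proj₁ (∷-injective eq)
  nth-map f g (x ∷ xs) eq d (suc j) j< = nth-map f g xs (proj₂ (∷-injective eq)) d j (ℕ.s≤s⁻¹ j<)

  nth-default : ∀ {A : Set} (d d′ : A) xs j → j ℕ.< length xs → nth d xs j ≡ nth d′ xs j
  nth-default d d′ (x ∷ xs) zero    _  = refl
  nth-default d d′ (x ∷ xs) (suc j) j< = nth-default d d′ xs j (ℕ.s≤s⁻¹ j<)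

  module Instance (L : Level) where
    open Level L
    open Engine L

    index : ℕ → ℕ
    index i = pred (nth 1 δs i)

    resolve : Factors → List (ℕ × ℤ)
    resolve []             = []
    resolve ((i , r) ∷ fs) = (index i , r) ∷ resolve fs

    order : Factors → ℕ
    order fs = ∣ degree (resolve fs) ∣ div 24

    etaQuotient : Factors → Series
    etaQuotient fs = shifts (order fs) (etaProduct (resolve fs))

    zSum : List ℤ → ℕ → Series
    zSum []       _ = zeros
    zSum (x ∷ xs) i = (λ n → x * V (index i) σ₁-series n) ⊕ zSum xs (suc i)

    Z-series : Series
    Z-series = const 1ℤ ⊕ zSum z 0

    a b c : ℕ → Series
    a i = at 1 (index i) E₂-series
    b i = at 2 (index i) E₄-series
    c i = at 3 (index i) E₆-series

    F : ℕ → Series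
    F j = etaQuotient (Form.factors (formAt j))

    open Model L a b c (etaQuotient tf) (etaQuotient Wf) Z-series F public

    module Initial (eu pa σs e₂ e₄ e₆ : List ℤ) where

      infixl 6 _-ᴸ_
      _-ᴸ_ : List ℤ → List ℤ → List ℤ
      xs -ᴸ ys = xs +ᴸ scaleᴸ -1ℤ ys

      Pᴸ : ℕ → ℤ → List ℤ
      Pᴸ d (+ k)    = powerᴸ K (gapᴸ K d 0 eu) k
      Pᴸ d -[1+ k ] = powerᴸ K (gapᴸ K d 0 pa) (suc k)

      etaProductᴸ : List (ℕ × ℤ) → List ℤ
      etaProductᴸ []             = segment K (const 1ℤ)
      etaProductᴸ ((d , r) ∷ fs) = Pᴸ d r *ᴸ etaProductᴸ fs

      etaQuotientᴸ : Factors → List ℤ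
      etaQuotientᴸ fs = shiftᴸ (order fs) (etaProductᴸ (resolve fs))

      zSumᴸ : List ℤ → ℕ → List ℤ
      zSumᴸ []       _ = segment K zeros
      zSumᴸ (x ∷ xs) i = scaleᴸ x (gapᴸ K (index i) 0 σs) +ᴸ zSumᴸ xs (suc i)

      atᴸ : ℕ → ℕ → List ℤ → List ℤ
      atᴸ zero    d xs = gapᴸ K d 0 xs
      atᴸ (suc k) d xs = scaleᴸ (+ suc d) (atᴸ k d xs)

      module Base (t W Z : List ℤ) where
        baseᴸ : ℕ → List ℤ
        baseᴸ 0 = atᴸ 1 (index 0) e₂
        baseᴸ 1 = t
        baseᴸ 2 = W
        baseᴸ 3 = Z
        baseᴸ _ = []

        approxᴸ : ℕ → Table → List ℤ
        approxᴸ k x = evalᴸ K baseᴸ (table# k x)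

        okZero : List ℤ → Bool
        okZero = vanishing K

        formOk : List Form → Bool
        formOk []       = true
        formOk (g ∷ gs) = okZero (scaleᴸ (Form.multiple g) (etaQuotientᴸ (Form.factors g)) -ᴸ approxᴸ 1 (Form.table g)) ∧ formOk gs

        tripleOk : ℕ → ℕ → Bool
        tripleOk zero    _ = formOk forms
        tripleOk (suc n) i =
          okZero (atᴸ 1 (index i) e₂ -ᴸ (baseᴸ 0 +ᴸ approxᴸ 0 (tab as i))) ∧
          (okZero (atᴸ 2 (index i) e₄ -ᴸ approxᴸ 1 (tab bs i)) ∧
          (okZero (atᴸ 3 (index i) e₆ -ᴸ approxᴸ 2 (tab cs i)) ∧ tripleOk n (suc i)))

        errorsOk : Bool
        errorsOk = okZero (Z *ᴸ Z -ᴸ evalᴸ K baseᴸ W²f) ∧ tripleOk m 0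

      ok : Bool
      ok = Base.errorsOk (etaQuotientᴸ tf) (etaQuotientᴸ Wf) (segment K (const 1ℤ) +ᴸ zSumᴸ z 0)

    negatives : List ℤ → ℕ → List ℤ
    negatives []       _ = []
    negatives (x ∷ xs) i = - (x * + suc (index i)) ∷ negatives xs (suc i)

    total : List ℤ → ℕ → ℤ
    total []       _ = 0ℤ
    total (x ∷ xs) i = x * + suc (index i) + total xs (suc i)

    initialOk-from : List ℤ → List ℤ → List ℤ → List ℤ → Bool
    initialOk-from eu σs e₂ e₄ = Initial.ok eu (inverseᴸ K eu) σs e₂ e₄ (e₂ *ᴸ e₄ +ᴸ scaleᴸ -1ℤ (scaleᴸ (+ 3) (θᴸ 0 e₄)))

    initialOk : List ℤ → Bool
    initialOk eu = initialOk-from eu (segment K σ₁-series) (segment K E₂-series) (segment K E₄-series)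

    Degree : Factors → Set
    Degree fs = degree (resolve fs) ≡ + (order fs ℕ.* 24)

    record Coherent : Set where
      field
        checked  : Checked
        m-pos    : 0 ℕ.< m
        index-0  : index 0 ≡ 0
        t-order  : order tf ≡ 1
        t-degree : Degree tf
        W-order  : order Wf ≡ 0
        W-degree : Degree Wf
        degrees  : map (λ g → degree (resolve (Form.factors g))) forms ≡ map (λ g → + (order (Form.factors g) ℕ.* 24)) forms
        z-e      : map (+ 2 *_) z ≡ negatives e 0
        e-total  : total e 0 ≡ + 48
        initial  : initialOk (eulerᴸ K) ≡ true

    module _ (coherent : Coherent) where
      open Coherent coherent

      E₂-sum-resolve : ∀ fs → E₂-sum (resolve fs) ≗ logSeries fs
      E₂-sum-resolve []             n = refl
      E₂-sum-resolve ((i , r) ∷ fs) n = cong (_+_ (r * a i n)) (E₂-sum-resolve fs n)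

      logDeriv-quotient : ∀ fs → Degree fs → LogDeriv (etaQuotient fs) (logSeries fs)
      logDeriv-quotient fs deg = logDeriv-cong (λ _ → refl) (E₂-sum-resolve fs) (logDeriv-etaQuotient (order fs) (resolve fs) deg)

      eSum : List ℤ → ℕ → Series
      eSum []       _ = zeros
      eSum (x ∷ xs) i = (λ n → x * + suc (index i) * V (index i) σ₁-series n) ⊕ eSum xs (suc i)

      a-expand : ∀ i n → a i n ≡ + suc (index i) * (const 1ℤ n - + 24 * V (index i) σ₁-series n)
      a-expand i n = cong (+ suc (index i) *_) (trans (gap-⊖ (index i) 0 (const 1ℤ) (λ k → + 24 * σ₁-series k) n)
        (cong₂ _-_ (V-const (index i) 1ℤ n) (gap-scale (index i) 0 (+ 24) σ₁-series n)))

      combine-expand : ∀ xs i n → combine xs i n ≡ total xs i * const 1ℤ n - + 24 * eSum xs i n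
      combine-expand []       i n = refl
      combine-expand (x ∷ xs) i n = trans (cong₂ (λ u v → x * u + v) (a-expand i n) (combine-expand xs (suc i) n))
        (solve 6 (λ x d c v t s → x :* (d :* (c :- :con (+ 24) :* v)) :+ (t :* c :- :con (+ 24) :* s) :=
          (x :* d :+ t) :* c :- :con (+ 24) :* (x :* d :* v :+ s)) refl
          x (+ suc (index i)) (const 1ℤ n) (V (index i) σ₁-series n) (total xs (suc i)) (eSum xs (suc i) n))

      zSum-expand : ∀ zs xs i → map (+ 2 *_) zs ≡ negatives xs i → ∀ n → + 2 * zSum zs i n ≡ - eSum xs i n
      zSum-expand []       []       i eq n = refl
      zSum-expand (y ∷ ys) (x ∷ xs) i eq n = begin
        + 2 * (y * V (index i) σ₁-series n + zSum ys (suc i) n)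
          ≡⟨ solve 3 (λ y v s → :con (+ 2) :* (y :* v :+ s) := (:con (+ 2) :* y) :* v :+ :con (+ 2) :* s) refl y (V (index i) σ₁-series n) (zSum ys (suc i) n) ⟩
        (+ 2 * y) * V (index i) σ₁-series n + + 2 * zSum ys (suc i) n
          ≡⟨ cong₂ (λ u v → u * V (index i) σ₁-series n + v) (proj₁ (∷-injective eq)) (zSum-expand ys xs (suc i) (proj₂ (∷-injective eq)) n) ⟩
        - (x * + suc (index i)) * V (index i) σ₁-series n + - eSum xs (suc i) n
          ≡⟨ trans (cong (_+ - eSum xs (suc i) n) (sym (ℤₚ.neg-distribˡ-* (x * + suc (index i)) (V (index i) σ₁-series n)))) (sym (ℤₚ.neg-distrib-+ (x * + suc (index i) * V (index i) σ₁-series n) (eSum xs (suc i) n))) ⟩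
        - eSum (x ∷ xs) i n ∎
        where open ≡-Reasoning

      zSum-0 : ∀ xs i → zSum xs i 0 ≡ 0ℤ
      zSum-0 []       i = refl
      zSum-0 (x ∷ xs) i = cong₂ _+_ (ℤₚ.*-zeroʳ x) (zSum-0 xs (suc i))

      laws : Laws
      laws = record
        { θa = λ i _ → transfer (+ 12) 1 1 (index i) E₂-series E₂-series E₂-series E₄-series θE₂ refl
        ; θb = λ i _ → transfer (+ 3) 1 2 (index i) E₄-series E₂-series E₄-series E₆-series θE₄ refl
        ; θc = λ i _ n → trans (transfer (+ 2) 1 3 (index i) E₆-series E₂-series E₆-series (E₄-series ⊛ E₄-series) θE₆ refl n)
                 (cong (_-_ ((a i ⊛ c i) n)) (sym (at-⊛ 2 2 (index i) E₄-series E₄-series n)))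
        ; θt = logDeriv-quotient tf t-degree
        ; θW = logDeriv-quotient Wf W-degree
        ; θF = λ j d j< n → trans
                 (logDeriv-quotient (Form.factors (formAt j))
                   (nth-map (λ g → degree (resolve (Form.factors g))) (λ g → + (order (Form.factors g) ℕ.* 24)) forms degrees (form 1ℤ [] ([] , [])) j j<) n)
                 (cong (λ g → (F j ⊛ logSeries (Form.factors g)) n) (nth-default (form 1ℤ [] ([] , [])) d forms j j<))
        ; 48Z = λ n → trans
                 (solve 2 (λ c s → :con (+ 48) :* (c :+ s) := :con (+ 48) :* c :+ :con (+ 24) :* (:con (+ 2) :* s)) refl (const 1ℤ n) (zSum z 0 n))
                 (trans (cong₂ (λ u v → u * const 1ℤ n + + 24 * v) (sym e-total) (zSum-expand z e 0 z-e n))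
                   (trans (cong (_+_ (total e 0 * const 1ℤ n)) (sym (ℤₚ.neg-distribʳ-* (+ 24) (eSum e 0 n)))) (sym (combine-expand e 0 n))))
        ; a₀ = cong (λ d → + suc d * 1ℤ) index-0
        ; t₀ = cong (λ k → shifts k (etaProduct (resolve tf)) 0) t-order
        ; W₀ = trans (cong (λ k → shifts k (etaProduct (resolve Wf)) 0) W-order) (etaProduct-0 (resolve Wf))
        ; Z₀ = cong (_+_ 1ℤ) (zSum-0 z 0)
        ; 0<m = m-pos
        }

      module Agreement (eu pa σs e₂ e₄ e₆ : List ℤ)
        (eu-agree : Agree eu euler) (pa-agree : Agree pa partitions) (σs-agree : Agree σs σ₁-series)
        (e₂-agree : Agree e₂ E₂-series) (e₄-agree : Agree e₄ E₄-series) (e₆-agree : Agree e₆ E₆-series) where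
        open Initial eu pa σs e₂ e₄ e₆

        agree-- : ∀ xs ys {f g} → Agree xs f → Agree ys g → Agree (xs -ᴸ ys) (f ⊖ g)
        agree-- xs ys {f} {g} p r = agree-cong (xs +ᴸ scaleᴸ -1ℤ ys) (λ n → cong (_+_ (f n)) (ℤₚ.-1*i≡-i (g n)))
          (agree-+ xs (scaleᴸ -1ℤ ys) p (agree-scale -1ℤ ys r))

        agree-P : ∀ d r → Agree (Pᴸ d r) (eulerPower d r)
        agree-P d (+ k)    = agree-power K (gapᴸ K d 0 eu) k (agree-gap K d 0 eu eu-agree)
        agree-P d -[1+ k ] = agree-power K (gapᴸ K d 0 pa) (suc k) (agree-gap K d 0 pa pa-agree)

        agree-etaProduct : ∀ fs → Agree (etaProductᴸ fs) (etaProduct fs)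
        agree-etaProduct []             = agree-segment K (const 1ℤ)
        agree-etaProduct ((d , r) ∷ fs) = agree-* (Pᴸ d r) (etaProductᴸ fs) (agree-P d r) (agree-etaProduct fs)

        agree-etaQuotient : ∀ fs → Agree (etaQuotientᴸ fs) (etaQuotient fs)
        agree-etaQuotient fs = agree-shift (order fs) (etaProductᴸ (resolve fs)) (agree-etaProduct (resolve fs))

        agree-zSum : ∀ xs i → Agree (zSumᴸ xs i) (zSum xs i)
        agree-zSum []       i = agree-segment K zeros
        agree-zSum (x ∷ xs) i = agree-+ (scaleᴸ x (gapᴸ K (index i) 0 σs)) (zSumᴸ xs (suc i))
          (agree-scale x (gapᴸ K (index i) 0 σs) (agree-gap K (index i) 0 σs σs-agree)) (agree-zSum xs (suc i))

        agree-at : ∀ k d xs {f} → Agree xs f → Agree (atᴸ k d xs) (at k d f)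
        agree-at zero    d xs h = agree-gap K d 0 xs h
        agree-at (suc k) d xs h = agree-scale (+ suc d) (atᴸ k d xs) (agree-at k d xs h)

        module BaseAgreement (t W Z : List ℤ) (t-agree : Agree t (etaQuotient tf)) (W-agree : Agree W (etaQuotient Wf))
          (Z-agree : Agree Z Z-series) where
          open Base t W Z

          agree-base : ∀ i → Agree (baseᴸ i) (base i)
          agree-base 0 = agree-at 1 (index 0) e₂ e₂-agree
          agree-base 1 = t-agree
          agree-base 2 = W-agree
          agree-base 3 = Z-agree
          agree-base (suc (suc (suc (suc _)))) = tt

          agree-approx : ∀ k x → Agree (approxᴸ k x) (approx k x)
          agree-approx k x = agree-eval K baseᴸ base (table# k x) agree-base

          Vanish : Series → Set
          Vanish s = ∀ n → n ℕ.< K → s n ≡ 0ℤ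

          zero-sound : ∀ xs {s} → Agree xs s → okZero xs ≡ true → Vanish s
          zero-sound xs h ok n n<K = vanishing-sound K xs h ok n n<K

          formErrors-vanish : ∀ gs j → (∀ k → k ℕ.< length gs → F (j ℕ.+ k) ≡ etaQuotient (Form.factors (nth (form 1ℤ [] ([] , [])) gs k))) →
            formOk gs ≡ true → All Vanish (formErrors gs j)
          formErrors-vanish []       j h ok = []
          formErrors-vanish (g ∷ gs) j h ok =
            zero-sound xs (agree-- _ (approxᴸ 1 (Form.table g))
                (agree-scale (Form.multiple g) (etaQuotientᴸ (Form.factors g)) (subst (Agree (etaQuotientᴸ (Form.factors g))) F-j (agree-etaQuotient (Form.factors g))))
                (agree-approx 1 (Form.table g)))
              (proj₁ (∧-split (okZero xs) (formOk gs) ok))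
            ∷ formErrors-vanish gs (suc j) (λ k k< → trans (cong F (sym (ℕₚ.+-suc j k))) (h (suc k) (s≤s k<)))
                (proj₂ (∧-split (okZero xs) (formOk gs) ok))
            where
            xs : List ℤ
            xs = scaleᴸ (Form.multiple g) (etaQuotientᴸ (Form.factors g)) -ᴸ approxᴸ 1 (Form.table g)
            F-j : etaQuotient (Form.factors g) ≡ F j
            F-j = sym (trans (cong F (sym (ℕₚ.+-identityʳ j))) (h 0 (s≤s z≤n)))

          tripleErrors-vanish : ∀ n i → tripleOk n i ≡ true → All Vanish (tripleErrors n i)
          tripleErrors-vanish zero    i ok = formErrors-vanish forms 0 (λ k k< → refl) ok
          tripleErrors-vanish (suc n) i ok =
              zero-sound xs (agree-- (atᴸ 1 (index i) e₂) (baseᴸ 0 +ᴸ approxᴸ 0 (tab as i)) (agree-at 1 (index i) e₂ e₂-agree)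
                (agree-+ (baseᴸ 0) (approxᴸ 0 (tab as i)) (agree-base 0) (agree-approx 0 (tab as i)))) (proj₁ ok₁)
            ∷ zero-sound ys (agree-- (atᴸ 2 (index i) e₄) (approxᴸ 1 (tab bs i)) (agree-at 2 (index i) e₄ e₄-agree) (agree-approx 1 (tab bs i))) (proj₁ ok₂)
            ∷ zero-sound zs (agree-- (atᴸ 3 (index i) e₆) (approxᴸ 2 (tab cs i)) (agree-at 3 (index i) e₆ e₆-agree) (agree-approx 2 (tab cs i))) (proj₁ ok₃)
            ∷ tripleErrors-vanish n (suc i) (proj₂ ok₃)
            where
            xs ys zs : List ℤ
            xs = atᴸ 1 (index i) e₂ -ᴸ (baseᴸ 0 +ᴸ approxᴸ 0 (tab as i))
            ys = atᴸ 2 (index i) e₄ -ᴸ approxᴸ 1 (tab bs i)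
            zs = atᴸ 3 (index i) e₆ -ᴸ approxᴸ 2 (tab cs i)
            ok₁ = ∧-split (okZero xs) (okZero ys ∧ (okZero zs ∧ tripleOk n (suc i))) ok
            ok₂ = ∧-split (okZero ys) (okZero zs ∧ tripleOk n (suc i)) (proj₂ ok₁)
            ok₃ = ∧-split (okZero zs) (tripleOk n (suc i)) (proj₂ ok₂)

          errors-vanish : errorsOk ≡ true → All Vanish errors
          errors-vanish ok =
              zero-sound xs (agree-- (Z *ᴸ Z) (evalᴸ K baseᴸ W²f) (agree-* Z Z Z-agree Z-agree) (agree-eval K baseᴸ base W²f agree-base))
                (proj₁ (∧-split (okZero xs) (tripleOk m 0) ok))
            ∷ tripleErrors-vanish m 0 (proj₂ (∧-split (okZero xs) (tripleOk m 0) ok))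
            where
            xs : List ℤ
            xs = Z *ᴸ Z -ᴸ evalᴸ K baseᴸ W²f

        errors-vanish : ok ≡ true → All (λ s → ∀ n → n ℕ.< K → s n ≡ 0ℤ) errors
        errors-vanish = BaseAgreement.errors-vanish (etaQuotientᴸ tf) (etaQuotientᴸ Wf) (segment K (const 1ℤ) +ᴸ zSumᴸ z 0)
          (agree-etaQuotient tf) (agree-etaQuotient Wf)
          (agree-+ (segment K (const 1ℤ)) (zSumᴸ z 0) (agree-segment K (const 1ℤ)) (agree-zSum z 0))

      errors-initial : All (λ s → ∀ n → n ℕ.< K → s n ≡ 0ℤ) errors
      errors-initial = Agreement.errors-vanish eu (inverseᴸ K eu) (segment K σ₁-series) e₂ e₄ (e₂ *ᴸ e₄ +ᴸ scaleᴸ -1ℤ (scaleᴸ (+ 3) (θᴸ 0 e₄)))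
        (agree-euler K) (agree-inverse K eu euler (agree-euler K)) (agree-segment K σ₁-series) (agree-segment K E₂-series) (agree-segment K E₄-series)
        (agree-cong (e₂ *ᴸ e₄ +ᴸ scaleᴸ -1ℤ (scaleᴸ (+ 3) (θᴸ 0 e₄))) (λ n → cong (_+_ ((E₂-series ⊛ E₄-series) n)) (ℤₚ.-1*i≡-i _))
          (agree-+ (e₂ *ᴸ e₄) (scaleᴸ -1ℤ (scaleᴸ (+ 3) (θᴸ 0 e₄))) (agree-* e₂ e₄ (agree-segment K E₂-series) (agree-segment K E₄-series))
            (agree-scale -1ℤ (scaleᴸ (+ 3) (θᴸ 0 e₄)) (agree-scale (+ 3) (θᴸ 0 e₄) (agree-θ 0 e₄ (agree-segment K E₄-series))))))
        initial
        where
        eu e₂ e₄ : List ℤ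
        eu = eulerᴸ K
        e₂ = segment K E₂-series
        e₄ = segment K E₄-series

      open Soundness laws checked errors-initial public

  record Relation : Set where
    field
      left right  : ℕ
      coefficient : ℤ
      bTerms      : List (ℕ × ℤ)
      formTerms   : List (ℕ × ℤ)

  module Relations (L : Level) where
    open Level L
    open Engine L
    open Instance L

    module _ (R : Relation) where
      open Relation R

      bPoly formPoly : List (ℕ × ℤ) → Poly
      bPoly []             = con 0ℤ
      bPoly ((i , x) ∷ xs) = scale x (B i) ⊞ bPoly xs
      formPoly []             = con 0ℤ
      formPoly ((j , x) ∷ xs) = scale x (var (5 ℕ.+ (triple m ℕ.+ j)) ⊞ table# 1 (Form.table (formAt j))) ⊞ formPoly xs

      bSeries formSeries : List (ℕ × ℤ) → Series
      bSeries []             = zeros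
      bSeries ((i , x) ∷ xs) = (λ n → x * b i n) ⊕ bSeries xs
      formSeries []             = zeros
      formSeries ((j , x) ∷ xs) = (λ n → x * (Form.multiple (formAt j) * F j n)) ⊕ formSeries xs

      relationPoly : Poly
      relationPoly = (scale coefficient ((A 0 ⊟ A left) ⊠ (A 0 ⊟ A right)) ⊞ bPoly bTerms) ⊞ formPoly formTerms

      relationSeries : Series
      relationSeries = ((λ n → coefficient * ((a 0 ⊖ a left) ⊛ (a 0 ⊖ a right)) n) ⊕ bSeries bTerms) ⊕ formSeries formTerms

      indices : Bool
      indices = (left <ᵇ m) ∧ ((right <ᵇ m) ∧ (below bTerms ∧ all (λ x → proj₁ x <ᵇ length forms) formTerms))

      module _ (coherent : Coherent) (ok : indices ≡ true) (relation-ok : vanishes relationPoly ≡ true) where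
        open Coherent coherent

        private
          ok₁ = ∧-split (left <ᵇ m) ((right <ᵇ m) ∧ (below bTerms ∧ all (λ x → proj₁ x <ᵇ length forms) formTerms)) ok
          ok₂ = ∧-split (right <ᵇ m) (below bTerms ∧ all (λ x → proj₁ x <ᵇ length forms) formTerms) (proj₂ ok₁)
          ok₃ = ∧-split (below bTerms) (all (λ x → proj₁ x <ᵇ length forms) formTerms) (proj₂ ok₂)

        bPoly-sound : ∀ xs → below xs ≡ true → ⟦ bPoly xs ⟧ (env coherent) ≗ bSeries xs
        bPoly-sound [] _ n = const-0 n
        bPoly-sound ((i , x) ∷ xs) below-xs n = trans (⊞-sound (scale x (B i)) (bPoly xs) (env coherent) n)
          (cong₂ _+_ (trans (scale-sound x (B i) (env coherent) n) (cong (x *_) (B-sound coherent i (<ᵇ-true i m (proj₁ split)) n)))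
            (bPoly-sound xs (proj₂ split) n))
          where split = ∧-split (i <ᵇ m) (below xs) below-xs

        formErrors-nth : ∀ gs i j d → j ℕ.< length gs →
          nth zeros (formErrors gs i) j ≡ (λ n → Form.multiple (nth d gs j) * F (i ℕ.+ j) n) ⊖ approx 1 (Form.table (nth d gs j))
        formErrors-nth (g ∷ gs) i zero    d _  = cong (λ e → (λ n → Form.multiple g * F e n) ⊖ approx 1 (Form.table g)) (sym (ℕₚ.+-identityʳ i))
        formErrors-nth (g ∷ gs) i (suc j) d j< = trans (formErrors-nth gs (suc i) j d (ℕ.s≤s⁻¹ j<))
          (cong (λ e → (λ n → Form.multiple (nth d gs j) * F e n) ⊖ approx 1 (Form.table (nth d gs j))) (sym (ℕₚ.+-suc i j)))

        formPoly-sound : ∀ xs → all (λ x → proj₁ x <ᵇ length forms) xs ≡ true → ⟦ formPoly xs ⟧ (env coherent) ≗ formSeries xs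
        formPoly-sound [] _ n = const-0 n
        formPoly-sound ((j , x) ∷ xs) below-xs n = trans (⊞-sound (scale x hat) (formPoly xs) (env coherent) n)
          (cong₂ _+_ (trans (scale-sound x hat (env coherent) n) (cong (x *_)
              (hat-sound coherent (5 ℕ.+ (triple m ℕ.+ j)) 1 (Form.table g) (λ n → Form.multiple g * F j n) n
                (cong (λ s → s n) (trans (form-at coherent m 0 j) (formErrors-nth forms 0 j (form 1ℤ [] ([] , [])) (<ᵇ-true j (length forms) (proj₁ split))))))))
            (formPoly-sound xs (proj₂ split) n))
          where
          g = formAt j
          hat = var (5 ℕ.+ (triple m ℕ.+ j)) ⊞ table# 1 (Form.table g)
          split = ∧-split (j <ᵇ length forms) (all (λ x → proj₁ x <ᵇ length forms) xs) below-xs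

        difference : ∀ i → i ℕ.< m → ⟦ A 0 ⊟ A i ⟧ (env coherent) ≗ a 0 ⊖ a i
        difference i i<m n = trans (⊟-sound coherent (A 0) (A i) (env coherent) n)
          (cong₂ _-_ (A-sound coherent 0 m-pos n) (A-sound coherent i i<m n))

        relation-holds : relationSeries ≗ zeros
        relation-holds n = trans (sym (trans
          (⊞-sound (scale coefficient ((A 0 ⊟ A left) ⊠ (A 0 ⊟ A right)) ⊞ bPoly bTerms) (formPoly formTerms) (env coherent) n)
          (cong₂ _+_
            (trans (⊞-sound (scale coefficient ((A 0 ⊟ A left) ⊠ (A 0 ⊟ A right))) (bPoly bTerms) (env coherent) n)
              (cong₂ _+_ (trans (scale-sound coefficient ((A 0 ⊟ A left) ⊠ (A 0 ⊟ A right)) (env coherent) n)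
                  (cong (coefficient *_) (product-sound coherent (A 0 ⊟ A left) (A 0 ⊟ A right)
                    (difference left (<ᵇ-true left m (proj₁ ok₁))) (difference right (<ᵇ-true right m (proj₁ ok₂))) n)))
                (bPoly-sound bTerms (proj₁ ok₃) n)))
            (formPoly-sound formTerms (proj₂ ok₃) n))))
          (vanishes-sound coherent relationPoly relation-ok n)

module Divisors where
  import Data.Integer.Properties as ℤₚ
  import Data.Nat.Properties as ℕₚ
  open import Data.Empty using (⊥-elim)
  open import Data.Integer.Base as ℤ using (ℤ; +_; 0ℤ; 1ℤ; ∣_∣)
  open import Data.List.Base using ([]; _∷_; _∷ʳ_; map; filter; upTo; applyUpTo)
  open import Data.List.Properties using (filter-++; filter-accept; filter-reject; map-++; upTo-∷ʳ)
  open import Data.Nat.Base as ℕ using (ℕ; zero; suc; _≤_; _<_; z≤n; s≤s)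
  open import Data.Nat.Divisibility using (_∣_; _∣?_; divides; 1∣_)
  open import Data.Nat.ListAction using (sum)
  open import Data.Nat.ListAction.Properties using (sum-++)
  open import Data.Sum.Base using (inj₁; inj₂)
  open import Defs using (σ)
  open import Function.Base using (_∘_)
  open import Relation.Binary.PropositionalEquality
  open import Relation.Nullary using (¬_; yes; no)
  open PowerSeries

  gap-hit : ∀ d k f i → gap d k f (k ℕ.+ i ℕ.* suc d) ≡ f i
  gap-hit d zero    f zero    = refl
  gap-hit d zero    f (suc i) = gap-hit d d (tail f) i
  gap-hit d (suc k) f i       = gap-hit d k f i

  gap-miss : ∀ d k f n → (∀ i → n ≢ k ℕ.+ i ℕ.* suc d) → gap d k f n ≡ 0ℤ
  gap-miss d zero    f zero    miss = ⊥-elim (miss 0 refl)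
  gap-miss d zero    f (suc n) miss = gap-miss d d (tail f) n (λ i e → miss (suc i) (cong suc e))
  gap-miss d (suc k) f zero    miss = refl
  gap-miss d (suc k) f (suc n) miss = gap-miss d k f n (λ i e → miss i (cong suc e))

  V-divides : ∀ d n → suc d ∣ suc n → V d positive (suc n) ≡ 1ℤ
  V-divides d n (divides (suc i) e) = trans (cong (V d positive) e) (gap-hit d 0 positive (suc i))

  V-not-divides : ∀ d n → ¬ (suc d ∣ n) → V d positive n ≡ 0ℤ
  V-not-divides d n ∤ = gap-miss d 0 positive n (λ i e → ∤ (divides i e))

  divisors-sum : ∀ k n N →
    + sum (map (ℕ._^ k) (filter (_∣? suc n) (map suc (upTo N)))) ≡ divisorSum (λ j → + (suc j ℕ.^ k)) N (suc n)
  divisors-sum k n zero    = refl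
  divisors-sum k n (suc N) = begin
    + S (map suc (upTo (suc N)))
      ≡⟨ cong (λ xs → + S xs) (trans (cong (map suc) (sym (upTo-∷ʳ N))) (map-++ suc (upTo N) (N ∷ []))) ⟩
    + S (map suc (upTo N) ∷ʳ suc N)
      ≡⟨ cong +_ (trans (cong (sum ∘ map (ℕ._^ k)) (filter-++ (_∣? suc n) (map suc (upTo N)) (suc N ∷ [])))
           (trans (cong sum (map-++ (ℕ._^ k) (filter (_∣? suc n) (map suc (upTo N))) (filter (_∣? suc n) (suc N ∷ []))))
             (sum-++ (map (ℕ._^ k) (filter (_∣? suc n) (map suc (upTo N)))) (map (ℕ._^ k) (filter (_∣? suc n) (suc N ∷ [])))))) ⟩
    + (S (map suc (upTo N)) ℕ.+ S (suc N ∷ []))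
      ≡⟨ trans (ℤₚ.pos-+ (S (map suc (upTo N))) (S (suc N ∷ []))) (cong₂ ℤ._+_ (divisors-sum k n N) last) ⟩
    divisorSum (λ j → + (suc j ℕ.^ k)) (suc N) (suc n) ∎
    where
    open ≡-Reasoning
    S : _ → ℕ
    S xs = sum (map (ℕ._^ k) (filter (_∣? suc n) xs))
    last : + S (suc N ∷ []) ≡ + (suc N ℕ.^ k) ℤ.* V N positive (suc n)
    last with suc N ∣? suc n
    ... | yes d = trans (cong (λ xs → + sum (map (ℕ._^ k) xs)) (filter-accept (_∣? suc n) {xs = []} d))
          (trans (cong +_ (ℕₚ.+-identityʳ (suc N ℕ.^ k))) (sym (trans (cong (ℤ._*_ (+ (suc N ℕ.^ k))) (V-divides N n d)) (ℤₚ.*-identityʳ (+ (suc N ℕ.^ k))))))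
    ... | no ∤  = trans (cong (λ xs → + sum (map (ℕ._^ k) xs)) (filter-reject (_∣? suc n) {xs = []} ∤))
          (sym (trans (cong (ℤ._*_ (+ (suc N ℕ.^ k))) (V-not-divides N (suc n) ∤)) (ℤₚ.*-zeroʳ (+ (suc N ℕ.^ k)))))

  σ-divisorSeries : ∀ k n → + σ k (suc n) ≡ divisorSeries (λ j → + (suc j ℕ.^ k)) (suc n)
  σ-divisorSeries k n = divisors-sum k n (suc n)

  divisorSum-cong : ∀ {w v} → (∀ j → w j ≡ v j) → ∀ N n → divisorSum w N n ≡ divisorSum v N n
  divisorSum-cong h N n = sumTo-cong N (λ j _ → cong (ℤ._* V j positive n) (h j))

  -- The weights of E₄ are kept in the form of a product.
  cube : ℕ → ℤ
  cube j = successor j ℤ.* (successor j ℤ.* successor j)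

  σ₁-coefficient : ∀ n → + σ 1 (suc n) ≡ σ₁-series (suc n)
  σ₁-coefficient n = trans (σ-divisorSeries 1 n) (divisorSum-cong (λ j → cong +_ (ℕₚ.*-identityʳ (suc j))) (suc n) (suc n))

  σ₃-coefficient : ∀ n → + σ 3 (suc n) ≡ divisorSeries cube (suc n)
  σ₃-coefficient n = trans (σ-divisorSeries 3 n) (divisorSum-cong
    (λ j → trans (cong (λ x → + (suc j ℕ.* (suc j ℕ.* x))) (ℕₚ.*-identityʳ (suc j)))
      (trans (ℤₚ.pos-* (suc j) (suc j ℕ.* suc j)) (cong (ℤ._*_ (successor j)) (ℤₚ.pos-* (suc j) (suc j))))) (suc n) (suc n))




  ∣gap∣≤1 : ∀ d k f → (∀ i → ∣ f i ∣ ≤ 1) → ∀ n → ∣ gap d k f n ∣ ≤ 1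
  ∣gap∣≤1 d zero    f h zero    = h 0
  ∣gap∣≤1 d zero    f h (suc n) = ∣gap∣≤1 d d (tail f) (h ∘ suc) n
  ∣gap∣≤1 d (suc k) f h zero    = z≤n
  ∣gap∣≤1 d (suc k) f h (suc n) = ∣gap∣≤1 d k f h n

  ∣positive∣≤1 : ∀ i → ∣ positive i ∣ ≤ 1
  ∣positive∣≤1 zero    = z≤n
  ∣positive∣≤1 (suc i) = ℕₚ.≤-refl

  ∣divisorSum∣ : ∀ w N n B → (∀ j → j < N → ∣ w j ∣ ≤ B) → ∣ divisorSum w N n ∣ ≤ N ℕ.* B
  ∣divisorSum∣ w zero    n B h = z≤n
  ∣divisorSum∣ w (suc N) n B h = ℕₚ.≤-trans (ℤₚ.∣i+j∣≤∣i∣+∣j∣ (divisorSum w N n) (w N ℤ.* V N positive n))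
    (ℕₚ.≤-trans (ℕₚ.+-mono-≤ (∣divisorSum∣ w N n B (λ j j< → h j (ℕₚ.m<n⇒m<1+n j<)))
      (ℕₚ.≤-trans (ℕₚ.≤-reflexive (ℤₚ.abs-* (w N) (V N positive n)))
        (ℕₚ.≤-trans (ℕₚ.*-mono-≤ (h N ℕₚ.≤-refl) (∣gap∣≤1 N 0 positive ∣positive∣≤1 n)) (ℕₚ.≤-reflexive (ℕₚ.*-identityʳ B)))))
      (ℕₚ.≤-reflexive (ℕₚ.+-comm (N ℕ.* B) B)))

  ∣divisorSum∣≤ : ∀ w N n B → (∀ j → j < n → ∣ w j ∣ ≤ B) → ∣ divisorSum w N n ∣ ≤ n ℕ.* B
  ∣divisorSum∣≤ w N n B h with ℕₚ.≤-total N n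
  ... | inj₁ N≤n = ℕₚ.≤-trans (∣divisorSum∣ w N n B (λ j j<N → h j (ℕₚ.<-≤-trans j<N N≤n))) (ℕₚ.*-monoˡ-≤ B N≤n)
  ... | inj₂ n≤N = ℕₚ.≤-trans (ℕₚ.≤-reflexive (cong ∣_∣ (divisorSum-≤ w n≤N))) (∣divisorSum∣ w n n B h)

  ∣σ₁∣≤ : ∀ N n → ∣ divisorSum successor N n ∣ ≤ n ℕ.* n
  ∣σ₁∣≤ N n = ∣divisorSum∣≤ successor N n n (λ j j<n → j<n)

  ∣σ₃∣≤ : ∀ n → ∣ divisorSeries cube n ∣ ≤ n ℕ.* (n ℕ.* (n ℕ.* n))
  ∣σ₃∣≤ n = ∣divisorSum∣≤ cube n n (n ℕ.* (n ℕ.* n)) (λ j j<n → ℕₚ.≤-trans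
    (ℕₚ.≤-reflexive (trans (ℤₚ.abs-* (successor j) (successor j ℤ.* successor j)) (cong (suc j ℕ.*_) (ℤₚ.abs-* (successor j) (successor j)))))
    (ℕₚ.*-mono-≤ j<n (ℕₚ.*-mono-≤ j<n j<n)))

  σ₁-0 : ∀ N → divisorSum successor N 0 ≡ 0ℤ
  σ₁-0 zero    = refl
  σ₁-0 (suc N) = trans (cong₂ ℤ._+_ (σ₁-0 N) (ℤₚ.*-zeroʳ (successor N))) refl

  σ₁-positive : ∀ n → 1 ≤ σ 1 (suc n)
  σ₁-positive n = ℕₚ.≤-trans (s≤s z≤n) (ℕₚ.≤-reflexive (sym (cong (sum ∘ map (ℕ._^ 1))
    (filter-accept (_∣? suc n) {1} {map suc (applyUpTo suc n)} (1∣ suc n)))))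

module Levels where
  open import Defs using (fromNat; fromNeg; ℕ-number; ℤ-number; ℤ-negative; tt)
  open import Data.List.Base using ([]; _∷_; replicate)
  open import Data.Nat.Base using (s≤s; z≤n)
  open import Data.Product.Base using (_,_)
  open import Relation.Binary.PropositionalEquality
  open PowerSeries

  level14 : Level
  level14 = record
    { δs = 1 ∷ 2 ∷ 7 ∷ 14 ∷ []
    ; Wf = (0 , 4) ∷ (1 , -2) ∷ (2 , 4) ∷ (3 , -2) ∷ []
    ; tf = (0 , -3) ∷ (1 , 3) ∷ (2 , -3) ∷ (3 , 3) ∷ []
    ; e = -6 ∷ 6 ∷ -6 ∷ 6 ∷ []
    ; z = 3 ∷ -6 ∷ 21 ∷ -42 ∷ []
    ; f = 1 ∷ 14 ∷ 61 ∷ 112 ∷ 64 ∷ []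
    ; as = ([] , [])
        ∷ (-3 ∷ 0 ∷ 24 ∷ [] , 4 ∷ [])
        ∷ (6 ∷ 48 ∷ 96 ∷ [] , [])
        ∷ (9 ∷ 48 ∷ 72 ∷ [] , 4 ∷ []) ∷ []
    ; bs = (25 ∷ 320 ∷ 2080 ∷ 6400 ∷ 6400 ∷ [] , -24 ∷ 96 ∷ 768 ∷ [])
        ∷ (100 ∷ 800 ∷ 2080 ∷ 2560 ∷ 1600 ∷ [] , -96 ∷ -96 ∷ 192 ∷ [])
        ∷ (25 ∷ 320 ∷ 2080 ∷ 6400 ∷ 6400 ∷ [] , 24 ∷ -96 ∷ -768 ∷ [])
        ∷ (100 ∷ 800 ∷ 2080 ∷ 2560 ∷ 1600 ∷ [] , 96 ∷ 96 ∷ -192 ∷ []) ∷ []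
    ; cs = (-171 ∷ -2304 ∷ -18792 ∷ -132480 ∷ -541440 ∷ -1050624 ∷ -700416 ∷ [] , 172 ∷ 608 ∷ -7616 ∷ -55040 ∷ -88064 ∷ [])
        ∷ (-1368 ∷ -16416 ∷ -67680 ∷ -132480 ∷ -150336 ∷ -147456 ∷ -87552 ∷ [] , 1376 ∷ 6880 ∷ 7616 ∷ -4864 ∷ -11008 ∷ [])
        ∷ (171 ∷ 2304 ∷ 18792 ∷ 132480 ∷ 541440 ∷ 1050624 ∷ 700416 ∷ [] , 172 ∷ 608 ∷ -7616 ∷ -55040 ∷ -88064 ∷ [])
        ∷ (1368 ∷ 16416 ∷ 67680 ∷ 132480 ∷ 150336 ∷ 147456 ∷ 87552 ∷ [] , 1376 ∷ 6880 ∷ 7616 ∷ -4864 ∷ -11008 ∷ []) ∷ []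
    ; forms = form 1 ((0 , 5) ∷ (1 , -1) ∷ (2 , 5) ∷ (3 , -1) ∷ []) (0 ∷ 1 ∷ [] , [])
        ∷ form 1 ((0 , 2) ∷ (1 , 2) ∷ (2 , 2) ∷ (3 , 2) ∷ []) (0 ∷ 0 ∷ 1 ∷ [] , [])
        ∷ form 2 ((0 , -2) ∷ (1 , 6) ∷ (2 , 6) ∷ (3 , -2) ∷ []) (0 ∷ 1 ∷ 7 ∷ 8 ∷ [] , 0 ∷ 1 ∷ [])
        ∷ form 2 ((0 , 6) ∷ (1 , -2) ∷ (2 , -2) ∷ (3 , 6) ∷ []) (0 ∷ 1 ∷ 7 ∷ 8 ∷ [] , 0 ∷ -1 ∷ []) ∷ []
    ; weights = 600 ∷ 1 ∷ 7394 ∷ 48103 ∷ 965 ∷ 36253 ∷ 364093 ∷ 200 ∷ 9013 ∷ 98542 ∷ 1030 ∷ 236796 ∷ 5851653 ∷ 585165300 ∷ 585165300 ∷ 585165300 ∷ 585165300 ∷ []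
    ; K = 16 }

  coherent14 : Instance.Coherent level14
  coherent14 = record
    { checked  = record { K-pos = refl ; weights-pos = refl ; tf-below = refl ; Wf-below = refl ; forms-below = refl ; e-length = refl ; rows-ok = refl }
    ; m-pos = s≤s z≤n ; index-0 = refl ; t-order = refl ; t-degree = refl ; W-order = refl ; W-degree = refl
    ; degrees = refl ; z-e = refl ; e-total = refl ; initial = refl }

  relation-1-7 : Relation
  relation-1-7 = record
    { left = 2 ; right = 2 ; coefficient = 25
    ; bTerms = (0 , -18) ∷ (2 , -18) ∷ []
    ; formTerms = (0 , -2880) ∷ (1 , -11520) ∷ [] }

  holds-1-7 : Relations.relationSeries level14 relation-1-7 ≗ zeros
  holds-1-7 = Relations.relation-holds level14 relation-1-7 coherent14 refl refl

  relation-2-7 : Relation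
  relation-2-7 = record
    { left = 1 ; right = 2 ; coefficient = 250
    ; bTerms = (0 , -129) ∷ (1 , 86) ∷ (2 , 21) ∷ (3 , -14) ∷ []
    ; formTerms = (0 , -14400) ∷ (2 , 1680) ∷ (1 , -80640) ∷ (3 , 25680) ∷ [] }

  holds-2-7 : Relations.relationSeries level14 relation-2-7 ≗ zeros
  holds-2-7 = Relations.relation-holds level14 relation-2-7 coherent14 refl refl

  relation-1-2∙7 : Relation
  relation-1-2∙7 = record
    { left = 3 ; right = 3 ; coefficient = 125
    ; bTerms = (0 , -111) ∷ (1 , 14) ∷ (2 , 14) ∷ (3 , -111) ∷ []
    ; formTerms = (2 , -25680) ∷ (1 , 23040) ∷ (3 , -1680) ∷ [] }

  holds-1-2∙7 : Relations.relationSeries level14 relation-1-2∙7 ≗ zeros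
  holds-1-2∙7 = Relations.relation-holds level14 relation-1-2∙7 coherent14 refl refl

  level22 : Level
  level22 = record
    { δs = 1 ∷ 2 ∷ 11 ∷ 22 ∷ []
    ; Wf = (0 , 4) ∷ (1 , -2) ∷ (2 , 4) ∷ (3 , -2) ∷ []
    ; tf = (0 , -2) ∷ (1 , 2) ∷ (2 , -2) ∷ (3 , 2) ∷ []
    ; e = -4 ∷ 4 ∷ -4 ∷ 4 ∷ []
    ; z = 2 ∷ -4 ∷ 22 ∷ -44 ∷ []
    ; f = 1 ∷ 12 ∷ 56 ∷ 148 ∷ 224 ∷ 192 ∷ 64 ∷ []
    ; as = ([] , [])
        ∷ (-5 ∷ -8 ∷ 16 ∷ 40 ∷ [] , 6 ∷ [])
        ∷ (10 ∷ 64 ∷ 160 ∷ 160 ∷ [] , [])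
        ∷ (15 ∷ 72 ∷ 144 ∷ 120 ∷ [] , 6 ∷ []) ∷ []
    ; bs = (61 ∷ 608 ∷ 3264 ∷ 11680 ∷ 25344 ∷ 31232 ∷ 15616 ∷ [] , -60 ∷ 0 ∷ 960 ∷ 1920 ∷ [])
        ∷ (244 ∷ 1952 ∷ 6336 ∷ 11680 ∷ 13056 ∷ 9728 ∷ 3904 ∷ [] , -240 ∷ -480 ∷ 0 ∷ 480 ∷ [])
        ∷ (61 ∷ 608 ∷ 3264 ∷ 11680 ∷ 25344 ∷ 31232 ∷ 15616 ∷ [] , 60 ∷ 0 ∷ -960 ∷ -1920 ∷ [])
        ∷ (244 ∷ 1952 ∷ 6336 ∷ 11680 ∷ 13056 ∷ 9728 ∷ 3904 ∷ [] , 240 ∷ 480 ∷ 0 ∷ -480 ∷ []) ∷ []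
    ; cs = (-665 ∷ -8232 ∷ -50736 ∷ -252728 ∷ -1075200 ∷ -3429888 ∷ -7449344 ∷ -10278912 ∷ -8171520 ∷ -2723840 ∷ [] , 666 ∷ 3744 ∷ 0 ∷ -70560 ∷ -290304 ∷ -511488 ∷ -340992 ∷ [])
        ∷ (-5320 ∷ -63840 ∷ -321216 ∷ -931168 ∷ -1714944 ∷ -2150400 ∷ -2021824 ∷ -1623552 ∷ -1053696 ∷ -340480 ∷ [] , 5328 ∷ 31968 ∷ 72576 ∷ 70560 ∷ 0 ∷ -59904 ∷ -42624 ∷ [])
        ∷ (665 ∷ 8232 ∷ 50736 ∷ 252728 ∷ 1075200 ∷ 3429888 ∷ 7449344 ∷ 10278912 ∷ 8171520 ∷ 2723840 ∷ [] , 666 ∷ 3744 ∷ 0 ∷ -70560 ∷ -290304 ∷ -511488 ∷ -340992 ∷ [])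
        ∷ (5320 ∷ 63840 ∷ 321216 ∷ 931168 ∷ 1714944 ∷ 2150400 ∷ 2021824 ∷ 1623552 ∷ 1053696 ∷ 340480 ∷ [] , 5328 ∷ 31968 ∷ 72576 ∷ 70560 ∷ 0 ∷ -59904 ∷ -42624 ∷ []) ∷ []
    ; forms = form 1 ((0 , 6) ∷ (1 , -2) ∷ (2 , 6) ∷ (3 , -2) ∷ []) (0 ∷ 1 ∷ [] , [])
        ∷ form 1 ((0 , 4) ∷ (2 , 4) ∷ []) (0 ∷ 0 ∷ 1 ∷ [] , [])
        ∷ form 1 ((0 , 2) ∷ (1 , 2) ∷ (2 , 2) ∷ (3 , 2) ∷ []) (0 ∷ 0 ∷ 0 ∷ 1 ∷ [] , [])
        ∷ form 1 ((1 , 4) ∷ (3 , 4) ∷ []) (0 ∷ 0 ∷ 0 ∷ 0 ∷ 1 ∷ [] , []) ∷ []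
    ; weights = 377 ∷ 1 ∷ 10537 ∷ 107897 ∷ 864 ∷ 53409 ∷ 842111 ∷ 200 ∷ 13028 ∷ 223537 ∷ 925 ∷ 319463 ∷ 12329307 ∷ 1232930700 ∷ 1232930700 ∷ 1232930700 ∷ 1232930700 ∷ []
    ; K = 25 }

  coherent22 : Instance.Coherent level22
  coherent22 = record
    { checked  = record { K-pos = refl ; weights-pos = refl ; tf-below = refl ; Wf-below = refl ; forms-below = refl ; e-length = refl ; rows-ok = refl }
    ; m-pos = s≤s z≤n ; index-0 = refl ; t-order = refl ; t-degree = refl ; W-order = refl ; W-degree = refl
    ; degrees = refl ; z-e = refl ; e-total = refl ; initial = refl }

  relation-1-11 : Relation
  relation-1-11 = record
    { left = 2 ; right = 2 ; coefficient = 61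
    ; bTerms = (0 , -50) ∷ (2 , -50) ∷ []
    ; formTerms = (0 , -17280) ∷ (1 , -118656) ∷ (2 , -276480) ∷ (3 , -276480) ∷ [] }

  holds-1-11 : Relations.relationSeries level22 relation-1-11 ≗ zeros
  holds-1-11 = Relations.relation-holds level22 relation-1-11 coherent22 refl refl

  level30 : Level
  level30 = record
    { δs = 1 ∷ 2 ∷ 3 ∷ 5 ∷ 6 ∷ 10 ∷ 15 ∷ 30 ∷ []
    ; Wf = (0 , 2) ∷ (1 , -4) ∷ (2 , -4) ∷ (3 , -4) ∷ (4 , 8) ∷ (5 , 8) ∷ (6 , 2) ∷ (7 , -4) ∷ []
    ; tf = (0 , -1) ∷ (1 , 2) ∷ (2 , 1) ∷ (3 , 1) ∷ (4 , -2) ∷ (5 , -2) ∷ (6 , -1) ∷ (7 , 2) ∷ []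
    ; e = -2 ∷ 3 ∷ 0 ∷ 0 ∷ -1 ∷ -1 ∷ -2 ∷ 3 ∷ []
    ; z = 1 ∷ -3 ∷ 0 ∷ 0 ∷ 3 ∷ 5 ∷ 15 ∷ -45 ∷ []
    ; f = 1 ∷ 6 ∷ 9 ∷ 6 ∷ -4 ∷ -6 ∷ 9 ∷ -6 ∷ 1 ∷ []
    ; as = ([] , [])
        ∷ (-7 ∷ -2 ∷ 31 ∷ 36 ∷ -1 ∷ -2 ∷ 1 ∷ [] , 8 ∷ 4 ∷ 4 ∷ [])
        ∷ (6 ∷ 24 ∷ 42 ∷ 0 ∷ 42 ∷ -24 ∷ 6 ∷ [] , -4 ∷ 16 ∷ 4 ∷ [])
        ∷ (8 ∷ 28 ∷ 40 ∷ 72 ∷ -40 ∷ 28 ∷ -8 ∷ [] , -4 ∷ 16 ∷ 4 ∷ [])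
        ∷ (5 ∷ 22 ∷ 43 ∷ 36 ∷ 11 ∷ -26 ∷ 13 ∷ [] , 0 ∷ 12 ∷ 12 ∷ [])
        ∷ (9 ∷ 30 ∷ 39 ∷ 36 ∷ -9 ∷ 30 ∷ -15 ∷ [] , 0 ∷ 12 ∷ 12 ∷ [])
        ∷ (14 ∷ 52 ∷ 82 ∷ 72 ∷ 2 ∷ 4 ∷ -2 ∷ [] , [])
        ∷ (21 ∷ 54 ∷ 51 ∷ 36 ∷ 3 ∷ 6 ∷ -3 ∷ [] , 8 ∷ 4 ∷ 4 ∷ []) ∷ []
    ; bs = (113 ∷ 572 ∷ 1666 ∷ 5068 ∷ 9663 ∷ 9784 ∷ 4220 ∷ -2056 ∷ 927 ∷ -1012 ∷ 34 ∷ -68 ∷ 17 ∷ [] , -112 ∷ 8 ∷ 1192 ∷ 2728 ∷ 2248 ∷ 1112 ∷ -8 ∷ -8 ∷ 8 ∷ [])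
        ∷ (452 ∷ 1808 ∷ 1384 ∷ -848 ∷ -228 ∷ 2656 ∷ 2960 ∷ -544 ∷ -612 ∷ 272 ∷ 136 ∷ -272 ∷ 68 ∷ [] , -448 ∷ -448 ∷ 928 ∷ 1312 ∷ 352 ∷ 128 ∷ -32 ∷ -32 ∷ 32 ∷ [])
        ∷ (17 ∷ 68 ∷ 34 ∷ 1012 ∷ 927 ∷ 2056 ∷ 4220 ∷ -9784 ∷ 9663 ∷ -5068 ∷ 1666 ∷ -572 ∷ 113 ∷ [] , -8 ∷ -8 ∷ 8 ∷ 1112 ∷ -2248 ∷ 2728 ∷ -1192 ∷ 8 ∷ 112 ∷ [])
        ∷ (17 ∷ 68 ∷ 34 ∷ 1012 ∷ 927 ∷ 2056 ∷ 4220 ∷ -9784 ∷ 9663 ∷ -5068 ∷ 1666 ∷ -572 ∷ 113 ∷ [] , 8 ∷ 8 ∷ -8 ∷ -1112 ∷ 2248 ∷ -2728 ∷ 1192 ∷ -8 ∷ -112 ∷ [])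
        ∷ (68 ∷ 272 ∷ 136 ∷ -272 ∷ -612 ∷ 544 ∷ 2960 ∷ -2656 ∷ -228 ∷ 848 ∷ 1384 ∷ -1808 ∷ 452 ∷ [] , -32 ∷ -32 ∷ 32 ∷ 128 ∷ -352 ∷ 1312 ∷ -928 ∷ -448 ∷ 448 ∷ [])
        ∷ (68 ∷ 272 ∷ 136 ∷ -272 ∷ -612 ∷ 544 ∷ 2960 ∷ -2656 ∷ -228 ∷ 848 ∷ 1384 ∷ -1808 ∷ 452 ∷ [] , 32 ∷ 32 ∷ -32 ∷ -128 ∷ 352 ∷ -1312 ∷ 928 ∷ 448 ∷ -448 ∷ [])
        ∷ (113 ∷ 572 ∷ 1666 ∷ 5068 ∷ 9663 ∷ 9784 ∷ 4220 ∷ -2056 ∷ 927 ∷ -1012 ∷ 34 ∷ -68 ∷ 17 ∷ [] , 112 ∷ -8 ∷ -1192 ∷ -2728 ∷ -2248 ∷ -1112 ∷ 8 ∷ 8 ∷ -8 ∷ [])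
        ∷ (452 ∷ 1808 ∷ 1384 ∷ -848 ∷ -228 ∷ 2656 ∷ 2960 ∷ -544 ∷ -612 ∷ 272 ∷ 136 ∷ -272 ∷ 68 ∷ [] , 448 ∷ 448 ∷ -928 ∷ -1312 ∷ -352 ∷ -128 ∷ 32 ∷ 32 ∷ -32 ∷ []) ∷ []
    ; cs = (-1687 ∷ -10374 ∷ -24759 ∷ -89264 ∷ -425460 ∷ -1246056 ∷ -2165324 ∷ -2180976 ∷ -1096410 ∷ -60228 ∷ 179886 ∷ 6384 ∷ 159404 ∷ 32088 ∷ 19236 ∷ -6608 ∷ 441 ∷ -294 ∷ 49 ∷ [] , 1688 ∷ 4812 ∷ -8820 ∷ -81368 ∷ -258224 ∷ -483132 ∷ -534284 ∷ -304720 ∷ -103528 ∷ 31956 ∷ -76 ∷ 7336 ∷ 0 ∷ -228 ∷ 76 ∷ [])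
        ∷ (-13496 ∷ -80976 ∷ -123480 ∷ 45920 ∷ 253344 ∷ 40992 ∷ -511168 ∷ -559776 ∷ -17808 ∷ 129024 ∷ -58800 ∷ -23520 ∷ 57568 ∷ 4704 ∷ -9408 ∷ 1568 ∷ 3528 ∷ -2352 ∷ 392 ∷ [] , 13504 ∷ 40512 ∷ -2016 ∷ -96544 ∷ -78016 ∷ -2400 ∷ -20512 ∷ -50816 ∷ -25856 ∷ 3648 ∷ -608 ∷ 4256 ∷ 0 ∷ -1824 ∷ 608 ∷ [])
        ∷ (-49 ∷ -294 ∷ -441 ∷ -6608 ∷ -19236 ∷ 32088 ∷ -159404 ∷ 6384 ∷ -179886 ∷ -60228 ∷ 1096410 ∷ -2180976 ∷ 2165324 ∷ -1246056 ∷ 425460 ∷ -89264 ∷ 24759 ∷ -10374 ∷ 1687 ∷ [] , 76 ∷ 228 ∷ 0 ∷ -7336 ∷ -76 ∷ -31956 ∷ -103528 ∷ 304720 ∷ -534284 ∷ 483132 ∷ -258224 ∷ 81368 ∷ -8820 ∷ -4812 ∷ 1688 ∷ [])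
        ∷ (49 ∷ 294 ∷ 441 ∷ 6608 ∷ 19236 ∷ -32088 ∷ 159404 ∷ -6384 ∷ 179886 ∷ 60228 ∷ -1096410 ∷ 2180976 ∷ -2165324 ∷ 1246056 ∷ -425460 ∷ 89264 ∷ -24759 ∷ 10374 ∷ -1687 ∷ [] , 76 ∷ 228 ∷ 0 ∷ -7336 ∷ -76 ∷ -31956 ∷ -103528 ∷ 304720 ∷ -534284 ∷ 483132 ∷ -258224 ∷ 81368 ∷ -8820 ∷ -4812 ∷ 1688 ∷ [])
        ∷ (-392 ∷ -2352 ∷ -3528 ∷ 1568 ∷ 9408 ∷ 4704 ∷ -57568 ∷ -23520 ∷ 58800 ∷ 129024 ∷ 17808 ∷ -559776 ∷ 511168 ∷ 40992 ∷ -253344 ∷ 45920 ∷ 123480 ∷ -80976 ∷ 13496 ∷ [] , 608 ∷ 1824 ∷ 0 ∷ -4256 ∷ -608 ∷ -3648 ∷ -25856 ∷ 50816 ∷ -20512 ∷ 2400 ∷ -78016 ∷ 96544 ∷ -2016 ∷ -40512 ∷ 13504 ∷ [])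
        ∷ (392 ∷ 2352 ∷ 3528 ∷ -1568 ∷ -9408 ∷ -4704 ∷ 57568 ∷ 23520 ∷ -58800 ∷ -129024 ∷ -17808 ∷ 559776 ∷ -511168 ∷ -40992 ∷ 253344 ∷ -45920 ∷ -123480 ∷ 80976 ∷ -13496 ∷ [] , 608 ∷ 1824 ∷ 0 ∷ -4256 ∷ -608 ∷ -3648 ∷ -25856 ∷ 50816 ∷ -20512 ∷ 2400 ∷ -78016 ∷ 96544 ∷ -2016 ∷ -40512 ∷ 13504 ∷ [])
        ∷ (1687 ∷ 10374 ∷ 24759 ∷ 89264 ∷ 425460 ∷ 1246056 ∷ 2165324 ∷ 2180976 ∷ 1096410 ∷ 60228 ∷ -179886 ∷ -6384 ∷ -159404 ∷ -32088 ∷ -19236 ∷ 6608 ∷ -441 ∷ 294 ∷ -49 ∷ [] , 1688 ∷ 4812 ∷ -8820 ∷ -81368 ∷ -258224 ∷ -483132 ∷ -534284 ∷ -304720 ∷ -103528 ∷ 31956 ∷ -76 ∷ 7336 ∷ 0 ∷ -228 ∷ 76 ∷ [])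
        ∷ (13496 ∷ 80976 ∷ 123480 ∷ -45920 ∷ -253344 ∷ -40992 ∷ 511168 ∷ 559776 ∷ 17808 ∷ -129024 ∷ 58800 ∷ 23520 ∷ -57568 ∷ -4704 ∷ 9408 ∷ -1568 ∷ -3528 ∷ 2352 ∷ -392 ∷ [] , 13504 ∷ 40512 ∷ -2016 ∷ -96544 ∷ -78016 ∷ -2400 ∷ -20512 ∷ -50816 ∷ -25856 ∷ 3648 ∷ -608 ∷ 4256 ∷ 0 ∷ -1824 ∷ 608 ∷ []) ∷ []
    ; forms = form 2 ((0 , 4) ∷ (3 , 4) ∷ []) (0 ∷ 1 ∷ -1 ∷ 3 ∷ 20 ∷ -14 ∷ -38 ∷ 14 ∷ 20 ∷ -3 ∷ -1 ∷ -1 ∷ [] , 0 ∷ 1 ∷ -4 ∷ -3 ∷ 8 ∷ 3 ∷ -4 ∷ -1 ∷ [])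
        ∷ form 2 ((0 , 2) ∷ (1 , 2) ∷ (2 , 2) ∷ (4 , 2) ∷ []) (0 ∷ 1 ∷ 1 ∷ -7 ∷ 0 ∷ 32 ∷ -2 ∷ -32 ∷ 0 ∷ 7 ∷ 1 ∷ -1 ∷ [] , 0 ∷ 1 ∷ -2 ∷ -1 ∷ 0 ∷ -1 ∷ 2 ∷ 1 ∷ [])
        ∷ form 2 ((0 , -2) ∷ (1 , 8) ∷ (3 , 2) ∷ []) (0 ∷ 1 ∷ 5 ∷ 1 ∷ -14 ∷ -7 ∷ 5 ∷ 19 ∷ 4 ∷ -14 ∷ [] , 0 ∷ 1 ∷ 2 ∷ -5 ∷ -2 ∷ 4 ∷ [])
        ∷ form 10 ((0 , 2) ∷ (3 , -2) ∷ (5 , 8) ∷ []) (0 ∷ 0 ∷ 0 ∷ 14 ∷ 4 ∷ -19 ∷ 5 ∷ 7 ∷ -14 ∷ -1 ∷ 5 ∷ -1 ∷ [] , 0 ∷ 0 ∷ 0 ∷ -4 ∷ -2 ∷ 5 ∷ 2 ∷ -1 ∷ [])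
        ∷ form 1 ((0 , 11) ∷ (1 , -5) ∷ (2 , -5) ∷ (3 , -5) ∷ (4 , 3) ∷ (5 , 3) ∷ (6 , 11) ∷ (7 , -5) ∷ []) (0 ∷ 1 ∷ -8 ∷ 27 ∷ -48 ∷ 42 ∷ 0 ∷ -42 ∷ 48 ∷ -27 ∷ 8 ∷ -1 ∷ [] , [])
        ∷ form 18 ((0 , 2) ∷ (1 , -3) ∷ (2 , -4) ∷ (3 , -3) ∷ (4 , 9) ∷ (5 , 4) ∷ (6 , 7) ∷ (7 , -4) ∷ []) (0 ∷ -1 ∷ 13 ∷ -4 ∷ -13 ∷ 10 ∷ -5 ∷ -4 ∷ 5 ∷ -1 ∷ [] , 0 ∷ 1 ∷ 2 ∷ -2 ∷ -2 ∷ 1 ∷ [])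
        ∷ form 2 ((0 , 4) ∷ (1 , -3) ∷ (2 , -2) ∷ (3 , 2) ∷ (4 , 5) ∷ (5 , 1) ∷ (6 , 0) ∷ (7 , 1) ∷ []) (0 ∷ 1 ∷ 3 ∷ 0 ∷ -9 ∷ -2 ∷ 9 ∷ 0 ∷ -3 ∷ 1 ∷ [] , 0 ∷ -1 ∷ 0 ∷ 2 ∷ 0 ∷ -1 ∷ [])
        ∷ form 18 ((0 , 1) ∷ (1 , -2) ∷ (2 , -3) ∷ (3 , 2) ∷ (4 , 8) ∷ (5 , -1) ∷ (6 , 2) ∷ (7 , 1) ∷ []) (0 ∷ -1 ∷ -1 ∷ 6 ∷ 10 ∷ -14 ∷ -7 ∷ 17 ∷ -8 ∷ -7 ∷ 6 ∷ -1 ∷ [] , 0 ∷ 1 ∷ -2 ∷ 0 ∷ 5 ∷ -2 ∷ -3 ∷ 1 ∷ [])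
        ∷ form 10 ((0 , 2) ∷ (1 , -2) ∷ (2 , 0) ∷ (3 , -2) ∷ (4 , 2) ∷ (5 , 6) ∷ (6 , 0) ∷ (7 , 2) ∷ []) (0 ∷ 1 ∷ 3 ∷ -2 ∷ -3 ∷ 0 ∷ -3 ∷ 2 ∷ 3 ∷ -1 ∷ [] , 0 ∷ -1 ∷ 0 ∷ 2 ∷ 0 ∷ -1 ∷ [])
        ∷ form 2 ((0 , 1) ∷ (1 , 2) ∷ (2 , 4) ∷ (3 , 3) ∷ (4 , -3) ∷ (5 , -2) ∷ (6 , -4) ∷ (7 , 7) ∷ []) (0 ∷ 0 ∷ 0 ∷ -1 ∷ -5 ∷ -6 ∷ 1 ∷ 6 ∷ 5 ∷ 2 ∷ -1 ∷ -1 ∷ [] , 0 ∷ 0 ∷ 0 ∷ 1 ∷ 2 ∷ 0 ∷ -2 ∷ -1 ∷ [])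
        ∷ form 450 ((0 , 1) ∷ (1 , 0) ∷ (2 , -1) ∷ (3 , -3) ∷ (4 , 0) ∷ (5 , 2) ∷ (6 , 7) ∷ (7 , 2) ∷ []) (0 ∷ 1 ∷ -4 ∷ -2 ∷ 40 ∷ -103 ∷ 158 ∷ -47 ∷ -140 ∷ 142 ∷ -54 ∷ 9 ∷ [] , 0 ∷ -1 ∷ 7 ∷ -19 ∷ 20 ∷ 11 ∷ -27 ∷ 9 ∷ [])
        ∷ form 90 ((0 , 1) ∷ (1 , -1) ∷ (2 , -2) ∷ (3 , 1) ∷ (4 , 4) ∷ (5 , -1) ∷ (6 , 0) ∷ (7 , 6) ∷ []) (0 ∷ -1 ∷ -3 ∷ 6 ∷ 10 ∷ -9 ∷ -22 ∷ 24 ∷ 10 ∷ -20 ∷ 5 ∷ [] , 0 ∷ 1 ∷ 0 ∷ -6 ∷ 5 ∷ 5 ∷ -5 ∷ [])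
        ∷ form 450 ((0 , 0) ∷ (1 , 1) ∷ (2 , 0) ∷ (3 , 2) ∷ (4 , -1) ∷ (5 , -3) ∷ (6 , 2) ∷ (7 , 7) ∷ []) (0 ∷ 1 ∷ 1 ∷ -12 ∷ 5 ∷ 32 ∷ -17 ∷ -62 ∷ 95 ∷ 7 ∷ -84 ∷ 34 ∷ [] , 0 ∷ -1 ∷ 2 ∷ 6 ∷ -20 ∷ 11 ∷ 18 ∷ -16 ∷ [])
        ∷ form 90 ((0 , -2) ∷ (1 , 3) ∷ (2 , 5) ∷ (3 , 3) ∷ (4 , -4) ∷ (5 , -4) ∷ (6 , -4) ∷ (7 , 11) ∷ []) (0 ∷ 0 ∷ 1 ∷ 6 ∷ 6 ∷ -13 ∷ -21 ∷ -2 ∷ 24 ∷ 23 ∷ -10 ∷ -14 ∷ [] , 0 ∷ 0 ∷ -1 ∷ -3 ∷ 3 ∷ 7 ∷ -2 ∷ -4 ∷ [])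
        ∷ form 90 ((0 , 1) ∷ (1 , 0) ∷ (2 , 1) ∷ (3 , 3) ∷ (4 , 0) ∷ (5 , -4) ∷ (6 , -5) ∷ (7 , 12) ∷ []) (0 ∷ 1 ∷ 8 ∷ 18 ∷ 2 ∷ -35 ∷ -38 ∷ 17 ∷ 38 ∷ -6 ∷ -10 ∷ 5 ∷ [] , 0 ∷ -1 ∷ -5 ∷ -3 ∷ 10 ∷ 9 ∷ -5 ∷ -5 ∷ [])
        ∷ form 450 ((0 , 0) ∷ (1 , 1) ∷ (2 , 1) ∷ (3 , 2) ∷ (4 , -2) ∷ (5 , -3) ∷ (6 , -3) ∷ (7 , 12) ∷ []) (0 ∷ -1 ∷ -6 ∷ -3 ∷ 25 ∷ 18 ∷ -28 ∷ -48 ∷ 25 ∷ 43 ∷ -16 ∷ -9 ∷ [] , 0 ∷ 1 ∷ 3 ∷ -6 ∷ -10 ∷ 14 ∷ 7 ∷ -9 ∷ [])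
        ∷ form 90 ((0 , -1) ∷ (1 , 3) ∷ (2 , 1) ∷ (3 , 3) ∷ (4 , -1) ∷ (5 , -5) ∷ (6 , -7) ∷ (7 , 15) ∷ []) (0 ∷ 0 ∷ 0 ∷ 1 ∷ 8 ∷ 19 ∷ 10 ∷ -16 ∷ -28 ∷ 1 ∷ 10 ∷ -5 ∷ [] , 0 ∷ 0 ∷ 0 ∷ -1 ∷ -5 ∷ -4 ∷ 5 ∷ 5 ∷ [])
        ∷ form 450 ((0 , 0) ∷ (1 , 1) ∷ (2 , 2) ∷ (3 , 2) ∷ (4 , -3) ∷ (5 , -3) ∷ (6 , -8) ∷ (7 , 17) ∷ []) (0 ∷ 1 ∷ 11 ∷ 43 ∷ 70 ∷ 32 ∷ -52 ∷ -92 ∷ -20 ∷ 7 ∷ -9 ∷ 9 ∷ [] , 0 ∷ -1 ∷ -8 ∷ -19 ∷ -10 ∷ 11 ∷ 18 ∷ 9 ∷ [])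
        ∷ form 2 ((0 , -1) ∷ (1 , 5) ∷ (3 , 5) ∷ (5 , -1) ∷ []) (0 ∷ 1 ∷ 4 ∷ -1 ∷ -9 ∷ -5 ∷ -3 ∷ 17 ∷ 9 ∷ -12 ∷ -1 ∷ [] , 0 ∷ 1 ∷ 1 ∷ -4 ∷ 0 ∷ 3 ∷ -1 ∷ [])
        ∷ form 2 ((0 , 5) ∷ (1 , -1) ∷ (3 , -1) ∷ (5 , 5) ∷ []) (0 ∷ 0 ∷ 1 ∷ -12 ∷ -9 ∷ 17 ∷ 3 ∷ -5 ∷ 9 ∷ -1 ∷ -4 ∷ 1 ∷ [] , 0 ∷ 0 ∷ 1 ∷ 3 ∷ 0 ∷ -4 ∷ -1 ∷ 1 ∷ []) ∷ []
    ; weights = 289 ∷ 1 ∷ 14140 ∷ 198911 ∷ 848 ∷ 71906 ∷ 1569509 ∷ 580 ∷ 1448 ∷ 7327 ∷ 629 ∷ 1798 ∷ 14289 ∷ 200 ∷ 5899 ∷ 67179 ∷ 278 ∷ 7123 ∷ 124434 ∷ 436 ∷ 22854 ∷ 575351 ∷ 1113 ∷ 356038 ∷ 18554134 ∷ replicate 20 1855413400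
    ; K = 36 }

  coherent30 : Instance.Coherent level30
  coherent30 = record
    { checked  = record { K-pos = refl ; weights-pos = refl ; tf-below = refl ; Wf-below = refl ; forms-below = refl ; e-length = refl ; rows-ok = refl }
    ; m-pos = s≤s z≤n ; index-0 = refl ; t-order = refl ; t-degree = refl ; W-order = refl ; W-degree = refl
    ; degrees = refl ; z-e = refl ; e-total = refl ; initial = refl }

  relation-1-2 : Relation
  relation-1-2 = record
    { left = 1 ; right = 1 ; coefficient = 5
    ; bTerms = (0 , -1) ∷ (1 , -1) ∷ []
    ; formTerms = [] }

  holds-1-2 : Relations.relationSeries level30 relation-1-2 ≗ zeros
  holds-1-2 = Relations.relation-holds level30 relation-1-2 coherent30 refl refl

  relation-1-3 : Relation
  relation-1-3 = record
    { left = 2 ; right = 2 ; coefficient = 5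
    ; bTerms = (0 , -2) ∷ (2 , -2) ∷ []
    ; formTerms = [] }

  holds-1-3 : Relations.relationSeries level30 relation-1-3 ≗ zeros
  holds-1-3 = Relations.relation-holds level30 relation-1-3 coherent30 refl refl

  relation-1-5 : Relation
  relation-1-5 = record
    { left = 3 ; right = 3 ; coefficient = 13
    ; bTerms = (0 , -8) ∷ (3 , -8) ∷ []
    ; formTerms = (0 , -288) ∷ [] }

  holds-1-5 : Relations.relationSeries level30 relation-1-5 ≗ zeros
  holds-1-5 = Relations.relation-holds level30 relation-1-5 coherent30 refl refl

  relation-2-3 : Relation
  relation-2-3 = record
    { left = 1 ; right = 2 ; coefficient = 50
    ; bTerms = (0 , -21) ∷ (1 , 14) ∷ (2 , 9) ∷ (4 , -6) ∷ []
    ; formTerms = (1 , 720) ∷ [] }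

  holds-2-3 : Relations.relationSeries level30 relation-2-3 ≗ zeros
  holds-2-3 = Relations.relation-holds level30 relation-2-3 coherent30 refl refl

  relation-2-5 : Relation
  relation-2-5 = record
    { left = 1 ; right = 3 ; coefficient = 130
    ; bTerms = (0 , -63) ∷ (1 , 42) ∷ (3 , 15) ∷ (5 , -10) ∷ []
    ; formTerms = (2 , -240) ∷ (3 , 6000) ∷ [] }

  holds-2-5 : Relations.relationSeries level30 relation-2-5 ≗ zeros
  holds-2-5 = Relations.relation-holds level30 relation-2-5 coherent30 refl refl

  relation-3-5 : Relation
  relation-3-5 = record
    { left = 2 ; right = 3 ; coefficient = 1300
    ; bTerms = (0 , -735) ∷ (2 , 315) ∷ (3 , 175) ∷ (6 , -75) ∷ []
    ; formTerms = (4 , -10800) ∷ (5 , 8800) ∷ (6 , 118800) ∷ (7 , 32400) ∷ (8 , -114480) ∷ (9 , -1663200) ∷ (10 , -2240) ∷ (11 , -92800) ∷ (12 , -32352) ∷ (13 , 130800) ∷ (14 , 28080) ∷ (15 , -35264) ∷ (16 , -240000) ∷ (17 , -70272) ∷ [] }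

  holds-3-5 : Relations.relationSeries level30 relation-3-5 ≗ zeros
  holds-3-5 = Relations.relation-holds level30 relation-3-5 coherent30 refl refl

  relation-1-2∙3 : Relation
  relation-1-2∙3 = record
    { left = 4 ; right = 4 ; coefficient = 25
    ; bTerms = (0 , -19) ∷ (1 , 6) ∷ (2 , 6) ∷ (4 , -19) ∷ []
    ; formTerms = (1 , -720) ∷ [] }

  holds-1-2∙3 : Relations.relationSeries level30 relation-1-2∙3 ≗ zeros
  holds-1-2∙3 = Relations.relation-holds level30 relation-1-2∙3 coherent30 refl refl

  relation-1-2∙5 : Relation
  relation-1-2∙5 = record
    { left = 5 ; right = 5 ; coefficient = 13
    ; bTerms = (0 , -11) ∷ (1 , 2) ∷ (3 , 2) ∷ (5 , -11) ∷ []
    ; formTerms = (18 , -1488) ∷ (19 , 240) ∷ [] }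

  holds-1-2∙5 : Relations.relationSeries level30 relation-1-2∙5 ≗ zeros
  holds-1-2∙5 = Relations.relation-holds level30 relation-1-2∙5 coherent30 refl refl

  relation-1-3∙5 : Relation
  relation-1-3∙5 = record
    { left = 6 ; right = 6 ; coefficient = 650
    ; bTerms = (0 , -575) ∷ (2 , 75) ∷ (3 , 75) ∷ (6 , -575) ∷ []
    ; formTerms = (4 , -298800) ∷ (5 , -207200) ∷ (6 , 3445200) ∷ (7 , 238800) ∷ (8 , -765360) ∷ (9 , 15429600) ∷ (10 , -168192) ∷ (11 , 1559680) ∷ (12 , 104800) ∷ (13 , -978640) ∷ (14 , -1808720) ∷ (15 , 378816) ∷ (16 , -325760) ∷ (17 , 1162368) ∷ [] }

  holds-1-3∙5 : Relations.relationSeries level30 relation-1-3∙5 ≗ zeros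
  holds-1-3∙5 = Relations.relation-holds level30 relation-1-3∙5 coherent30 refl refl

module Analysis where
  import Algebra.Solver.Ring.Simple as RingSolver
  import Data.Integer.Properties as ℤₚ
  import Data.Nat.Properties as ℕₚ
  open import Data.Nat.Solver using () renaming (module +-*-Solver to ℕSolver)
  import Data.Rational.Properties as ℚₚ
  import Data.Rational.Unnormalised.Base as ℚᵘ
  import Data.Rational.Unnormalised.Properties as ℚᵘₚ
  open import Algebra.Bundles using (CommutativeRing)
  open import Algebra.Solver.Ring.AlmostCommutativeRing using (fromCommutativeRing)
  open import Data.Empty using (⊥; ⊥-elim)
  open import Data.Integer.Base as ℤ using (ℤ; +_; -[1+_]; 0ℤ; 1ℤ)
  open import Data.Nat.Base as ℕ using (ℕ; zero; suc; _⊔_; _!; NonZero)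
  open import Data.Product.Base using (_×_; _,_; proj₁; proj₂; ∃)
  open import Data.Product.Properties using (≡-dec)
  open import Data.Rational.Base as ℚ using (ℚ; 0ℚ; 1ℚ; ½; _+_; _*_; -_; _-_; _≤_; _<_; ∣_∣; mkℚ; *≤*; *<*)
  open import Data.Rational.Solver using (module +-*-Solver)
  open import Data.Sum.Base using (inj₁; inj₂)
  open import Defs as D using (ℂ; value; inverse; isInverse; _^ᶻ_; ℍ; point; re; im; seq; cauchy; _≈_; _⟶_; 1ℂ; 0ℂ; σ; _·_; _^_; ∑; ∏)
  open import Function.Base using (_∘_)
  open import Level using (0ℓ)
  open import Relation.Binary.PropositionalEquality
  open +-*-Solver using (solve; _:+_; _:*_; _:-_; :-_; _:=_; con)
  open PowerSeries hiding (con; at)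
  open Divisors

  *-mono-≤ : ∀ {a b c d} → 0ℚ ≤ a → a ≤ b → 0ℚ ≤ c → c ≤ d → a * c ≤ b * d
  *-mono-≤ {a} {b} {c} {d} 0≤a a≤b 0≤c c≤d = ℚₚ.≤-trans
    (ℚₚ.*-monoʳ-≤-nonNeg c ⦃ ℚ.nonNegative 0≤c ⦄ a≤b)
    (ℚₚ.*-monoˡ-≤-nonNeg b ⦃ ℚ.nonNegative (ℚₚ.≤-trans 0≤a a≤b) ⦄ c≤d)

  *-monoʳ : ∀ {a b} c → 0ℚ ≤ c → a ≤ b → c * a ≤ c * b
  *-monoʳ c 0≤c = ℚₚ.*-monoˡ-≤-nonNeg c ⦃ ℚ.nonNegative 0≤c ⦄

  *-monoˡ : ∀ {a b} c → 0ℚ ≤ c → a ≤ b → a * c ≤ b * c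
  *-monoˡ c 0≤c = ℚₚ.*-monoʳ-≤-nonNeg c ⦃ ℚ.nonNegative 0≤c ⦄

  0≤* : ∀ {a b} → 0ℚ ≤ a → 0ℚ ≤ b → 0ℚ ≤ a * b
  0≤* {a} {b} 0≤a 0≤b = subst (_≤ a * b) (ℚₚ.*-zeroʳ a) (*-monoʳ a 0≤a 0≤b)

  0≤+ : ∀ {a b} → 0ℚ ≤ a → 0ℚ ≤ b → 0ℚ ≤ a + b
  0≤+ {a} {b} 0≤a 0≤b = subst (_≤ a + b) (ℚₚ.+-identityˡ 0ℚ) (ℚₚ.+-mono-≤ 0≤a 0≤b)

  0<* : ∀ {a b} → 0ℚ < a → 0ℚ < b → 0ℚ < a * b
  0<* {a} {b} 0<a 0<b = subst (_< a * b) (ℚₚ.*-zeroʳ a) (ℚₚ.*-monoʳ-<-pos a ⦃ ℚ.positive 0<a ⦄ 0<b)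

  0≤1 : 0ℚ ≤ 1ℚ
  0≤1 = ℚₚ.<⇒≤ (ℚₚ.positive⁻¹ 1ℚ)

  infixr 8 _^ℚ_
  _^ℚ_ : ℚ → ℕ → ℚ
  x ^ℚ zero  = 1ℚ
  x ^ℚ suc n = x * x ^ℚ n

  0≤^ : ∀ {x} n → 0ℚ ≤ x → 0ℚ ≤ x ^ℚ n
  0≤^ zero    0≤x = 0≤1
  0≤^ (suc n) 0≤x = 0≤* 0≤x (0≤^ n 0≤x)

  ^-+ : ∀ x m n → x ^ℚ (m ℕ.+ n) ≡ x ^ℚ m * x ^ℚ n
  ^-+ x zero    n = sym (ℚₚ.*-identityˡ _)
  ^-+ x (suc m) n = trans (cong (x *_) (^-+ x m n)) (sym (ℚₚ.*-assoc x _ _))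

  ^-* : ∀ x m n → x ^ℚ (m ℕ.* n) ≡ (x ^ℚ n) ^ℚ m
  ^-* x zero    n = refl
  ^-* x (suc m) n = trans (^-+ x n (m ℕ.* n)) (cong (x ^ℚ n *_) (^-* x m n))

  *-^ : ∀ x y n → (x * y) ^ℚ n ≡ x ^ℚ n * y ^ℚ n
  *-^ x y zero    = refl
  *-^ x y (suc n) = trans (cong (x * y *_) (*-^ x y n))
    (solve 4 (λ a b c d → a :* b :* (c :* d) := a :* c :* (b :* d)) refl x y (x ^ℚ n) (y ^ℚ n))

  1^ : ∀ n → 1ℚ ^ℚ n ≡ 1ℚ
  1^ zero    = refl
  1^ (suc n) = trans (ℚₚ.*-identityˡ _) (1^ n)

  ^-mono : ∀ {x y} n → 0ℚ ≤ x → x ≤ y → x ^ℚ n ≤ y ^ℚ n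
  ^-mono zero    0≤x x≤y = ℚₚ.≤-refl
  ^-mono (suc n) 0≤x x≤y = *-mono-≤ 0≤x x≤y (0≤^ n 0≤x) (^-mono n 0≤x x≤y)

  ^-≤1 : ∀ {x} n → 0ℚ ≤ x → x ≤ 1ℚ → x ^ℚ n ≤ 1ℚ
  ^-≤1 {x} n 0≤x x≤1 = subst (x ^ℚ n ≤_) (1^ n) (^-mono n 0≤x x≤1)

  -- Gaussian rationals: the n-th approximations of a complex number.
  G : Set
  G = ℚ × ℚ

  infixl 6 _+ᴳ_ _-ᴳ_
  infixl 7 _*ᴳ_

  _+ᴳ_ _-ᴳ_ _*ᴳ_ : G → G → G
  (a , b) +ᴳ (c , d) = a + c , b + d
  (a , b) -ᴳ (c , d) = a + - c , b + - d
  (a , b) *ᴳ (c , d) = a * c + - (b * d) , a * d + b * c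

  negᴳ : G → G
  negᴳ (a , b) = - a , - b

  0ᴳ 1ᴳ : G
  0ᴳ = 0ℚ , 0ℚ
  1ᴳ = 1ℚ , 0ℚ

  real : ℚ → G
  real c = c , 0ℚ

  private
    ext : ∀ {a b c d : ℚ} → a ≡ c → b ≡ d → (a , b) ≡ (c , d)
    ext = cong₂ _,_

  G-ring : CommutativeRing 0ℓ 0ℓ
  G-ring = record
    { Carrier = G ; _≈_ = _≡_ ; _+_ = _+ᴳ_ ; _*_ = _*ᴳ_ ; -_ = negᴳ ; 0# = 0ᴳ ; 1# = 1ᴳ
    ; isCommutativeRing = record
      { isRing = record
        { +-isAbelianGroup = record
          { isGroup = record
            { isMonoid = record
              { isSemigroup = record
                { isMagma = record { isEquivalence = isEquivalence ; ∙-cong = cong₂ _+ᴳ_ }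
                ; assoc = λ { (a , b) (c , d) (e , f) → ext (ℚₚ.+-assoc a c e) (ℚₚ.+-assoc b d f) } }
              ; identity = (λ { (a , b) → ext (ℚₚ.+-identityˡ a) (ℚₚ.+-identityˡ b) })
                         , (λ { (a , b) → ext (ℚₚ.+-identityʳ a) (ℚₚ.+-identityʳ b) }) }
            ; inverse = (λ { (a , b) → ext (ℚₚ.+-inverseˡ a) (ℚₚ.+-inverseˡ b) })
                      , (λ { (a , b) → ext (ℚₚ.+-inverseʳ a) (ℚₚ.+-inverseʳ b) })
            ; ⁻¹-cong = cong negᴳ }
          ; comm = λ { (a , b) (c , d) → ext (ℚₚ.+-comm a c) (ℚₚ.+-comm b d) } }
        ; *-cong = cong₂ _*ᴳ_
        ; *-assoc = λ { (a , b) (c , d) (e , f) → ext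
            (solve 6 (λ a b c d e f → (a :* c :+ :- (b :* d)) :* e :+ :- ((a :* d :+ b :* c) :* f) := a :* (c :* e :+ :- (d :* f)) :+ :- (b :* (c :* f :+ d :* e))) refl a b c d e f)
            (solve 6 (λ a b c d e f → (a :* c :+ :- (b :* d)) :* f :+ (a :* d :+ b :* c) :* e := a :* (c :* f :+ d :* e) :+ b :* (c :* e :+ :- (d :* f))) refl a b c d e f) }
        ; *-identity = (λ { (a , b) → ext (solve 2 (λ a b → con 1ℚ :* a :+ :- (con 0ℚ :* b) := a) refl a b) (solve 2 (λ a b → con 1ℚ :* b :+ con 0ℚ :* a := b) refl a b) })
                     , (λ { (a , b) → ext (solve 2 (λ a b → a :* con 1ℚ :+ :- (b :* con 0ℚ) := a) refl a b) (solve 2 (λ a b → a :* con 0ℚ :+ b :* con 1ℚ := b) refl a b) })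
        ; distrib = (λ { (a , b) (c , d) (e , f) → ext
            (solve 6 (λ a b c d e f → a :* (c :+ e) :+ :- (b :* (d :+ f)) := a :* c :+ :- (b :* d) :+ (a :* e :+ :- (b :* f))) refl a b c d e f)
            (solve 6 (λ a b c d e f → a :* (d :+ f) :+ b :* (c :+ e) := a :* d :+ b :* c :+ (a :* f :+ b :* e)) refl a b c d e f) })
                  , (λ { (a , b) (c , d) (e , f) → ext
            (solve 6 (λ a b c d e f → (c :+ e) :* a :+ :- ((d :+ f) :* b) := c :* a :+ :- (d :* b) :+ (e :* a :+ :- (f :* b))) refl a b c d e f)
            (solve 6 (λ a b c d e f → (c :+ e) :* b :+ (d :+ f) :* a := c :* b :+ d :* a :+ (e :* b :+ f :* a)) refl a b c d e f) }) }
      ; *-comm = λ { (a , b) (c , d) → ext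
          (solve 4 (λ a b c d → a :* c :+ :- (b :* d) := c :* a :+ :- (d :* b)) refl a b c d)
          (solve 4 (λ a b c d → a :* d :+ b :* c := c :* b :+ d :* a) refl a b c d) } } }

  open CommutativeRing G-ring public using () renaming
    ( +-assoc to +ᴳ-assoc; +-comm to +ᴳ-comm; +-identityˡ to +ᴳ-identityˡ; +-identityʳ to +ᴳ-identityʳ
    ; *-assoc to *ᴳ-assoc; *-comm to *ᴳ-comm; *-identityˡ to *ᴳ-identityˡ; *-identityʳ to *ᴳ-identityʳ
    ; distribˡ to *ᴳ-distribˡ; distribʳ to *ᴳ-distribʳ; zeroˡ to *ᴳ-zeroˡ; zeroʳ to *ᴳ-zeroʳ; -‿inverseʳ to -ᴳ-inverseʳ )

  module GSolver = RingSolver (fromCommutativeRing G-ring) (≡-dec ℚₚ._≟_ ℚₚ._≟_)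

  ‖_‖ : G → ℚ
  ‖ a , b ‖ = ∣ a ∣ + ∣ b ∣

  0≤‖‖ : ∀ w → 0ℚ ≤ ‖ w ‖
  0≤‖‖ (a , b) = 0≤+ (ℚₚ.0≤∣p∣ a) (ℚₚ.0≤∣p∣ b)

  ‖+‖ : ∀ w v → ‖ w +ᴳ v ‖ ≤ ‖ w ‖ + ‖ v ‖
  ‖+‖ (a , b) (c , d) = ℚₚ.≤-trans (ℚₚ.+-mono-≤ (ℚₚ.∣p+q∣≤∣p∣+∣q∣ a c) (ℚₚ.∣p+q∣≤∣p∣+∣q∣ b d))
    (ℚₚ.≤-reflexive (solve 4 (λ a b c d → (a :+ c) :+ (b :+ d) := (a :+ b) :+ (c :+ d)) refl (∣ a ∣) (∣ b ∣) (∣ c ∣) (∣ d ∣)))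

  ‖-‖ : ∀ w → ‖ negᴳ w ‖ ≡ ‖ w ‖
  ‖-‖ (a , b) = cong₂ _+_ (ℚₚ.∣-p∣≡∣p∣ a) (ℚₚ.∣-p∣≡∣p∣ b)

  ‖*‖ : ∀ w v → ‖ w *ᴳ v ‖ ≤ ‖ w ‖ * ‖ v ‖
  ‖*‖ (a , b) (c , d) = ℚₚ.≤-trans
    (ℚₚ.+-mono-≤
      (ℚₚ.≤-trans (ℚₚ.∣p+q∣≤∣p∣+∣q∣ (a * c) (- (b * d))) (ℚₚ.≤-reflexive (cong₂ _+_ (ℚₚ.∣p*q∣≡∣p∣*∣q∣ a c) (trans (ℚₚ.∣-p∣≡∣p∣ (b * d)) (ℚₚ.∣p*q∣≡∣p∣*∣q∣ b d)))))
      (ℚₚ.≤-trans (ℚₚ.∣p+q∣≤∣p∣+∣q∣ (a * d) (b * c)) (ℚₚ.≤-reflexive (cong₂ _+_ (ℚₚ.∣p*q∣≡∣p∣*∣q∣ a d) (ℚₚ.∣p*q∣≡∣p∣*∣q∣ b c)))))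
    (ℚₚ.≤-reflexive (solve 4 (λ a b c d → (a :* c :+ b :* d) :+ (a :* d :+ b :* c) := (a :+ b) :* (c :+ d)) refl (∣ a ∣) (∣ b ∣) (∣ c ∣) (∣ d ∣)))

  ‖real*‖ : ∀ c w → ‖ real c *ᴳ w ‖ ≡ ∣ c ∣ * ‖ w ‖
  ‖real*‖ c (a , b) = trans
    (cong₂ (λ x y → ∣ x ∣ + ∣ y ∣) (solve 3 (λ c a b → c :* a :+ :- (con 0ℚ :* b) := c :* a) refl c a b)
      (solve 3 (λ c a b → c :* b :+ con 0ℚ :* a := c :* b) refl c a b))
    (trans (cong₂ _+_ (ℚₚ.∣p*q∣≡∣p∣*∣q∣ c a) (ℚₚ.∣p*q∣≡∣p∣*∣q∣ c b)) (sym (ℚₚ.*-distribˡ-+ (∣ c ∣) (∣ a ∣) (∣ b ∣))))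

  infixr 8 _^ᴳ_
  _^ᴳ_ : G → ℕ → G
  w ^ᴳ zero  = 1ᴳ
  w ^ᴳ suc n = w *ᴳ w ^ᴳ n

  ^ᴳ-+ : ∀ x m n → x ^ᴳ (m ℕ.+ n) ≡ x ^ᴳ m *ᴳ x ^ᴳ n
  ^ᴳ-+ x zero    n = sym (*ᴳ-identityˡ _)
  ^ᴳ-+ x (suc m) n = trans (cong (x *ᴳ_) (^ᴳ-+ x m n)) (sym (*ᴳ-assoc x _ _))

  ^ᴳ-* : ∀ x m n → x ^ᴳ (m ℕ.* n) ≡ (x ^ᴳ n) ^ᴳ m
  ^ᴳ-* x zero    n = refl
  ^ᴳ-* x (suc m) n = trans (^ᴳ-+ x n (m ℕ.* n)) (cong (x ^ᴳ n *ᴳ_) (^ᴳ-* x m n))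

  sumᴳ : ℕ → (ℕ → G) → G
  sumᴳ zero    α = 0ᴳ
  sumᴳ (suc n) α = α 0 +ᴳ sumᴳ n (α ∘ suc)

  infixl 7 _⋆_
  _⋆_ : (ℕ → G) → (ℕ → G) → ℕ → G
  (α ⋆ β) zero    = α 0 *ᴳ β 0
  (α ⋆ β) (suc n) = α 0 *ᴳ β (suc n) +ᴳ ((α ∘ suc) ⋆ β) n

  sumᴳ-cong : ∀ n {α β : ℕ → G} → (∀ i → α i ≡ β i) → sumᴳ n α ≡ sumᴳ n β
  sumᴳ-cong zero    h = refl
  sumᴳ-cong (suc n) h = cong₂ _+ᴳ_ (h 0) (sumᴳ-cong n (h ∘ suc))

  sumᴳ-last : ∀ n α → sumᴳ (suc n) α ≡ sumᴳ n α +ᴳ α n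
  sumᴳ-last zero    α = trans (+ᴳ-identityʳ (α 0)) (sym (+ᴳ-identityˡ (α 0)))
  sumᴳ-last (suc n) α = trans (cong (α 0 +ᴳ_) (sumᴳ-last n (α ∘ suc))) (sym (+ᴳ-assoc (α 0) _ _))

  sumᴳ-*ˡ : ∀ n c α → sumᴳ n (λ i → c *ᴳ α i) ≡ c *ᴳ sumᴳ n α
  sumᴳ-*ˡ zero    c α = sym (*ᴳ-zeroʳ c)
  sumᴳ-*ˡ (suc n) c α = trans (cong (c *ᴳ α 0 +ᴳ_) (sumᴳ-*ˡ n c (α ∘ suc))) (sym (*ᴳ-distribˡ c _ _))

  sumᴳ-+ : ∀ n α β → sumᴳ n (λ i → α i +ᴳ β i) ≡ sumᴳ n α +ᴳ sumᴳ n β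
  sumᴳ-+ zero    α β = sym (+ᴳ-identityˡ 0ᴳ)
  sumᴳ-+ (suc n) α β = trans (cong ((α 0 +ᴳ β 0) +ᴳ_) (sumᴳ-+ n (α ∘ suc) (β ∘ suc)))
    (GSolver.solve 4 (λ a b c d → (a GSolver.:+ b) GSolver.:+ (c GSolver.:+ d) GSolver.:= (a GSolver.:+ c) GSolver.:+ (b GSolver.:+ d)) refl
      (α 0) (β 0) (sumᴳ n (α ∘ suc)) (sumᴳ n (β ∘ suc)))

  sumᴳ-++ : ∀ m n α → sumᴳ (m ℕ.+ n) α ≡ sumᴳ m α +ᴳ sumᴳ n (λ i → α (m ℕ.+ i))
  sumᴳ-++ zero    n α = sym (+ᴳ-identityˡ _)
  sumᴳ-++ (suc m) n α = trans (cong (α 0 +ᴳ_) (sumᴳ-++ m n (α ∘ suc))) (sym (+ᴳ-assoc (α 0) _ _))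

  -- The weighted ℓ¹ norm Σ μⁱ ‖αᵢ‖ of the first n terms.
  norm : ℚ → ℕ → (ℕ → G) → ℚ
  norm μ zero    α = 0ℚ
  norm μ (suc n) α = ‖ α 0 ‖ + μ * norm μ n (α ∘ suc)

  module Weighted (μ : ℚ) (1≤μ : 1ℚ ≤ μ) where

    0≤μ : 0ℚ ≤ μ
    0≤μ = ℚₚ.≤-trans 0≤1 1≤μ

    0≤norm : ∀ n α → 0ℚ ≤ norm μ n α
    0≤norm zero    α = ℚₚ.≤-refl
    0≤norm (suc n) α = 0≤+ (0≤‖‖ (α 0)) (0≤* 0≤μ (0≤norm n (α ∘ suc)))

    norm-last : ∀ n α → norm μ (suc n) α ≡ norm μ n α + μ ^ℚ n * ‖ α n ‖
    norm-last zero    α = solve 2 (λ a m → a :+ m :* con 0ℚ := con 0ℚ :+ con 1ℚ :* a) refl (‖ α 0 ‖) μ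
    norm-last (suc n) α = trans (cong (λ s → ‖ α 0 ‖ + μ * s) (norm-last n (α ∘ suc)))
      (solve 5 (λ a m s p b → a :+ m :* (s :+ p :* b) := (a :+ m :* s) :+ (m :* p) :* b) refl
        (‖ α 0 ‖) μ (norm μ n (α ∘ suc)) (μ ^ℚ n) (‖ α (suc n) ‖))

    ‖sum‖≤norm : ∀ n α → ‖ sumᴳ n α ‖ ≤ norm μ n α
    ‖sum‖≤norm zero    α = ℚₚ.≤-refl
    ‖sum‖≤norm (suc n) α = ℚₚ.≤-trans (‖+‖ (α 0) (sumᴳ n (α ∘ suc))) (ℚₚ.+-monoʳ-≤ (‖ α 0 ‖)
      (ℚₚ.≤-trans (‖sum‖≤norm n (α ∘ suc)) (subst (_≤ μ * norm μ n (α ∘ suc)) (ℚₚ.*-identityˡ _) (*-monoˡ (norm μ n (α ∘ suc)) (0≤norm n (α ∘ suc)) 1≤μ))))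

    cauchy-product : ∀ n α β →
      μ ^ℚ n * ‖ sumᴳ n α *ᴳ sumᴳ n β -ᴳ sumᴳ n (α ⋆ β) ‖ ≤ norm μ n α * norm μ n β
    cauchy-product zero    α β = ℚₚ.≤-reflexive refl
    cauchy-product (suc n) α β = begin
      μ * μ ^ℚ n * ‖ (α 0 +ᴳ A) *ᴳ sumᴳ (suc n) β -ᴳ (α 0 *ᴳ β 0 +ᴳ sumᴳ n (λ i → α 0 *ᴳ β (suc i) +ᴳ (α′ ⋆ β) i)) ‖
        ≡⟨ cong (λ w → μ * μ ^ℚ n * ‖ w ‖) step ⟩
      μ * μ ^ℚ n * ‖ (A *ᴳ sumᴳ n β -ᴳ C) +ᴳ A *ᴳ β n ‖
        ≤⟨ *-monoʳ (μ * μ ^ℚ n) 0≤μμⁿ (ℚₚ.≤-trans (‖+‖ (A *ᴳ sumᴳ n β -ᴳ C) (A *ᴳ β n)) (ℚₚ.+-monoʳ-≤ (‖ A *ᴳ sumᴳ n β -ᴳ C ‖)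
             (ℚₚ.≤-trans (‖*‖ A (β n)) (*-monoˡ (‖ β n ‖) (0≤‖‖ (β n)) (‖sum‖≤norm n α′))))) ⟩
      μ * μ ^ℚ n * (‖ A *ᴳ sumᴳ n β -ᴳ C ‖ + norm μ n α′ * ‖ β n ‖)
        ≡⟨ solve 5 (λ m p d a b → m :* p :* (d :+ a :* b) := m :* (p :* d) :+ m :* (a :* (p :* b))) refl
             μ (μ ^ℚ n) (‖ A *ᴳ sumᴳ n β -ᴳ C ‖) (norm μ n α′) (‖ β n ‖) ⟩
      μ * (μ ^ℚ n * ‖ A *ᴳ sumᴳ n β -ᴳ C ‖) + μ * (norm μ n α′ * (μ ^ℚ n * ‖ β n ‖))
        ≤⟨ ℚₚ.+-monoˡ-≤ _ (*-monoʳ μ 0≤μ (cauchy-product n α′ β)) ⟩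
      μ * (norm μ n α′ * norm μ n β) + μ * (norm μ n α′ * (μ ^ℚ n * ‖ β n ‖))
        ≡⟨ trans (solve 4 (λ m a b c → m :* (a :* b) :+ m :* (a :* c) := (m :* a) :* (b :+ c)) refl μ (norm μ n α′) (norm μ n β) (μ ^ℚ n * ‖ β n ‖))
             (cong (μ * norm μ n α′ *_) (sym (norm-last n β))) ⟩
      (μ * norm μ n α′) * norm μ (suc n) β
        ≤⟨ *-monoˡ (norm μ (suc n) β) (0≤norm (suc n) β) (subst (_≤ norm μ (suc n) α) (ℚₚ.+-identityˡ (μ * norm μ n α′)) (ℚₚ.+-monoˡ-≤ (μ * norm μ n α′) (0≤‖‖ (α 0)))) ⟩
      norm μ (suc n) α * norm μ (suc n) β ∎
      where
      open ℚₚ.≤-Reasoning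
      α′ : ℕ → G
      α′ = α ∘ suc
      A C : G
      A = sumᴳ n α′
      C = sumᴳ n (α′ ⋆ β)
      0≤μμⁿ : 0ℚ ≤ μ * μ ^ℚ n
      0≤μμⁿ = 0≤^ (suc n) 0≤μ
      inner : α 0 *ᴳ β 0 +ᴳ sumᴳ n (λ i → α 0 *ᴳ β (suc i) +ᴳ (α′ ⋆ β) i) ≡ α 0 *ᴳ sumᴳ (suc n) β +ᴳ C
      inner = trans (cong (α 0 *ᴳ β 0 +ᴳ_) (trans (sumᴳ-+ n (λ i → α 0 *ᴳ β (suc i)) (α′ ⋆ β)) (cong (_+ᴳ C) (sumᴳ-*ˡ n (α 0) (β ∘ suc)))))
        (trans (sym (+ᴳ-assoc (α 0 *ᴳ β 0) _ _)) (cong (_+ᴳ C) (sym (*ᴳ-distribˡ (α 0) (β 0) (sumᴳ n (β ∘ suc))))))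
      step : (α 0 +ᴳ A) *ᴳ sumᴳ (suc n) β -ᴳ (α 0 *ᴳ β 0 +ᴳ sumᴳ n (λ i → α 0 *ᴳ β (suc i) +ᴳ (α′ ⋆ β) i)) ≡ (A *ᴳ sumᴳ n β -ᴳ C) +ᴳ A *ᴳ β n
      step = trans (cong ((α 0 +ᴳ A) *ᴳ sumᴳ (suc n) β -ᴳ_) inner) (trans
        (GSolver.solve 4 (λ a A B C → (a GSolver.:+ A) GSolver.:* B GSolver.:- (a GSolver.:* B GSolver.:+ C) GSolver.:= A GSolver.:* B GSolver.:- C) refl (α 0) A (sumᴳ (suc n) β) C)
        (trans (cong (λ B → A *ᴳ B -ᴳ C) (sumᴳ-last n β))
          (GSolver.solve 4 (λ A B b C → A GSolver.:* (B GSolver.:+ b) GSolver.:- C GSolver.:= (A GSolver.:* B GSolver.:- C) GSolver.:+ A GSolver.:* b) refl A (sumᴳ n β) (β n) C)))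

  open GSolver using () renaming (solve to Gsolve; _:+_ to _⊹_; _:*_ to _⊗_; _:-_ to _⊝_; _:=_ to _≔_)

  infixl 9 _!_
  _!_ : ℂ → ℕ → G
  w ! m = seq (re w) m , seq (im w) m

  DoubleSeq : Set
  DoubleSeq = ℕ → ℕ → G

  -- Iterated limits: the inner index runs through the approximations of one
  -- complex number.
  Eventually : (ℕ → ℕ → Set) → Set
  Eventually P = ∃ λ N → ∀ n → N ℕ.≤ n → ∃ λ M → ∀ m → M ℕ.≤ m → P n m

  record Null (x : DoubleSeq) : Set where
    constructor null
    field smallness : ∀ ε → 0ℚ < ε → Eventually λ n m → ‖ x n m ‖ < ε
  open Null

  record Bounded (x : DoubleSeq) : Set where
    constructor bounded
    field bounded-by : ∃ λ B → 0ℚ < B × Eventually λ n m → ‖ x n m ‖ ≤ B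
  open Bounded

  infix 4 _↝_
  record _↝_ (x : DoubleSeq) (w : ℂ) : Set where
    constructor limit
    field error-null : Null λ n m → x n m -ᴳ w ! m
  open _↝_

  Close : ℂ → ℂ → Set
  Close w v = ∀ ε → 0ℚ < ε → ∃ λ M → ∀ m → M ℕ.≤ m → ‖ w ! m -ᴳ v ! m ‖ < ε

  eventually-map : ∀ {P Q : ℕ → ℕ → Set} → (∀ n m → P n m → Q n m) → Eventually P → Eventually Q
  eventually-map f (N , h) = N , λ n n≥ → let M , k = h n n≥ in M , λ m m≥ → f n m (k m m≥)

  eventually-zip : ∀ {P Q R : ℕ → ℕ → Set} → (∀ n m → P n m → Q n m → R n m) → Eventually P → Eventually Q → Eventually R
  eventually-zip f (N , h) (N′ , h′) = N ⊔ N′ , λ n n≥ →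
    let M  , k  = h n (ℕₚ.m⊔n≤o⇒m≤o N N′ n≥)
        M′ , k′ = h′ n (ℕₚ.m⊔n≤o⇒n≤o N N′ n≥)
    in M ⊔ M′ , λ m m≥ → f n m (k m (ℕₚ.m⊔n≤o⇒m≤o M M′ m≥)) (k′ m (ℕₚ.m⊔n≤o⇒n≤o M M′ m≥))

  halves : ∀ ε → ½ * ε + ½ * ε ≡ ε
  halves = solve 1 (λ e → con ½ :* e :+ con ½ :* e := e) refl

  half-pos : ∀ {ε} → 0ℚ < ε → 0ℚ < ½ * ε
  half-pos = 0<* (ℚₚ.positive⁻¹ ½)

  quotient : ∀ {ε B} → 0ℚ < ε → 0ℚ < B → ∃ λ δ → 0ℚ < δ × B * δ ≡ ε
  quotient {ε} {B} 0<ε 0<B = ε * B⁻¹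
    , 0<* 0<ε (ℚₚ.positive⁻¹ B⁻¹ ⦃ ℚₚ.1/pos⇒pos B ⦃ ℚ.positive 0<B ⦄ ⦄)
    , trans (solve 3 (λ b e c → b :* (e :* c) := e :* (b :* c)) refl B ε B⁻¹)
        (trans (cong (ε *_) (ℚₚ.*-inverseʳ B ⦃ ℚₚ.pos⇒nonZero B ⦃ ℚ.positive 0<B ⦄ ⦄)) (ℚₚ.*-identityʳ ε))
    where
    B⁻¹ = (ℚ.1/ B) ⦃ ℚₚ.pos⇒nonZero B ⦃ ℚ.positive 0<B ⦄ ⦄

  null-cong : ∀ {x y} → (∀ n m → x n m ≡ y n m) → Null x → Null y
  null-cong e h .smallness ε 0<ε = eventually-map (λ n m → subst (λ w → ‖ w ‖ < ε) (e n m)) (smallness h ε 0<ε)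

  null-+ : ∀ {x y} → Null x → Null y → Null λ n m → x n m +ᴳ y n m
  null-+ {x} {y} h k .smallness ε 0<ε = eventually-zip
    (λ n m p r → ℚₚ.≤-<-trans (‖+‖ (x n m) (y n m)) (subst (‖ x n m ‖ + ‖ y n m ‖ <_) (halves ε) (ℚₚ.+-mono-< p r)))
    (smallness h (½ * ε) (half-pos 0<ε)) (smallness k (½ * ε) (half-pos 0<ε))

  null-neg : ∀ {x} → Null x → Null λ n m → negᴳ (x n m)
  null-neg {x} h .smallness ε 0<ε = eventually-map (λ n m → subst (_< ε) (sym (‖-‖ (x n m)))) (smallness h ε 0<ε)

  null-* : ∀ {x y} → Null x → Bounded y → Null λ n m → x n m *ᴳ y n m
  null-* {x} {y} h (bounded (B , 0<B , k)) .smallness ε 0<ε = let δ , 0<δ , Bδ≡ε = quotient 0<ε 0<B in eventually-zip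
    (λ n m p r → ℚₚ.≤-<-trans (ℚₚ.≤-trans (‖*‖ (x n m) (y n m)) (*-monoʳ (‖ x n m ‖) (0≤‖‖ (x n m)) r))
      (subst (‖ x n m ‖ * B <_) (trans (ℚₚ.*-comm δ B) Bδ≡ε) (ℚₚ.*-monoˡ-<-pos B ⦃ ℚ.positive 0<B ⦄ p)))
    (smallness h δ 0<δ) k

  bounded-* : ∀ {x y} → Bounded x → Bounded y → Bounded λ n m → x n m *ᴳ y n m
  bounded-* {x} {y} (bounded (B , 0<B , h)) (bounded (C , 0<C , k)) .bounded-by = B * C , 0<* 0<B 0<C , eventually-zip
    (λ n m p r → ℚₚ.≤-trans (‖*‖ (x n m) (y n m)) (*-mono-≤ (0≤‖‖ (x n m)) p (0≤‖‖ (y n m)) r)) h k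

  null-dominated : ∀ {x} (c : ℕ → ℚ) → (∀ ε → 0ℚ < ε → ∃ λ N → ∀ n → N ℕ.≤ n → c n < ε) →
    (∃ λ M → ∀ n m → M ℕ.≤ m → ‖ x n m ‖ ≤ c n) → Null x
  null-dominated c h (M , k) .smallness ε 0<ε = let N , l = h ε 0<ε in N , λ n n≥ → M , λ m m≥ → ℚₚ.≤-<-trans (k n m m≥) (l n n≥)

  ‖swap‖ : ∀ w v → ‖ w -ᴳ v ‖ ≡ ‖ v -ᴳ w ‖
  ‖swap‖ w v = trans (sym (‖-‖ (w -ᴳ v))) (cong ‖_‖ (Gsolve 2 (λ w v → GSolver.:- (w ⊝ v) ≔ v ⊝ w) refl w v))

  ‖triangle‖ : ∀ u v w → ‖ u -ᴳ w ‖ ≤ ‖ u -ᴳ v ‖ + ‖ v -ᴳ w ‖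
  ‖triangle‖ u v w = subst (λ z → ‖ z ‖ ≤ ‖ u -ᴳ v ‖ + ‖ v -ᴳ w ‖)
    (Gsolve 3 (λ u v w → (u ⊝ v) ⊹ (v ⊝ w) ≔ u ⊝ w) refl u v w) (‖+‖ (u -ᴳ v) (v -ᴳ w))

  ‖bounded-by‖ : ∀ u v → ‖ u ‖ ≤ ‖ u -ᴳ v ‖ + ‖ v ‖
  ‖bounded-by‖ u v = subst (λ z → ‖ z ‖ ≤ ‖ u -ᴳ v ‖ + ‖ v ‖) (Gsolve 2 (λ u v → (u ⊝ v) ⊹ v ≔ u) refl u v) (‖+‖ (u -ᴳ v) v)

  constant-bounded : ∀ w → ∃ λ B → 0ℚ < B × ∃ λ M → ∀ m → M ℕ.≤ m → ‖ w ! m ‖ ≤ B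
  constant-bounded w =
    let M  , h  = cauchy (re w) 1ℚ (ℚₚ.positive⁻¹ 1ℚ)
        M′ , h′ = cauchy (im w) 1ℚ (ℚₚ.positive⁻¹ 1ℚ)
        N = M ⊔ M′
        two = 1ℚ + 1ℚ
    in two + ‖ w ! N ‖ , ℚₚ.+-mono-<-≤ (ℚₚ.positive⁻¹ two) (0≤‖‖ (w ! N)) , N , λ m m≥ →
      ℚₚ.≤-trans (‖bounded-by‖ (w ! m) (w ! N)) (ℚₚ.+-monoˡ-≤ (‖ w ! N ‖) (ℚₚ.<⇒≤ (ℚₚ.+-mono-<
        (h m N (ℕₚ.m⊔n≤o⇒m≤o M M′ m≥) (ℕₚ.m≤m⊔n M M′)) (h′ m N (ℕₚ.m⊔n≤o⇒n≤o M M′ m≥) (ℕₚ.m≤n⊔m M M′)))))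

  cst-bounded : ∀ w → Bounded λ _ m → w ! m
  cst-bounded w .bounded-by = let B , 0<B , M , h = constant-bounded w in B , 0<B , 0 , λ _ _ → M , h

  ↝-bounded : ∀ {x} w → x ↝ w → Bounded x
  ↝-bounded {x} w h .bounded-by = let B , 0<B , k = bounded-by (cst-bounded w) in
    1ℚ + B , ℚₚ.+-mono-< (ℚₚ.positive⁻¹ 1ℚ) 0<B , eventually-zip
      (λ n m p r → ℚₚ.≤-trans (‖bounded-by‖ (x n m) (w ! m)) (ℚₚ.+-mono-≤ (ℚₚ.<⇒≤ p) r)) (smallness (error-null h) 1ℚ (ℚₚ.positive⁻¹ 1ℚ)) k

  null-0 : Null λ _ _ → 0ᴳ
  null-0 .smallness ε 0<ε = 0 , λ _ _ → 0 , λ _ _ → 0<ε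

  ↝-cst : ∀ w → (λ _ m → w ! m) ↝ w
  ↝-cst w .error-null = null-cong (λ _ m → sym (-ᴳ-inverseʳ (w ! m))) null-0

  ↝-cong : ∀ {x y} w → (∀ n m → x n m ≡ y n m) → x ↝ w → y ↝ w
  ↝-cong w e h .error-null = null-cong (λ n m → cong (_-ᴳ w ! m) (e n m)) (error-null h)

  ↝-null : ∀ {x y} w → Null (λ n m → y n m -ᴳ x n m) → x ↝ w → y ↝ w
  ↝-null {x} {y} w h k .error-null = null-cong (λ n m → Gsolve 3 (λ y x w → (y ⊝ x) ⊹ (x ⊝ w) ≔ y ⊝ w) refl (y n m) (x n m) (w ! m)) (null-+ h (error-null k))

  ↝-+ : ∀ {x y} w v → x ↝ w → y ↝ v → (λ n m → x n m +ᴳ y n m) ↝ w D.+ v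
  ↝-+ {x} {y} w v h k .error-null = null-cong
    (λ n m → Gsolve 4 (λ x y w v → (x ⊝ w) ⊹ (y ⊝ v) ≔ (x ⊹ y) ⊝ (w ⊹ v)) refl (x n m) (y n m) (w ! m) (v ! m)) (null-+ (error-null h) (error-null k))

  ↝-- : ∀ {x y} w v → x ↝ w → y ↝ v → (λ n m → x n m -ᴳ y n m) ↝ w D.- v
  ↝-- {x} {y} w v h k .error-null = null-cong
    (λ n m → Gsolve 4 (λ x y w v → (x ⊝ w) ⊹ GSolver.:- (y ⊝ v) ≔ (x ⊝ y) ⊝ (w ⊝ v)) refl (x n m) (y n m) (w ! m) (v ! m)) (null-+ (error-null h) (null-neg (error-null k)))

  ↝-* : ∀ {x y} w v → x ↝ w → y ↝ v → (λ n m → x n m *ᴳ y n m) ↝ w D.* v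
  ↝-* {x} {y} w v h k .error-null = null-cong
    (λ n m → Gsolve 4 (λ x y w v → (x ⊝ w) ⊗ y ⊹ (y ⊝ v) ⊗ w ≔ (x ⊗ y) ⊝ (w ⊗ v)) refl (x n m) (y n m) (w ! m) (v ! m))
    (null-+ (null-* (error-null h) (↝-bounded v k)) (null-* (error-null k) (cst-bounded w)))

  real-· : ∀ c w m → (c D.· w) ! m ≡ real c *ᴳ w ! m
  real-· c w m = cong₂ _,_ (solve 3 (λ c a b → c :* a := c :* a :+ :- (con 0ℚ :* b)) refl c (seq (re w) m) (seq (im w) m))
    (solve 3 (λ c a b → c :* b := c :* b :+ con 0ℚ :* a) refl c (seq (re w) m) (seq (im w) m))

  ↝-· : ∀ {x} c w → x ↝ w → (λ n m → real c *ᴳ x n m) ↝ c D.· w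
  ↝-· {x} c w h .error-null = null-cong
    (λ n m → trans (Gsolve 3 (λ x w c → (x ⊝ w) ⊗ c ≔ c ⊗ x ⊝ c ⊗ w) refl (x n m) (w ! m) (real c)) (cong (real c *ᴳ x n m -ᴳ_) (sym (real-· c w m))))
    (null-* (error-null h) (bounded (1ℚ + ‖ real c ‖ , ℚₚ.+-mono-<-≤ (ℚₚ.positive⁻¹ 1ℚ) (0≤‖‖ (real c)) , 0 , λ _ _ → 0 , λ _ _ →
      subst (_≤ 1ℚ + ‖ real c ‖) (ℚₚ.+-identityˡ (‖ real c ‖)) (ℚₚ.+-monoˡ-≤ (‖ real c ‖) 0≤1))))

  ≈⇒Close : ∀ w v → w ≈ v → Close w v
  ≈⇒Close w v (p , r) ε 0<ε =
    let M , h = p (½ * ε) (half-pos 0<ε) ; M′ , k = r (½ * ε) (half-pos 0<ε)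
    in M ⊔ M′ , λ m m≥ → subst (‖ w ! m -ᴳ v ! m ‖ <_) (halves ε)
         (ℚₚ.+-mono-< (h m (ℕₚ.m⊔n≤o⇒m≤o M M′ m≥)) (k m (ℕₚ.m⊔n≤o⇒n≤o M M′ m≥)))

  Close⇒≈ : ∀ w v → Close w v → w ≈ v
  Close⇒≈ w v h = (λ ε 0<ε → let M , k = h ε 0<ε in M , λ m m≥ → ℚₚ.≤-<-trans (fst m) (k m m≥))
                , (λ ε 0<ε → let M , k = h ε 0<ε in M , λ m m≥ → ℚₚ.≤-<-trans (snd m) (k m m≥))
    where
    fst : ∀ m → ∣ seq (re w) m - seq (re v) m ∣ ≤ ‖ w ! m -ᴳ v ! m ‖
    fst m = subst (_≤ ‖ w ! m -ᴳ v ! m ‖) (ℚₚ.+-identityʳ _) (ℚₚ.+-monoʳ-≤ (∣ seq (re w) m - seq (re v) m ∣) (ℚₚ.0≤∣p∣ (seq (im w) m - seq (im v) m)))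
    snd : ∀ m → ∣ seq (im w) m - seq (im v) m ∣ ≤ ‖ w ! m -ᴳ v ! m ‖
    snd m = subst (_≤ ‖ w ! m -ᴳ v ! m ‖) (ℚₚ.+-identityˡ _) (ℚₚ.+-monoˡ-≤ (∣ seq (im w) m - seq (im v) m ∣) (ℚₚ.0≤∣p∣ (seq (re w) m - seq (re v) m)))

  pointwise⇒≈ : ∀ w v → (∀ m → w ! m ≡ v ! m) → w ≈ v
  pointwise⇒≈ w v e = Close⇒≈ w v (λ ε 0<ε → 0 , λ m _ → subst (λ z → ‖ z ‖ < ε) (sym (trans (cong (_-ᴳ v ! m) (e m)) (-ᴳ-inverseʳ (v ! m)))) 0<ε)

  ≈-sym : ∀ w v → w ≈ v → v ≈ w
  ≈-sym w v h = Close⇒≈ v w (λ ε 0<ε → let M , k = ≈⇒Close w v h ε 0<ε in M , λ m m≥ → subst (_< ε) (‖swap‖ (w ! m) (v ! m)) (k m m≥))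

  ↝-≈ : ∀ {x} w v → w ≈ v → x ↝ w → x ↝ v
  ↝-≈ {x} w v e h .error-null = null-cong (λ n m → Gsolve 3 (λ x w v → (x ⊝ w) ⊹ (w ⊝ v) ≔ x ⊝ v) refl (x n m) (w ! m) (v ! m))
    (null-+ (error-null h) (null λ ε 0<ε → 0 , λ _ _ → ≈⇒Close w v e ε 0<ε))

  ↝-unique : ∀ {x} w v → x ↝ w → x ↝ v → w ≈ v
  ↝-unique {x} w v h k = Close⇒≈ w v λ ε 0<ε →
    let N , l = smallness (null-cong {y = λ _ m → w ! m -ᴳ v ! m} (λ n m → Gsolve 3 (λ x w v → GSolver.:- (x ⊝ w) ⊹ (x ⊝ v) ≔ w ⊝ v) refl (x n m) (w ! m) (v ! m)) (null-+ (null-neg (error-null h)) (error-null k))) ε 0<ε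
    in l N ℕₚ.≤-refl

  ≈-trans : ∀ u v w → u ≈ v → v ≈ w → u ≈ w
  ≈-trans u v w p r = ↝-unique u w (↝-cst u) (↝-≈ v w r (↝-≈ u v p (↝-cst u)))

  *-cong : ∀ w w′ v v′ → w ≈ w′ → v ≈ v′ → w D.* v ≈ w′ D.* v′
  *-cong w w′ v v′ p r = ↝-unique (w D.* v) (w′ D.* v′) (↝-cst (w D.* v)) (↝-* w′ v′ (↝-≈ w w′ p (↝-cst w)) (↝-≈ v v′ r (↝-cst v)))

  ∸-cong : ∀ w w′ v v′ → w ≈ w′ → v ≈ v′ → w D.- v ≈ w′ D.- v′
  ∸-cong w w′ v v′ p r = ↝-unique (w D.- v) (w′ D.- v′) (↝-cst (w D.- v)) (↝-- w′ v′ (↝-≈ w w′ p (↝-cst w)) (↝-≈ v v′ r (↝-cst v)))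

  +-cong : ∀ w w′ v v′ → w ≈ w′ → v ≈ v′ → w D.+ v ≈ w′ D.+ v′
  +-cong w w′ v v′ p r = ↝-unique (w D.+ v) (w′ D.+ v′) (↝-cst (w D.+ v)) (↝-+ w′ v′ (↝-≈ w w′ p (↝-cst w)) (↝-≈ v v′ r (↝-cst v)))

  ·-cong : ∀ c w v → w ≈ v → c D.· w ≈ c D.· v
  ·-cong c w v p = ↝-unique (c D.· w) (c D.· v) (↝-cong (c D.· w) (λ _ m → real-· c w m) (↝-cst (c D.· w))) (↝-· c v (↝-≈ w v p (↝-cst w)))

  ^-! : ∀ w n m → (w D.^ n) ! m ≡ (w ! m) ^ᴳ n
  ^-! w zero    m = refl
  ^-! w (suc n) m = cong (w ! m *ᴳ_) (^-! w n m)

  ^-cong : ∀ w v n → w ≈ v → w D.^ n ≈ v D.^ n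
  ^-cong w v zero    e = pointwise⇒≈ 1ℂ 1ℂ (λ _ → refl)
  ^-cong w v (suc n) e = *-cong w v (w D.^ n) (v D.^ n) e (^-cong w v n e)

  0≤square : ∀ x → 0ℚ ≤ x * x
  0≤square x with ℚₚ.≤-total 0ℚ x
  ... | inj₁ 0≤x = 0≤* 0≤x 0≤x
  ... | inj₂ x≤0 = subst (0ℚ ≤_) (solve 1 (λ x → (:- x) :* (:- x) := x :* x) refl x) (0≤* (ℚₚ.neg-antimono-≤ x≤0) (ℚₚ.neg-antimono-≤ x≤0))

  square-≤ : ∀ x ε → 0ℚ < ε → x * x ≤ ε * ε → ∣ x ∣ ≤ ε
  square-≤ x ε 0<ε h with ℚₚ.≤-total (∣ x ∣) ε
  ... | inj₁ p = p
  ... | inj₂ p = ℚₚ.*-cancelˡ-≤-pos ε ⦃ ℚ.positive 0<ε ⦄ (begin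
      ε * ∣ x ∣     ≤⟨ *-monoˡ (∣ x ∣) (ℚₚ.0≤∣p∣ x) p ⟩
      ∣ x ∣ * ∣ x ∣ ≡⟨ trans (sym (ℚₚ.∣p*q∣≡∣p∣*∣q∣ x x)) (ℚₚ.0≤p⇒∣p∣≡p (0≤square x)) ⟩
      x * x         ≤⟨ h ⟩
      ε * ε         ∎)
    where open ℚₚ.≤-Reasoning

  ⟶⇒↝ : ∀ (a : ℕ → ℂ) l → a ⟶ l → (λ n m → a n ! m) ↝ l
  ⟶⇒↝ a l h .error-null .smallness ε 0<ε = let δ = ½ * (½ * ε) ; 0<δ = half-pos (half-pos 0<ε) ; N , k = h δ 0<δ in N , λ n n≥ →
    let e , 0<e , M , b = k n n≥ in M , λ m m≥ →
      let x = seq (re (a n)) m - seq (re l) m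
          y = seq (im (a n)) m - seq (im l) m
          x²+y²≤ : x * x + y * y ≤ δ * δ
          x²+y²≤ = ℚₚ.≤-trans (subst (_≤ x * x + y * y + e) (ℚₚ.+-identityʳ (x * x + y * y)) (ℚₚ.+-monoʳ-≤ (x * x + y * y) (ℚₚ.<⇒≤ 0<e))) (b m m≥)
      in ℚₚ.≤-<-trans (ℚₚ.+-mono-≤
           (square-≤ x δ 0<δ (ℚₚ.≤-trans (subst (_≤ x * x + y * y) (ℚₚ.+-identityʳ (x * x)) (ℚₚ.+-monoʳ-≤ (x * x) (0≤square y))) x²+y²≤))
           (square-≤ y δ 0<δ (ℚₚ.≤-trans (subst (_≤ x * x + y * y) (ℚₚ.+-identityˡ (y * y)) (ℚₚ.+-monoˡ-≤ (y * y) (0≤square x))) x²+y²≤)))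
         (subst₂ _<_ (sym (halves (½ * ε))) (trans (cong (_+_ (½ * ε)) refl) (halves ε))
           (subst (_< ½ * ε + ½ * ε) (ℚₚ.+-identityˡ (½ * ε)) (ℚₚ.+-monoˡ-< (½ * ε) (half-pos 0<ε))))

  ↝-constant : ∀ {x} w N → (∀ n m → N ℕ.≤ n → x n m ≡ w ! m) → x ↝ w
  ↝-constant {x} w N h = limit (null λ ε 0<ε → N , λ n n≥ → 0 , λ m _ →
    subst (λ z → ‖ z ‖ < ε) (sym (trans (cong (_-ᴳ w ! m) (h n m n≥)) (-ᴳ-inverseʳ (w ! m)))) 0<ε)

  fromℤ : ℤ → ℚ
  fromℤ i = i ℚ./ 1

  private
    fromℤᵘ : ∀ i → ℚ.toℚᵘ (fromℤ i) ℚᵘ.≃ ℚᵘ.mkℚᵘ i 0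
    fromℤᵘ i = ℚₚ.toℚᵘ-fromℚᵘ (ℚᵘ.mkℚᵘ i 0)

  fromℤ-+ : ∀ i j → fromℤ (i ℤ.+ j) ≡ fromℤ i + fromℤ j
  fromℤ-+ i j = ℚₚ.toℚᵘ-injective (ℚᵘₚ.≃-trans (fromℤᵘ (i ℤ.+ j)) (ℚᵘₚ.≃-sym (ℚᵘₚ.≃-trans (ℚₚ.toℚᵘ-homo-+ (fromℤ i) (fromℤ j))
    (ℚᵘₚ.≃-trans (ℚᵘₚ.+-cong (fromℤᵘ i) (fromℤᵘ j)) (ℚᵘ.*≡* (cong (ℤ._* 1ℤ) (cong₂ ℤ._+_ (ℤₚ.*-identityʳ i) (ℤₚ.*-identityʳ j))))))))

  fromℤ-* : ∀ i j → fromℤ (i ℤ.* j) ≡ fromℤ i * fromℤ j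
  fromℤ-* i j = ℚₚ.toℚᵘ-injective (ℚᵘₚ.≃-trans (fromℤᵘ (i ℤ.* j)) (ℚᵘₚ.≃-sym (ℚᵘₚ.≃-trans (ℚₚ.toℚᵘ-homo-* (fromℤ i) (fromℤ j))
    (ℚᵘₚ.*-cong (fromℤᵘ i) (fromℤᵘ j)))))

  fromℤ-neg : ∀ i → fromℤ (ℤ.- i) ≡ - fromℤ i
  fromℤ-neg i = trans (cong fromℤ (sym (ℤₚ.-1*i≡-i i))) (trans (fromℤ-* ℤ.-1ℤ i) (solve 1 (λ x → con (fromℤ ℤ.-1ℤ) :* x := :- x) refl (fromℤ i)))

  fromℤ-mono : ∀ {i j} → i ℤ.≤ j → fromℤ i ≤ fromℤ j
  fromℤ-mono {i} {j} i≤j = ℚₚ.toℚᵘ-cancel-≤ (ℚᵘₚ.≤-respʳ-≃ (ℚᵘₚ.≃-sym (fromℤᵘ j)) (ℚᵘₚ.≤-respˡ-≃ (ℚᵘₚ.≃-sym (fromℤᵘ i)) (ℚᵘ.*≤* (ℤₚ.*-monoʳ-≤-nonNeg 1ℤ i≤j))))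

  fromℕ : ℕ → ℚ
  fromℕ n = fromℤ (+ n)

  fromℕ-mono : ∀ {m n} → m ℕ.≤ n → fromℕ m ≤ fromℕ n
  fromℕ-mono m≤n = fromℤ-mono (ℤ.+≤+ m≤n)

  0≤fromℕ : ∀ n → 0ℚ ≤ fromℕ n
  0≤fromℕ n = fromℕ-mono {0} {n} ℕ.z≤n

  fromℕ-suc : ∀ n → fromℕ (suc n) ≡ 1ℚ + fromℕ n
  fromℕ-suc n = trans (cong fromℤ (ℤₚ.pos-+ 1 n)) (fromℤ-+ 1ℤ (+ n))

  0<fromℕ-suc : ∀ n → 0ℚ < fromℕ (suc n)
  0<fromℕ-suc n = ℚₚ.<-≤-trans (ℚₚ.positive⁻¹ 1ℚ) (fromℕ-mono {1} {suc n} (ℕ.s≤s ℕ.z≤n))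

  ∣fromℤ∣ : ∀ i → ∣ fromℤ i ∣ ≡ fromℕ ℤ.∣ i ∣
  ∣fromℤ∣ (+ n)    = ℚₚ.0≤p⇒∣p∣≡p (0≤fromℕ n)
  ∣fromℤ∣ -[1+ n ] = trans (cong ∣_∣ (fromℤ-neg (+ suc n))) (trans (ℚₚ.∣-p∣≡∣p∣ (fromℕ (suc n))) (ℚₚ.0≤p⇒∣p∣≡p (0≤fromℕ (suc n))))

  archimedean : ∀ x → ∃ λ n → x < fromℕ n
  archimedean x@(mkℚ i d _) = suc ℤ.∣ i ∣ , ℚₚ.toℚᵘ-cancel-< (ℚᵘₚ.<-respʳ-≃ (ℚᵘₚ.≃-sym (fromℤᵘ (+ suc ℤ.∣ i ∣)))
    (ℚᵘ.*<* (ℤₚ.≤-<-trans (ℤₚ.≤-reflexive (ℤₚ.*-identityʳ i)) (ℤₚ.<-≤-trans (i<1+∣i∣ i) (subst (ℤ._≤ + suc ℤ.∣ i ∣ ℤ.* + suc d) (ℤₚ.*-identityʳ _) (ℤₚ.*-monoˡ-≤-nonNeg (+ suc ℤ.∣ i ∣) (ℤ.+≤+ (ℕ.s≤s (ℕ.z≤n {d})))))))))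
    where
    i<1+∣i∣ : ∀ i → i ℤ.< + suc ℤ.∣ i ∣
    i<1+∣i∣ (+ n)    = ℤ.+<+ ℕₚ.≤-refl
    i<1+∣i∣ -[1+ n ] = ℤ.-<+

  archimedean-* : ∀ x ε → 0ℚ < ε → ∃ λ n → x < ε * fromℕ n
  archimedean-* x ε 0<ε = n , subst (_< ε * fromℕ n) cancel (ℚₚ.*-monoʳ-<-pos ε ⦃ ℚ.positive 0<ε ⦄ (proj₂ large))
    where
    ε⁻¹ : ℚ
    ε⁻¹ = (ℚ.1/ ε) ⦃ ℚₚ.pos⇒nonZero ε ⦃ ℚ.positive 0<ε ⦄ ⦄
    large : ∃ λ n → x * ε⁻¹ < fromℕ n
    large = archimedean (x * ε⁻¹)
    n : ℕ
    n = proj₁ large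
    cancel : ε * (x * ε⁻¹) ≡ x
    cancel = trans (solve 3 (λ e x i → e :* (x :* i) := x :* (e :* i)) refl ε x ε⁻¹)
      (trans (cong (x *_) (ℚₚ.*-inverseʳ ε ⦃ ℚₚ.pos⇒nonZero ε ⦃ ℚ.positive 0<ε ⦄ ⦄)) (ℚₚ.*-identityʳ x))

  term : Series → G → ℕ → G
  term f x i = real (fromℤ (f i)) *ᴳ x ^ᴳ i

  real-* : ∀ a b → real (a * b) ≡ real a *ᴳ real b
  real-* a b = cong₂ _,_ (solve 2 (λ a b → a :* b := a :* b :+ :- (con 0ℚ :* con 0ℚ)) refl a b) (solve 2 (λ a b → con 0ℚ := a :* con 0ℚ :+ con 0ℚ :* b) refl a b)

  ⋆-congˡ : ∀ n {α β : ℕ → G} (γ : ℕ → G) → (∀ i → α i ≡ β i) → (α ⋆ γ) n ≡ (β ⋆ γ) n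
  ⋆-congˡ zero    γ h = cong (_*ᴳ γ 0) (h 0)
  ⋆-congˡ (suc n) γ h = cong₂ _+ᴳ_ (cong (_*ᴳ γ (suc n)) (h 0)) (⋆-congˡ n γ (h ∘ suc))

  term-⊛ : ∀ f g x k → (term f x ⋆ term g x) k ≡ term (f ⊛ g) x k
  term-⊛ f g x k = trans (⋆-congˡ k (term g x) (λ i → sym (*ᴳ-identityˡ (term f x i)))) (trans (go 1ᴳ f k) (*ᴳ-identityˡ _))
    where
    product : ∀ i j → real (fromℤ (i ℤ.* j)) ≡ real (fromℤ i) *ᴳ real (fromℤ j)
    product i j = trans (cong real (fromℤ-* i j)) (real-* (fromℤ i) (fromℤ j))
    go : ∀ c f k → ((λ i → c *ᴳ term f x i) ⋆ term g x) k ≡ c *ᴳ term (f ⊛ g) x k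
    go c f zero = trans
      (Gsolve 4 (λ c a b e → c ⊗ (a ⊗ e) ⊗ (b ⊗ e) ≔ c ⊗ (a ⊗ b ⊗ (e ⊗ e))) refl c (real (fromℤ (f 0))) (real (fromℤ (g 0))) 1ᴳ)
      (cong (c *ᴳ_) (cong₂ _*ᴳ_ (sym (product (f 0) (g 0))) (*ᴳ-identityˡ 1ᴳ)))
    go c f (suc k) = begin
      (c *ᴳ term f x 0) *ᴳ term g x (suc k) +ᴳ ((λ i → c *ᴳ term f x (suc i)) ⋆ term g x) k
        ≡⟨ cong₂ _+ᴳ_ (Gsolve 4 (λ c a b e → c ⊗ (a ⊗ GSolver.con 1ᴳ) ⊗ (b ⊗ e) ≔ c ⊗ (a ⊗ b ⊗ e)) refl c (real (fromℤ (f 0))) (real (fromℤ (g (suc k)))) (x ^ᴳ suc k))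
             (trans (⋆-congˡ k (term g x) (λ i → Gsolve 4 (λ c a x e → c ⊗ (a ⊗ (x ⊗ e)) ≔ c ⊗ x ⊗ (a ⊗ e)) refl c (real (fromℤ (f (suc i)))) x (x ^ᴳ i))) (go (c *ᴳ x) (tail f) k)) ⟩
      c *ᴳ (real (fromℤ (f 0)) *ᴳ real (fromℤ (g (suc k))) *ᴳ x ^ᴳ suc k) +ᴳ c *ᴳ x *ᴳ (real (fromℤ ((tail f ⊛ g) k)) *ᴳ x ^ᴳ k)
        ≡⟨ Gsolve 5 (λ c p x s e → c ⊗ (p ⊗ (x ⊗ e)) ⊹ c ⊗ x ⊗ (s ⊗ e) ≔ c ⊗ ((p ⊹ s) ⊗ (x ⊗ e))) refl c (real (fromℤ (f 0)) *ᴳ real (fromℤ (g (suc k)))) x (real (fromℤ ((tail f ⊛ g) k))) (x ^ᴳ k) ⟩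
      c *ᴳ ((real (fromℤ (f 0)) *ᴳ real (fromℤ (g (suc k))) +ᴳ real (fromℤ ((tail f ⊛ g) k))) *ᴳ x ^ᴳ suc k)
        ≡⟨ cong (λ s → c *ᴳ (s *ᴳ x ^ᴳ suc k)) (trans (cong (_+ᴳ real (fromℤ ((tail f ⊛ g) k))) (sym (product (f 0) (g (suc k)))))
             (cong real (sym (fromℤ-+ (f 0 ℤ.* g (suc k)) ((tail f ⊛ g) k))))) ⟩
      c *ᴳ term (f ⊛ g) x (suc k) ∎
      where open ≡-Reasoning

  term-⊕ : ∀ f g x i → term (f ⊕ g) x i ≡ term f x i +ᴳ term g x i
  term-⊕ f g x i = trans (cong (λ s → real s *ᴳ x ^ᴳ i) (fromℤ-+ (f i) (g i))) (*ᴳ-distribʳ (x ^ᴳ i) (real (fromℤ (f i))) (real (fromℤ (g i))))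

  term-scale : ∀ c f x i → term (λ n → c ℤ.* f n) x i ≡ real (fromℤ c) *ᴳ term f x i
  term-scale c f x i = trans (cong (_*ᴳ x ^ᴳ i) (trans (cong real (fromℤ-* c (f i))) (real-* (fromℤ c) (fromℤ (f i))))) (*ᴳ-assoc (real (fromℤ c)) (real (fromℤ (f i))) (x ^ᴳ i))

  absSum : ℚ → ℕ → Series → ℚ
  absSum r zero    f = 0ℚ
  absSum r (suc n) f = ∣ fromℤ (f 0) ∣ + r * absSum r n (tail f)

  record HasSum (y : ℂ) (f : Series) (w : ℂ) : Set where
    constructor hasSum
    field sums : (λ n m → sumᴳ n (term f (y ! m))) ↝ w
  open HasSum public

  -- A radius g < 1 with inverse μ.  All points used below satisfy |y| < g⁶, and
  -- all series have coefficients summable at the radius g⁵.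
  record Radius : Set where
    field
      g μ K    : ℚ
      0≤g      : 0ℚ ≤ g
      g≤1      : g ≤ 1ℚ
      1≤μ      : 1ℚ ≤ μ
      gμ≡1     : g * μ ≡ 1ℚ
      0≤K      : 0ℚ ≤ K
      n*gⁿ≤K   : ∀ n → fromℕ n * g ^ℚ n ≤ K
      sum≤K    : ∀ n → absSum g n (λ _ → 1ℤ) ≤ K

  module Sums (R : Radius) where
    open Radius R
    open Weighted μ 1≤μ

    r : ℚ
    r = g ^ℚ 5

    0≤r : 0ℚ ≤ r
    0≤r = 0≤^ 5 0≤g

    r≤1 : r ≤ 1ℚ
    r≤1 = ^-≤1 5 0≤g g≤1

    Point : ℂ → Set
    Point y = ∃ λ M → ∀ m → M ℕ.≤ m → ∀ i → ‖ (y ! m) ^ᴳ i ‖ ≤ (1ℚ + 1ℚ) * (g ^ℚ 6) ^ℚ i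

    record Summable (f : Series) : Set where
      constructor summable
      field bound : ∃ λ B → 0ℚ ≤ B × ∀ n → absSum r n f ≤ B

    0≤absSum : ∀ n f → 0ℚ ≤ absSum r n f
    0≤absSum zero    f = ℚₚ.≤-refl
    0≤absSum (suc n) f = 0≤+ (ℚₚ.0≤∣p∣ (fromℤ (f 0))) (0≤* 0≤r (0≤absSum n (tail f)))

    absSum-last : ∀ ρ n f → absSum ρ (suc n) f ≡ absSum ρ n f + ρ ^ℚ n * ∣ fromℤ (f n) ∣
    absSum-last ρ zero    f = solve 2 (λ a m → a :+ m :* con 0ℚ := con 0ℚ :+ con 1ℚ :* a) refl (∣ fromℤ (f 0) ∣) ρ
    absSum-last ρ (suc n) f = trans (cong (λ s → ∣ fromℤ (f 0) ∣ + ρ * s) (absSum-last ρ n (tail f)))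
      (solve 5 (λ a m s p b → a :+ m :* (s :+ p :* b) := (a :+ m :* s) :+ (m :* p) :* b) refl
        (∣ fromℤ (f 0) ∣) ρ (absSum ρ n (tail f)) (ρ ^ℚ n) (∣ fromℤ (f (suc n)) ∣))

    absSum-step : ∀ n f → absSum r n f ≤ absSum r (suc n) f
    absSum-step n f = subst (absSum r n f ≤_) (sym (absSum-last r n f))
      (subst (_≤ absSum r n f + r ^ℚ n * ∣ fromℤ (f n) ∣) (ℚₚ.+-identityʳ _) (ℚₚ.+-monoʳ-≤ (absSum r n f) (0≤* (0≤^ n 0≤r) (ℚₚ.0≤∣p∣ (fromℤ (f n))))))

    absSum-cong : ∀ n {f h} → f ≗ h → absSum r n f ≡ absSum r n h
    absSum-cong zero    e = refl
    absSum-cong (suc n) e = cong₂ (λ a b → ∣ fromℤ a ∣ + r * b) (e 0) (absSum-cong n (e ∘ suc))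

    absSum-⊕ : ∀ n f h → absSum r n (f ⊕ h) ≤ absSum r n f + absSum r n h
    absSum-⊕ zero    f h = ℚₚ.≤-reflexive refl
    absSum-⊕ (suc n) f h = ℚₚ.≤-trans
      (ℚₚ.+-mono-≤ (ℚₚ.≤-trans (ℚₚ.≤-reflexive (cong ∣_∣ (fromℤ-+ (f 0) (h 0)))) (ℚₚ.∣p+q∣≤∣p∣+∣q∣ (fromℤ (f 0)) (fromℤ (h 0)))) (*-monoʳ r 0≤r (absSum-⊕ n (tail f) (tail h))))
      (ℚₚ.≤-reflexive (solve 5 (λ a b r c d → (a :+ b) :+ r :* (c :+ d) := (a :+ r :* c) :+ (b :+ r :* d)) refl
        (∣ fromℤ (f 0) ∣) (∣ fromℤ (h 0) ∣) r (absSum r n (tail f)) (absSum r n (tail h))))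

    absSum-scale : ∀ n c f → absSum r n (λ i → c ℤ.* f i) ≡ ∣ fromℤ c ∣ * absSum r n f
    absSum-scale zero    c f = sym (ℚₚ.*-zeroʳ (∣ fromℤ c ∣))
    absSum-scale (suc n) c f = trans (cong₂ (λ a b → a + r * b) (trans (cong ∣_∣ (fromℤ-* c (f 0))) (ℚₚ.∣p*q∣≡∣p∣*∣q∣ (fromℤ c) (fromℤ (f 0)))) (absSum-scale n c (tail f)))
      (solve 4 (λ c a r s → c :* a :+ r :* (c :* s) := c :* (a :+ r :* s)) refl (∣ fromℤ c ∣) (∣ fromℤ (f 0) ∣) r (absSum r n (tail f)))

    absSum-⊛ : ∀ n f h → absSum r n (f ⊛ h) ≤ absSum r n f * absSum r n h
    absSum-⊛ zero    f h = ℚₚ.≤-reflexive refl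
    absSum-⊛ (suc n) f h = begin
      ∣ fromℤ (f 0 ℤ.* h 0) ∣ + r * absSum r n ((λ k → f 0 ℤ.* h (suc k)) ⊕ (tail f ⊛ h))
        ≤⟨ ℚₚ.+-mono-≤ (ℚₚ.≤-reflexive (trans (cong ∣_∣ (fromℤ-* (f 0) (h 0))) (ℚₚ.∣p*q∣≡∣p∣*∣q∣ (fromℤ (f 0)) (fromℤ (h 0)))))
             (*-monoʳ r 0≤r (ℚₚ.≤-trans (absSum-⊕ n (λ k → f 0 ℤ.* h (suc k)) (tail f ⊛ h))
               (ℚₚ.+-mono-≤ (ℚₚ.≤-reflexive (absSum-scale n (f 0) (tail h)))
                 (ℚₚ.≤-trans (absSum-⊛ n (tail f) h) (*-monoʳ (absSum r n (tail f)) (0≤absSum n (tail f)) (absSum-step n h)))))) ⟩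
      a * b + r * (a * absSum r n (tail h) + absSum r n (tail f) * absSum r (suc n) h)
        ≡⟨ solve 5 (λ a b r t s → a :* b :+ r :* (a :* t :+ s :* (b :+ r :* t)) := (a :+ r :* s) :* (b :+ r :* t)) refl a b r (absSum r n (tail h)) (absSum r n (tail f)) ⟩
      absSum r (suc n) f * absSum r (suc n) h ∎
      where
      open ℚₚ.≤-Reasoning
      a b : ℚ
      a = ∣ fromℤ (f 0) ∣
      b = ∣ fromℤ (h 0) ∣

    absSum-gap : ∀ d k n f → absSum r n (gap d k f) ≤ absSum r n f
    absSum-gap d k       zero    f = ℚₚ.≤-refl
    absSum-gap d zero    (suc n) f = ℚₚ.+-monoʳ-≤ (∣ fromℤ (f 0) ∣) (*-monoʳ r 0≤r (absSum-gap d d n (tail f)))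
    absSum-gap d (suc k) (suc n) f = begin
      0ℚ + r * absSum r n (gap d k f) ≡⟨ ℚₚ.+-identityˡ _ ⟩
      r * absSum r n (gap d k f)      ≤⟨ *-monoʳ r 0≤r (absSum-gap d k n f) ⟩
      r * absSum r n f                ≤⟨ *-monoˡ (absSum r n f) (0≤absSum n f) r≤1 ⟩
      1ℚ * absSum r n f               ≡⟨ ℚₚ.*-identityˡ _ ⟩
      absSum r n f                    ≤⟨ absSum-step n f ⟩
      absSum r (suc n) f              ∎
      where open ℚₚ.≤-Reasoning

    summable-cong : ∀ {f h} → f ≗ h → Summable f → Summable h
    summable-cong e (summable (B , 0≤B , p)) = summable (B , 0≤B , λ n → subst (_≤ B) (absSum-cong n e) (p n))

    summable-⊕ : ∀ {f h} → Summable f → Summable h → Summable (f ⊕ h)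
    summable-⊕ {f} {h} (summable (B , 0≤B , p)) (summable (C , 0≤C , k)) = summable (B + C , 0≤+ 0≤B 0≤C , λ n → ℚₚ.≤-trans (absSum-⊕ n f h) (ℚₚ.+-mono-≤ (p n) (k n)))

    summable-scale : ∀ c {f} → Summable f → Summable (λ n → c ℤ.* f n)
    summable-scale c {f} (summable (B , 0≤B , p)) = summable (∣ fromℤ c ∣ * B , 0≤* (ℚₚ.0≤∣p∣ (fromℤ c)) 0≤B ,
      λ n → subst (_≤ ∣ fromℤ c ∣ * B) (sym (absSum-scale n c f)) (*-monoʳ (∣ fromℤ c ∣) (ℚₚ.0≤∣p∣ (fromℤ c)) (p n)))

    summable-⊛ : ∀ {f h} → Summable f → Summable h → Summable (f ⊛ h)
    summable-⊛ {f} {h} (summable (B , 0≤B , p)) (summable (C , 0≤C , k)) = summable (B * C , 0≤* 0≤B 0≤C ,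
      λ n → ℚₚ.≤-trans (absSum-⊛ n f h) (*-mono-≤ (0≤absSum n f) (p n) (0≤absSum n h) (k n)))

    summable-gap : ∀ d k {f} → Summable f → Summable (gap d k f)
    summable-gap d k {f} (summable (B , 0≤B , p)) = summable (B , 0≤B , λ n → ℚₚ.≤-trans (absSum-gap d k n f) (p n))

    summable-const : ∀ c → Summable (const c)
    summable-const c = summable (∣ fromℤ c ∣ , ℚₚ.0≤∣p∣ (fromℤ c) , bound)
      where
      tail-0 : ∀ n → absSum r n (tail (const c)) ≡ 0ℚ
      tail-0 zero    = refl
      tail-0 (suc n) = trans (ℚₚ.+-identityˡ _) (trans (cong (r *_) (tail-0 n)) (ℚₚ.*-zeroʳ r))
      bound : ∀ n → absSum r n (const c) ≤ ∣ fromℤ c ∣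
      bound zero    = ℚₚ.0≤∣p∣ (fromℤ c)
      bound (suc n) = ℚₚ.≤-reflexive (trans (cong (λ s → ∣ fromℤ c ∣ + r * s) (tail-0 n)) (trans (cong (_+_ (∣ fromℤ c ∣)) (ℚₚ.*-zeroʳ r)) (ℚₚ.+-identityʳ _)))

    summable-shift : ∀ {f} → Summable f → Summable (shift f)
    summable-shift {f} (summable (B , 0≤B , p)) = summable (B , 0≤B , λ { zero → 0≤B ; (suc n) → ℚₚ.≤-trans (ℚₚ.≤-reflexive (ℚₚ.+-identityˡ _))
      (ℚₚ.≤-trans (*-monoˡ (absSum r n f) (0≤absSum n f) r≤1) (ℚₚ.≤-trans (ℚₚ.≤-reflexive (ℚₚ.*-identityˡ (absSum r n f))) (p n))) })

    summable-monomial : ∀ s → Summable (monomial s)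
    summable-monomial zero    = summable-const 1ℤ
    summable-monomial (suc s) = summable-shift (summable-monomial s)

    gⁿμⁿ : ∀ n → g ^ℚ n * μ ^ℚ n ≡ 1ℚ
    gⁿμⁿ n = trans (sym (*-^ g μ n)) (trans (cong (_^ℚ n) gμ≡1) (1^ n))

    0≤2 : 0ℚ ≤ 1ℚ + 1ℚ
    0≤2 = 0≤+ 0≤1 0≤1

    norm-term : ∀ x → (∀ i → ‖ x ^ᴳ i ‖ ≤ (1ℚ + 1ℚ) * (g ^ℚ 6) ^ℚ i) → ∀ f n → norm μ n (term f x) ≤ (1ℚ + 1ℚ) * absSum r n f
    norm-term x hx f zero    = ℚₚ.≤-reflexive refl
    norm-term x hx f (suc n) = begin
      norm μ (suc n) (term f x)
        ≡⟨ norm-last n (term f x) ⟩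
      norm μ n (term f x) + μ ^ℚ n * ‖ term f x n ‖
        ≤⟨ ℚₚ.+-mono-≤ (norm-term x hx f n) (*-monoʳ (μ ^ℚ n) (0≤^ n 0≤μ)
             (ℚₚ.≤-trans (ℚₚ.≤-reflexive (‖real*‖ (fromℤ (f n)) (x ^ᴳ n))) (*-monoʳ (∣ fromℤ (f n) ∣) (ℚₚ.0≤∣p∣ (fromℤ (f n))) (hx n)))) ⟩
      (1ℚ + 1ℚ) * absSum r n f + μ ^ℚ n * (∣ fromℤ (f n) ∣ * ((1ℚ + 1ℚ) * (g ^ℚ 6) ^ℚ n))
        ≡⟨ cong (_+_ ((1ℚ + 1ℚ) * absSum r n f)) (trans (cong (λ e → μ ^ℚ n * (∣ fromℤ (f n) ∣ * ((1ℚ + 1ℚ) * e))) (*-^ g (g ^ℚ 5) n))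
             (trans (solve 5 (λ m a t e p → m :* (a :* (t :* (e :* p))) := (e :* m) :* (t :* (p :* a))) refl (μ ^ℚ n) (∣ fromℤ (f n) ∣) (1ℚ + 1ℚ) (g ^ℚ n) (r ^ℚ n))
               (trans (cong (_* ((1ℚ + 1ℚ) * (r ^ℚ n * ∣ fromℤ (f n) ∣))) (gⁿμⁿ n)) (ℚₚ.*-identityˡ _)))) ⟩
      (1ℚ + 1ℚ) * absSum r n f + (1ℚ + 1ℚ) * (r ^ℚ n * ∣ fromℤ (f n) ∣)
        ≡⟨ trans (sym (ℚₚ.*-distribˡ-+ (1ℚ + 1ℚ) (absSum r n f) (r ^ℚ n * ∣ fromℤ (f n) ∣))) (cong ((1ℚ + 1ℚ) *_) (sym (absSum-last r n f))) ⟩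
      (1ℚ + 1ℚ) * absSum r (suc n) f ∎
      where open ℚₚ.≤-Reasoning

    unweight : ∀ n {x B} → 0ℚ ≤ x → μ ^ℚ n * x ≤ B → x ≤ B * g ^ℚ n
    unweight n {x} {B} 0≤x h = begin
      x                          ≡⟨ sym (trans (cong (_* x) (gⁿμⁿ n)) (ℚₚ.*-identityˡ x)) ⟩
      g ^ℚ n * μ ^ℚ n * x        ≡⟨ ℚₚ.*-assoc (g ^ℚ n) _ _ ⟩
      g ^ℚ n * (μ ^ℚ n * x)      ≤⟨ *-monoʳ (g ^ℚ n) (0≤^ n 0≤g) h ⟩
      g ^ℚ n * B                 ≡⟨ ℚₚ.*-comm (g ^ℚ n) B ⟩
      B * g ^ℚ n                 ∎
      where open ℚₚ.≤-Reasoning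

    geometric-null : ∀ B → 0ℚ ≤ B → ∀ ε → 0ℚ < ε → ∃ λ N → ∀ n → N ℕ.≤ n → B * g ^ℚ n < ε
    geometric-null B 0≤B ε 0<ε = suc N , λ n N<n → ℚₚ.*-cancelʳ-<-nonNeg (fromℕ n) ⦃ ℚ.nonNegative (0≤fromℕ n) ⦄
      (ℚₚ.≤-<-trans (scaled n) (ℚₚ.<-≤-trans (proj₂ bound) (*-monoʳ ε (ℚₚ.<⇒≤ 0<ε) (fromℕ-mono (ℕₚ.<⇒≤ N<n)))))
      where
      bound : ∃ λ N → B * K < ε * fromℕ N
      bound = archimedean-* (B * K) ε 0<ε
      N : ℕ
      N = proj₁ bound
      scaled : ∀ n → B * g ^ℚ n * fromℕ n ≤ B * K
      scaled n = subst (_≤ B * K) (solve 3 (λ b p n → b :* (n :* p) := b :* p :* n) refl B (g ^ℚ n) (fromℕ n)) (*-monoʳ B 0≤B (n*gⁿ≤K n))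

    hasSum-cong : ∀ y {f h} w → f ≗ h → HasSum y f w → HasSum y h w
    hasSum-cong y w e (hasSum k) = hasSum (↝-cong w (λ n m → sumᴳ-cong n (λ i → cong (λ a → real (fromℤ a) *ᴳ (y ! m) ^ᴳ i) (e i))) k)

    hasSum-⊕ : ∀ y {f h} w v → HasSum y f w → HasSum y h v → HasSum y (f ⊕ h) (w D.+ v)
    hasSum-⊕ y {f} {h} w v (hasSum p) (hasSum k) = hasSum (↝-cong (w D.+ v)
      (λ n m → sym (trans (sumᴳ-cong n (term-⊕ f h (y ! m))) (sumᴳ-+ n (term f (y ! m)) (term h (y ! m))))) (↝-+ w v p k))

    hasSum-scale : ∀ y c {f} w → HasSum y f w → HasSum y (λ n → c ℤ.* f n) (fromℤ c D.· w)
    hasSum-scale y c {f} w (hasSum p) = hasSum (↝-cong (fromℤ c D.· w)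
      (λ n m → sym (trans (sumᴳ-cong n (term-scale c f (y ! m))) (sumᴳ-*ˡ n (real (fromℤ c)) (term f (y ! m))))) (↝-· (fromℤ c) w p))

    product-error : ∀ y → Point y → ∀ {f h} → Summable f → Summable h →
      Null λ n m → sumᴳ n (term f (y ! m)) *ᴳ sumᴳ n (term h (y ! m)) -ᴳ sumᴳ n (term (f ⊛ h) (y ! m))
    product-error y (M , hy) {f} {h} (summable (B , 0≤B , p)) (summable (C , 0≤C , k)) =
      null-dominated (λ n → ((1ℚ + 1ℚ) * B) * ((1ℚ + 1ℚ) * C) * g ^ℚ n) (geometric-null _ (0≤* (0≤* 0≤2 0≤B) (0≤* 0≤2 0≤C)))
        (M , λ n m m≥ → unweight n (0≤‖‖ (S f n m *ᴳ S h n m -ᴳ S (f ⊛ h) n m)) (ℚₚ.≤-trans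
          (subst (λ s → μ ^ℚ n * ‖ S f n m *ᴳ S h n m -ᴳ s ‖ ≤ norm μ n (term f (y ! m)) * norm μ n (term h (y ! m)))
            (sumᴳ-cong n (term-⊛ f h (y ! m))) (cauchy-product n (term f (y ! m)) (term h (y ! m))))
          (*-mono-≤ (0≤norm n _) (bound f B p n m m≥) (0≤norm n _) (bound h C k n m m≥))))
      where
      S : Series → ℕ → ℕ → G
      S f n m = sumᴳ n (term f (y ! m))
      bound : ∀ f B → (∀ n → absSum r n f ≤ B) → ∀ n m → M ℕ.≤ m → norm μ n (term f (y ! m)) ≤ (1ℚ + 1ℚ) * B
      bound f B p n m m≥ = ℚₚ.≤-trans (norm-term (y ! m) (hy m m≥) f n) (*-monoʳ (1ℚ + 1ℚ) 0≤2 (p n))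

    hasSum-⊛ : ∀ y → Point y → ∀ {f h} → Summable f → Summable h → ∀ w v → HasSum y f w → HasSum y h v → HasSum y (f ⊛ h) (w D.* v)
    hasSum-⊛ y hy {f} {h} sf sh w v (hasSum hf) (hasSum hh) = hasSum (↝-null (w D.* v)
      (null-cong (λ n m → Gsolve 2 (λ a b → GSolver.:- (a ⊝ b) ≔ b ⊝ a) refl (S f n m *ᴳ S h n m) (S (f ⊛ h) n m)) (null-neg (product-error y hy sf sh)))
      (↝-* w v hf hh))
      where
      S : Series → ℕ → ℕ → G
      S f n m = sumᴳ n (term f (y ! m))

  evaluate : ℕ → Series → G → G
  evaluate n f x = sumᴳ n (term f x)

  term-suc : ∀ f x i → term f x (suc i) ≡ x *ᴳ term (tail f) x i
  term-suc f x i = Gsolve 3 (λ a x e → a ⊗ (x ⊗ e) ≔ x ⊗ (a ⊗ e)) refl (real (fromℤ (f (suc i)))) x (x ^ᴳ i)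

  evaluate-suc : ∀ n f x → evaluate (suc n) f x ≡ real (fromℤ (f 0)) +ᴳ x *ᴳ evaluate n (tail f) x
  evaluate-suc n f x = cong₂ _+ᴳ_ (*ᴳ-identityʳ (real (fromℤ (f 0))))
    (trans (sumᴳ-cong n (term-suc f x)) (sumᴳ-*ˡ n x (term (tail f) x)))

  evaluate-0∷ : ∀ n f x → f 0 ≡ 0ℤ → evaluate (suc n) f x ≡ x *ᴳ evaluate n (tail f) x
  evaluate-0∷ n f x h = trans (evaluate-suc n f x) (trans (cong (λ c → real (fromℤ c) +ᴳ x *ᴳ evaluate n (tail f) x) h) (+ᴳ-identityˡ _))

  evaluate-gap : ∀ d k n f x → evaluate (k ℕ.+ n) (gap d k f) x ≡ x ^ᴳ k *ᴳ evaluate n (V d f) x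
  evaluate-gap d zero    n f x = sym (*ᴳ-identityˡ _)
  evaluate-gap d (suc k) n f x = trans (evaluate-0∷ (k ℕ.+ n) (gap d (suc k) f) x refl)
    (trans (cong (x *ᴳ_) (evaluate-gap d k n f x)) (sym (*ᴳ-assoc x (x ^ᴳ k) (evaluate n (V d f) x))))

  evaluate-V : ∀ d n f x → evaluate (n ℕ.* suc d) (V d f) x ≡ evaluate n f (x ^ᴳ suc d)
  evaluate-V d zero    f x = refl
  evaluate-V d (suc n) f x = begin
    evaluate (suc (d ℕ.+ n ℕ.* suc d)) (V d f) x
      ≡⟨ evaluate-suc (d ℕ.+ n ℕ.* suc d) (V d f) x ⟩
    real (fromℤ (f 0)) +ᴳ x *ᴳ evaluate (d ℕ.+ n ℕ.* suc d) (gap d d (tail f)) x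
      ≡⟨ cong (λ s → real (fromℤ (f 0)) +ᴳ x *ᴳ s) (trans (evaluate-gap d d (n ℕ.* suc d) (tail f) x) (cong (x ^ᴳ d *ᴳ_) (evaluate-V d n (tail f) x))) ⟩
    real (fromℤ (f 0)) +ᴳ x *ᴳ (x ^ᴳ d *ᴳ evaluate n (tail f) (x ^ᴳ suc d))
      ≡⟨ cong (real (fromℤ (f 0)) +ᴳ_) (sym (*ᴳ-assoc x (x ^ᴳ d) (evaluate n (tail f) (x ^ᴳ suc d)))) ⟩
    real (fromℤ (f 0)) +ᴳ x ^ᴳ suc d *ᴳ evaluate n (tail f) (x ^ᴳ suc d)
      ≡⟨ sym (evaluate-suc n f (x ^ᴳ suc d)) ⟩
    evaluate (suc n) f (x ^ᴳ suc d) ∎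
    where open ≡-Reasoning

  evaluate-monomial : ∀ s n x → s ℕ.< n → evaluate n (monomial s) x ≡ x ^ᴳ s
  evaluate-monomial zero (suc n) x _ = trans (evaluate-suc n (const 1ℤ) x) (trans
    (cong (1ᴳ +ᴳ_) (trans (cong (x *ᴳ_) (zero-sum n)) (*ᴳ-zeroʳ x))) (+ᴳ-identityʳ 1ᴳ))
    where
    zero-sum : ∀ n → evaluate n (tail (const 1ℤ)) x ≡ 0ᴳ
    zero-sum zero    = refl
    zero-sum (suc n) = trans (evaluate-0∷ n (tail (const 1ℤ)) x refl) (trans (cong (x *ᴳ_) (zero-sum n)) (*ᴳ-zeroʳ x))
  evaluate-monomial (suc s) (suc n) x s<n = trans (evaluate-0∷ n (monomial (suc s)) x refl) (cong (x *ᴳ_) (evaluate-monomial s n x (ℕ.s≤s⁻¹ s<n)))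

  gap-one : ∀ d k → gap d k (const 1ℤ) ≗ monomial k
  gap-one d zero    n       = V-const d 1ℤ n
  gap-one d (suc k) zero    = refl
  gap-one d (suc k) (suc n) = gap-one d k n

  V-1-q : ∀ d → V d 1-q ≗ const 1ℤ ⊖ monomial (suc d)
  V-1-q d n = trans (gap-⊖ d 0 (const 1ℤ) (shift (const 1ℤ)) n) (cong₂ ℤ._-_ (V-const d 1ℤ n) (shifted n))
    where
    shifted : V d (shift (const 1ℤ)) ≗ monomial (suc d)
    shifted zero    = refl
    shifted (suc n) = gap-one d d n

  module Series-sums (R : Radius) where
    open Radius R
    open Weighted μ 1≤μ
    open Sums R

    tail-norm : ∀ n k α → μ ^ℚ n * ‖ sumᴳ k (λ i → α (n ℕ.+ i)) ‖ ≤ norm μ (n ℕ.+ k) α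
    tail-norm zero    k α = subst (_≤ norm μ k α) (sym (ℚₚ.*-identityˡ (‖ sumᴳ k α ‖))) (‖sum‖≤norm k α)
    tail-norm (suc n) k α = begin
      μ * μ ^ℚ n * ‖ sumᴳ k (λ i → α (suc n ℕ.+ i)) ‖
        ≡⟨ ℚₚ.*-assoc μ (μ ^ℚ n) (‖ sumᴳ k (λ i → α (suc n ℕ.+ i)) ‖) ⟩
      μ * (μ ^ℚ n * ‖ sumᴳ k (λ i → α (suc n ℕ.+ i)) ‖)
        ≤⟨ *-monoʳ μ 0≤μ (tail-norm n k (α ∘ suc)) ⟩
      μ * norm μ (n ℕ.+ k) (α ∘ suc)
        ≤⟨ subst (_≤ ‖ α 0 ‖ + μ * norm μ (n ℕ.+ k) (α ∘ suc)) (ℚₚ.+-identityˡ (μ * norm μ (n ℕ.+ k) (α ∘ suc)))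
             (ℚₚ.+-monoˡ-≤ (μ * norm μ (n ℕ.+ k) (α ∘ suc)) (0≤‖‖ (α 0))) ⟩
      norm μ (suc n ℕ.+ k) α ∎
      where open ℚₚ.≤-Reasoning

    tail-small : ∀ x → (∀ i → ‖ x ^ᴳ i ‖ ≤ (1ℚ + 1ℚ) * (g ^ℚ 6) ^ℚ i) → ∀ f B → (∀ n → absSum r n f ≤ B) → ∀ n n′ → n ℕ.≤ n′ →
      ‖ evaluate n f x -ᴳ evaluate n′ f x ‖ ≤ (1ℚ + 1ℚ) * B * g ^ℚ n
    tail-small x hx f B p n n′ n≤n′ = subst (λ w → ‖ w ‖ ≤ (1ℚ + 1ℚ) * B * g ^ℚ n) (sym difference)
      (subst (_≤ (1ℚ + 1ℚ) * B * g ^ℚ n) (sym (‖-‖ T)) (unweight n (0≤‖‖ T)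
        (ℚₚ.≤-trans (tail-norm n k (term f x)) (ℚₚ.≤-trans (norm-term x hx f (n ℕ.+ k)) (*-monoʳ (1ℚ + 1ℚ) 0≤2 (p (n ℕ.+ k)))))))
      where
      k : ℕ
      k = n′ ℕ.∸ n
      T : G
      T = sumᴳ k (λ i → term f x (n ℕ.+ i))
      difference : evaluate n f x -ᴳ evaluate n′ f x ≡ negᴳ T
      difference = trans (cong (λ j → evaluate n f x -ᴳ evaluate j f x) (sym (ℕₚ.m+[n∸m]≡n n≤n′)))
        (trans (cong (evaluate n f x -ᴳ_) (sumᴳ-++ n k (term f x))) (Gsolve 2 (λ a t → a ⊝ (a ⊹ t) ≔ GSolver.:- t) refl (evaluate n f x) T))

    hasSum-subsequence : ∀ y → Point y → ∀ {f} → Summable f → ∀ w (φ : ℕ → ℕ) → (∀ n → n ℕ.≤ φ n) →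
      (λ n m → evaluate (φ n) f (y ! m)) ↝ w → HasSum y f w
    hasSum-subsequence y (M , hy) {f} (summable (B , 0≤B , p)) w φ φ≥ h = hasSum (↝-null w
      (null-dominated (λ n → (1ℚ + 1ℚ) * B * g ^ℚ n) (geometric-null ((1ℚ + 1ℚ) * B) (0≤* 0≤2 0≤B))
        (M , λ n m m≥ → tail-small (y ! m) (hy m m≥) f B p n (φ n) (φ≥ n))) h)

    hasSum-V : ∀ d y → Point y → ∀ {f} → Summable f → ∀ w → HasSum (y D.^ suc d) f w → HasSum y (V d f) w
    hasSum-V d y hy {f} sf w h = hasSum-subsequence y hy (summable-gap d 0 sf) w (ℕ._* suc d) (λ n → ℕₚ.m≤m*n n (suc d))
      (↝-cong w (λ n m → trans (cong (evaluate n f) (^-! y (suc d) m)) (sym (evaluate-V d n f (y ! m)))) (sums h))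

    hasSum-monomial : ∀ y s → HasSum y (monomial s) (y D.^ s)
    hasSum-monomial y s = hasSum (↝-constant (y D.^ s) (suc s) (λ n m s<n → trans (evaluate-monomial s n (y ! m) s<n) (sym (^-! y s m))))

    hasSum-zeros : ∀ y → HasSum y zeros 0ℂ
    hasSum-zeros y = hasSum (↝-constant 0ℂ 0 (λ n m _ → go n (y ! m)))
      where
      go : ∀ n x → evaluate n zeros x ≡ 0ᴳ
      go zero    x = refl
      go (suc n) x = trans (evaluate-0∷ n zeros x refl) (trans (cong (x *ᴳ_) (go n x)) (*ᴳ-zeroʳ x))

    hasSum-⊖ : ∀ y {f h} w v → HasSum y f w → HasSum y h v → HasSum y (f ⊖ h) (w D.- v)
    hasSum-⊖ y {f} {h} w v (hasSum p) (hasSum k) = hasSum (↝-cong (w D.- v) (λ n m → sym (evaluate-⊖ n (y ! m))) (↝-- w v p k))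
      where
      term-⊖ : ∀ x i → term (f ⊖ h) x i ≡ term f x i +ᴳ real (fromℤ ℤ.-1ℤ) *ᴳ term h x i
      term-⊖ x i = trans (trans (cong (λ a → real (fromℤ (f i ℤ.+ a)) *ᴳ x ^ᴳ i) (sym (ℤₚ.-1*i≡-i (h i)))) (term-⊕ f (λ i → ℤ.-1ℤ ℤ.* h i) x i))
        (cong (term f x i +ᴳ_) (term-scale ℤ.-1ℤ h x i))
      evaluate-⊖ : ∀ n x → evaluate n (f ⊖ h) x ≡ evaluate n f x -ᴳ evaluate n h x
      evaluate-⊖ n x = trans (sumᴳ-cong n (term-⊖ x)) (trans (sumᴳ-+ n (term f x) (λ i → real (fromℤ ℤ.-1ℤ) *ᴳ term h x i))
        (trans (cong (evaluate n f x +ᴳ_) (sumᴳ-*ˡ n (real (fromℤ ℤ.-1ℤ)) (term h x)))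
          (Gsolve 2 (λ a b → a ⊹ GSolver.con (real (fromℤ ℤ.-1ℤ)) ⊗ b ≔ a ⊝ b) refl (evaluate n f x) (evaluate n h x))))

    hasSum-eulerProduct : ∀ y → Point y → (∀ N → Summable (eulerProduct N)) → ∀ N →
      HasSum y (eulerProduct N) (D.∏ N (λ k → 1ℂ D.- y D.^ suc k))
    hasSum-eulerProduct y hy summ zero    = hasSum-monomial y 0
    hasSum-eulerProduct y hy summ (suc N) = hasSum-⊛ y hy (summ N)
      (summable-gap N 0 (summable-⊕ (summable-const 1ℤ) (summable-cong (λ i → ℤₚ.-1*i≡-i (shift (const 1ℤ) i)) (summable-scale ℤ.-1ℤ (summable-shift (summable-const 1ℤ))))))
      (D.∏ N (λ k → 1ℂ D.- y D.^ suc k)) (1ℂ D.- y D.^ suc N)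
      (hasSum-eulerProduct y hy summ N)
      (hasSum-cong y (1ℂ D.- y D.^ suc N) (λ n → sym (V-1-q N n)) (hasSum-⊖ y 1ℂ (y D.^ suc N) (hasSum-monomial y 0) (hasSum-monomial y (suc N))))

    hasSum-euler : ∀ y → Point y → ∀ B → 0ℚ ≤ B → (∀ N n → absSum r n (eulerProduct N) ≤ B) → ∀ w →
      (λ N m → D.∏ N (λ k → 1ℂ D.- y D.^ suc k) ! m) ↝ w → HasSum y euler w
    hasSum-euler y (M , hy) B 0≤B p w h = hasSum (↝-null w (null small-difference) h)
      where
      product : ℕ → ℂ
      product N = D.∏ N (λ k → 1ℂ D.- y D.^ suc k)
      truncated : ∀ n x → evaluate n euler x ≡ evaluate n (eulerProduct n) x
      truncated n x = go n ℕₚ.≤-refl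
        where
        go : ∀ j → j ℕ.≤ n → evaluate j euler x ≡ evaluate j (eulerProduct n) x
        go zero    _   = refl
        go (suc j) j<n = trans (sumᴳ-last j (term euler x)) (trans
          (cong₂ _+ᴳ_ (go j (ℕₚ.<⇒≤ j<n)) (cong (λ c → real (fromℤ c) *ᴳ x ^ᴳ j) (sym (eulerProduct-≤ (ℕₚ.<⇒≤ j<n)))))
          (sym (sumᴳ-last j (term (eulerProduct n) x))))
      small-difference : ∀ ε → 0ℚ < ε → Eventually λ n m → ‖ evaluate n euler (y ! m) -ᴳ product n ! m ‖ < ε
      small-difference ε 0<ε = proj₁ far , λ n n≥ → at n n≥
        where
        far = geometric-null ((1ℚ + 1ℚ) * B) (0≤* 0≤2 0≤B) (½ * ε) (half-pos 0<ε)
        at : ∀ n → proj₁ far ℕ.≤ n → ∃ λ M → ∀ m → M ℕ.≤ m → ‖ evaluate n euler (y ! m) -ᴳ product n ! m ‖ < ε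
        at n n≥ = M ℕ.⊔ proj₁ late , λ m m≥ → subst (‖ evaluate n euler (y ! m) -ᴳ product n ! m ‖ <_) (halves ε)
            (ℚₚ.≤-<-trans (‖triangle‖ (evaluate n euler (y ! m)) (evaluate n′ (eulerProduct n) (y ! m)) (product n ! m))
              (ℚₚ.+-mono-<
                (ℚₚ.≤-<-trans (subst (λ z → ‖ z -ᴳ evaluate n′ (eulerProduct n) (y ! m) ‖ ≤ (1ℚ + 1ℚ) * B * g ^ℚ n) (sym (truncated n (y ! m)))
                    (tail-small (y ! m) (hy m (ℕₚ.m⊔n≤o⇒m≤o M (proj₁ late) m≥)) (eulerProduct n) B (p n) n n′ (ℕₚ.m≤m⊔n n (proj₁ limit-n)))) (proj₂ far n n≥))
                (proj₂ late m (ℕₚ.m⊔n≤o⇒n≤o M (proj₁ late) m≥))))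
          where
          limit-n = Null.smallness (_↝_.error-null (sums (hasSum-eulerProduct y (M , hy) (λ N → summable (B , 0≤B , p N)) n))) (½ * ε) (half-pos 0<ε)
          n′ : ℕ
          n′ = n ℕ.⊔ proj₁ limit-n
          late = proj₂ limit-n n′ (ℕₚ.m≤n⊔m n (proj₁ limit-n))

    hasSum-inverse : ∀ y → Point y → ∀ {f h} → Summable f → Summable h → f ⊛ h ≗ const 1ℤ → ∀ w w⁻¹ → w D.* w⁻¹ ≈ 1ℂ →
      HasSum y f w → HasSum y h w⁻¹
    hasSum-inverse y hy {f} {h} sf sh fh≡1 w w⁻¹ ww⁻¹≈1 (hasSum hf) = hasSum (↝-null w⁻¹ difference (↝-cst w⁻¹))
      where
      S : Series → DoubleSeq
      S f n m = evaluate n f (y ! m)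
      h-bounded : Bounded (S h)
      h-bounded = bounded (let M , b = hy ; B , 0≤B , p = Summable.bound sh in
        1ℚ + (1ℚ + 1ℚ) * B , ℚₚ.+-mono-<-≤ (ℚₚ.positive⁻¹ 1ℚ) (0≤* 0≤2 0≤B) , 0 , λ n _ → M , λ m m≥ →
          ℚₚ.≤-trans (‖sum‖≤norm n (term h (y ! m))) (ℚₚ.≤-trans (norm-term (y ! m) (b m m≥) h n)
            (ℚₚ.≤-trans (*-monoʳ (1ℚ + 1ℚ) 0≤2 (p n)) (subst (_≤ 1ℚ + (1ℚ + 1ℚ) * B) (ℚₚ.+-identityˡ ((1ℚ + 1ℚ) * B)) (ℚₚ.+-monoˡ-≤ ((1ℚ + 1ℚ) * B) 0≤1)))))
      one : HasSum y (f ⊛ h) 1ℂ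
      one = hasSum-cong y 1ℂ (λ n → sym (fh≡1 n)) (hasSum-monomial y 0)
      -- f h ∼ 1 without assuming that the partial sums of h converge.
      partial : Null λ n m → S f n m *ᴳ S h n m -ᴳ 1ᴳ
      partial = null-cong (λ n m → Gsolve 3 (λ a b o → (a ⊝ b) ⊹ (b ⊝ o) ≔ a ⊝ o) refl (S f n m *ᴳ S h n m) (S (f ⊛ h) n m) 1ᴳ)
        (null-+ (product-error y hy sf sh) (_↝_.error-null (sums one)))
      unit : Null λ n m → w ! m *ᴳ w⁻¹ ! m -ᴳ 1ᴳ
      unit = _↝_.error-null (↝-≈ (w D.* w⁻¹) 1ℂ ww⁻¹≈1 (↝-cst (w D.* w⁻¹)))
      difference : Null λ n m → S h n m -ᴳ w⁻¹ ! m
      difference = null-cong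
        (λ n m → Gsolve 4 (λ f h w i → (f ⊗ h ⊝ GSolver.con 1ᴳ) ⊗ i ⊹ GSolver.:- ((f ⊝ w) ⊗ (h ⊗ i) ⊹ (w ⊗ i ⊝ GSolver.con 1ᴳ) ⊗ h) ≔ h ⊝ i) refl
          (S f n m) (S h n m) (w ! m) (w⁻¹ ! m))
        (null-+ (null-* partial (cst-bounded w⁻¹))
          (null-neg (null-+ (null-* (_↝_.error-null hf) (bounded-* h-bounded (cst-bounded w⁻¹))) (null-* unit h-bounded))))

  inverse-ℕ : ∀ d .⦃ _ : NonZero d ⦄ → (+ 1 ℚ./ d) * fromℕ d ≡ 1ℚ
  inverse-ℕ (suc d) = ℚₚ.toℚᵘ-injective (ℚᵘₚ.≃-trans (ℚₚ.toℚᵘ-homo-* (+ 1 ℚ./ suc d) (fromℕ (suc d)))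
    (ℚᵘₚ.≃-trans (ℚᵘₚ.*-cong (ℚₚ.toℚᵘ-fromℚᵘ (ℚᵘ.mkℚᵘ (+ 1) d)) (ℚₚ.toℚᵘ-fromℚᵘ (ℚᵘ.mkℚᵘ (+ suc d) 0)))
      (ℚᵘ.*≡* (cong +_ (trans (ℕₚ.*-identityʳ (1 ℕ.* suc d)) (cong (1 ℕ.*_) (sym (ℕₚ.*-identityʳ (suc d)))))))))

  invFact : ℕ → ℚ
  invFact k = (+ 1 ℚ./ (k !)) ⦃ ℕₚ._!≢0 k ⦄

  invFact-! : ∀ k → invFact k * fromℕ (k !) ≡ 1ℚ
  invFact-! k = inverse-ℕ (k !) ⦃ ℕₚ._!≢0 k ⦄

  fromℕ-* : ∀ m n → fromℕ (m ℕ.* n) ≡ fromℕ m * fromℕ n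
  fromℕ-* m n = trans (cong fromℤ (ℤₚ.pos-* m n)) (fromℤ-* (+ m) (+ n))

  invFact-suc : ∀ k → fromℕ (suc k) * invFact (suc k) ≡ invFact k
  invFact-suc k = begin
    a * i                       ≡⟨ sym (trans (cong (a * i *_) (invFact-! k)) (ℚₚ.*-identityʳ (a * i))) ⟩
    a * i * (j * b)             ≡⟨ solve 4 (λ a i j b → a :* i :* (j :* b) := i :* (a :* b) :* j) refl a i j b ⟩
    i * (a * b) * j             ≡⟨ cong (λ c → i * c * j) (sym (fromℕ-* (suc k) (k !))) ⟩
    i * fromℕ (suc k !) * j     ≡⟨ cong (_* j) (invFact-! (suc k)) ⟩
    1ℚ * j                      ≡⟨ ℚₚ.*-identityˡ j ⟩
    j                           ∎
    where
    open ≡-Reasoning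
    a b i j : ℚ
    a = fromℕ (suc k)
    b = fromℕ (k !)
    i = invFact (suc k)
    j = invFact k

  0<inverse : ∀ d .⦃ _ : NonZero d ⦄ → 0ℚ < + 1 ℚ./ d
  0<inverse d = ℚₚ.positive⁻¹ (+ 1 ℚ./ d) ⦃ ℚₚ.normalize-pos 1 d ⦄

  0≤invFact : ∀ k → 0ℚ ≤ invFact k
  0≤invFact k = ℚₚ.<⇒≤ (0<inverse (k !) ⦃ ℕₚ._!≢0 k ⦄)

  exponential : G → ℕ → G
  exponential v k = real (invFact k) *ᴳ v ^ᴳ k

  exponential-0 : ∀ v → exponential v 0 ≡ 1ᴳ
  exponential-0 v = *ᴳ-identityʳ 1ᴳ

  exponential-suc : ∀ v k → real (fromℕ (suc k)) *ᴳ exponential v (suc k) ≡ v *ᴳ exponential v k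
  exponential-suc v k = trans (Gsolve 4 (λ n i v e → n ⊗ (i ⊗ (v ⊗ e)) ≔ v ⊗ (n ⊗ i ⊗ e)) refl (real (fromℕ (suc k))) (real (invFact (suc k))) v (v ^ᴳ k))
    (cong (λ c → v *ᴳ (c *ᴳ v ^ᴳ k)) (trans (sym (real-* (fromℕ (suc k)) (invFact (suc k)))) (cong real (invFact-suc k))))

  weighted : (ℕ → G) → ℕ → G
  weighted α k = real (fromℕ k) *ᴳ α k

  ⋆-congʳ : ∀ n (α : ℕ → G) {β γ : ℕ → G} → (∀ i → β i ≡ γ i) → (α ⋆ β) n ≡ (α ⋆ γ) n
  ⋆-congʳ zero    α h = cong (α 0 *ᴳ_) (h 0)
  ⋆-congʳ (suc n) α h = cong₂ _+ᴳ_ (cong (α 0 *ᴳ_) (h (suc n))) (⋆-congʳ n (α ∘ suc) h)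

  ⋆-scaleˡ : ∀ n c α β → ((λ i → c *ᴳ α i) ⋆ β) n ≡ c *ᴳ (α ⋆ β) n
  ⋆-scaleˡ zero    c α β = *ᴳ-assoc c (α 0) (β 0)
  ⋆-scaleˡ (suc n) c α β = trans (cong₂ _+ᴳ_ (*ᴳ-assoc c (α 0) (β (suc n))) (⋆-scaleˡ n c (α ∘ suc) β)) (sym (*ᴳ-distribˡ c (α 0 *ᴳ β (suc n)) (((α ∘ suc) ⋆ β) n)))

  ⋆-scaleʳ : ∀ n c α β → (α ⋆ (λ i → c *ᴳ β i)) n ≡ c *ᴳ (α ⋆ β) n
  ⋆-scaleʳ zero    c α β = Gsolve 3 (λ c a b → a ⊗ (c ⊗ b) ≔ c ⊗ (a ⊗ b)) refl c (α 0) (β 0)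
  ⋆-scaleʳ (suc n) c α β = trans (cong (α 0 *ᴳ (c *ᴳ β (suc n)) +ᴳ_) (⋆-scaleʳ n c (α ∘ suc) β))
    (Gsolve 4 (λ c a b s → a ⊗ (c ⊗ b) ⊹ c ⊗ s ≔ c ⊗ (a ⊗ b ⊹ s)) refl c (α 0) (β (suc n)) (((α ∘ suc) ⋆ β) n))

  ⋆-addˡ : ∀ n α β γ → ((λ i → α i +ᴳ β i) ⋆ γ) n ≡ (α ⋆ γ) n +ᴳ (β ⋆ γ) n
  ⋆-addˡ zero    α β γ = *ᴳ-distribʳ (γ 0) (α 0) (β 0)
  ⋆-addˡ (suc n) α β γ = trans (cong ((α 0 +ᴳ β 0) *ᴳ γ (suc n) +ᴳ_) (⋆-addˡ n (α ∘ suc) (β ∘ suc) γ))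
    (Gsolve 5 (λ a b c s t → (a ⊹ b) ⊗ c ⊹ (s ⊹ t) ≔ (a ⊗ c ⊹ s) ⊹ (b ⊗ c ⊹ t)) refl (α 0) (β 0) (γ (suc n)) (((α ∘ suc) ⋆ γ) n) (((β ∘ suc) ⋆ γ) n))

  ⋆-last : ∀ n α β → (α ⋆ β) (suc n) ≡ α (suc n) *ᴳ β 0 +ᴳ (α ⋆ (β ∘ suc)) n
  ⋆-last zero    α β = +ᴳ-comm (α 0 *ᴳ β 1) (α 1 *ᴳ β 0)
  ⋆-last (suc n) α β = trans (cong (α 0 *ᴳ β (suc (suc n)) +ᴳ_) (⋆-last n (α ∘ suc) β))
    (Gsolve 3 (λ a b c → a ⊹ (b ⊹ c) ≔ b ⊹ (a ⊹ c)) refl (α 0 *ᴳ β (suc (suc n))) (α (suc (suc n)) *ᴳ β 0) (((α ∘ suc) ⋆ (β ∘ suc)) n))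

  weighted-suc : ∀ α k → weighted α (suc k) ≡ α (suc k) +ᴳ weighted (α ∘ suc) k
  weighted-suc α k = trans (cong (λ c → real c *ᴳ α (suc k)) (fromℕ-suc k))
    (trans (*ᴳ-distribʳ (α (suc k)) 1ᴳ (real (fromℕ k))) (cong (_+ᴳ weighted (α ∘ suc) k) (*ᴳ-identityˡ (α (suc k)))))

  weighted-⋆ : ∀ n α β → weighted (α ⋆ β) n ≡ (weighted α ⋆ β) n +ᴳ (α ⋆ weighted β) n
  weighted-⋆ zero    α β = Gsolve 2 (λ a b → z ⊗ (a ⊗ b) ≔ z ⊗ a ⊗ b ⊹ a ⊗ (z ⊗ b)) refl (α 0) (β 0)
    where
    z : ∀ {k} → GSolver.Polynomial k
    z = GSolver.con 0ᴳ
  weighted-⋆ (suc n) α β = begin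
    weighted (α ⋆ β) (suc n)
      ≡⟨ cong (λ c → real c *ᴳ (α ⋆ β) (suc n)) (fromℕ-suc n) ⟩
    real (1ℚ + fromℕ n) *ᴳ (α 0 *ᴳ β (suc n) +ᴳ s)
      ≡⟨ Gsolve 4 (λ n a b s → (GSolver.con 1ᴳ ⊹ n) ⊗ (a ⊗ b ⊹ s) ≔ a ⊗ ((GSolver.con 1ᴳ ⊹ n) ⊗ b) ⊹ (s ⊹ n ⊗ s)) refl (real (fromℕ n)) (α 0) (β (suc n)) s ⟩
    α 0 *ᴳ (real (1ℚ + fromℕ n) *ᴳ β (suc n)) +ᴳ (s +ᴳ weighted ((α ∘ suc) ⋆ β) n)
      ≡⟨ cong₂ (λ c t → α 0 *ᴳ (real c *ᴳ β (suc n)) +ᴳ (s +ᴳ t)) (sym (fromℕ-suc n)) (weighted-⋆ n (α ∘ suc) β) ⟩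
    α 0 *ᴳ weighted β (suc n) +ᴳ (s +ᴳ ((weighted (α ∘ suc) ⋆ β) n +ᴳ ((α ∘ suc) ⋆ weighted β) n))
      ≡⟨ Gsolve 4 (λ x s t u → x ⊹ (s ⊹ (t ⊹ u)) ≔ (s ⊹ t) ⊹ (x ⊹ u)) refl (α 0 *ᴳ weighted β (suc n)) s ((weighted (α ∘ suc) ⋆ β) n) (((α ∘ suc) ⋆ weighted β) n) ⟩
    (s +ᴳ (weighted (α ∘ suc) ⋆ β) n) +ᴳ (α ⋆ weighted β) (suc n)
      ≡⟨ cong (_+ᴳ (α ⋆ weighted β) (suc n)) (sym (trans
           (cong (_+ᴳ ((weighted α ∘ suc) ⋆ β) n) (trans (cong (_*ᴳ β (suc n)) (*ᴳ-zeroˡ (α 0))) (*ᴳ-zeroˡ (β (suc n)))))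
           (trans (+ᴳ-identityˡ (((weighted α ∘ suc) ⋆ β) n)) (trans (⋆-congˡ n β (weighted-suc α)) (⋆-addˡ n (α ∘ suc) (weighted (α ∘ suc)) β))))) ⟩
    (weighted α ⋆ β) (suc n) +ᴳ (α ⋆ weighted β) (suc n) ∎
    where
    open ≡-Reasoning
    s : G
    s = ((α ∘ suc) ⋆ β) n

  exponential-⋆ : ∀ v w n → (exponential v ⋆ exponential w) n ≡ exponential (v +ᴳ w) n
  exponential-⋆ v w zero    = trans (cong₂ _*ᴳ_ (exponential-0 v) (exponential-0 w)) (trans (*ᴳ-identityˡ 1ᴳ) (sym (exponential-0 (v +ᴳ w))))
  exponential-⋆ v w (suc n) = begin
    c (suc n)
      ≡⟨ sym (trans (cong (_*ᴳ c (suc n)) unit) (*ᴳ-identityˡ (c (suc n)))) ⟩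
    real i *ᴳ real (fromℕ (suc n)) *ᴳ c (suc n)
      ≡⟨ *ᴳ-assoc (real i) (real (fromℕ (suc n))) (c (suc n)) ⟩
    real i *ᴳ weighted (exponential v ⋆ exponential w) (suc n)
      ≡⟨ cong (real i *ᴳ_) (trans (weighted-⋆ (suc n) (exponential v) (exponential w)) (cong₂ _+ᴳ_ left right)) ⟩
    real i *ᴳ (v *ᴳ c n +ᴳ w *ᴳ c n)
      ≡⟨ cong (real i *ᴳ_) (trans (sym (*ᴳ-distribʳ (c n) v w)) (cong ((v +ᴳ w) *ᴳ_) (exponential-⋆ v w n))) ⟩
    real i *ᴳ ((v +ᴳ w) *ᴳ exponential (v +ᴳ w) n)
      ≡⟨ cong (real i *ᴳ_) (sym (exponential-suc (v +ᴳ w) n)) ⟩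
    real i *ᴳ (real (fromℕ (suc n)) *ᴳ exponential (v +ᴳ w) (suc n))
      ≡⟨ trans (sym (*ᴳ-assoc (real i) (real (fromℕ (suc n))) (exponential (v +ᴳ w) (suc n)))) (trans (cong (_*ᴳ exponential (v +ᴳ w) (suc n)) unit) (*ᴳ-identityˡ (exponential (v +ᴳ w) (suc n)))) ⟩
    exponential (v +ᴳ w) (suc n) ∎
    where
    open ≡-Reasoning
    c : ℕ → G
    c = exponential v ⋆ exponential w
    i : ℚ
    i = + 1 ℚ./ suc n
    unit : real i *ᴳ real (fromℕ (suc n)) ≡ 1ᴳ
    unit = trans (sym (real-* i (fromℕ (suc n)))) (cong real (inverse-ℕ (suc n)))
    left : (weighted (exponential v) ⋆ exponential w) (suc n) ≡ v *ᴳ c n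
    left = trans (cong₂ _+ᴳ_ (trans (cong (_*ᴳ exponential w (suc n)) (*ᴳ-zeroˡ (exponential v 0))) (*ᴳ-zeroˡ (exponential w (suc n))))
      (trans (⋆-congˡ n (exponential w) (exponential-suc v)) (⋆-scaleˡ n v (exponential v) (exponential w)))) (+ᴳ-identityˡ (v *ᴳ c n))
    right : (exponential v ⋆ weighted (exponential w)) (suc n) ≡ w *ᴳ c n
    right = trans (⋆-last n (exponential v) (weighted (exponential w)))
      (trans (cong₂ _+ᴳ_ (trans (cong (exponential v (suc n) *ᴳ_) (*ᴳ-zeroˡ (exponential w 0))) (*ᴳ-zeroʳ (exponential v (suc n))))
        (trans (⋆-congʳ n (exponential v) (exponential-suc w)) (⋆-scaleʳ n w (exponential v) (exponential w)))) (+ᴳ-identityˡ (w *ᴳ c n)))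

  two : ℚ
  two = 1ℚ + 1ℚ

  1≤two : 1ℚ ≤ two
  1≤two = subst (_≤ two) (ℚₚ.+-identityʳ 1ℚ) (ℚₚ.+-monoʳ-≤ 1ℚ 0≤1)

  open Weighted two 1≤two using (norm-last; cauchy-product; 0≤norm) renaming (0≤μ to 0≤two)

  expSum : ℚ → ℕ → ℚ
  expSum x zero    = 0ℚ
  expSum x (suc n) = expSum x n + invFact n * x ^ℚ n

  ‖^‖ : ∀ w n → ‖ w ^ᴳ n ‖ ≤ ‖ w ‖ ^ℚ n
  ‖^‖ w zero    = ℚₚ.≤-refl
  ‖^‖ w (suc n) = ℚₚ.≤-trans (‖*‖ w (w ^ᴳ n)) (*-monoʳ (‖ w ‖) (0≤‖‖ w) (‖^‖ w n))

  norm-exponential : ∀ v C → ‖ v ‖ ≤ C → ∀ n → norm two n (exponential v) ≤ expSum (two * C) n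
  norm-exponential v C h zero    = ℚₚ.≤-refl
  norm-exponential v C h (suc n) = subst (_≤ expSum (two * C) (suc n)) (sym (norm-last n (exponential v)))
    (ℚₚ.+-mono-≤ (norm-exponential v C h n) (begin
      two ^ℚ n * ‖ exponential v n ‖
        ≡⟨ cong (two ^ℚ n *_) (trans (‖real*‖ (invFact n) (v ^ᴳ n)) (cong (_* ‖ v ^ᴳ n ‖) (ℚₚ.0≤p⇒∣p∣≡p (0≤invFact n)))) ⟩
      two ^ℚ n * (invFact n * ‖ v ^ᴳ n ‖)
        ≤⟨ *-monoʳ (two ^ℚ n) (0≤^ n 0≤two) (*-monoʳ (invFact n) (0≤invFact n) (ℚₚ.≤-trans (‖^‖ v n) (^-mono n (0≤‖‖ v) h))) ⟩
      two ^ℚ n * (invFact n * C ^ℚ n)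
        ≡⟨ trans (solve 3 (λ t i c → t :* (i :* c) := i :* (t :* c)) refl (two ^ℚ n) (invFact n) (C ^ℚ n)) (cong (invFact n *_) (sym (*-^ two C n))) ⟩
      invFact n * (two * C) ^ℚ n ∎))
    where open ℚₚ.≤-Reasoning

  module _ (x : ℚ) (0<x : 0ℚ < x) where
    private
      t : ℕ → ℚ
      t n = invFact n * x ^ℚ n

      0≤t : ∀ n → 0ℚ ≤ t n
      0≤t n = 0≤* (0≤invFact n) (0≤^ n (ℚₚ.<⇒≤ 0<x))

      t-suc : ∀ n → fromℕ (suc n) * t (suc n) ≡ x * t n
      t-suc n = trans (solve 4 (λ a i x p → a :* (i :* (x :* p)) := x :* (a :* i :* p)) refl (fromℕ (suc n)) (invFact (suc n)) x (x ^ℚ n))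
        (cong (λ i → x * (i * x ^ℚ n)) (invFact-suc n))

      halving : ∀ n → two * x ≤ fromℕ n → two * t (suc n) ≤ t n
      halving n h = ℚₚ.*-cancelˡ-≤-pos x ⦃ ℚ.positive 0<x ⦄ (begin
        x * (two * t (suc n))     ≡⟨ solve 3 (λ x t w → x :* (t :* w) := t :* x :* w) refl x two (t (suc n)) ⟩
        two * x * t (suc n)       ≤⟨ *-monoˡ (t (suc n)) (0≤t (suc n)) (ℚₚ.≤-trans h (fromℕ-mono (ℕₚ.n≤1+n n))) ⟩
        fromℕ (suc n) * t (suc n) ≡⟨ t-suc n ⟩
        x * t n                   ∎)
        where open ℚₚ.≤-Reasoning

      N : ℕ
      N = proj₁ (archimedean (two * x))

      late : ∀ k → expSum x (k ℕ.+ N) + two * t (k ℕ.+ N) ≤ expSum x N + two * t N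
      late zero    = ℚₚ.≤-refl
      late (suc k) = ℚₚ.≤-trans (begin
        expSum x (k ℕ.+ N) + t (k ℕ.+ N) + two * t (suc (k ℕ.+ N))
          ≤⟨ ℚₚ.+-monoʳ-≤ (expSum x (k ℕ.+ N) + t (k ℕ.+ N)) (halving (k ℕ.+ N) (ℚₚ.≤-trans (ℚₚ.<⇒≤ (proj₂ (archimedean (two * x)))) (fromℕ-mono (ℕₚ.m≤n+m N k)))) ⟩
        expSum x (k ℕ.+ N) + t (k ℕ.+ N) + t (k ℕ.+ N)
          ≡⟨ solve 2 (λ s t → s :+ t :+ t := s :+ con two :* t) refl (expSum x (k ℕ.+ N)) (t (k ℕ.+ N)) ⟩
        expSum x (k ℕ.+ N) + two * t (k ℕ.+ N) ∎) (late k)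
        where open ℚₚ.≤-Reasoning

      increasing : ∀ k n → expSum x n ≤ expSum x (k ℕ.+ n)
      increasing zero    n = ℚₚ.≤-refl
      increasing (suc k) n = ℚₚ.≤-trans (increasing k n) (subst (_≤ expSum x (suc (k ℕ.+ n))) (ℚₚ.+-identityʳ (expSum x (k ℕ.+ n))) (ℚₚ.+-monoʳ-≤ (expSum x (k ℕ.+ n)) (0≤t (k ℕ.+ n))))

    expSum-bound : ℚ
    expSum-bound = expSum x N + two * t N

    expSum-bounded : ∀ n → expSum x n ≤ expSum-bound
    expSum-bounded n = ℚₚ.≤-trans (increasing N n) (subst (λ k → expSum x k ≤ expSum-bound) (ℕₚ.+-comm n N)
      (ℚₚ.≤-trans (subst (_≤ expSum x (n ℕ.+ N) + two * t (n ℕ.+ N)) (ℚₚ.+-identityʳ (expSum x (n ℕ.+ N))) (ℚₚ.+-monoʳ-≤ (expSum x (n ℕ.+ N)) (0≤* 0≤two (0≤t (n ℕ.+ N))))) (late n)))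

  bernoulli : ∀ c → 0ℚ ≤ c → ∀ n → 1ℚ + fromℕ n * c ≤ (1ℚ + c) ^ℚ n
  bernoulli c 0≤c zero    = ℚₚ.≤-reflexive (solve 1 (λ c → con 1ℚ :+ con 0ℚ :* c := con 1ℚ) refl c)
  bernoulli c 0≤c (suc n) = begin
    1ℚ + fromℕ (suc n) * c
      ≡⟨ trans (cong (λ k → 1ℚ + k * c) (fromℕ-suc n)) (solve 2 (λ k c → con 1ℚ :+ (con 1ℚ :+ k) :* c := con 1ℚ :+ c :+ k :* c :+ con 0ℚ) refl (fromℕ n) c) ⟩
    1ℚ + c + fromℕ n * c + 0ℚ
      ≤⟨ ℚₚ.+-monoʳ-≤ (1ℚ + c + fromℕ n * c) (0≤* 0≤c (0≤* (0≤fromℕ n) 0≤c)) ⟩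
    1ℚ + c + fromℕ n * c + c * (fromℕ n * c)
      ≡⟨ solve 2 (λ k c → con 1ℚ :+ c :+ k :* c :+ c :* (k :* c) := (con 1ℚ :+ c) :* (con 1ℚ :+ k :* c)) refl (fromℕ n) c ⟩
    (1ℚ + c) * (1ℚ + fromℕ n * c)
      ≤⟨ *-monoʳ (1ℚ + c) (0≤+ 0≤1 0≤c) (bernoulli c 0≤c n) ⟩
    (1ℚ + c) ^ℚ suc n ∎
    where open ℚₚ.≤-Reasoning

  null-harmonic : ∀ {x} C → (∃ λ M → ∀ n m → M ℕ.≤ m → fromℕ n * ‖ x n m ‖ ≤ C) → Null x
  null-harmonic {x} C (M , h) = null λ ε 0<ε →
    let N , C<εN = archimedean-* C ε 0<ε in suc N , λ n N<n → M , λ m m≥ →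
      ℚₚ.*-cancelˡ-<-nonNeg (fromℕ n) ⦃ ℚ.nonNegative (0≤fromℕ n) ⦄ (ℚₚ.≤-<-trans (h n m m≥)
        (ℚₚ.<-≤-trans C<εN (subst (ε * fromℕ N ≤_) (ℚₚ.*-comm ε (fromℕ n)) (*-monoʳ ε (ℚₚ.<⇒≤ 0<ε) (fromℕ-mono (ℕₚ.<⇒≤ N<n))))))

  ∑-! : ∀ N (a : ℕ → ℂ) m → D.∑ N a ! m ≡ sumᴳ N (λ i → a i ! m)
  ∑-! zero    a m = refl
  ∑-! (suc N) a m = trans (cong (_+ᴳ a N ! m) (∑-! N a m)) (sym (sumᴳ-last N (λ i → a i ! m)))

  module Exponential (F : D.ModularFunctions) where
    open D.ModularFunctions using (exp; isExp)

    exp-sums : ∀ w → (λ n m → sumᴳ n (exponential (w ! m))) ↝ exp F w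
    exp-sums w = ↝-cong (exp F w) partial (⟶⇒↝ (λ N → D.∑ N summand) (exp F w) (isExp F w))
      where
      summand : ℕ → ℂ
      summand k = ((+ 1 ℚ./ (k !)) ⦃ ℕₚ._!≢0 k ⦄) D.· w D.^ k
      summand-! : ∀ m k → summand k ! m ≡ exponential (w ! m) k
      summand-! m k = trans (real-· ((+ 1 ℚ./ (k !)) ⦃ ℕₚ._!≢0 k ⦄) (w D.^ k) m) (cong (real (invFact k) *ᴳ_) (^-! w k m))
      partial : ∀ n m → D.∑ n summand ! m ≡ sumᴳ n (exponential (w ! m))
      partial n m = trans (∑-! n summand m) (sumᴳ-cong n (summand-! m))

    exp-+ : ∀ u v w → (∀ m → w ! m ≡ u ! m +ᴳ v ! m) → exp F w ≈ exp F u D.* exp F v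
    exp-+ u v w e = ↝-unique (exp F w) (exp F u D.* exp F v) (exp-sums w) (↝-null (exp F u D.* exp F v) difference (↝-* (exp F u) (exp F v) (exp-sums u) (exp-sums v)))
      where
      S : ℂ → DoubleSeq
      S w n m = sumᴳ n (exponential (w ! m))
      bound : ∀ w → ∃ λ B → 0ℚ ≤ B × ∃ λ M → ∀ n m → M ℕ.≤ m → norm two n (exponential (w ! m)) ≤ B
      bound w = let C , 0<C , M , h = constant-bounded w ; 0<x = 0<* (ℚₚ.positive⁻¹ two) 0<C in
        expSum-bound (two * C) 0<x , expSum-bounded (two * C) 0<x 0 , M , λ n m m≥ →
          ℚₚ.≤-trans (norm-exponential (w ! m) C (h m m≥) n) (expSum-bounded (two * C) 0<x n)
      difference : Null λ n m → S w n m -ᴳ S u n m *ᴳ S v n m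
      difference = let B , 0≤B , M , p = bound u ; C , 0≤C , M′ , k = bound v in null-harmonic (B * C) (M ℕ.⊔ M′ , λ n m m≥ → begin
        fromℕ n * ‖ S w n m -ᴳ S u n m *ᴳ S v n m ‖
          ≤⟨ *-monoˡ (‖ S w n m -ᴳ S u n m *ᴳ S v n m ‖) (0≤‖‖ (S w n m -ᴳ S u n m *ᴳ S v n m)) (n≤2ⁿ n) ⟩
        two ^ℚ n * ‖ S w n m -ᴳ S u n m *ᴳ S v n m ‖
          ≡⟨ cong (two ^ℚ n *_) (trans (‖swap‖ (S w n m) (S u n m *ᴳ S v n m)) (cong (λ s → ‖ S u n m *ᴳ S v n m -ᴳ s ‖)
               (sumᴳ-cong n (λ i → trans (cong (λ x → exponential x i) (e m)) (sym (exponential-⋆ (u ! m) (v ! m) i)))))) ⟩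
        two ^ℚ n * ‖ S u n m *ᴳ S v n m -ᴳ sumᴳ n (exponential (u ! m) ⋆ exponential (v ! m)) ‖
          ≤⟨ cauchy-product n (exponential (u ! m)) (exponential (v ! m)) ⟩
        norm two n (exponential (u ! m)) * norm two n (exponential (v ! m))
          ≤⟨ *-mono-≤ (0≤norm n (exponential (u ! m))) (p n m (ℕₚ.m⊔n≤o⇒m≤o M M′ m≥)) (0≤norm n (exponential (v ! m))) (k n m (ℕₚ.m⊔n≤o⇒n≤o M M′ m≥)) ⟩
        B * C ∎)
        where
        open ℚₚ.≤-Reasoning
        n≤2ⁿ : ∀ n → fromℕ n ≤ two ^ℚ n
        n≤2ⁿ n = ℚₚ.≤-trans (subst (_≤ 1ℚ + fromℕ n * 1ℚ) (trans (ℚₚ.+-identityˡ (fromℕ n * 1ℚ)) (ℚₚ.*-identityʳ (fromℕ n))) (ℚₚ.+-monoˡ-≤ (fromℕ n * 1ℚ) 0≤1)) (bernoulli 1ℚ 0≤1 n)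

    exp-0 : ∀ w → (∀ m → w ! m ≡ 0ᴳ) → exp F w ≈ 1ℂ
    exp-0 w e = ↝-unique (exp F w) 1ℂ (exp-sums w) (↝-constant 1ℂ 1 λ { (suc n) m _ → trans (cong (λ x → sumᴳ (suc n) (exponential x)) (e m)) (at-0 n) })
      where
      rest : ∀ n → sumᴳ n (λ i → exponential 0ᴳ (suc i)) ≡ 0ᴳ
      rest n = trans (sumᴳ-cong n (λ i → trans (cong (real (invFact (suc i)) *ᴳ_) (*ᴳ-zeroˡ (0ᴳ ^ᴳ i))) (trans (*ᴳ-zeroʳ (real (invFact (suc i)))) (sym (*ᴳ-zeroˡ 0ᴳ)))))
        (trans (sumᴳ-*ˡ n 0ᴳ (λ _ → 0ᴳ)) (*ᴳ-zeroˡ (sumᴳ n (λ _ → 0ᴳ))))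
      at-0 : ∀ n → sumᴳ (suc n) (exponential 0ᴳ) ≡ 1ᴳ
      at-0 n = trans (cong₂ _+ᴳ_ (*ᴳ-identityˡ 1ᴳ) (rest n)) (+ᴳ-identityʳ 1ᴳ)

    exp-multiple : ∀ w n v → (∀ m → v ! m ≡ real (fromℕ n) *ᴳ w ! m) → exp F v ≈ exp F w D.^ n
    exp-multiple w zero    v e = exp-0 v (λ m → trans (e m) (*ᴳ-zeroˡ (w ! m)))
    exp-multiple w (suc n) v e = ≈-trans (exp F v) (exp F w D.* exp F u) (exp F w D.* exp F w D.^ n)
      (exp-+ w u v (λ m → trans (e m) (trans (cong (λ c → real c *ᴳ w ! m) (fromℕ-suc n))
        (trans (*ᴳ-distribʳ (w ! m) 1ᴳ (real (fromℕ n))) (cong₂ _+ᴳ_ (*ᴳ-identityˡ (w ! m)) (sym (real-· (fromℕ n) w m)))))))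
      (*-cong (exp F w) (exp F w) (exp F u) (exp F w D.^ n) (pointwise⇒≈ (exp F w) (exp F w) (λ _ → refl)) (exp-multiple w n u (real-· (fromℕ n) w)))
      where
      u : ℂ
      u = fromℕ n D.· w

    exp-inverse : ∀ w v → (∀ m → v ! m ≡ negᴳ (w ! m)) → exp F w D.* exp F v ≈ 1ℂ
    exp-inverse w v e = ≈-trans (exp F w D.* exp F v) (exp F 0ℂ) 1ℂ
      (≈-sym (exp F 0ℂ) (exp F w D.* exp F v) (exp-+ w v 0ℂ (λ m → sym (trans (cong (w ! m +ᴳ_) (e m)) (Gsolve 1 (λ w → w ⊹ GSolver.:- w ≔ GSolver.con 0ᴳ) refl (w ! m))))))
      (exp-0 0ℂ (λ _ → refl))

  0≤- : ∀ {a b} → a ≤ b → 0ℚ ≤ b - a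
  0≤- {a} {b} h = subst (_≤ b - a) (ℚₚ.+-inverseʳ a) (ℚₚ.+-monoˡ-≤ (- a) h)

  bernoulli-< : ∀ c → 0ℚ ≤ c → c ≤ 1ℚ → ∀ n → 1ℚ - fromℕ n * c ≤ (1ℚ - c) ^ℚ n
  bernoulli-< c 0≤c c≤1 zero    = ℚₚ.≤-reflexive (solve 1 (λ c → con 1ℚ :- con 0ℚ :* c := con 1ℚ) refl c)
  bernoulli-< c 0≤c c≤1 (suc n) = begin
    1ℚ - fromℕ (suc n) * c
      ≡⟨ trans (cong (λ k → 1ℚ - k * c) (fromℕ-suc n)) (solve 2 (λ k c → con 1ℚ :- (con 1ℚ :+ k) :* c := con 1ℚ :- c :- k :* c :+ con 0ℚ) refl (fromℕ n) c) ⟩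
    1ℚ - c - fromℕ n * c + 0ℚ
      ≤⟨ ℚₚ.+-monoʳ-≤ (1ℚ - c - fromℕ n * c) (0≤* 0≤c (0≤* (0≤fromℕ n) 0≤c)) ⟩
    1ℚ - c - fromℕ n * c + c * (fromℕ n * c)
      ≡⟨ solve 2 (λ k c → con 1ℚ :- c :- k :* c :+ c :* (k :* c) := (con 1ℚ :- c) :* (con 1ℚ :- k :* c)) refl (fromℕ n) c ⟩
    (1ℚ - c) * (1ℚ - fromℕ n * c)
      ≤⟨ *-monoʳ (1ℚ - c) (0≤- c≤1) (bernoulli-< c 0≤c c≤1 n) ⟩
    (1ℚ - c) ^ℚ suc n ∎
    where open ℚₚ.≤-Reasoning

  module Geometric (p : ℕ) where
    P K b c g μ : ℚ
    P = fromℕ (suc p)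
    K = fromℕ (suc (suc p))
    b = + 1 ℚ./ suc p
    c = + 1 ℚ./ suc (suc p)
    g = 1ℚ - c
    μ = 1ℚ + b

    K≡1+P : K ≡ 1ℚ + P
    K≡1+P = fromℕ-suc (suc p)

    cK : c * K ≡ 1ℚ
    cK = inverse-ℕ (suc (suc p))

    bP : b * P ≡ 1ℚ
    bP = inverse-ℕ (suc p)

    0<c : 0ℚ < c
    0<c = 0<inverse (suc (suc p))

    0<b : 0ℚ < b
    0<b = 0<inverse (suc p)

    1≤K : 1ℚ ≤ K
    1≤K = fromℕ-mono {1} {suc (suc p)} (ℕ.s≤s ℕ.z≤n)

    c≤1 : c ≤ 1ℚ
    c≤1 = subst₂ _≤_ (ℚₚ.*-identityʳ c) cK (*-monoʳ c (ℚₚ.<⇒≤ 0<c) 1≤K)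

    1≤μ : 1ℚ ≤ μ
    1≤μ = subst (_≤ μ) (ℚₚ.+-identityʳ 1ℚ) (ℚₚ.+-monoʳ-≤ 1ℚ (ℚₚ.<⇒≤ 0<b))

    0≤g : 0ℚ ≤ g
    0≤g = 0≤- c≤1

    g≤1 : g ≤ 1ℚ
    g≤1 = subst (g ≤_) (ℚₚ.+-identityʳ 1ℚ) (ℚₚ.+-monoʳ-≤ 1ℚ (ℚₚ.neg-antimono-≤ (ℚₚ.<⇒≤ 0<c)))

    gμ≡1 : g * μ ≡ 1ℚ
    gμ≡1 = begin
      (1ℚ - c) * (1ℚ + b)
        ≡⟨ solve 2 (λ c b → (con 1ℚ :- c) :* (con 1ℚ :+ b) := con 1ℚ :+ (b :- c :* (con 1ℚ :+ b))) refl c b ⟩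
      1ℚ + (b - c * (1ℚ + b))
        ≡⟨ cong (λ x → 1ℚ + (b - c * (x + b))) (sym bP) ⟩
      1ℚ + (b - c * (b * P + b))
        ≡⟨ solve 3 (λ c b P → con 1ℚ :+ (b :- c :* (b :* P :+ b)) := con 1ℚ :+ b :* (con 1ℚ :- c :* (con 1ℚ :+ P))) refl c b P ⟩
      1ℚ + b * (1ℚ - c * (1ℚ + P))
        ≡⟨ cong (λ x → 1ℚ + b * (1ℚ - x)) (trans (cong (c *_) (sym K≡1+P)) cK) ⟩
      1ℚ + b * (1ℚ - 1ℚ)
        ≡⟨ solve 1 (λ b → con 1ℚ :+ b :* (con 1ℚ :- con 1ℚ) := con 1ℚ) refl b ⟩
      1ℚ ∎
      where open ≡-Reasoning

    0≤μ : 0ℚ ≤ μ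
    0≤μ = ℚₚ.≤-trans 0≤1 1≤μ

    P≤K : P ≤ K
    P≤K = fromℕ-mono (ℕₚ.n≤1+n (suc p))

    n*gⁿ≤K : ∀ n → fromℕ n * g ^ℚ n ≤ K
    n*gⁿ≤K n = ℚₚ.≤-trans (begin
      fromℕ n * g ^ℚ n
        ≡⟨ sym (trans (cong (λ x → x * (fromℕ n * g ^ℚ n)) (trans (ℚₚ.*-comm P b) bP)) (ℚₚ.*-identityˡ (fromℕ n * g ^ℚ n))) ⟩
      P * b * (fromℕ n * g ^ℚ n)
        ≡⟨ solve 4 (λ P b n e → P :* b :* (n :* e) := P :* e :* (n :* b)) refl P b (fromℕ n) (g ^ℚ n) ⟩
      P * g ^ℚ n * (fromℕ n * b)
        ≤⟨ *-monoʳ (P * g ^ℚ n) (0≤* (0≤fromℕ (suc p)) (0≤^ n 0≤g)) nb≤μⁿ ⟩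
      P * g ^ℚ n * μ ^ℚ n
        ≡⟨ trans (ℚₚ.*-assoc P (g ^ℚ n) (μ ^ℚ n)) (cong (P *_) (trans (sym (*-^ g μ n)) (trans (cong (_^ℚ n) gμ≡1) (1^ n)))) ⟩
      P * 1ℚ
        ≡⟨ ℚₚ.*-identityʳ P ⟩
      P ∎) P≤K
      where
      open ℚₚ.≤-Reasoning
      nb≤μⁿ : fromℕ n * b ≤ μ ^ℚ n
      nb≤μⁿ = ℚₚ.≤-trans (subst (_≤ 1ℚ + fromℕ n * b) (ℚₚ.+-identityˡ (fromℕ n * b)) (ℚₚ.+-monoˡ-≤ (fromℕ n * b) 0≤1)) (bernoulli b (ℚₚ.<⇒≤ 0<b) n)

    1+gK : 1ℚ + g * K ≡ K
    1+gK = trans (solve 2 (λ c K → con 1ℚ :+ (con 1ℚ :- c) :* K := (con 1ℚ :- c :* K) :+ K) refl c K)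
      (trans (cong (λ x → (1ℚ - x) + K) cK) (trans (cong (_+ K) (ℚₚ.+-inverseʳ 1ℚ)) (ℚₚ.+-identityˡ K)))

    0≤K : 0ℚ ≤ K
    0≤K = 0≤fromℕ (suc (suc p))

    sum≤K : ∀ n → absSum g n (λ _ → 1ℤ) ≤ K
    sum≤K zero    = 0≤K
    sum≤K (suc n) = subst (1ℚ + g * absSum g n (λ _ → 1ℤ) ≤_) 1+gK (ℚₚ.+-monoʳ-≤ 1ℚ (*-monoʳ g 0≤g (sum≤K n)))

    radius : Radius
    radius = record { g = g ; μ = μ ; K = K ; 0≤g = 0≤g ; g≤1 = g≤1 ; 1≤μ = 1≤μ ; gμ≡1 = gμ≡1 ; 0≤K = 0≤K ; n*gⁿ≤K = n*gⁿ≤K ; sum≤K = sum≤K }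

    0<g : 0ℚ < g
    0<g = ℚₚ.*-cancelʳ-<-nonNeg μ ⦃ ℚ.nonNegative 0≤μ ⦄ (subst₂ _<_ (sym (ℚₚ.*-zeroˡ μ)) (sym gμ≡1) (ℚₚ.positive⁻¹ 1ℚ))

    ½≤gⁿ : ∀ n → n ℕ.+ n ≡ suc (suc p) → ½ ≤ g ^ℚ n
    ½≤gⁿ n e = subst (_≤ g ^ℚ n) half (bernoulli-< c (ℚₚ.<⇒≤ 0<c) c≤1 n)
      where
      twice : fromℕ n * c + fromℕ n * c ≡ 1ℚ
      twice = trans (solve 2 (λ n c → n :* c :+ n :* c := c :* (n :+ n)) refl (fromℕ n) c)
        (trans (cong (c *_) (trans (sym (fromℤ-+ (+ n) (+ n))) (cong fromℕ e))) cK)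
      half : 1ℚ - fromℕ n * c ≡ ½
      half = trans (solve 1 (λ x → con 1ℚ :- x := con 1ℚ :- con ½ :* (x :+ x)) refl (fromℕ n * c)) (cong (λ x → 1ℚ - ½ * x) twice)

  0<^ : ∀ {x} n → 0ℚ < x → 0ℚ < x ^ℚ n
  0<^ zero    0<x = ℚₚ.positive⁻¹ 1ℚ
  0<^ (suc n) 0<x = 0<* 0<x (0<^ n 0<x)

  ∣_∣²ᴳ : G → ℚ
  ∣ a , b ∣²ᴳ = a * a + b * b

  square-* : ∀ w v → ∣ w *ᴳ v ∣²ᴳ ≡ ∣ w ∣²ᴳ * ∣ v ∣²ᴳ
  square-* (a , b) (c , d) = solve 4 (λ a b c d →
    (a :* c :+ :- (b :* d)) :* (a :* c :+ :- (b :* d)) :+ (a :* d :+ b :* c) :* (a :* d :+ b :* c) := (a :* a :+ b :* b) :* (c :* c :+ d :* d)) refl a b c d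

  square-^ : ∀ w n → ∣ w ^ᴳ n ∣²ᴳ ≡ ∣ w ∣²ᴳ ^ℚ n
  square-^ w zero    = refl
  square-^ w (suc n) = trans (square-* w (w ^ᴳ n)) (cong (∣ w ∣²ᴳ *_) (square-^ w n))

  ∣∣²≡ : ∀ x → ∣ x ∣ * ∣ x ∣ ≡ x * x
  ∣∣²≡ x = trans (sym (ℚₚ.∣p*q∣≡∣p∣*∣q∣ x x)) (ℚₚ.0≤p⇒∣p∣≡p (0≤square x))

  0≤∣∣² : ∀ w → 0ℚ ≤ ∣ w ∣²ᴳ
  0≤∣∣² (a , b) = 0≤+ (0≤square a) (0≤square b)

  ∣∣²≤‖‖² : ∀ w → ∣ w ∣²ᴳ ≤ ‖ w ‖ * ‖ w ‖
  ∣∣²≤‖‖² (a , b) = begin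
    a * a + b * b                               ≡⟨ sym (cong₂ _+_ (∣∣²≡ a) (∣∣²≡ b)) ⟩
    ∣ a ∣ * ∣ a ∣ + ∣ b ∣ * ∣ b ∣               ≡⟨ sym (ℚₚ.+-identityʳ _) ⟩
    ∣ a ∣ * ∣ a ∣ + ∣ b ∣ * ∣ b ∣ + 0ℚ          ≤⟨ ℚₚ.+-monoʳ-≤ (∣ a ∣ * ∣ a ∣ + ∣ b ∣ * ∣ b ∣) (0≤+ 0≤ab 0≤ab) ⟩
    ∣ a ∣ * ∣ a ∣ + ∣ b ∣ * ∣ b ∣ + (∣ a ∣ * ∣ b ∣ + ∣ a ∣ * ∣ b ∣)
      ≡⟨ solve 2 (λ a b → a :* a :+ b :* b :+ (a :* b :+ a :* b) := (a :+ b) :* (a :+ b)) refl (∣ a ∣) (∣ b ∣) ⟩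
    (∣ a ∣ + ∣ b ∣) * (∣ a ∣ + ∣ b ∣)           ∎
    where
    open ℚₚ.≤-Reasoning
    0≤ab : 0ℚ ≤ ∣ a ∣ * ∣ b ∣
    0≤ab = 0≤* (ℚₚ.0≤∣p∣ a) (ℚₚ.0≤∣p∣ b)

  ‖‖²≤2∣∣² : ∀ w → ‖ w ‖ * ‖ w ‖ ≤ (1ℚ + 1ℚ) * ∣ w ∣²ᴳ
  ‖‖²≤2∣∣² (a , b) = begin
    (∣ a ∣ + ∣ b ∣) * (∣ a ∣ + ∣ b ∣)
      ≡⟨ sym (ℚₚ.+-identityʳ _) ⟩
    (∣ a ∣ + ∣ b ∣) * (∣ a ∣ + ∣ b ∣) + 0ℚ
      ≤⟨ ℚₚ.+-monoʳ-≤ ((∣ a ∣ + ∣ b ∣) * (∣ a ∣ + ∣ b ∣)) (0≤square (∣ a ∣ - ∣ b ∣)) ⟩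
    (∣ a ∣ + ∣ b ∣) * (∣ a ∣ + ∣ b ∣) + (∣ a ∣ - ∣ b ∣) * (∣ a ∣ - ∣ b ∣)
      ≡⟨ solve 2 (λ a b → (a :+ b) :* (a :+ b) :+ (a :- b) :* (a :- b) := (con 1ℚ :+ con 1ℚ) :* (a :* a :+ b :* b)) refl (∣ a ∣) (∣ b ∣) ⟩
    (1ℚ + 1ℚ) * (∣ a ∣ * ∣ a ∣ + ∣ b ∣ * ∣ b ∣)
      ≡⟨ cong ((1ℚ + 1ℚ) *_) (cong₂ _+_ (∣∣²≡ a) (∣∣²≡ b)) ⟩
    (1ℚ + 1ℚ) * (a * a + b * b) ∎
    where open ℚₚ.≤-Reasoning

  ¼ : ℚ
  ¼ = ½ * ½

  ≤-by-contradiction : ∀ a b → (b ≤ a → ⊥) → a ≤ b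
  ≤-by-contradiction a b h with ℚₚ.≤-total a b
  ... | inj₁ a≤b = a≤b
  ... | inj₂ b≤a = ⊥-elim (h b≤a)

  module _ (k : ℕ) (g : ℚ) (0<g : 0ℚ < g) (½≤ : ½ ≤ g ^ℚ (suc k ℕ.* 12)) where

    small-power⇒point : ∀ x → ‖ x ^ᴳ suc k ‖ < ¼ → ∀ i → ‖ x ^ᴳ i ‖ ≤ (1ℚ + 1ℚ) * (g ^ℚ 6) ^ℚ i
    small-power⇒point x h i = subst (_≤ B) (ℚₚ.0≤p⇒∣p∣≡p (0≤‖‖ (x ^ᴳ i))) (square-≤ (‖ x ^ᴳ i ‖) B 0<B (begin
      ‖ x ^ᴳ i ‖ * ‖ x ^ᴳ i ‖
        ≤⟨ ‖‖²≤2∣∣² (x ^ᴳ i) ⟩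
      (1ℚ + 1ℚ) * ∣ x ^ᴳ i ∣²ᴳ
        ≤⟨ *-monoʳ (1ℚ + 1ℚ) 0≤2 (ℚₚ.≤-trans (ℚₚ.≤-reflexive (square-^ x i)) (^-mono i (0≤∣∣² x) s≤)) ⟩
      (1ℚ + 1ℚ) * (g ^ℚ 12) ^ℚ i
        ≡⟨ cong ((1ℚ + 1ℚ) *_) (trans (cong (_^ℚ i) (^-+ g 6 6)) (*-^ (g ^ℚ 6) (g ^ℚ 6) i)) ⟩
      (1ℚ + 1ℚ) * (e * e)
        ≡⟨ sym (ℚₚ.+-identityʳ ((1ℚ + 1ℚ) * (e * e))) ⟩
      (1ℚ + 1ℚ) * (e * e) + 0ℚ
        ≤⟨ ℚₚ.+-monoʳ-≤ ((1ℚ + 1ℚ) * (e * e)) (0≤* 0≤2 (0≤square e)) ⟩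
      (1ℚ + 1ℚ) * (e * e) + (1ℚ + 1ℚ) * (e * e)
        ≡⟨ solve 1 (λ e → (con 1ℚ :+ con 1ℚ) :* (e :* e) :+ (con 1ℚ :+ con 1ℚ) :* (e :* e) := ((con 1ℚ :+ con 1ℚ) :* e) :* ((con 1ℚ :+ con 1ℚ) :* e)) refl e ⟩
      B * B ∎))
      where
      open ℚₚ.≤-Reasoning
      0≤2 : 0ℚ ≤ 1ℚ + 1ℚ
      0≤2 = 0≤+ 0≤1 0≤1
      e B : ℚ
      e = (g ^ℚ 6) ^ℚ i
      B = (1ℚ + 1ℚ) * e
      0<B : 0ℚ < B
      0<B = 0<* (ℚₚ.positive⁻¹ (1ℚ + 1ℚ)) (0<^ i (0<^ 6 0<g))
      s≤ : ∣ x ∣²ᴳ ≤ g ^ℚ 12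
      s≤ = ≤-by-contradiction (∣ x ∣²ᴳ) (g ^ℚ 12) (λ h′ → ℚₚ.<-irrefl refl (ℚₚ.<-≤-trans ¼²<½ (begin
        ½                           ≤⟨ ½≤ ⟩
        g ^ℚ (suc k ℕ.* 12)         ≡⟨ ^-* g (suc k) 12 ⟩
        (g ^ℚ 12) ^ℚ suc k          ≤⟨ ^-mono (suc k) (0≤^ 12 (ℚₚ.<⇒≤ 0<g)) h′ ⟩
        ∣ x ∣²ᴳ ^ℚ suc k            ≡⟨ sym (square-^ x (suc k)) ⟩
        ∣ x ^ᴳ suc k ∣²ᴳ            ≤⟨ ∣∣²≤‖‖² (x ^ᴳ suc k) ⟩
        ‖ x ^ᴳ suc k ‖ * ‖ x ^ᴳ suc k ‖ ≤⟨ *-mono-≤ (0≤‖‖ (x ^ᴳ suc k)) (ℚₚ.<⇒≤ h) (0≤‖‖ (x ^ᴳ suc k)) (ℚₚ.<⇒≤ h) ⟩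
        ¼ * ¼                       ∎)))
        where
        ¼²<½ : ¼ * ¼ < ½
        ¼²<½ = ℚ.*<* (ℤ.+<+ (ℕ.s≤s (ℕ.s≤s (ℕ.s≤s ℕ.z≤n))))

  -- With 24 (k + 1) = p + 2 we get g ^ (12 (k + 1)) ≥ 1/2.
  module PowerRadius (k : ℕ) where
    p : ℕ
    p = 22 ℕ.+ (k ℕ.* 12 ℕ.+ k ℕ.* 12)

    open Geometric p public

    small-power : ∀ x → ‖ x ^ᴳ suc k ‖ < ¼ → ∀ i → ‖ x ^ᴳ i ‖ ≤ (1ℚ + 1ℚ) * (g ^ℚ 6) ^ℚ i
    small-power = small-power⇒point k g 0<g (½≤gⁿ (suc k ℕ.* 12) double)
      where
      double : suc k ℕ.* 12 ℕ.+ suc k ℕ.* 12 ≡ suc (suc p)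
      double = ℕSolver.solve 1 (λ m → (ℕSolver.con 12 ℕSolver.:+ m) ℕSolver.:+ (ℕSolver.con 12 ℕSolver.:+ m) ℕSolver.:= ℕSolver.con 24 ℕSolver.:+ (m ℕSolver.:+ m)) refl (k ℕ.* 12)

  ^-swap : ∀ x k n → (x ^ℚ k) ^ℚ n ≡ (x ^ℚ n) ^ℚ k
  ^-swap x k n = trans (sym (^-* x n k)) (trans (cong (x ^ℚ_) (ℕₚ.*-comm n k)) (^-* x k n))

  ∣fromℤ-*∣ : ∀ i j → ∣ fromℤ (i ℤ.* j) ∣ ≡ ∣ fromℤ i ∣ * ∣ fromℤ j ∣
  ∣fromℤ-*∣ i j = trans (cong ∣_∣ (fromℤ-* i j)) (ℚₚ.∣p*q∣≡∣p∣*∣q∣ (fromℤ i) (fromℤ j))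

  module Growth (R : Radius) where
    open Radius R
    open Sums R

    ρ : ℚ
    ρ = g ^ℚ 4

    0≤ρ : 0ℚ ≤ ρ
    0≤ρ = 0≤^ 4 0≤g

    absSum-≤ : ∀ s C f → (∀ n → s ^ℚ n * ∣ fromℤ (f n) ∣ ≤ C * g ^ℚ n) → ∀ n → absSum s n f ≤ C * absSum g n (λ _ → 1ℤ)
    absSum-≤ s C f h zero    = ℚₚ.≤-reflexive (sym (ℚₚ.*-zeroʳ C))
    absSum-≤ s C f h (suc n) = begin
      absSum s (suc n) f                                 ≡⟨ absSum-last s n f ⟩
      absSum s n f + s ^ℚ n * ∣ fromℤ (f n) ∣            ≤⟨ ℚₚ.+-mono-≤ (absSum-≤ s C f h n) (h n) ⟩
      C * absSum g n (λ _ → 1ℤ) + C * g ^ℚ n             ≡⟨ solve 3 (λ c a e → c :* a :+ c :* e := c :* (a :+ e :* con 1ℚ)) refl C (absSum g n (λ _ → 1ℤ)) (g ^ℚ n) ⟩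
      C * (absSum g n (λ _ → 1ℤ) + g ^ℚ n * 1ℚ)          ≡⟨ cong (C *_) (sym (absSum-last g n (λ _ → 1ℤ))) ⟩
      C * absSum g (suc n) (λ _ → 1ℤ)                    ∎
      where open ℚₚ.≤-Reasoning

    absSum-bounded : ∀ s C f → 0ℚ ≤ C → (∀ n → s ^ℚ n * ∣ fromℤ (f n) ∣ ≤ C * g ^ℚ n) → ∀ n → absSum s n f ≤ C * K
    absSum-bounded s C f 0≤C h n = ℚₚ.≤-trans (absSum-≤ s C f h n) (*-monoʳ C 0≤C (sum≤K n))

    -- A coefficient bound n² or n⁴ is absorbed by as many factors gⁿ.
    module _ (n : ℕ) where
      private
        e N : ℚ
        e = g ^ℚ n
        N = fromℕ n
        0≤e : 0ℚ ≤ e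
        0≤e = 0≤^ n 0≤g
        0≤eN : 0ℚ ≤ e * N
        0≤eN = 0≤* 0≤e (0≤fromℕ n)
        eN≤K : e * N ≤ K
        eN≤K = subst (_≤ K) (ℚₚ.*-comm N e) (n*gⁿ≤K n)

      quadratic-bound : ∀ x → x ≤ N * N → ρ ^ℚ n * x ≤ K * K * e
      quadratic-bound x h = begin
        ρ ^ℚ n * x                      ≤⟨ *-monoʳ (ρ ^ℚ n) (0≤^ n 0≤ρ) h ⟩
        ρ ^ℚ n * (N * N)                ≡⟨ cong (_* (N * N)) (^-swap g 4 n) ⟩
        e * (e * (e * (e * 1ℚ))) * (N * N)
          ≡⟨ solve 2 (λ e N → e :* (e :* (e :* (e :* con 1ℚ))) :* (N :* N) := e :* (e :* (e :* N :* (e :* N)))) refl e N ⟩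
        e * (e * (e * N * (e * N)))     ≤⟨ *-monoʳ e 0≤e (*-mono-≤ 0≤e (^-≤1 n 0≤g g≤1) (0≤* 0≤eN 0≤eN) (*-mono-≤ 0≤eN eN≤K 0≤eN eN≤K)) ⟩
        e * (1ℚ * (K * K))              ≡⟨ solve 2 (λ e K → e :* (con 1ℚ :* (K :* K)) := K :* K :* e) refl e K ⟩
        K * K * e                       ∎
        where open ℚₚ.≤-Reasoning

      quartic-bound : ∀ x → x ≤ N * (N * (N * N)) → r ^ℚ n * x ≤ K * K * (K * K) * e
      quartic-bound x h = begin
        r ^ℚ n * x                      ≤⟨ *-monoʳ (r ^ℚ n) (0≤^ n 0≤r) h ⟩
        r ^ℚ n * (N * (N * (N * N)))    ≡⟨ cong (_* (N * (N * (N * N)))) (^-swap g 5 n) ⟩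
        e * (e * (e * (e * (e * 1ℚ)))) * (N * (N * (N * N)))
          ≡⟨ solve 2 (λ e N → e :* (e :* (e :* (e :* (e :* con 1ℚ)))) :* (N :* (N :* (N :* N))) := e :* (e :* N :* (e :* N) :* (e :* N :* (e :* N)))) refl e N ⟩
        e * (e * N * (e * N) * (e * N * (e * N)))
          ≤⟨ *-monoʳ e 0≤e (*-mono-≤ 0≤eN² eN²≤ 0≤eN² eN²≤) ⟩
        e * (K * K * (K * K))           ≡⟨ ℚₚ.*-comm e (K * K * (K * K)) ⟩
        K * K * (K * K) * e             ∎
        where
        open ℚₚ.≤-Reasoning
        0≤eN² : 0ℚ ≤ e * N * (e * N)
        0≤eN² = 0≤* 0≤eN 0≤eN
        eN²≤ : e * N * (e * N) ≤ K * K
        eN²≤ = *-mono-≤ 0≤eN eN≤K 0≤eN eN≤K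

    summable-quartic : ∀ f → (∀ n → ℤ.∣ f n ∣ ℕ.≤ n ℕ.* (n ℕ.* (n ℕ.* n))) → Summable f
    summable-quartic f h = summable (C * K , 0≤* 0≤C 0≤K , absSum-bounded r C f 0≤C (λ n → quartic-bound n (∣ fromℤ (f n) ∣)
      (subst₂ _≤_ (sym (∣fromℤ∣ (f n))) (trans (fromℕ-* n (n ℕ.* (n ℕ.* n))) (cong (fromℕ n *_) (trans (fromℕ-* n (n ℕ.* n)) (cong (fromℕ n *_) (fromℕ-* n n))))) (fromℕ-mono (h n)))))
      where
      C : ℚ
      C = K * K * (K * K)
      0≤C : 0ℚ ≤ C
      0≤C = 0≤* (0≤* 0≤K 0≤K) (0≤* 0≤K 0≤K)

    convolution-bound : ∀ n h f W → (∀ i → i ℕ.≤ n → ρ ^ℚ i * ∣ fromℤ (f i) ∣ ≤ W) → ρ ^ℚ n * ∣ fromℤ ((h ⊛ f) n) ∣ ≤ absSum ρ (suc n) h * W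
    convolution-bound zero    h f W p = begin
      1ℚ * ∣ fromℤ (h 0 ℤ.* f 0) ∣          ≡⟨ cong (1ℚ *_) (∣fromℤ-*∣ (h 0) (f 0)) ⟩
      1ℚ * (∣ fromℤ (h 0) ∣ * ∣ fromℤ (f 0) ∣) ≡⟨ solve 2 (λ a b → con 1ℚ :* (a :* b) := a :* (con 1ℚ :* b)) refl (∣ fromℤ (h 0) ∣) (∣ fromℤ (f 0) ∣) ⟩
      ∣ fromℤ (h 0) ∣ * (1ℚ * ∣ fromℤ (f 0) ∣) ≤⟨ *-monoʳ (∣ fromℤ (h 0) ∣) (ℚₚ.0≤∣p∣ (fromℤ (h 0))) (p 0 ℕ.z≤n) ⟩
      ∣ fromℤ (h 0) ∣ * W                    ≡⟨ cong (_* W) (sym (trans (cong (_+_ (∣ fromℤ (h 0) ∣)) (ℚₚ.*-zeroʳ ρ)) (ℚₚ.+-identityʳ (∣ fromℤ (h 0) ∣)))) ⟩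
      (∣ fromℤ (h 0) ∣ + ρ * 0ℚ) * W         ∎
      where open ℚₚ.≤-Reasoning
    convolution-bound (suc n) h f W p = begin
      ρ ^ℚ suc n * ∣ fromℤ (h 0 ℤ.* f (suc n) ℤ.+ (tail h ⊛ f) n) ∣
        ≤⟨ *-monoʳ (ρ ^ℚ suc n) (0≤^ (suc n) 0≤ρ) (ℚₚ.≤-trans (ℚₚ.≤-reflexive (cong ∣_∣ (fromℤ-+ (h 0 ℤ.* f (suc n)) ((tail h ⊛ f) n))))
             (ℚₚ.≤-trans (ℚₚ.∣p+q∣≤∣p∣+∣q∣ (fromℤ (h 0 ℤ.* f (suc n))) (fromℤ ((tail h ⊛ f) n))) (ℚₚ.≤-reflexive (cong (_+ c) (∣fromℤ-*∣ (h 0) (f (suc n))))))) ⟩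
      ρ * ρ ^ℚ n * (a * b + c)
        ≡⟨ solve 5 (λ ρ e a b c → ρ :* e :* (a :* b :+ c) := a :* (ρ :* e :* b) :+ ρ :* (e :* c)) refl ρ (ρ ^ℚ n) a b c ⟩
      a * (ρ ^ℚ suc n * b) + ρ * (ρ ^ℚ n * c)
        ≤⟨ ℚₚ.+-mono-≤ (*-monoʳ a (ℚₚ.0≤∣p∣ (fromℤ (h 0))) (p (suc n) ℕₚ.≤-refl))
             (*-monoʳ ρ 0≤ρ (convolution-bound n (tail h) f W (λ i i≤n → p i (ℕₚ.m≤n⇒m≤1+n i≤n)))) ⟩
      a * W + ρ * (absSum ρ (suc n) (tail h) * W)
        ≡⟨ solve 4 (λ a w ρ s → a :* w :+ ρ :* (s :* w) := (a :+ ρ :* s) :* w) refl a W ρ (absSum ρ (suc n) (tail h)) ⟩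
      absSum ρ (suc (suc n)) h * W ∎
      where
      open ℚₚ.≤-Reasoning
      a b c : ℚ
      a = ∣ fromℤ (h 0) ∣
      b = ∣ fromℤ (f (suc n)) ∣
      c = ∣ fromℤ ((tail h ⊛ f) n) ∣

    threshold : ∃ λ b → K * K * K < fromℕ b
    threshold = archimedean (K * K * K)

    b : ℕ
    b = proj₁ threshold

    β : ℚ
    β = fromℕ (suc b)

    1≤β : 1ℚ ≤ β
    1≤β = fromℕ-mono {1} {suc b} (ℕ.s≤s ℕ.z≤n)

    0≤β : 0ℚ ≤ β
    0≤β = ℚₚ.≤-trans 0≤1 1≤β

    growth-bound : ℚ
    growth-bound = β ^ℚ b * K

    0≤growth-bound : 0ℚ ≤ growth-bound
    0≤growth-bound = 0≤* (0≤^ b 0≤β) 0≤K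

    module _ (S f : Series) (S₀ : S 0 ≡ 0ℤ) (S≤ : ∀ n → ℤ.∣ S n ∣ ℕ.≤ n ℕ.* n) (f₀ : f 0 ≡ 1ℤ)
      (recurrence : ∀ n → ℤ.∣ + n ℤ.* f n ∣ ≡ ℤ.∣ (S ⊛ f) n ∣) where
      private
        a : ℕ → ℚ
        a n = ρ ^ℚ n * ∣ fromℤ (f n) ∣

        0≤a : ∀ n → 0ℚ ≤ a n
        0≤a n = 0≤* (0≤^ n 0≤ρ) (ℚₚ.0≤∣p∣ (fromℤ (f n)))

        S-sum : ∀ n → absSum ρ n S ≤ fromℕ b
        S-sum n = ℚₚ.≤-trans (absSum-bounded ρ (K * K) S (0≤* 0≤K 0≤K) (λ n → quadratic-bound n (∣ fromℤ (S n) ∣)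
          (subst₂ _≤_ (sym (∣fromℤ∣ (S n))) (fromℕ-* n n) (fromℕ-mono (S≤ n)))) n) (ℚₚ.<⇒≤ (proj₂ threshold))

        step : ∀ n W → 0ℚ ≤ W → (∀ i → i ℕ.≤ n → a i ≤ W) → fromℕ (suc n) * a (suc n) ≤ fromℕ b * W
        step n W 0≤W p = begin
          fromℕ (suc n) * a (suc n)
            ≡⟨ solve 3 (λ n e x → n :* (e :* x) := e :* (n :* x)) refl (fromℕ (suc n)) (ρ ^ℚ suc n) (∣ fromℤ (f (suc n)) ∣) ⟩
          ρ ^ℚ suc n * (fromℕ (suc n) * ∣ fromℤ (f (suc n)) ∣)
            ≡⟨ cong (ρ ^ℚ suc n *_) coefficient ⟩
          ρ * ρ ^ℚ n * ∣ fromℤ ((tail S ⊛ f) n) ∣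
            ≡⟨ ℚₚ.*-assoc ρ (ρ ^ℚ n) (∣ fromℤ ((tail S ⊛ f) n) ∣) ⟩
          ρ * (ρ ^ℚ n * ∣ fromℤ ((tail S ⊛ f) n) ∣)
            ≤⟨ *-monoʳ ρ 0≤ρ (convolution-bound n (tail S) f W p) ⟩
          ρ * (absSum ρ (suc n) (tail S) * W)
            ≡⟨ sym (ℚₚ.*-assoc ρ (absSum ρ (suc n) (tail S)) W) ⟩
          ρ * absSum ρ (suc n) (tail S) * W
            ≤⟨ *-monoˡ W 0≤W (ℚₚ.≤-trans (subst (_≤ absSum ρ (suc (suc n)) S) (ℚₚ.+-identityˡ (ρ * absSum ρ (suc n) (tail S)))
                 (ℚₚ.+-monoˡ-≤ (ρ * absSum ρ (suc n) (tail S)) (ℚₚ.0≤∣p∣ (fromℤ (S 0))))) (S-sum (suc (suc n)))) ⟩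
          fromℕ b * W ∎
          where
          open ℚₚ.≤-Reasoning
          coefficient : fromℕ (suc n) * ∣ fromℤ (f (suc n)) ∣ ≡ ∣ fromℤ ((tail S ⊛ f) n) ∣
          coefficient = trans (cong (_* ∣ fromℤ (f (suc n)) ∣) (sym (∣fromℤ∣ (+ suc n))))
            (trans (sym (∣fromℤ-*∣ (+ suc n) (f (suc n))))
              (trans (∣fromℤ∣ (+ suc n ℤ.* f (suc n))) (trans (cong fromℕ (recurrence (suc n)))
                (trans (sym (∣fromℤ∣ ((S ⊛ f) (suc n)))) (cong (∣_∣ ∘ fromℤ)
                  (trans (cong (λ s → s ℤ.* f (suc n) ℤ.+ (tail S ⊛ f) n) S₀) (ℤₚ.+-identityˡ ((tail S ⊛ f) n))))))))

        early : ∀ n i → i ℕ.≤ n → a i ≤ β ^ℚ n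
        early zero    zero _ = ℚₚ.≤-reflexive (cong (λ x → 1ℚ * ∣ fromℤ x ∣) f₀)
        early (suc n) i i≤1+n with ℕₚ.m≤n⇒m<n∨m≡n i≤1+n
        ... | inj₁ (ℕ.s≤s i≤n) = ℚₚ.≤-trans (early n i i≤n) (subst (_≤ β ^ℚ suc n) (ℚₚ.*-identityˡ (β ^ℚ n)) (*-monoˡ (β ^ℚ n) (0≤^ n 0≤β) 1≤β))
        ... | inj₂ refl        = begin
            a (suc n)                 ≡⟨ sym (ℚₚ.*-identityˡ (a (suc n))) ⟩
            1ℚ * a (suc n)            ≤⟨ *-monoˡ (a (suc n)) (0≤a (suc n)) (fromℕ-mono {1} {suc n} (ℕ.s≤s ℕ.z≤n)) ⟩
            fromℕ (suc n) * a (suc n) ≤⟨ step n (β ^ℚ n) (0≤^ n 0≤β) (early n) ⟩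
            fromℕ b * β ^ℚ n          ≤⟨ *-monoˡ (β ^ℚ n) (0≤^ n 0≤β) (fromℕ-mono (ℕₚ.n≤1+n b)) ⟩
            β * β ^ℚ n                ∎
          where open ℚₚ.≤-Reasoning

        late : ∀ k i → i ℕ.≤ k ℕ.+ b → a i ≤ β ^ℚ b
        late zero    i i≤ = early b i i≤
        late (suc k) i i≤ with ℕₚ.m≤n⇒m<n∨m≡n i≤
        ... | inj₁ (ℕ.s≤s i≤n) = late k i i≤n
        ... | inj₂ refl        = ℚₚ.*-cancelˡ-≤-pos (fromℕ (suc (k ℕ.+ b))) ⦃ ℚ.positive (0<fromℕ-suc (k ℕ.+ b)) ⦄
          (ℚₚ.≤-trans (step (k ℕ.+ b) (β ^ℚ b) (0≤^ b 0≤β) (late k))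
            (*-monoˡ (β ^ℚ b) (0≤^ b 0≤β) (fromℕ-mono (ℕₚ.≤-trans (ℕₚ.m≤n+m b k) (ℕₚ.n≤1+n (k ℕ.+ b))))))

      growth : ∀ n → absSum r n f ≤ growth-bound
      growth = absSum-bounded r (β ^ℚ b) f (0≤^ b 0≤β) (λ n → begin
        r ^ℚ n * ∣ fromℤ (f n) ∣            ≡⟨ cong (_* ∣ fromℤ (f n) ∣) (*-^ g ρ n) ⟩
        g ^ℚ n * ρ ^ℚ n * ∣ fromℤ (f n) ∣   ≡⟨ ℚₚ.*-assoc (g ^ℚ n) (ρ ^ℚ n) (∣ fromℤ (f n) ∣) ⟩
        g ^ℚ n * a n                        ≤⟨ *-monoʳ (g ^ℚ n) (0≤^ n 0≤g) (late n n (ℕₚ.m≤m+n n b)) ⟩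
        g ^ℚ n * β ^ℚ b                     ≡⟨ ℚₚ.*-comm (g ^ℚ n) (β ^ℚ b) ⟩
        β ^ℚ b * g ^ℚ n                     ∎)
        where open ℚₚ.≤-Reasoning

    ⊛-24 : ∀ f S n → (f ⊛ -24[ S ]) n ≡ -[1+ 23 ] ℤ.* (S ⊛ f) n
    ⊛-24 f S n = trans (⊛-cong {f} (λ _ → refl) (λ i → ℤₚ.neg-distribˡ-* (+ 24) (S i)) n)
      (trans (⊛-scale -[1+ 23 ] f S n) (cong (-[1+ 23 ] ℤ.*_) (⊛-comm f S n)))

    ∣24*∣-cancel : ∀ i j → ℤ.∣ + 24 ℤ.* i ∣ ≡ ℤ.∣ + 24 ℤ.* j ∣ → ℤ.∣ i ∣ ≡ ℤ.∣ j ∣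
    ∣24*∣-cancel i j e = ℕₚ.*-cancelˡ-≡ ℤ.∣ i ∣ ℤ.∣ j ∣ 24 (trans (sym (ℤₚ.abs-* (+ 24) i)) (trans e (ℤₚ.abs-* (+ 24) j)))

    recurrence : ∀ f S → LogDeriv f -24[ S ] → ∀ n → ℤ.∣ + n ℤ.* f n ∣ ≡ ℤ.∣ (S ⊛ f) n ∣
    recurrence f S law n = ∣24*∣-cancel (+ n ℤ.* f n) ((S ⊛ f) n) (trans (cong ℤ.∣_∣ (trans (law n) (⊛-24 f S n)))
      (trans (ℤₚ.abs-* -[1+ 23 ] ((S ⊛ f) n)) (sym (ℤₚ.abs-* (+ 24) ((S ⊛ f) n)))))

    recurrence⁻ : ∀ f S → LogDeriv f (negate -24[ S ]) → ∀ n → ℤ.∣ + n ℤ.* f n ∣ ≡ ℤ.∣ (S ⊛ f) n ∣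
    recurrence⁻ f S law n = ∣24*∣-cancel (+ n ℤ.* f n) ((S ⊛ f) n) (cong ℤ.∣_∣ (trans (law n) (trans
      (⊛-cong {f} (λ _ → refl) (λ i → ℤₚ.neg-involutive (+ 24 ℤ.* S i)) n) (trans (⊛-scale (+ 24) f S n) (cong (+ 24 ℤ.*_) (⊛-comm f S n))))))

    eulerProduct-0 : ∀ N → eulerProduct N 0 ≡ 1ℤ
    eulerProduct-0 zero    = refl
    eulerProduct-0 (suc N) = cong (ℤ._* 1ℤ) (eulerProduct-0 N)

    eulerProduct-bounded : ∀ N n → absSum r n (eulerProduct N) ≤ growth-bound
    eulerProduct-bounded N = growth (divisorSum successor N) (eulerProduct N) (σ₁-0 N) (∣σ₁∣≤ N) (eulerProduct-0 N)
      (recurrence (eulerProduct N) (divisorSum successor N) (logDeriv-eulerProduct N))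

    summable-euler : Summable euler
    summable-euler = summable (growth-bound , 0≤growth-bound , growth σ₁-series euler refl (λ n → ∣σ₁∣≤ n n) refl (recurrence euler σ₁-series logDeriv-euler))

    summable-partitions : Summable partitions
    summable-partitions = summable (growth-bound , 0≤growth-bound , growth σ₁-series partitions refl (λ n → ∣σ₁∣≤ n n) refl
      (recurrence⁻ partitions σ₁-series (logDeriv-inverse euler partitions -24[ σ₁-series ] (⊛-inverse euler refl) logDeriv-euler)))

    summable-σ₃ : Summable (divisorSeries cube)
    summable-σ₃ = summable-quartic (divisorSeries cube) ∣σ₃∣≤

    summable-σ₁ : Summable σ₁-series
    summable-σ₁ = summable-quartic σ₁-series (λ n → ℕₚ.≤-trans (∣σ₁∣≤ n n) (ℕₚ.*-monoʳ-≤ n (n≤n³ n)))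
      where
      n≤n³ : ∀ n → n ℕ.≤ n ℕ.* (n ℕ.* n)
      n≤n³ zero    = ℕ.z≤n
      n≤n³ (suc n) = ℕₚ.m≤m*n (suc n) (suc n ℕ.* suc n)

  ≈-refl : ∀ w → w ≈ w
  ≈-refl w = pointwise⇒≈ w w (λ _ → refl)

  ∑-cong : ∀ N (a b : ℕ → ℂ) → (∀ k → a k ≈ b k) → ∑ N a ≈ ∑ N b
  ∑-cong zero    a b h = ≈-refl 0ℂ
  ∑-cong (suc N) a b h = +-cong (∑ N a) (∑ N b) (a N) (b N) (∑-cong N a b h) (h N)

  ∏-cong : ∀ N (a b : ℕ → ℂ) → (∀ k → a k ≈ b k) → ∏ N a ≈ ∏ N b
  ∏-cong zero    a b h = ≈-refl 1ℂ
  ∏-cong (suc N) a b h = *-cong (∏ N a) (∏ N b) (a N) (b N) (∏-cong N a b h) (h N)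

  ↝-sequence : ∀ (a b : ℕ → ℂ) w → (∀ n → a n ≈ b n) → (λ n m → a n ! m) ↝ w → (λ n m → b n ! m) ↝ w
  ↝-sequence a b w e h = ↝-null w (null λ ε 0<ε → 0 , λ n _ → ≈⇒Close (b n) (a n) (≈-sym (a n) (b n) (e n)) ε 0<ε) h

  ·-factor : ∀ c d e w m → c ≡ e * d → (c · w) ! m ≡ real e *ᴳ (d · w) ! m
  ·-factor c d e w m h = trans (real-· c w m) (trans (cong (λ x → real x *ᴳ w ! m) h)
    (trans (cong (_*ᴳ w ! m) (real-* e d)) (trans (*ᴳ-assoc (real e) (real d) (w ! m)) (cong (real e *ᴳ_) (sym (real-· d w m))))))

  ·-neg : ∀ c w m → ((- c) · w) ! m ≡ negᴳ ((c · w) ! m)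
  ·-neg c w m = trans (real-· (- c) w m) (trans (Gsolve 2 (λ c w → (GSolver.:- c) ⊗ w ≔ GSolver.:- (c ⊗ w)) refl (real c) (w ! m)) (cong negᴳ (sym (real-· c w m))))

  ·-scaled : ∀ c a v w n → (∀ m → w ! m ≡ real n *ᴳ v ! m) → ∀ m → (c · (a D.* w)) ! m ≡ real n *ᴳ (c · (a D.* v)) ! m
  ·-scaled c a v w n e m = trans (real-· c (a D.* w) m) (trans (cong (λ p → real c *ᴳ (a ! m *ᴳ p)) (e m))
    (trans (Gsolve 4 (λ c a n p → c ⊗ (a ⊗ (n ⊗ p)) ≔ n ⊗ (c ⊗ (a ⊗ p))) refl (real c) (a ! m) (real n) (v ! m))
      (cong (real n *ᴳ_) (sym (real-· c (a D.* v) m)))))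

  ^-+ᶜ : ∀ w m n → w ^ (m ℕ.+ n) ≈ w ^ m D.* w ^ n
  ^-+ᶜ w a b = pointwise⇒≈ (w ^ (a ℕ.+ b)) (w ^ a D.* w ^ b) (λ m → trans (^-! w (a ℕ.+ b) m)
    (trans (^ᴳ-+ (w ! m) a b) (cong₂ _*ᴳ_ (sym (^-! w a m)) (sym (^-! w b m)))))

  ^-*ᶜ : ∀ w m n → w ^ (m ℕ.* n) ≈ (w ^ n) ^ m
  ^-*ᶜ w a b = pointwise⇒≈ (w ^ (a ℕ.* b)) ((w ^ b) ^ a) (λ m → trans (^-! w (a ℕ.* b) m)
    (trans (^ᴳ-* (w ! m) a b) (trans (cong (_^ᴳ a) (sym (^-! w b m))) (sym (^-! (w ^ b) a m)))))

  *ᴳ-^ : ∀ x y n → (x *ᴳ y) ^ᴳ n ≡ x ^ᴳ n *ᴳ y ^ᴳ n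
  *ᴳ-^ x y zero    = sym (*ᴳ-identityˡ 1ᴳ)
  *ᴳ-^ x y (suc n) = trans (cong (x *ᴳ y *ᴳ_) (*ᴳ-^ x y n))
    (Gsolve 4 (λ a b c d → a ⊗ b ⊗ (c ⊗ d) ≔ a ⊗ c ⊗ (b ⊗ d)) refl x y (x ^ᴳ n) (y ^ᴳ n))

  *-^ᶜ : ∀ w v n → (w D.* v) ^ n ≈ w ^ n D.* v ^ n
  *-^ᶜ w v n = pointwise⇒≈ ((w D.* v) ^ n) (w ^ n D.* v ^ n) (λ m → trans (^-! (w D.* v) n m)
    (trans (*ᴳ-^ (w ! m) (v ! m) n) (cong₂ _*ᴳ_ (sym (^-! w n m)) (sym (^-! v n m)))))

  1ᴳ^ : ∀ n → 1ᴳ ^ᴳ n ≡ 1ᴳ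
  1ᴳ^ zero    = refl
  1ᴳ^ (suc n) = trans (*ᴳ-identityˡ (1ᴳ ^ᴳ n)) (1ᴳ^ n)

  inverse-^ : ∀ w v n → w D.* v ≈ 1ℂ → w ^ n D.* v ^ n ≈ 1ℂ
  inverse-^ w v n h = ≈-trans (w ^ n D.* v ^ n) ((w D.* v) ^ n) 1ℂ (≈-sym ((w D.* v) ^ n) (w ^ n D.* v ^ n) (*-^ᶜ w v n))
    (≈-trans ((w D.* v) ^ n) (1ℂ ^ n) 1ℂ (^-cong (w D.* v) 1ℂ n h) (pointwise⇒≈ (1ℂ ^ n) 1ℂ (λ m → trans (^-! 1ℂ n m) (1ᴳ^ n))))

  cancel : ∀ w v x → w D.* v ≈ 1ℂ → v D.* (w D.* x) ≈ x
  cancel w v x h = ≈-trans (v D.* (w D.* x)) ((w D.* v) D.* x) x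
    (pointwise⇒≈ (v D.* (w D.* x)) ((w D.* v) D.* x) (λ m → Gsolve 3 (λ v w x → v ⊗ (w ⊗ x) ≔ (w ⊗ v) ⊗ x) refl (v ! m) (w ! m) (x ! m)))
    (≈-trans ((w D.* v) D.* x) (1ℂ D.* x) x (*-cong (w D.* v) 1ℂ x x h (≈-refl x)) (pointwise⇒≈ (1ℂ D.* x) x (λ m → *ᴳ-identityˡ (x ! m))))

  *-commᶜ : ∀ w v → w D.* v ≈ v D.* w
  *-commᶜ w v = pointwise⇒≈ (w D.* v) (v D.* w) (λ m → *ᴳ-comm (w ! m) (v ! m))

  -- The terms of a convergent series tend to 0, hence so do the powers of y, as
  -- all coefficients are at least 1.
  small-power : ∀ c (b : ℕ → ℚ) y l → (λ N → 1ℂ D.- c · ∑ N (λ k → b k · y ^ suc k)) ⟶ l → 1ℚ ≤ c → (∀ k → 1ℚ ≤ b k) →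
    ∃ λ k → ∃ λ M → ∀ m → M ℕ.≤ m → ‖ (y ! m) ^ᴳ suc k ‖ < ¼
  small-power c b y l a⟶l 1≤c 1≤b = N , M ℕ.⊔ M′ , λ m m≥ → bound m (proj₂ (close N ℕₚ.≤-refl) m (ℕₚ.m⊔n≤o⇒m≤o M M′ m≥)) (proj₂ (close (suc N) (ℕₚ.n≤1+n N)) m (ℕₚ.m⊔n≤o⇒n≤o M M′ m≥))
    where
    s a : ℕ → ℂ
    s N = ∑ N (λ k → b k · y ^ suc k)
    a N = 1ℂ D.- c · s N
    0<½¼ : 0ℚ < ½ * ¼
    0<½¼ = half-pos (half-pos (ℚₚ.positive⁻¹ ½))
    converges : Eventually λ n m → ‖ a n ! m -ᴳ l ! m ‖ < ½ * ¼
    converges = Null.smallness (_↝_.error-null (⟶⇒↝ a l a⟶l)) (½ * ¼) 0<½¼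
    N : ℕ
    N = proj₁ converges
    close : ∀ n → N ℕ.≤ n → ∃ λ M → ∀ m → M ℕ.≤ m → ‖ a n ! m -ᴳ l ! m ‖ < ½ * ¼
    close = proj₂ converges
    M M′ : ℕ
    M  = proj₁ (close N ℕₚ.≤-refl)
    M′ = proj₁ (close (suc N) (ℕₚ.n≤1+n N))
    difference : ∀ m → a N ! m -ᴳ a (suc N) ! m ≡ real c *ᴳ (real (b N) *ᴳ (y ! m) ^ᴳ suc N)
    difference m = begin
      (1ᴳ -ᴳ (c · s N) ! m) -ᴳ (1ᴳ -ᴳ (c · s (suc N)) ! m)
        ≡⟨ cong₂ (λ a b → (1ᴳ -ᴳ a) -ᴳ (1ᴳ -ᴳ b)) (real-· c (s N) m) (real-· c (s (suc N)) m) ⟩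
      (1ᴳ -ᴳ real c *ᴳ s N ! m) -ᴳ (1ᴳ -ᴳ real c *ᴳ (s N ! m +ᴳ (b N · y ^ suc N) ! m))
        ≡⟨ Gsolve 4 (λ o c s t → (o ⊝ c ⊗ s) ⊝ (o ⊝ c ⊗ (s ⊹ t)) ≔ c ⊗ t) refl 1ᴳ (real c) (s N ! m) ((b N · y ^ suc N) ! m) ⟩
      real c *ᴳ (b N · y ^ suc N) ! m
        ≡⟨ cong (real c *ᴳ_) (trans (real-· (b N) (y ^ suc N) m) (cong (real (b N) *ᴳ_) (^-! y (suc N) m))) ⟩
      real c *ᴳ (real (b N) *ᴳ (y ! m) ^ᴳ suc N) ∎
      where open ≡-Reasoning
    bound : ∀ m → ‖ a N ! m -ᴳ l ! m ‖ < ½ * ¼ → ‖ a (suc N) ! m -ᴳ l ! m ‖ < ½ * ¼ → ‖ (y ! m) ^ᴳ suc N ‖ < ¼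
    bound m h h′ = begin-strict
      x
        ≤⟨ enlarge x (0≤‖‖ ((y ! m) ^ᴳ suc N)) (b N) (1≤b N) ⟩
      b N * x
        ≤⟨ enlarge (b N * x) (0≤* (ℚₚ.≤-trans 0≤1 (1≤b N)) (0≤‖‖ ((y ! m) ^ᴳ suc N))) c 1≤c ⟩
      c * (b N * x)
        ≡⟨ sym (trans (‖real*‖ c (real (b N) *ᴳ (y ! m) ^ᴳ suc N)) (cong₂ _*_ (ℚₚ.0≤p⇒∣p∣≡p (ℚₚ.≤-trans 0≤1 1≤c))
             (trans (‖real*‖ (b N) ((y ! m) ^ᴳ suc N)) (cong (_* x) (ℚₚ.0≤p⇒∣p∣≡p (ℚₚ.≤-trans 0≤1 (1≤b N))))))) ⟩
      ‖ real c *ᴳ (real (b N) *ᴳ (y ! m) ^ᴳ suc N) ‖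
        ≡⟨ cong ‖_‖ (sym (difference m)) ⟩
      ‖ a N ! m -ᴳ a (suc N) ! m ‖
        ≤⟨ ‖triangle‖ (a N ! m) (l ! m) (a (suc N) ! m) ⟩
      ‖ a N ! m -ᴳ l ! m ‖ + ‖ l ! m -ᴳ a (suc N) ! m ‖
        <⟨ ℚₚ.+-mono-< h (subst (_< ½ * ¼) (‖swap‖ (a (suc N) ! m) (l ! m)) h′) ⟩
      ½ * ¼ + ½ * ¼
        ≡⟨ halves ¼ ⟩
      ¼ ∎
      where
      open ℚₚ.≤-Reasoning
      x : ℚ
      x = ‖ (y ! m) ^ᴳ suc N ‖
      enlarge : ∀ x → 0ℚ ≤ x → ∀ c → 1ℚ ≤ c → x ≤ c * x
      enlarge x 0≤x c 1≤c = subst (_≤ c * x) (ℚₚ.*-identityˡ x) (*-monoˡ x 0≤x 1≤c)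

  module Convergence (F : D.ModularFunctions) (z : ℍ) where
    open D.ModularFunctions using (π; exp; E₂; isE₂)

    nome-power : ∃ λ k → ∃ λ M → ∀ m → M ℕ.≤ m → ‖ (exp F ((+ 2 ℚ./ 1) · (D.ofReal (π F) D.* D.𝕚 D.* point z)) ! m) ^ᴳ suc k ‖ < ¼
    nome-power = small-power (+ 24 ℚ./ 1) (λ k → (+ σ 1 (suc k) ℚ./ 1)) (exp F ((+ 2 ℚ./ 1) · (D.ofReal (π F) D.* D.𝕚 D.* point z))) (E₂ F z) (isE₂ F z)
      (fromℕ-mono {1} {24} (ℕ.s≤s ℕ.z≤n)) (λ k → fromℕ-mono {1} {σ 1 (suc k)} (σ₁-positive k))

    R : Radius
    R = PowerRadius.radius (proj₁ nome-power)

    nome-point : Sums.Point R (exp F ((+ 2 ℚ./ 1) · (D.ofReal (π F) D.* D.𝕚 D.* point z)))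
    nome-point = proj₁ (proj₂ nome-power) , λ m m≥ → PowerRadius.small-power (proj₁ nome-power) (exp F ((+ 2 ℚ./ 1) · (D.ofReal (π F) D.* D.𝕚 D.* point z)) ! m) (proj₂ (proj₂ nome-power) m m≥)

  ∑-evaluate : ∀ (b : ℕ → ℚ) (s : Series) → s 0 ≡ 0ℤ → (∀ k → b k ≡ fromℤ (s (suc k))) → ∀ y N m →
    ∑ N (λ k → b k · y ^ suc k) ! m ≡ evaluate (suc N) s (y ! m)
  ∑-evaluate b s s₀ e y N m = trans (∑-! N (λ k → b k · y ^ suc k) m) (trans (sumᴳ-cong N summand)
    (sym (trans (cong (λ c → real (fromℤ c) *ᴳ 1ᴳ +ᴳ sumᴳ N (term s (y ! m) ∘ suc)) s₀)
      (trans (cong (_+ᴳ sumᴳ N (term s (y ! m) ∘ suc)) (*ᴳ-zeroˡ 1ᴳ)) (+ᴳ-identityˡ (sumᴳ N (term s (y ! m) ∘ suc)))))))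
    where
    summand : ∀ k → (b k · y ^ suc k) ! m ≡ term s (y ! m) (suc k)
    summand k = trans (real-· (b k) (y ^ suc k) m) (cong₂ (λ c x → real c *ᴳ x) (e k) (^-! y (suc k) m))

  module Values (R : Radius) where
    open Radius R
    open Sums R
    open Series-sums R
    open Growth R

    point-^ : ∀ y δ .⦃ _ : NonZero δ ⦄ → Point y → Point (y ^ δ)
    point-^ y (suc d) (M , h) = M , λ m m≥ i → subst (λ x → ‖ x ‖ ≤ (1ℚ + 1ℚ) * (g ^ℚ 6) ^ℚ i)
      (trans (^ᴳ-* (y ! m) i (suc d)) (cong (_^ᴳ i) (sym (^-! y (suc d) m))))
      (ℚₚ.≤-trans (h m m≥ (i ℕ.* suc d)) (*-monoʳ (1ℚ + 1ℚ) 0≤2 (begin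
        (g ^ℚ 6) ^ℚ (i ℕ.* suc d)              ≡⟨ cong ((g ^ℚ 6) ^ℚ_) (trans (ℕₚ.*-suc i d) refl) ⟩
        (g ^ℚ 6) ^ℚ (i ℕ.+ i ℕ.* d)            ≡⟨ ^-+ (g ^ℚ 6) i (i ℕ.* d) ⟩
        (g ^ℚ 6) ^ℚ i * (g ^ℚ 6) ^ℚ (i ℕ.* d)  ≤⟨ *-monoʳ ((g ^ℚ 6) ^ℚ i) (0≤^ i (0≤^ 6 0≤g)) (^-≤1 (i ℕ.* d) (0≤^ 6 0≤g) (^-≤1 6 0≤g g≤1)) ⟩
        (g ^ℚ 6) ^ℚ i * 1ℚ                     ≡⟨ ℚₚ.*-identityʳ ((g ^ℚ 6) ^ℚ i) ⟩
        (g ^ℚ 6) ^ℚ i                          ∎)))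
      where open ℚₚ.≤-Reasoning

    hasSum-≈ : ∀ y {f} w v → w ≈ v → HasSum y f w → HasSum y f v
    hasSum-≈ y w v e (hasSum h) = hasSum (↝-≈ w v e h)

    hasSum-unique : ∀ y {f} w v → HasSum y f w → HasSum y f v → w ≈ v
    hasSum-unique y w v (hasSum h) (hasSum k) = ↝-unique w v h k

    evaluate-1+ : ∀ c s n x → evaluate (suc n) (const 1ℤ ⊕ (λ i → c ℤ.* s i)) x ≡ 1ᴳ +ᴳ real (fromℤ c) *ᴳ evaluate (suc n) s x
    evaluate-1+ c s n x = trans (sumᴳ-cong (suc n) (term-⊕ (const 1ℤ) (λ i → c ℤ.* s i) x))
      (trans (sumᴳ-+ (suc n) (term (const 1ℤ) x) (term (λ i → c ℤ.* s i) x)) (cong₂ _+ᴳ_ (evaluate-monomial 0 (suc n) x (ℕ.s≤s ℕ.z≤n))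
        (trans (sumᴳ-cong (suc n) (term-scale c s x)) (sumᴳ-*ˡ (suc n) (real (fromℤ c)) (term s x)))))

    hasSum-1+ : ∀ y → Point y → ∀ c {s} → Summable s → ∀ w → (λ N m → 1ᴳ +ᴳ real (fromℤ c) *ᴳ evaluate (suc N) s (y ! m)) ↝ w →
      HasSum y (const 1ℤ ⊕ (λ i → c ℤ.* s i)) w
    hasSum-1+ y hy c {s} hs w h = hasSum-subsequence y hy (summable-⊕ (summable-const 1ℤ) (summable-scale c hs)) w suc ℕₚ.n≤1+n
      (↝-cong w (λ N m → sym (evaluate-1+ c s N (y ! m))) h)

    hasSum-1-c∑ : ∀ y y′ → y′ ≈ y → Point y → ∀ c c′ → c ≡ fromℤ c′ → ∀ b {s} → Summable s → s 0 ≡ 0ℤ → (∀ k → b k ≡ fromℤ (s (suc k))) →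
      ∀ w → (λ N → 1ℂ D.- c · ∑ N (λ k → b k · y′ ^ suc k)) ⟶ w → HasSum y (const 1ℤ ⊕ (λ i → ℤ.- c′ ℤ.* s i)) w
    hasSum-1-c∑ y y′ y′≈y hy c c′ c≡ b {s} hs s₀ bs w h = hasSum-1+ y hy (ℤ.- c′) hs w
      (↝-cong w eq (↝-sequence (partial y′) (partial y) w partial-cong (⟶⇒↝ (partial y′) w h)))
      where
      partial : ℂ → ℕ → ℂ
      partial y N = 1ℂ D.- c · ∑ N (λ k → b k · y ^ suc k)
      partial-cong : ∀ N → partial y′ N ≈ partial y N
      partial-cong N = ∸-cong 1ℂ 1ℂ (c · ∑ N (λ k → b k · y′ ^ suc k)) (c · ∑ N (λ k → b k · y ^ suc k)) (≈-refl 1ℂ)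
        (·-cong c (∑ N (λ k → b k · y′ ^ suc k)) (∑ N (λ k → b k · y ^ suc k)) (∑-cong N (λ k → b k · y′ ^ suc k) (λ k → b k · y ^ suc k)
          (λ k → ·-cong (b k) (y′ ^ suc k) (y ^ suc k) (^-cong y′ y (suc k) y′≈y))))
      eq : ∀ N m → partial y N ! m ≡ 1ᴳ +ᴳ real (fromℤ (ℤ.- c′)) *ᴳ evaluate (suc N) s (y ! m)
      eq N m = trans (cong (1ᴳ -ᴳ_) (trans (real-· c (∑ N (λ k → b k · y ^ suc k)) m) (cong₂ (λ x e → real x *ᴳ e) c≡ (∑-evaluate b s s₀ bs y N m))))
        (trans (Gsolve 3 (λ o c e → o ⊝ c ⊗ e ≔ o ⊹ (GSolver.:- c) ⊗ e) refl 1ᴳ (real (fromℤ c′)) (evaluate (suc N) s (y ! m)))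
          (cong (λ x → 1ᴳ +ᴳ real x *ᴳ evaluate (suc N) s (y ! m)) (sym (fromℤ-neg c′))))

    hasSum-1+c∑ : ∀ y y′ → y′ ≈ y → Point y → ∀ c c′ → c ≡ fromℤ c′ → ∀ b {s} → Summable s → s 0 ≡ 0ℤ → (∀ k → b k ≡ fromℤ (s (suc k))) →
      ∀ w → (λ N → 1ℂ D.+ c · ∑ N (λ k → b k · y′ ^ suc k)) ⟶ w → HasSum y (const 1ℤ ⊕ (λ i → c′ ℤ.* s i)) w
    hasSum-1+c∑ y y′ y′≈y hy c c′ c≡ b {s} hs s₀ bs w h = hasSum-1+ y hy c′ hs w
      (↝-cong w eq (↝-sequence (partial y′) (partial y) w partial-cong (⟶⇒↝ (partial y′) w h)))
      where
      partial : ℂ → ℕ → ℂ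
      partial y N = 1ℂ D.+ c · ∑ N (λ k → b k · y ^ suc k)
      partial-cong : ∀ N → partial y′ N ≈ partial y N
      partial-cong N = +-cong 1ℂ 1ℂ (c · ∑ N (λ k → b k · y′ ^ suc k)) (c · ∑ N (λ k → b k · y ^ suc k)) (≈-refl 1ℂ)
        (·-cong c (∑ N (λ k → b k · y′ ^ suc k)) (∑ N (λ k → b k · y ^ suc k)) (∑-cong N (λ k → b k · y′ ^ suc k) (λ k → b k · y ^ suc k)
          (λ k → ·-cong (b k) (y′ ^ suc k) (y ^ suc k) (^-cong y′ y (suc k) y′≈y))))
      eq : ∀ N m → partial y N ! m ≡ 1ᴳ +ᴳ real (fromℤ c′) *ᴳ evaluate (suc N) s (y ! m)
      eq N m = cong (1ᴳ +ᴳ_) (trans (real-· c (∑ N (λ k → b k · y ^ suc k)) m) (cong₂ (λ x e → real x *ᴳ e) c≡ (∑-evaluate b s s₀ bs y N m)))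

    hasSum-η : ∀ y → Point y → ∀ A u u⁻¹ (B : ℕ → ℂ) w → A ≈ u → u D.* u⁻¹ ≈ 1ℂ → (∀ k → B k ≈ y ^ suc k) →
      (λ N → A D.* ∏ N (λ k → 1ℂ D.- B k)) ⟶ w → HasSum y euler (u⁻¹ D.* w)
    hasSum-η y hy A u u⁻¹ B w A≈u unit B≈ h = hasSum-euler y hy growth-bound 0≤growth-bound eulerProduct-bounded (u⁻¹ D.* w)
      (↝-sequence (λ N → u⁻¹ D.* (A D.* P N)) Q (u⁻¹ D.* w) cancelled (↝-* u⁻¹ w (↝-cst u⁻¹) (⟶⇒↝ (λ N → A D.* P N) w h)))
      where
      P Q : ℕ → ℂ
      P N = ∏ N (λ k → 1ℂ D.- B k)
      Q N = ∏ N (λ k → 1ℂ D.- y ^ suc k)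
      cancelled : ∀ N → u⁻¹ D.* (A D.* P N) ≈ Q N
      cancelled N = ≈-trans (u⁻¹ D.* (A D.* P N)) (u⁻¹ D.* (u D.* Q N)) (Q N)
        (*-cong u⁻¹ u⁻¹ (A D.* P N) (u D.* Q N) (≈-refl u⁻¹) (*-cong A u (P N) (Q N) A≈u
          (∏-cong N (λ k → 1ℂ D.- B k) (λ k → 1ℂ D.- y ^ suc k) (λ k → ∸-cong 1ℂ 1ℂ (B k) (y ^ suc k) (≈-refl 1ℂ) (B≈ k)))))
        (cancel u u⁻¹ (Q N) unit)

    summable-power : ∀ {f} n → Summable f → Summable (power f n)
    summable-power zero    hf = summable-const 1ℤ
    summable-power (suc n) hf = summable-⊛ hf (summable-power n hf)

    hasSum-power : ∀ y → Point y → ∀ {f} n → Summable f → ∀ w → HasSum y f w → HasSum y (power f n) (w ^ n)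
    hasSum-power y hy zero    hf w h = hasSum-monomial y 0
    hasSum-power y hy (suc n) hf w h = hasSum-⊛ y hy hf (summable-power n hf) w (w ^ n) h (hasSum-power y hy n hf w h)

    shifts-monomial : ∀ k f → shifts k f ≗ monomial k ⊛ f
    shifts-monomial zero    f n = sym (⊛-identityˡ f n)
    shifts-monomial (suc k) f n = sym (trans (shift-⊛ (monomial k) f n) (shift-cong n))
      where
      shift-cong : shift (monomial k ⊛ f) ≗ shift (shifts k f)
      shift-cong zero    = refl
      shift-cong (suc n) = sym (shifts-monomial k f n)

    hasSum-shifts : ∀ y → Point y → ∀ k {f} → Summable f → ∀ w → HasSum y f w → HasSum y (shifts k f) (y ^ k D.* w)
    hasSum-shifts y hy k {f} hf w h = hasSum-cong y (y ^ k D.* w) (λ n → sym (shifts-monomial k f n))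
      (hasSum-⊛ y hy (summable-monomial k) hf (y ^ k) w (hasSum-monomial y k) h)

    hasSum-^ᶻ : ∀ y → Point y → ∀ d w → HasSum y (V d euler) (value w) → ∀ r → HasSum y (eulerPower d r) (w ^ᶻ r)
    hasSum-^ᶻ y hy d w h (+ n)    = hasSum-power y hy n (summable-gap d 0 summable-euler) (value w) h
    hasSum-^ᶻ y hy d w h -[1+ n ] = hasSum-power y hy (suc n) (summable-gap d 0 summable-partitions) (inverse w)
      (hasSum-inverse y hy (summable-gap d 0 summable-euler) (summable-gap d 0 summable-partitions) (V-inverse d) (value w) (inverse w) (isInverse w) h)

module ModularForms where
  import Data.Integer.Properties as ℤₚ
  import Data.Nat.Properties as ℕₚ
  import Data.Rational.Properties as ℚₚ
  open import Data.Integer.Base as ℤ using (ℤ; +_; -[1+_]; 0ℤ; 1ℤ)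
  open import Data.Integer.Solver using () renaming (module +-*-Solver to ℤSolver)
  open import Data.List.Base using (List; []; _∷_; map; _++_; replicate)
  open import Data.Nat.Base as ℕ using (ℕ; zero; suc; NonZero; pred)
  open import Data.Product.Base using (_×_; _,_; proj₁; proj₂)
  open import Data.Rational.Base as ℚ using (ℚ; 1ℚ)
  open import Defs as D using (ℂ; ℂˣ; value; inverse; isInverse; _^ᶻ_; ℍ; point; _⊙_; EtaFactor; _↑_; _≈_; 1ℂ; 0ℂ; σ; _·_; _^_; ∏)
  open import Function.Base using (_∘_)
  open import Relation.Binary.PropositionalEquality
  open PowerSeries
  open Divisors
  open Analysis
  open GSolver using () renaming (solve to Gsolve; _:*_ to _⊗_; _:-_ to _⊝_; _:=_ to _≔_)

  V-0 : ∀ f → V 0 f ≗ f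
  V-0 f zero    = refl
  V-0 f (suc n) = V-0 (tail f) n

  fromℕ-/ : ∀ n → + n ℚ./ 1 ≡ fromℕ n
  fromℕ-/ n = refl

  E₂-series-1+ : const 1ℤ ⊕ (λ i → ℤ.- (+ 24) ℤ.* σ₁-series i) ≗ E₂-series
  E₂-series-1+ n = cong (ℤ._+_ (const 1ℤ n)) (sym (ℤₚ.neg-distribˡ-* (+ 24) (σ₁-series n)))

  raise lower : ℕ → ℤ → ℕ
  raise δ (+ n)    = n ℕ.* δ
  raise δ -[1+ n ] = 0
  lower δ (+ n)    = 0
  lower δ -[1+ n ] = suc n ℕ.* δ

  raises lowers : List EtaFactor → ℕ
  raises []           = 0
  raises (δ ↑ r ∷ fs) = raise δ r ℕ.+ raises fs
  lowers []           = 0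
  lowers (δ ↑ r ∷ fs) = lower δ r ℕ.+ lowers fs

  factors : List EtaFactor → List (ℕ × ℤ)
  factors []           = []
  factors (δ ↑ r ∷ fs) = (pred δ , r) ∷ factors fs

  swap-units : ∀ u u⁻¹ v v⁻¹ → u D.* u⁻¹ ≈ 1ℂ → v D.* v⁻¹ ≈ 1ℂ → (u⁻¹ D.* v) D.* (v⁻¹ D.* u) ≈ 1ℂ
  swap-units u u⁻¹ v v⁻¹ h k = ≈-trans ((u⁻¹ D.* v) D.* (v⁻¹ D.* u)) ((u D.* u⁻¹) D.* (v D.* v⁻¹)) 1ℂ
    (pointwise⇒≈ ((u⁻¹ D.* v) D.* (v⁻¹ D.* u)) ((u D.* u⁻¹) D.* (v D.* v⁻¹)) (λ m →
      Gsolve 4 (λ u w v x → (w ⊗ v) ⊗ (x ⊗ u) ≔ (u ⊗ w) ⊗ (v ⊗ x)) refl (u ! m) (u⁻¹ ! m) (v ! m) (v⁻¹ ! m)))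
    (≈-trans ((u D.* u⁻¹) D.* (v D.* v⁻¹)) (1ℂ D.* 1ℂ) 1ℂ (*-cong (u D.* u⁻¹) 1ℂ (v D.* v⁻¹) 1ℂ h k) (pointwise⇒≈ (1ℂ D.* 1ℂ) 1ℂ (λ _ → *ᴳ-identityˡ 1ᴳ)))

  *-identityʳᶜ : ∀ w → w D.* 1ℂ ≈ w
  *-identityʳᶜ w = pointwise⇒≈ (w D.* 1ℂ) w (λ m → *ᴳ-identityʳ (w ! m))

  positive-power : ∀ u s s⁻¹ v n δ → s ≈ u ^ δ → s D.* s⁻¹ ≈ 1ℂ → v ^ n ≈ u ^ (n ℕ.* δ) D.* 1ℂ D.* (s⁻¹ D.* v) ^ n
  positive-power u s s⁻¹ v n δ e h = ≈-trans (v ^ n) ((s D.* (s⁻¹ D.* v)) ^ n) (u ^ (n ℕ.* δ) D.* 1ℂ D.* (s⁻¹ D.* v) ^ n)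
    (^-cong v (s D.* (s⁻¹ D.* v)) n (≈-sym (s D.* (s⁻¹ D.* v)) v (cancel s⁻¹ s v (≈-trans (s⁻¹ D.* s) (s D.* s⁻¹) 1ℂ (*-commᶜ s⁻¹ s) h))))
    (≈-trans ((s D.* (s⁻¹ D.* v)) ^ n) (s ^ n D.* (s⁻¹ D.* v) ^ n) (u ^ (n ℕ.* δ) D.* 1ℂ D.* (s⁻¹ D.* v) ^ n) (*-^ᶜ s (s⁻¹ D.* v) n)
      (*-cong (s ^ n) (u ^ (n ℕ.* δ) D.* 1ℂ) ((s⁻¹ D.* v) ^ n) ((s⁻¹ D.* v) ^ n)
        (≈-trans (s ^ n) (u ^ (n ℕ.* δ)) (u ^ (n ℕ.* δ) D.* 1ℂ)
          (≈-trans (s ^ n) ((u ^ δ) ^ n) (u ^ (n ℕ.* δ)) (^-cong s (u ^ δ) n e) (≈-sym (u ^ (n ℕ.* δ)) ((u ^ δ) ^ n) (^-*ᶜ u n δ)))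
          (≈-sym (u ^ (n ℕ.* δ) D.* 1ℂ) (u ^ (n ℕ.* δ)) (*-identityʳᶜ (u ^ (n ℕ.* δ)))))
        (≈-refl ((s⁻¹ D.* v) ^ n))))

  negative-power : ∀ u⁻¹ s s⁻¹ v⁻¹ n δ → s⁻¹ ≈ u⁻¹ ^ δ → s D.* s⁻¹ ≈ 1ℂ → v⁻¹ ^ n ≈ 1ℂ D.* u⁻¹ ^ (n ℕ.* δ) D.* (v⁻¹ D.* s) ^ n
  negative-power u⁻¹ s s⁻¹ v⁻¹ n δ e h = ≈-trans (v⁻¹ ^ n) (u⁻¹ ^ (n ℕ.* δ) D.* 1ℂ D.* (s D.* v⁻¹) ^ n) (1ℂ D.* u⁻¹ ^ (n ℕ.* δ) D.* (v⁻¹ D.* s) ^ n)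
    (positive-power u⁻¹ s⁻¹ s v⁻¹ n δ e (≈-trans (s⁻¹ D.* s) (s D.* s⁻¹) 1ℂ (*-commᶜ s⁻¹ s) h))
    (*-cong (u⁻¹ ^ (n ℕ.* δ) D.* 1ℂ) (1ℂ D.* u⁻¹ ^ (n ℕ.* δ)) ((s D.* v⁻¹) ^ n) ((v⁻¹ D.* s) ^ n)
      (*-commᶜ (u⁻¹ ^ (n ℕ.* δ)) 1ℂ) (^-cong (s D.* v⁻¹) (v⁻¹ D.* s) n (*-commᶜ s v⁻¹)))

  -- With u = exp(πi z / 12) and w = η(δz) this is the infinite product ∏ (1 - qⁿᵟ).
  product : ∀ u u⁻¹ → u D.* u⁻¹ ≈ 1ℂ → ℕ → ℂˣ → ℂˣ
  product u u⁻¹ h δ w = record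
    { value = u⁻¹ ^ δ D.* value w ; inverse = inverse w D.* u ^ δ
    ; isInverse = swap-units (u ^ δ) (u⁻¹ ^ δ) (value w) (inverse w) (inverse-^ u u⁻¹ δ h) (isInverse w) }

  ^ᶻ-product : ∀ u u⁻¹ (h : u D.* u⁻¹ ≈ 1ℂ) δ w r → w ^ᶻ r ≈ u ^ raise δ r D.* u⁻¹ ^ lower δ r D.* product u u⁻¹ h δ w ^ᶻ r
  ^ᶻ-product u u⁻¹ h δ w (+ n)    = positive-power u (u ^ δ) (u⁻¹ ^ δ) (value w) n δ (≈-refl (u ^ δ)) (inverse-^ u u⁻¹ δ h)
  ^ᶻ-product u u⁻¹ h δ w -[1+ n ] = negative-power u⁻¹ (u ^ δ) (u⁻¹ ^ δ) (inverse w) (suc n) δ (≈-refl (u⁻¹ ^ δ)) (inverse-^ u u⁻¹ δ h)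

  combine-powers : ∀ u w a a′ b b′ x x′ → (u ^ a D.* w ^ b D.* x) D.* (u ^ a′ D.* w ^ b′ D.* x′) ≈ u ^ (a ℕ.+ a′) D.* w ^ (b ℕ.+ b′) D.* (x D.* x′)
  combine-powers u w a a′ b b′ x x′ = ≈-trans ((u ^ a D.* w ^ b D.* x) D.* (u ^ a′ D.* w ^ b′ D.* x′)) ((u ^ a D.* u ^ a′) D.* (w ^ b D.* w ^ b′) D.* (x D.* x′)) (u ^ (a ℕ.+ a′) D.* w ^ (b ℕ.+ b′) D.* (x D.* x′))
    (pointwise⇒≈ ((u ^ a D.* w ^ b D.* x) D.* (u ^ a′ D.* w ^ b′ D.* x′)) ((u ^ a D.* u ^ a′) D.* (w ^ b D.* w ^ b′) D.* (x D.* x′)) (λ m →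
      Gsolve 6 (λ p p′ r r′ x x′ → (p ⊗ r ⊗ x) ⊗ (p′ ⊗ r′ ⊗ x′) ≔ (p ⊗ p′) ⊗ (r ⊗ r′) ⊗ (x ⊗ x′)) refl ((u ^ a) ! m) ((u ^ a′) ! m) ((w ^ b) ! m) ((w ^ b′) ! m) (x ! m) (x′ ! m)))
    (*-cong ((u ^ a D.* u ^ a′) D.* (w ^ b D.* w ^ b′)) (u ^ (a ℕ.+ a′) D.* w ^ (b ℕ.+ b′)) (x D.* x′) (x D.* x′)
      (*-cong (u ^ a D.* u ^ a′) (u ^ (a ℕ.+ a′)) (w ^ b D.* w ^ b′) (w ^ (b ℕ.+ b′))
        (≈-sym (u ^ (a ℕ.+ a′)) (u ^ a D.* u ^ a′) (^-+ᶜ u a a′)) (≈-sym (w ^ (b ℕ.+ b′)) (w ^ b D.* w ^ b′) (^-+ᶜ w b b′)))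
      (≈-refl (x D.* x′)))

  combine-factors : ∀ u w a a′ b b′ x x′ v v′ → v ≈ u ^ a D.* w ^ b D.* x → v′ ≈ u ^ a′ D.* w ^ b′ D.* x′ → v D.* v′ ≈ u ^ (a ℕ.+ a′) D.* w ^ (b ℕ.+ b′) D.* (x D.* x′)
  combine-factors u w a a′ b b′ x x′ v v′ h h′ = ≈-trans (v D.* v′) ((u ^ a D.* w ^ b D.* x) D.* (u ^ a′ D.* w ^ b′ D.* x′)) (u ^ (a ℕ.+ a′) D.* w ^ (b ℕ.+ b′) D.* (x D.* x′))
    (*-cong v (u ^ a D.* w ^ b D.* x) v′ (u ^ a′ D.* w ^ b′ D.* x′) h h′) (combine-powers u w a a′ b b′ x x′)

  absorb-powers : ∀ u w y k b a x → a ≡ k ℕ.* 24 ℕ.+ b → u D.* w ≈ 1ℂ → y ≈ u ^ 24 → u ^ a D.* w ^ b D.* x ≈ y ^ k D.* x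
  absorb-powers u w y k b .(k ℕ.* 24 ℕ.+ b) x refl h e = *-cong (u ^ (k ℕ.* 24 ℕ.+ b) D.* w ^ b) (y ^ k) x x
    (≈-trans (u ^ (k ℕ.* 24 ℕ.+ b) D.* w ^ b) ((u ^ (k ℕ.* 24) D.* u ^ b) D.* w ^ b) (y ^ k)
      (*-cong (u ^ (k ℕ.* 24 ℕ.+ b)) (u ^ (k ℕ.* 24) D.* u ^ b) (w ^ b) (w ^ b) (^-+ᶜ u (k ℕ.* 24) b) (≈-refl (w ^ b)))
      (≈-trans ((u ^ (k ℕ.* 24) D.* u ^ b) D.* w ^ b) (u ^ (k ℕ.* 24) D.* (u ^ b D.* w ^ b)) (y ^ k)
        (pointwise⇒≈ ((u ^ (k ℕ.* 24) D.* u ^ b) D.* w ^ b) (u ^ (k ℕ.* 24) D.* (u ^ b D.* w ^ b)) (λ m → *ᴳ-assoc ((u ^ (k ℕ.* 24)) ! m) ((u ^ b) ! m) ((w ^ b) ! m)))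
        (≈-trans (u ^ (k ℕ.* 24) D.* (u ^ b D.* w ^ b)) ((u ^ 24) ^ k D.* 1ℂ) (y ^ k)
          (*-cong (u ^ (k ℕ.* 24)) ((u ^ 24) ^ k) (u ^ b D.* w ^ b) 1ℂ (^-*ᶜ u k 24) (inverse-^ u w b h))
          (≈-trans ((u ^ 24) ^ k D.* 1ℂ) ((u ^ 24) ^ k) (y ^ k) (*-identityʳᶜ ((u ^ 24) ^ k)) (≈-sym (y ^ k) ((u ^ 24) ^ k) (^-cong y (u ^ 24) k e))))))
    (≈-refl x)

  open D.ModularFunctions using (π; exp; E₂; isE₂; E₄; isE₄; η; isη)

  record QExpansions (F : D.ModularFunctions) (z : ℍ) (R : Radius) (y : ℂ) : Set where
    open Sums R
    field
      y-point        : Point y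
      E₂-expansion-1 : HasSum y E₂-series (E₂ F z)
      E₄-expansion-1 : HasSum y E₄-series (E₄ F z)
      E₂-expansion   : ∀ d → HasSum y (V d E₂-series) (E₂ F (suc d ⊙ z))
      E₄-expansion   : ∀ d → HasSum y (V d E₄-series) (E₄ F (suc d ⊙ z))
      η-expansion    : ∀ fs k → raises fs ≡ k ℕ.* 24 ℕ.+ lowers fs → HasSum y (shifts k (etaProduct (factors fs))) (D.Forms.η[_] F fs z)
      summable-E₂    : Summable E₂-series

  -- The limits of the truncated sums and products, given the values y, u, u⁻¹ of
  -- exp(2πi z), exp(πi z / 12), exp(-πi z / 12) and their behaviour under z ↦ δz.
  module Evaluation (F : D.ModularFunctions) (z : ℍ) (R : Radius) (y u u⁻¹ : ℂ) (y-point : Sums.Point R y)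
    (y-exp : exp F ((+ 2 ℚ./ 1) · (D.ofReal (π F) D.* D.𝕚 D.* point z)) ≈ y)
    (y-multiple : ∀ d → exp F ((+ 2 ℚ./ 1) · (D.ofReal (π F) D.* D.𝕚 D.* point (suc d ⊙ z))) ≈ y ^ suc d)
    (u-multiple : ∀ d → exp F ((+ 1 ℚ./ 12) · (D.ofReal (π F) D.* D.𝕚 D.* point (suc d ⊙ z))) ≈ u ^ suc d)
    (u-inverse : u D.* u⁻¹ ≈ 1ℂ) (y-u : y ≈ u ^ 24) where
    open D.Forms F using (η[_])
    open Exponential F
    open Sums R
    open Series-sums R
    open Growth R using (summable-euler; summable-partitions; summable-σ₁; summable-σ₃)
    open Values R

    summable-E₂ : Summable E₂-series
    summable-E₂ = summable-cong E₂-series-1+ (summable-⊕ (summable-const 1ℤ) (summable-scale (ℤ.- (+ 24)) summable-σ₁))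

    hasSum-E₂-1 : HasSum y E₂-series (E₂ F z)
    hasSum-E₂-1 = hasSum-cong y (E₂ F z) E₂-series-1+
      (hasSum-1-c∑ y (exp F ((+ 2 ℚ./ 1) · (D.ofReal (π F) D.* D.𝕚 D.* point z))) y-exp y-point
        (+ 24 ℚ./ 1) (+ 24) refl (λ k → + σ 1 (suc k) ℚ./ 1) {σ₁-series} summable-σ₁ refl (λ k → cong fromℤ (σ₁-coefficient k)) (E₂ F z) (isE₂ F z))

    hasSum-E₄-1 : HasSum y E₄-series (E₄ F z)
    hasSum-E₄-1 = hasSum-1+c∑ y (exp F ((+ 2 ℚ./ 1) · (D.ofReal (π F) D.* D.𝕚 D.* point z))) y-exp y-point
      (+ 240 ℚ./ 1) (+ 240) refl (λ k → + σ 3 (suc k) ℚ./ 1) {divisorSeries cube} summable-σ₃ refl (λ k → cong fromℤ (σ₃-coefficient k)) (E₄ F z) (isE₄ F z)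

    module _ (d : ℕ) where
      point-nome : Point (y ^ suc d)
      point-nome = point-^ y (suc d) y-point

      hasSum-E₂ : HasSum y (V d E₂-series) (E₂ F (suc d ⊙ z))
      hasSum-E₂ = hasSum-V d y y-point summable-E₂ (E₂ F (suc d ⊙ z))
        (hasSum-cong (y ^ suc d) (E₂ F (suc d ⊙ z)) E₂-series-1+
          (hasSum-1-c∑ (y ^ suc d) (exp F ((+ 2 ℚ./ 1) · (D.ofReal (π F) D.* D.𝕚 D.* point (suc d ⊙ z)))) (y-multiple d) point-nome
            (+ 24 ℚ./ 1) (+ 24) refl (λ k → (+ σ 1 (suc k) ℚ./ 1)) {σ₁-series} summable-σ₁ refl (λ k → cong fromℤ (σ₁-coefficient k)) (E₂ F (suc d ⊙ z)) (isE₂ F (suc d ⊙ z))))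

      hasSum-E₄ : HasSum y (V d E₄-series) (E₄ F (suc d ⊙ z))
      hasSum-E₄ = hasSum-V d y y-point (summable-⊕ (summable-const 1ℤ) (summable-scale (+ 240) summable-σ₃)) (E₄ F (suc d ⊙ z))
        (hasSum-1+c∑ (y ^ suc d) (exp F ((+ 2 ℚ./ 1) · (D.ofReal (π F) D.* D.𝕚 D.* point (suc d ⊙ z)))) (y-multiple d) point-nome
            (+ 240 ℚ./ 1) (+ 240) refl (λ k → (+ σ 3 (suc k) ℚ./ 1)) {divisorSeries cube} summable-σ₃ refl (λ k → cong fromℤ (σ₃-coefficient k)) (E₄ F (suc d ⊙ z)) (isE₄ F (suc d ⊙ z)))

      nome′-multiple : ∀ k → exp F ((+ (2 ℕ.* suc k) ℚ./ 1) · (D.ofReal (π F) D.* D.𝕚 D.* point (suc d ⊙ z))) ≈ exp F ((+ 2 ℚ./ 1) · (D.ofReal (π F) D.* D.𝕚 D.* point (suc d ⊙ z))) ^ suc k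
      nome′-multiple k = exp-multiple ((+ 2 ℚ./ 1) · (D.ofReal (π F) D.* D.𝕚 D.* point (suc d ⊙ z))) (suc k) ((+ (2 ℕ.* suc k) ℚ./ 1) · (D.ofReal (π F) D.* D.𝕚 D.* point (suc d ⊙ z)))
        (λ m → ·-factor (+ (2 ℕ.* suc k) ℚ./ 1) (+ 2 ℚ./ 1) (fromℕ (suc k)) (D.ofReal (π F) D.* D.𝕚 D.* point (suc d ⊙ z)) m (double k))
        where
        double : ∀ k → + (2 ℕ.* suc k) ℚ./ 1 ≡ fromℕ (suc k) ℚ.* fromℕ 2
        double k = trans (fromℕ-/ (2 ℕ.* suc k)) (trans (fromℕ-* 2 (suc k)) (ℚₚ.*-comm (fromℕ 2) (fromℕ (suc k))))

      hasSum-euler-product : HasSum (y ^ suc d) euler (u⁻¹ ^ suc d D.* value (η F (suc d ⊙ z)))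
      hasSum-euler-product = hasSum-η (y ^ suc d) point-nome
        (exp F ((+ 1 ℚ./ 12) · (D.ofReal (π F) D.* D.𝕚 D.* point (suc d ⊙ z)))) (u ^ suc d) (u⁻¹ ^ suc d)
        (λ k → exp F ((+ (2 ℕ.* suc k) ℚ./ 1) · (D.ofReal (π F) D.* D.𝕚 D.* point (suc d ⊙ z)))) (value (η F (suc d ⊙ z)))
        (u-multiple d) (inverse-^ u u⁻¹ (suc d) u-inverse)
        (λ k → ≈-trans (exp F ((+ (2 ℕ.* suc k) ℚ./ 1) · (D.ofReal (π F) D.* D.𝕚 D.* point (suc d ⊙ z)))) ((exp F ((+ 2 ℚ./ 1) · (D.ofReal (π F) D.* D.𝕚 D.* point (suc d ⊙ z)))) ^ suc k) ((y ^ suc d) ^ suc k)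
          (nome′-multiple k) (^-cong (exp F ((+ 2 ℚ./ 1) · (D.ofReal (π F) D.* D.𝕚 D.* point (suc d ⊙ z)))) (y ^ suc d) (suc k) (y-multiple d)))
        (isη F (suc d ⊙ z))

      hasSum-eulerPower : ∀ r → HasSum y (eulerPower d r) (product u u⁻¹ u-inverse (suc d) (η F (suc d ⊙ z)) ^ᶻ r)
      hasSum-eulerPower = hasSum-^ᶻ y y-point d (product u u⁻¹ u-inverse (suc d) (η F (suc d ⊙ z)))
        (hasSum-V d y y-point summable-euler (value (product u u⁻¹ u-inverse (suc d) (η F (suc d ⊙ z)))) hasSum-euler-product)

      summable-eulerPower : ∀ r → Summable (eulerPower d r)
      summable-eulerPower (+ n)    = summable-power n (summable-gap d 0 summable-euler)
      summable-eulerPower -[1+ n ] = summable-power (suc n) (summable-gap d 0 summable-partitions)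

    record Factor (δ : ℕ) (w : ℂˣ) : Set where
      field
        unit  : ℂˣ
        powers : ∀ r → w ^ᶻ r ≈ u ^ raise δ r D.* u⁻¹ ^ lower δ r D.* unit ^ᶻ r
        sum   : ∀ r → HasSum y (eulerPower (pred δ) r) (unit ^ᶻ r)

    factor-suc : ∀ d → Factor (suc d) (η F (suc d ⊙ z))
    factor-suc d = record
      { unit  = product u u⁻¹ u-inverse (suc d) (η F (suc d ⊙ z))
      ; powers = ^ᶻ-product u u⁻¹ u-inverse (suc d) (η F (suc d ⊙ z))
      ; sum   = hasSum-eulerPower d }

    factor : ∀ δ .⦃ _ : NonZero δ ⦄ → Factor δ (η F (δ ⊙ z))
    factor (suc d) = factor-suc d

    record Quotient (fs : List EtaFactor) : Set where
      field
        unit  : ℂ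
        value≈ : η[ fs ] z ≈ u ^ raises fs D.* u⁻¹ ^ lowers fs D.* unit
        sum   : HasSum y (etaProduct (factors fs)) unit
        summ  : Summable (etaProduct (factors fs))

    quotient-[] : Quotient []
    quotient-[] = record
      { unit  = 1ℂ
      ; value≈ = pointwise⇒≈ 1ℂ (1ℂ D.* 1ℂ D.* 1ℂ) (λ m → sym (trans (cong (_*ᴳ 1ᴳ) (*ᴳ-identityˡ 1ᴳ)) (*ᴳ-identityˡ 1ᴳ)))
      ; sum   = hasSum-monomial y 0
      ; summ  = summable-const 1ℤ }

    quotient-∷ : ∀ δ .⦃ _ : NonZero δ ⦄ r fs → Factor δ (η F (δ ⊙ z)) → Quotient fs → Quotient (δ ↑ r ∷ fs)
    quotient-∷ δ r fs f t = record
      { unit  = Factor.unit f ^ᶻ r D.* Quotient.unit t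
      ; value≈ = combine-factors u u⁻¹ (raise δ r) (raises fs) (lower δ r) (lowers fs) (Factor.unit f ^ᶻ r) (Quotient.unit t)
          (η F (δ ⊙ z) ^ᶻ r) (η[ fs ] z) (Factor.powers f r) (Quotient.value≈ t)
      ; sum   = hasSum-⊛ y y-point (summable-eulerPower (pred δ) r) (Quotient.summ t) (Factor.unit f ^ᶻ r) (Quotient.unit t) (Factor.sum f r) (Quotient.sum t)
      ; summ  = summable-⊛ (summable-eulerPower (pred δ) r) (Quotient.summ t) }

    assemble : ∀ fs → Quotient fs
    assemble []           = quotient-[]
    assemble (δ ↑ r ∷ fs) = quotient-∷ δ r fs (factor δ) (assemble fs)

    hasSum-etaQuotient : ∀ fs k → raises fs ≡ k ℕ.* 24 ℕ.+ lowers fs → HasSum y (shifts k (etaProduct (factors fs))) (η[ fs ] z)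
    hasSum-etaQuotient fs k e = go (assemble fs)
      where
      go : Quotient fs → HasSum y (shifts k (etaProduct (factors fs))) (η[ fs ] z)
      go t = hasSum-≈ y (y ^ k D.* unit) (η[ fs ] z)
        (≈-sym (η[ fs ] z) (y ^ k D.* unit) (≈-trans (η[ fs ] z) (u ^ raises fs D.* u⁻¹ ^ lowers fs D.* unit) (y ^ k D.* unit)
          value≈ (absorb-powers u u⁻¹ y k (lowers fs) (raises fs) unit e u-inverse y-u)))
        (hasSum-shifts y y-point k summ unit sum)
        where open Quotient t

    qExpansions : QExpansions F z R y
    qExpansions = record
      { y-point = y-point ; E₂-expansion-1 = hasSum-E₂-1 ; E₄-expansion-1 = hasSum-E₄-1 ; E₂-expansion = hasSum-E₂ ; E₄-expansion = hasSum-E₄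
      ; η-expansion = hasSum-etaQuotient ; summable-E₂ = summable-E₂ }

  module Instantiation (F : D.ModularFunctions) (z : ℍ) where
    open Exponential F
    open Convergence F z

    point-! : ∀ d m → point (suc d ⊙ z) ! m ≡ real (fromℕ (suc d)) *ᴳ point z ! m
    point-! d m = real-· (+ suc d ℚ./ 1) (point z) m

    multiple : ∀ c d → exp F (c · (D.ofReal (π F) D.* D.𝕚 D.* point (suc d ⊙ z))) ≈ exp F (c · (D.ofReal (π F) D.* D.𝕚 D.* point z)) ^ suc d
    multiple c d = exp-multiple (c · (D.ofReal (π F) D.* D.𝕚 D.* point z)) (suc d) (c · (D.ofReal (π F) D.* D.𝕚 D.* point (suc d ⊙ z)))
      (·-scaled c (D.ofReal (π F) D.* D.𝕚) (point z) (point (suc d ⊙ z)) (fromℕ (suc d)) (point-! d))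

    open Evaluation F z R
      (exp F ((+ 2 ℚ./ 1) · (D.ofReal (π F) D.* D.𝕚 D.* point z)))
      (exp F ((+ 1 ℚ./ 12) · (D.ofReal (π F) D.* D.𝕚 D.* point z)))
      (exp F ((ℚ.- (+ 1 ℚ./ 12)) · (D.ofReal (π F) D.* D.𝕚 D.* point z)))
      nome-point
      (≈-refl (exp F ((+ 2 ℚ./ 1) · (D.ofReal (π F) D.* D.𝕚 D.* point z))))
      (multiple (+ 2 ℚ./ 1)) (multiple (+ 1 ℚ./ 12))
      (exp-inverse ((+ 1 ℚ./ 12) · (D.ofReal (π F) D.* D.𝕚 D.* point z)) ((ℚ.- (+ 1 ℚ./ 12)) · (D.ofReal (π F) D.* D.𝕚 D.* point z))
        (·-neg (+ 1 ℚ./ 12) (D.ofReal (π F) D.* D.𝕚 D.* point z)))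
      (exp-multiple ((+ 1 ℚ./ 12) · (D.ofReal (π F) D.* D.𝕚 D.* point z)) 24 ((+ 2 ℚ./ 1) · (D.ofReal (π F) D.* D.𝕚 D.* point z))
        (λ m → ·-factor (+ 2 ℚ./ 1) (+ 1 ℚ./ 12) (fromℕ 24) (D.ofReal (π F) D.* D.𝕚 D.* point z) m refl)) public

  -- Linear combinations, with lists that may end in missing zeros.
  dot : List ℤ → List Series → Series
  dot []       _        = zeros
  dot (c ∷ cs) []       = zeros
  dot (c ∷ cs) (f ∷ fs) = (λ n → c ℤ.* f n) ⊕ dot cs fs

  infixl 6 _+ᵛ_ _-ᵛ_

  _+ᵛ_ _-ᵛ_ : List ℤ → List ℤ → List ℤ
  []       +ᵛ ds       = ds
  (c ∷ cs) +ᵛ []       = c ∷ cs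
  (c ∷ cs) +ᵛ (d ∷ ds) = c ℤ.+ d ∷ cs +ᵛ ds
  cs -ᵛ ds = cs +ᵛ map ℤ.-_ ds

  unit : ℕ → ℤ → List ℤ
  unit i k = replicate i 0ℤ ++ k ∷ []

  dot-+ : ∀ cs ds fs n → dot (cs +ᵛ ds) fs n ≡ dot cs fs n ℤ.+ dot ds fs n
  dot-+ []       ds       fs       n = sym (ℤₚ.+-identityˡ (dot ds fs n))
  dot-+ (c ∷ cs) []       fs       n = sym (ℤₚ.+-identityʳ (dot (c ∷ cs) fs n))
  dot-+ (c ∷ cs) (d ∷ ds) []       n = refl
  dot-+ (c ∷ cs) (d ∷ ds) (f ∷ fs) n = trans (cong (ℤ._+_ ((c ℤ.+ d) ℤ.* f n)) (dot-+ cs ds fs n))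
    (ℤSolver.solve 5 (λ c d f s t → (c ℤSolver.:+ d) ℤSolver.:* f ℤSolver.:+ (s ℤSolver.:+ t) ℤSolver.:= (c ℤSolver.:* f ℤSolver.:+ s) ℤSolver.:+ (d ℤSolver.:* f ℤSolver.:+ t)) refl
      c d (f n) (dot cs fs n) (dot ds fs n))

  dot-neg : ∀ cs fs n → dot (map ℤ.-_ cs) fs n ≡ ℤ.- dot cs fs n
  dot-neg []       fs       n = refl
  dot-neg (c ∷ cs) []       n = refl
  dot-neg (c ∷ cs) (f ∷ fs) n = trans (cong₂ ℤ._+_ (sym (ℤₚ.neg-distribˡ-* c (f n))) (dot-neg cs fs n)) (sym (ℤₚ.neg-distrib-+ (c ℤ.* f n) (dot cs fs n)))

  dot-- : ∀ cs ds fs n → dot (cs -ᵛ ds) fs n ≡ dot cs fs n ℤ.- dot ds fs n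
  dot-- cs ds fs n = trans (dot-+ cs (map ℤ.-_ ds) fs n) (cong (ℤ._+_ (dot cs fs n)) (dot-neg ds fs n))

  dot-unit : ∀ i k fs n → dot (unit i k) fs n ≡ k ℤ.* nth zeros fs i n
  dot-unit zero    k []       n = sym (ℤₚ.*-zeroʳ k)
  dot-unit zero    k (f ∷ fs) n = ℤₚ.+-identityʳ (k ℤ.* f n)
  dot-unit (suc i) k []       n = sym (ℤₚ.*-zeroʳ k)
  dot-unit (suc i) k (f ∷ fs) n = trans (ℤₚ.+-identityˡ (dot (unit i k) fs n)) (dot-unit i k fs n)

  ·-· : ∀ a b c w → a ℚ.* b ≡ c → ∀ m → (c · w) ! m ≡ (a · (b · w)) ! m
  ·-· a b c w e m = trans (real-· c w m) (trans (cong (λ x → real x *ᴳ w ! m) (sym e)) (trans (cong (_*ᴳ w ! m) (real-* a b))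
    (trans (*ᴳ-assoc (real a) (real b) (w ! m)) (trans (cong (real a *ᴳ_) (sym (real-· b w m))) (sym (real-· a (b · w) m))))))

  over-1 : ℕ → ℤ → ℚ
  over-1 p n = n ℚ./ suc (p ℕ.^ 2)

  module RelationVector (Lv : Level) (Rel : Relation) where
    open Level Lv
    open Engine Lv using (formAt)
    open Instance Lv
    open Relation Rel
    open Relations Lv

    atoms : List Series
    atoms = (a 0 ⊖ a left) ⊛ (a 0 ⊖ a right) ∷ map (b ∘ proj₁) bTerms ++ map (F ∘ proj₁) formTerms

    weight : ℕ × ℤ → ℤ
    weight (j , x) = x ℤ.* Form.multiple (formAt j)

    vector : List ℤ
    vector = coefficient ∷ map proj₂ bTerms ++ map weight formTerms

    vector-relation : relationSeries Rel ≗ dot vector atoms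
    vector-relation n = trans (ℤₚ.+-assoc (coefficient ℤ.* ((a 0 ⊖ a left) ⊛ (a 0 ⊖ a right)) n) (bSeries Rel bTerms n) (formSeries Rel formTerms n))
      (cong (ℤ._+_ (coefficient ℤ.* ((a 0 ⊖ a left) ⊛ (a 0 ⊖ a right)) n)) (both bTerms))
      where
      fs : ∀ xs → formSeries Rel xs n ≡ dot (map weight xs) (map (F ∘ proj₁) xs) n
      fs []             = refl
      fs ((j , x) ∷ xs) = cong₂ ℤ._+_ (sym (ℤₚ.*-assoc x (Form.multiple (formAt j)) (F j n))) (fs xs)
      both : ∀ ys → bSeries Rel ys n ℤ.+ formSeries Rel formTerms n ≡
        dot (map proj₂ ys ++ map weight formTerms) (map (b ∘ proj₁) ys ++ map (F ∘ proj₁) formTerms) n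
      both []             = trans (ℤₚ.+-identityˡ (formSeries Rel formTerms n)) (fs formTerms)
      both ((i , x) ∷ ys) = trans (ℤₚ.+-assoc (x ℤ.* b i n) (bSeries Rel ys n) (formSeries Rel formTerms n)) (cong (ℤ._+_ (x ℤ.* b i n)) (both ys))

    vector-vanishes : relationSeries Rel ≗ zeros → dot vector atoms ≗ zeros
    vector-vanishes h n = trans (sym (vector-relation n)) (h n)

  module Combination (F : D.ModularFunctions) (z : ℍ) (R : Radius) (y : ℂ) (Q : QExpansions F z R y) where
    open QExpansions Q
    open Sums R
    open D.Forms using (η[_]; L; C[1,_]; C[_,_]; C[1,_∙_])
    open Values R
    open Series-sums R

    -- The number s w has the q-expansion with the given coordinates.
    record Expansion (s : ℤ) (A : List Series) (w : ℂ) (cs : List ℤ) : Set where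
      constructor expansion
      field sum : HasSum y (dot cs A) (fromℤ s · w)
    open Expansion

    exp-unit : ∀ s A i k {f} w v → HasSum y f v → nth zeros A i ≗ f → (∀ m → (fromℤ k · v) ! m ≡ (fromℤ s · w) ! m) → Expansion s A w (unit i k)
    exp-unit s A i k {f} w v h e p = expansion (hasSum-≈ y (fromℤ k · v) (fromℤ s · w) (pointwise⇒≈ (fromℤ k · v) (fromℤ s · w) p)
      (hasSum-cong y (fromℤ k · v) (λ n → sym (trans (dot-unit i k A n) (cong (k ℤ.*_) (e n)))) (hasSum-scale y k v h)))

    infixl 6 _⟨+⟩_ _⟨-⟩_

    _⟨+⟩_ : ∀ {s A w v cs ds} → Expansion s A w cs → Expansion s A v ds → Expansion s A (w D.+ v) (cs +ᵛ ds)
    _⟨+⟩_ {s} {A} {w} {v} {cs} {ds} (expansion h) (expansion k) = expansion (hasSum-≈ y (fromℤ s · w D.+ fromℤ s · v) (fromℤ s · (w D.+ v))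
      (pointwise⇒≈ (fromℤ s · w D.+ fromℤ s · v) (fromℤ s · (w D.+ v)) (λ m → trans (cong₂ _+ᴳ_ (real-· (fromℤ s) w m) (real-· (fromℤ s) v m))
        (trans (sym (*ᴳ-distribˡ (real (fromℤ s)) (w ! m) (v ! m))) (sym (real-· (fromℤ s) (w D.+ v) m)))))
      (hasSum-cong y (fromℤ s · w D.+ fromℤ s · v) (λ n → sym (dot-+ cs ds A n)) (hasSum-⊕ y (fromℤ s · w) (fromℤ s · v) h k)))

    _⟨-⟩_ : ∀ {s A w v cs ds} → Expansion s A w cs → Expansion s A v ds → Expansion s A (w D.- v) (cs -ᵛ ds)
    _⟨-⟩_ {s} {A} {w} {v} {cs} {ds} (expansion h) (expansion k) = expansion (hasSum-≈ y (fromℤ s · w D.- fromℤ s · v) (fromℤ s · (w D.- v))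
      (pointwise⇒≈ (fromℤ s · w D.- fromℤ s · v) (fromℤ s · (w D.- v)) (λ m → trans (cong₂ _-ᴳ_ (real-· (fromℤ s) w m) (real-· (fromℤ s) v m))
        (trans (Gsolve 3 (λ s w v → s ⊗ w ⊝ s ⊗ v ≔ s ⊗ (w ⊝ v)) refl (real (fromℤ s)) (w ! m) (v ! m)) (sym (real-· (fromℤ s) (w D.- v) m)))))
      (hasSum-cong y (fromℤ s · w D.- fromℤ s · v) (λ n → sym (dot-- cs ds A n)) (hasSum-⊖ y (fromℤ s · w) (fromℤ s · v) h k)))

    exp-0 : ∀ {s A} → Expansion s A 0ℂ []
    exp-0 {s} {A} = expansion (hasSum-≈ y 0ℂ (fromℤ s · 0ℂ) (pointwise⇒≈ 0ℂ (fromℤ s · 0ℂ) (λ m → sym (trans (real-· (fromℤ s) 0ℂ m) (*ᴳ-zeroʳ (real (fromℤ s)))))) (hasSum-zeros y))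

    exp-cong : ∀ {s A w cs} → Expansion s A w cs → ∀ v → (∀ m → w ! m ≡ v ! m) → Expansion s A v cs
    exp-cong {s} {A} {w} (expansion h) v e = expansion (hasSum-≈ y (fromℤ s · w) (fromℤ s · v) (·-cong (fromℤ s) w v (pointwise⇒≈ w v e)) h)

    exp-η : ∀ {s A} i c k fs ν → raises fs ≡ ν ℕ.* 24 ℕ.+ lowers fs → nth zeros A i ≗ shifts ν (etaProduct (factors fs)) → fromℤ s ℚ.* c ≡ fromℤ k →
      Expansion s A (c · η[_] F fs z) (unit i k)
    exp-η {s} {A} i c k fs ν e h p = exp-unit s A i k (c · η[_] F fs z) (η[_] F fs z) (η-expansion fs ν e) h (·-· (fromℤ s) c (fromℤ k) (η[_] F fs z) p)

    exp-E₄-1 : ∀ {s A} i c k → nth zeros A i ≗ at 2 0 E₄-series → fromℤ s ℚ.* c ≡ fromℤ k → Expansion s A (c · E₄ F z) (unit i k)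
    exp-E₄-1 {s} {A} i c k h p = exp-unit s A i k (c · E₄ F z) (E₄ F z) E₄-expansion-1
      (λ n → trans (h n) (trans (ℤₚ.*-identityˡ (1ℤ ℤ.* V 0 E₄-series n)) (trans (ℤₚ.*-identityˡ (V 0 E₄-series n)) (V-0 E₄-series n)))) (·-· (fromℤ s) c (fromℤ k) (E₄ F z) p)

    at-2 : ∀ d → at 2 d E₄-series ≗ (λ n → (+ suc d ℤ.* + suc d) ℤ.* V d E₄-series n)
    at-2 d n = sym (ℤₚ.*-assoc (+ suc d) (+ suc d) (V d E₄-series n))

    exp-scaled : ∀ {s A} i e c k {f} w → HasSum y f w → nth zeros A i ≗ (λ n → e ℤ.* f n) → fromℤ s ℚ.* c ≡ fromℤ (k ℤ.* e) → Expansion s A (c · w) (unit i k)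
    exp-scaled {s} {A} i e c k w H h p = exp-unit s A i k (c · w) (fromℤ e · w) (hasSum-scale y e w H) h
      (λ m → trans (sym (·-· (fromℤ k) (fromℤ e) (fromℤ (k ℤ.* e)) w (sym (fromℤ-* k e)) m)) (·-· (fromℤ s) c (fromℤ (k ℤ.* e)) w p m))

    exp-E₄ : ∀ {s A} i d c k → nth zeros A i ≗ at 2 d E₄-series → fromℤ s ℚ.* c ≡ fromℤ (k ℤ.* (+ suc d ℤ.* + suc d)) →
      Expansion s A (c · E₄ F (suc d ⊙ z)) (unit i k)
    exp-E₄ i d c k h p = exp-scaled i (+ suc d ℤ.* + suc d) c k (E₄ F (suc d ⊙ z)) (E₄-expansion d) (λ n → trans (h n) (at-2 d n)) p

    ℓ : ℕ → Series
    ℓ d = at 1 0 E₂-series ⊖ at 1 d E₂-series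

    L-sum : ∀ d → HasSum y (ℓ d) (L F (suc d) z)
    L-sum d = hasSum-≈ y (E₂ F z D.- fromℤ (+ suc d) · E₂ F (suc d ⊙ z)) (L F (suc d) z)
      (pointwise⇒≈ (E₂ F z D.- fromℤ (+ suc d) · E₂ F (suc d ⊙ z)) (L F (suc d) z) (λ m → refl))
      (hasSum-⊖ y (E₂ F z) (fromℤ (+ suc d) · E₂ F (suc d ⊙ z))
        (hasSum-cong y (E₂ F z) (λ n → sym (trans (ℤₚ.*-identityˡ (V 0 E₂-series n)) (V-0 E₂-series n))) E₂-expansion-1)
        (hasSum-scale y (+ suc d) (E₂ F (suc d ⊙ z)) (E₂-expansion d)))

    ℓ-summable : ∀ d → Summable (ℓ d)
    ℓ-summable d = summable-cong (λ n → cong (ℤ._+_ (at 1 0 E₂-series n)) (ℤₚ.-1*i≡-i (at 1 d E₂-series n)))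
      (summable-⊕ (summable-scale (+ 1) (summable-gap 0 0 summable-E₂)) (summable-scale ℤ.-1ℤ (summable-scale (+ suc d) (summable-gap d 0 summable-E₂))))

    exp-L : ∀ {s A} d₁ d₂ → nth zeros A 0 ≗ ℓ d₁ ⊛ ℓ d₂ → Expansion s A (L F (suc d₁) z D.* L F (suc d₂) z) (s ∷ [])
    exp-L {s} {A} d₁ d₂ h = exp-unit s A 0 s (L F (suc d₁) z D.* L F (suc d₂) z) (L F (suc d₁) z D.* L F (suc d₂) z)
      (hasSum-⊛ y y-point (ℓ-summable d₁) (ℓ-summable d₂) (L F (suc d₁) z) (L F (suc d₂) z) (L-sum d₁) (L-sum d₂)) h (λ m → refl)

    exp-square : ∀ {s A} d w → HasSum y (ℓ d) w → nth zeros A 0 ≗ ℓ d ⊛ ℓ d → Expansion s A (w ^ 2) (s ∷ [])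
    exp-square {s} {A} d w H h = exp-unit s A 0 s (w ^ 2) (w D.* w) (hasSum-⊛ y y-point (ℓ-summable d) (ℓ-summable d) w w H H) h (scaled w)
      where
      scaled : ∀ w m → (fromℤ s · (w D.* w)) ! m ≡ (fromℤ s · (w ^ 2)) ! m
      scaled w m = trans (real-· (fromℤ s) (w D.* w) m) (trans (cong (λ x → real (fromℤ s) *ᴳ (w ! m *ᴳ x)) (sym (*ᴳ-identityʳ (w ! m)))) (sym (real-· (fromℤ s) (w ^ 2) m)))

    -- Two numbers are equal when the difference of their coordinates is a linear relation.
    conclude : ∀ {d A w v cs ds} ρ → dot ρ A ≗ zeros → Expansion (+ suc d) A w cs → Expansion (+ suc d) A v ds → cs -ᵛ ds ≡ ρ → w ≈ v
    conclude {d} {A} {w} {v} {cs} {ds} ρ h (expansion H) (expansion K) e = cancel-· c⁻¹ (fromℤ (+ suc d)) w v unit-eq (hasSum-unique y (fromℤ (+ suc d) · w) (fromℤ (+ suc d) · v)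
      (hasSum-cong y (fromℤ (+ suc d) · w) same H) K)
      where
      c⁻¹ : ℚ
      c⁻¹ = + 1 ℚ./ suc d
      unit-eq : c⁻¹ ℚ.* fromℤ (+ suc d) ≡ 1ℚ
      unit-eq = inverse-ℕ (suc d)
      same : dot cs A ≗ dot ds A
      same n = ℤₚ.i-j≡0⇒i≡j (dot cs A n) (dot ds A n) (trans (sym (dot-- cs ds A n)) (trans (cong (λ r → dot r A n) e) (h n)))
      cancel-· : ∀ a c w v → a ℚ.* c ≡ 1ℚ → c · w ≈ c · v → w ≈ v
      cancel-· a c w v e h = ≈-trans w (a · (c · w)) v (pointwise⇒≈ w (a · (c · w)) (λ m → trans (sym (one w m)) (·-· a c 1ℚ w e m)))
        (≈-trans (a · (c · w)) (a · (c · v)) v (·-cong a (c · w) (c · v) h) (pointwise⇒≈ (a · (c · v)) v (λ m → trans (sym (·-· a c 1ℚ v e m)) (one v m))))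
        where
        one : ∀ w m → (1ℚ · w) ! m ≡ w ! m
        one w m = trans (real-· 1ℚ w m) (*ᴳ-identityˡ (w ! m))

    hasSum-pointwise : ∀ {f w v} → HasSum y f w → (∀ m → w ! m ≡ v ! m) → HasSum y f v
    hasSum-pointwise {f} {w} {v} h e = hasSum-≈ y w v (pointwise⇒≈ w v e) h

    -- The equations n ≡ suc d are for numerals, which are not literally successors.
    E₄-at : ∀ n .⦃ _ : NonZero n ⦄ d → n ≡ suc d → HasSum y (V d E₄-series) (E₄ F (n ⊙ z))
    E₄-at .(suc d) d refl = E₄-expansion d

    L-at : ∀ n .⦃ _ : NonZero n ⦄ d → n ≡ suc d → HasSum y (ℓ d) (L F n z)
    L-at .(suc d) d refl = hasSum-pointwise (L-sum d) (λ m → refl)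

    module _ {s : ℤ} {A : List Series} (d₁ d₂ : ℕ) (k₀ k₁ k₂ k₃ : ℤ) where
      private
        d₃ : ℕ
        d₃ = d₂ ℕ.+ d₁ ℕ.* suc d₂
        P₁ P₂ : ℤ
        P₁ = + suc d₁
        P₂ = + suc d₂
        c : ℤ → ℚ
        c n = n ℚ./ (suc (suc d₁ ℕ.^ 2) ℕ.* suc (suc d₂ ℕ.^ 2))

      exp-E₄-product : ∀ c → nth zeros A 4 ≗ at 2 d₃ E₄-series → fromℤ s ℚ.* c ≡ fromℤ (k₃ ℤ.* (+ suc d₃ ℤ.* + suc d₃)) →
        Expansion s A (c · E₄ F (_⊙_ (suc d₁ ℕ.* suc d₂) ⦃ ℕₚ.m*n≢0 (suc d₁) (suc d₂) ⦄ z)) (unit 4 k₃)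
      exp-E₄-product c h e = exp-scaled 4 (+ suc d₃ ℤ.* + suc d₃) c k₃ (E₄ F (_⊙_ (suc d₁ ℕ.* suc d₂) ⦃ ℕₚ.m*n≢0 (suc d₁) (suc d₂) ⦄ z))
        (E₄-at (suc d₁ ℕ.* suc d₂) ⦃ ℕₚ.m*n≢0 (suc d₁) (suc d₂) ⦄ d₃ refl) (λ n → trans (h n) (at-2 d₃ n)) e

      exp-L²-product : nth zeros A 0 ≗ ℓ d₃ ⊛ ℓ d₃ → Expansion s A (L F (suc d₁ ℕ.* suc d₂) ⦃ ℕₚ.m*n≢0 (suc d₁) (suc d₂) ⦄ z ^ 2) (s ∷ [])
      exp-L²-product h = exp-square d₃ (L F (suc d₁ ℕ.* suc d₂) ⦃ ℕₚ.m*n≢0 (suc d₁) (suc d₂) ⦄ z) (L-at (suc d₁ ℕ.* suc d₂) ⦃ ℕₚ.m*n≢0 (suc d₁) (suc d₂) ⦄ d₃ refl) h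

      exp-C₂ : ∀ n₁ n₂ .⦃ _ : NonZero n₁ ⦄ .⦃ _ : NonZero n₂ ⦄ → n₁ ≡ suc d₁ → n₂ ≡ suc d₂ → nth zeros A 0 ≗ ℓ d₁ ⊛ ℓ d₂ →
        nth zeros A 1 ≗ at 2 0 E₄-series → nth zeros A 2 ≗ at 2 d₁ E₄-series → nth zeros A 3 ≗ at 2 d₂ E₄-series → nth zeros A 4 ≗ at 2 d₃ E₄-series →
        fromℤ s ℚ.* c ((P₁ ℤ.^ 2 ℤ.- P₁ ℤ.+ + 1) ℤ.* (P₂ ℤ.^ 2 ℤ.- P₂ ℤ.+ + 1)) ≡ fromℤ k₀ →
        fromℤ s ℚ.* c (P₁ ℤ.^ 3 ℤ.* (P₂ ℤ.^ 2 ℤ.- P₂ ℤ.+ + 1)) ≡ fromℤ (k₁ ℤ.* (P₁ ℤ.* P₁)) →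
        fromℤ s ℚ.* c (P₂ ℤ.^ 3 ℤ.* (P₁ ℤ.^ 2 ℤ.- P₁ ℤ.+ + 1)) ≡ fromℤ (k₂ ℤ.* (P₂ ℤ.* P₂)) →
        fromℤ s ℚ.* c (P₁ ℤ.^ 3 ℤ.* P₂ ℤ.^ 3) ≡ fromℤ (k₃ ℤ.* (+ suc d₃ ℤ.* + suc d₃)) →
        Expansion s A (C[_,_] F n₁ n₂ z) ((s ∷ []) -ᵛ (unit 1 k₀ -ᵛ unit 2 k₁ -ᵛ unit 3 k₂ +ᵛ unit 4 k₃))
      exp-C₂ .(suc d₁) .(suc d₂) refl refl h h₀ h₁ h₂ h₃ e₀ e₁ e₂ e₃ = exp-cong
        (exp-L d₁ d₂ h ⟨-⟩ (exp-E₄-1 1 (c ((P₁ ℤ.^ 2 ℤ.- P₁ ℤ.+ + 1) ℤ.* (P₂ ℤ.^ 2 ℤ.- P₂ ℤ.+ + 1))) k₀ h₀ e₀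
          ⟨-⟩ exp-E₄ 2 d₁ (c (P₁ ℤ.^ 3 ℤ.* (P₂ ℤ.^ 2 ℤ.- P₂ ℤ.+ + 1))) k₁ h₁ e₁
          ⟨-⟩ exp-E₄ 3 d₂ (c (P₂ ℤ.^ 3 ℤ.* (P₁ ℤ.^ 2 ℤ.- P₁ ℤ.+ + 1))) k₂ h₂ e₂
          ⟨+⟩ exp-E₄-product (c (P₁ ℤ.^ 3 ℤ.* P₂ ℤ.^ 3)) h₃ e₃))
        _ (λ m → refl)

      exp-C₃ : ∀ n₁ n₂ .⦃ _ : NonZero n₁ ⦄ .⦃ _ : NonZero n₂ ⦄ → n₁ ≡ suc d₁ → n₂ ≡ suc d₂ → nth zeros A 0 ≗ ℓ d₃ ⊛ ℓ d₃ →
        nth zeros A 1 ≗ at 2 0 E₄-series → nth zeros A 2 ≗ at 2 d₁ E₄-series → nth zeros A 3 ≗ at 2 d₂ E₄-series → nth zeros A 4 ≗ at 2 d₃ E₄-series →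
        fromℤ s ℚ.* (1ℚ ℚ.- c (+ 2 ℤ.* P₁ ℤ.* P₂)) ≡ fromℤ k₀ →
        fromℤ s ℚ.* c (+ 2 ℤ.* P₁ ℤ.^ 3 ℤ.* P₂) ≡ fromℤ (k₁ ℤ.* (P₁ ℤ.* P₁)) →
        fromℤ s ℚ.* c (+ 2 ℤ.* P₁ ℤ.* P₂ ℤ.^ 3) ≡ fromℤ (k₂ ℤ.* (P₂ ℤ.* P₂)) →
        fromℤ s ℚ.* ((P₁ ℤ.^ 2 ℤ.* P₂ ℤ.^ 2 ℚ./ 1) ℚ.- c (+ 2 ℤ.* P₁ ℤ.^ 3 ℤ.* P₂ ℤ.^ 3)) ≡ fromℤ (k₃ ℤ.* (+ suc d₃ ℤ.* + suc d₃)) →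
        Expansion s A (C[1,_∙_] F n₁ n₂ z) ((s ∷ []) -ᵛ (unit 1 k₀ -ᵛ unit 2 k₁ -ᵛ unit 3 k₂ +ᵛ unit 4 k₃))
      exp-C₃ .(suc d₁) .(suc d₂) refl refl h h₀ h₁ h₂ h₃ e₀ e₁ e₂ e₃ = exp-cong
        (exp-L²-product h ⟨-⟩ (exp-E₄-1 1 (1ℚ ℚ.- c (+ 2 ℤ.* P₁ ℤ.* P₂)) k₀ h₀ e₀
          ⟨-⟩ exp-E₄ 2 d₁ (c (+ 2 ℤ.* P₁ ℤ.^ 3 ℤ.* P₂)) k₁ h₁ e₁
          ⟨-⟩ exp-E₄ 3 d₂ (c (+ 2 ℤ.* P₁ ℤ.* P₂ ℤ.^ 3)) k₂ h₂ e₂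
          ⟨+⟩ exp-E₄-product ((P₁ ℤ.^ 2 ℤ.* P₂ ℤ.^ 2 ℚ./ 1) ℚ.- c (+ 2 ℤ.* P₁ ℤ.^ 3 ℤ.* P₂ ℤ.^ 3)) h₃ e₃))
        _ (λ m → refl)

    exp-C₁ : ∀ {s A} n .⦃ _ : NonZero n ⦄ d k₁ k₂ → n ≡ suc d → let P = + suc d in
      nth zeros A 0 ≗ ℓ d ⊛ ℓ d → nth zeros A 1 ≗ at 2 0 E₄-series → nth zeros A 2 ≗ at 2 d E₄-series →
      fromℤ s ℚ.* over-1 (suc d) ((P ℤ.- + 1) ℤ.^ 2) ≡ fromℤ k₁ →
      fromℤ s ℚ.* over-1 (suc d) (P ℤ.^ 2 ℤ.* (P ℤ.- + 1) ℤ.^ 2) ≡ fromℤ (k₂ ℤ.* (P ℤ.* P)) →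
      Expansion s A (C[1,_] F n z) ((s ∷ []) -ᵛ (unit 1 k₁ +ᵛ unit 2 k₂))
    exp-C₁ .(suc d) d k₁ k₂ refl h₀ h₁ h₂ e₁ e₂ = let P = + suc d in exp-cong
      (exp-square d (L F (suc d) z) (L-sum d) h₀ ⟨-⟩ (exp-E₄-1 1 (over-1 (suc d) ((P ℤ.- + 1) ℤ.^ 2)) k₁ h₁ e₁
        ⟨+⟩ exp-E₄ 2 d (over-1 (suc d) (P ℤ.^ 2 ℤ.* (P ℤ.- + 1) ℤ.^ 2)) k₂ h₂ e₂))
      _ (λ m → refl)

    by-relation : ∀ Lv Rel d → Relations.relationSeries Lv Rel ≗ zeros → ∀ {w v cs ds} →
      Expansion (+ suc d) (RelationVector.atoms Lv Rel) w cs → Expansion (+ suc d) (RelationVector.atoms Lv Rel) v ds →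
      cs -ᵛ ds ≡ RelationVector.vector Lv Rel → w ≈ v
    by-relation Lv Rel d h = conclude {d} {RelationVector.atoms Lv Rel} (RelationVector.vector Lv Rel) (RelationVector.vector-vanishes Lv Rel h)

open import Defs
open import Data.List.Base using ([]; _∷_)
open import Data.Product.Base using (_×_; _,_)
open import Data.Rational.Base using (_/_)

module Identification where
  open import Relation.Binary.PropositionalEquality using (refl)
  open Levels
  open Analysis using (Radius; module Convergence)
  open ModularForms

  module Identities (F : ModularFunctions) (z : ℍ) (R : Radius) (y : ℂ) (Q : QExpansions F z R y) where
    open Combination F z R y Q

    identity-1-2 = by-relation level30 relation-1-2 4 holds-1-2
      (exp-C₁ 2 1 1 1 refl (λ _ → refl) (λ _ → refl) (λ _ → refl) refl refl)
      exp-0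
      refl

    identity-1-3 = by-relation level30 relation-1-3 4 holds-1-3
      (exp-C₁ 3 2 2 2 refl (λ _ → refl) (λ _ → refl) (λ _ → refl) refl refl)
      exp-0
      refl

    identity-1-5 = by-relation level30 relation-1-5 12 holds-1-5
      (exp-C₁ 5 4 8 8 refl (λ _ → refl) (λ _ → refl) (λ _ → refl) refl refl)
      ( exp-η 3 (576 / 13) 576 (1 ↑ 4 ∷ 5 ↑ 4 ∷ []) 1 refl (λ _ → refl) refl )
      refl

    identity-1-7 = by-relation level14 relation-1-7 24 holds-1-7
      (exp-C₁ 7 6 18 18 refl (λ _ → refl) (λ _ → refl) (λ _ → refl) refl refl)
      ( exp-η 3 (576 / 5) 2880 (1 ↑ 5 ∷ 2 ↑ -1 ∷ 7 ↑ 5 ∷ 14 ↑ -1 ∷ []) 1 refl (λ _ → refl) refl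
      ⟨+⟩ exp-η 4 (2304 / 5) 11520 (1 ↑ 2 ∷ 2 ↑ 2 ∷ 7 ↑ 2 ∷ 14 ↑ 2 ∷ []) 2 refl (λ _ → refl) refl )
      refl

    identity-1-11 = by-relation level22 relation-1-11 60 holds-1-11
      (exp-C₁ 11 10 50 50 refl (λ _ → refl) (λ _ → refl) (λ _ → refl) refl refl)
      ( exp-η 3 (17280 / 61) 17280 (1 ↑ 6 ∷ 2 ↑ -2 ∷ 11 ↑ 6 ∷ 22 ↑ -2 ∷ []) 1 refl (λ _ → refl) refl
      ⟨+⟩ exp-η 4 (118656 / 61) 118656 (1 ↑ 4 ∷ 11 ↑ 4 ∷ []) 2 refl (λ _ → refl) refl
      ⟨+⟩ exp-η 5 (276480 / 61) 276480 (1 ↑ 2 ∷ 2 ↑ 2 ∷ 11 ↑ 2 ∷ 22 ↑ 2 ∷ []) 3 refl (λ _ → refl) refl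
      ⟨+⟩ exp-η 6 (276480 / 61) 276480 (2 ↑ 4 ∷ 22 ↑ 4 ∷ []) 4 refl (λ _ → refl) refl )
      refl

    identity-2-3 = by-relation level30 relation-2-3 49 holds-2-3
      (exp-C₂ 1 2 21 14 9 6 2 3 refl refl (λ _ → refl) (λ _ → refl) (λ _ → refl) (λ _ → refl) (λ _ → refl) refl refl refl refl)
      ( exp-η 5 (-144 / 5) -1440 (1 ↑ 2 ∷ 2 ↑ 2 ∷ 3 ↑ 2 ∷ 6 ↑ 2 ∷ []) 1 refl (λ _ → refl) refl )
      refl

    identity-2-5 = by-relation level30 relation-2-5 129 holds-2-5
      (exp-C₂ 1 4 63 42 15 10 2 5 refl refl (λ _ → refl) (λ _ → refl) (λ _ → refl) (λ _ → refl) (λ _ → refl) refl refl refl refl)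
      ( exp-η 5 (48 / 13) 480 (1 ↑ -2 ∷ 2 ↑ 8 ∷ 5 ↑ 2 ∷ []) 1 refl (λ _ → refl) refl
      ⟨+⟩ exp-η 6 (-6000 / 13) -60000 (1 ↑ 2 ∷ 5 ↑ -2 ∷ 10 ↑ 8 ∷ []) 3 refl (λ _ → refl) refl )
      refl

    identity-2-7 = by-relation level14 relation-2-7 249 holds-2-7
      (exp-C₂ 1 6 129 86 21 14 2 7 refl refl (λ _ → refl) (λ _ → refl) (λ _ → refl) (λ _ → refl) (λ _ → refl) refl refl refl refl)
      ( exp-η 5 (288 / 5) 14400 (1 ↑ 5 ∷ 2 ↑ -1 ∷ 7 ↑ 5 ∷ 14 ↑ -1 ∷ []) 1 refl (λ _ → refl) refl
      ⟨+⟩ exp-η 6 (-336 / 25) -3360 (1 ↑ -2 ∷ 2 ↑ 6 ∷ 7 ↑ 6 ∷ 14 ↑ -2 ∷ []) 1 refl (λ _ → refl) refl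
      ⟨+⟩ exp-η 7 (8064 / 25) 80640 (1 ↑ 2 ∷ 2 ↑ 2 ∷ 7 ↑ 2 ∷ 14 ↑ 2 ∷ []) 2 refl (λ _ → refl) refl
      ⟨+⟩ exp-η 8 (-5136 / 25) -51360 (1 ↑ 6 ∷ 2 ↑ -2 ∷ 7 ↑ -2 ∷ 14 ↑ 6 ∷ []) 3 refl (λ _ → refl) refl )
      refl

    identity-3-5 = by-relation level30 relation-3-5 1299 holds-3-5
      (exp-C₂ 2 4 735 315 175 75 3 5 refl refl (λ _ → refl) (λ _ → refl) (λ _ → refl) (λ _ → refl) (λ _ → refl) refl refl refl refl)
      ( exp-η 5 (108 / 13) 10800 (1 ↑ 11 ∷ 2 ↑ -5 ∷ 3 ↑ -5 ∷ 5 ↑ -5 ∷ 6 ↑ 3 ∷ 10 ↑ 3 ∷ 15 ↑ 11 ∷ 30 ↑ -5 ∷ []) 1 refl (λ _ → refl) refl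
      ⟨+⟩ exp-η 6 (-1584 / 13) -158400 (1 ↑ 2 ∷ 2 ↑ -3 ∷ 3 ↑ -4 ∷ 5 ↑ -3 ∷ 6 ↑ 9 ∷ 10 ↑ 4 ∷ 15 ↑ 7 ∷ 30 ↑ -4 ∷ []) 2 refl (λ _ → refl) refl
      ⟨+⟩ exp-η 7 (-2376 / 13) -237600 (1 ↑ 4 ∷ 2 ↑ -3 ∷ 3 ↑ -2 ∷ 5 ↑ 2 ∷ 6 ↑ 5 ∷ 10 ↑ 1 ∷ 15 ↑ 0 ∷ 30 ↑ 1 ∷ []) 3 refl (λ _ → refl) refl
      ⟨+⟩ exp-η 8 (-5832 / 13) -583200 (1 ↑ 1 ∷ 2 ↑ -2 ∷ 3 ↑ -3 ∷ 5 ↑ 2 ∷ 6 ↑ 8 ∷ 10 ↑ -1 ∷ 15 ↑ 2 ∷ 30 ↑ 1 ∷ []) 4 refl (λ _ → refl) refl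
      ⟨+⟩ exp-η 9 (11448 / 13) 1144800 (1 ↑ 2 ∷ 2 ↑ -2 ∷ 3 ↑ 0 ∷ 5 ↑ -2 ∷ 6 ↑ 2 ∷ 10 ↑ 6 ∷ 15 ↑ 0 ∷ 30 ↑ 2 ∷ []) 5 refl (λ _ → refl) refl
      ⟨+⟩ exp-η 10 (33264 / 13) 3326400 (1 ↑ 1 ∷ 2 ↑ 2 ∷ 3 ↑ 4 ∷ 5 ↑ 3 ∷ 6 ↑ -3 ∷ 10 ↑ -2 ∷ 15 ↑ -4 ∷ 30 ↑ 7 ∷ []) 6 refl (λ _ → refl) refl
      ⟨+⟩ exp-η 11 (10080 / 13) 1008000 (1 ↑ 1 ∷ 2 ↑ 0 ∷ 3 ↑ -1 ∷ 5 ↑ -3 ∷ 6 ↑ 0 ∷ 10 ↑ 2 ∷ 15 ↑ 7 ∷ 30 ↑ 2 ∷ []) 7 refl (λ _ → refl) refl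
      ⟨+⟩ exp-η 12 (83520 / 13) 8352000 (1 ↑ 1 ∷ 2 ↑ -1 ∷ 3 ↑ -2 ∷ 5 ↑ 1 ∷ 6 ↑ 4 ∷ 10 ↑ -1 ∷ 15 ↑ 0 ∷ 30 ↑ 6 ∷ []) 8 refl (λ _ → refl) refl
      ⟨+⟩ exp-η 13 (145584 / 13) 14558400 (1 ↑ 0 ∷ 2 ↑ 1 ∷ 3 ↑ 0 ∷ 5 ↑ 2 ∷ 6 ↑ -1 ∷ 10 ↑ -3 ∷ 15 ↑ 2 ∷ 30 ↑ 7 ∷ []) 9 refl (λ _ → refl) refl
      ⟨+⟩ exp-η 14 (-117720 / 13) -11772000 (1 ↑ -2 ∷ 2 ↑ 3 ∷ 3 ↑ 5 ∷ 5 ↑ 3 ∷ 6 ↑ -4 ∷ 10 ↑ -4 ∷ 15 ↑ -4 ∷ 30 ↑ 11 ∷ []) 10 refl (λ _ → refl) refl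
      ⟨+⟩ exp-η 15 (-1944 / 1) -2527200 (1 ↑ 1 ∷ 2 ↑ 0 ∷ 3 ↑ 1 ∷ 5 ↑ 3 ∷ 6 ↑ 0 ∷ 10 ↑ -4 ∷ 15 ↑ -5 ∷ 30 ↑ 12 ∷ []) 11 refl (λ _ → refl) refl
      ⟨+⟩ exp-η 16 (158688 / 13) 15868800 (1 ↑ 0 ∷ 2 ↑ 1 ∷ 3 ↑ 1 ∷ 5 ↑ 2 ∷ 6 ↑ -2 ∷ 10 ↑ -3 ∷ 15 ↑ -3 ∷ 30 ↑ 12 ∷ []) 12 refl (λ _ → refl) refl
      ⟨+⟩ exp-η 17 (216000 / 13) 21600000 (1 ↑ -1 ∷ 2 ↑ 3 ∷ 3 ↑ 1 ∷ 5 ↑ 3 ∷ 6 ↑ -1 ∷ 10 ↑ -5 ∷ 15 ↑ -7 ∷ 30 ↑ 15 ∷ []) 13 refl (λ _ → refl) refl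
      ⟨+⟩ exp-η 18 (316224 / 13) 31622400 (1 ↑ 0 ∷ 2 ↑ 1 ∷ 3 ↑ 2 ∷ 5 ↑ 2 ∷ 6 ↑ -3 ∷ 10 ↑ -3 ∷ 15 ↑ -8 ∷ 30 ↑ 17 ∷ []) 15 refl (λ _ → refl) refl )
      refl

    identity-1-2∙3 = by-relation level30 relation-1-2∙3 24 holds-1-2∙3
      (exp-C₃ 1 2 19 6 6 19 2 3 refl refl (λ _ → refl) (λ _ → refl) (λ _ → refl) (λ _ → refl) (λ _ → refl) refl refl refl refl)
      ( exp-η 5 (288 / 5) 1440 (1 ↑ 2 ∷ 2 ↑ 2 ∷ 3 ↑ 2 ∷ 6 ↑ 2 ∷ []) 1 refl (λ _ → refl) refl )
      refl

    identity-1-2∙5 = by-relation level30 relation-1-2∙5 12 holds-1-2∙5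
      (exp-C₃ 1 4 11 2 2 11 2 5 refl refl (λ _ → refl) (λ _ → refl) (λ _ → refl) (λ _ → refl) (λ _ → refl) refl refl refl refl)
      ( exp-η 5 (2976 / 13) 2976 (1 ↑ -1 ∷ 2 ↑ 5 ∷ 5 ↑ 5 ∷ 10 ↑ -1 ∷ []) 1 refl (λ _ → refl) refl
      ⟨+⟩ exp-η 6 (-480 / 13) -480 (1 ↑ 5 ∷ 2 ↑ -1 ∷ 5 ↑ -1 ∷ 10 ↑ 5 ∷ []) 2 refl (λ _ → refl) refl )
      refl

    identity-1-2∙7 = by-relation level14 relation-1-2∙7 124 holds-1-2∙7
      (exp-C₃ 1 6 111 14 14 111 2 7 refl refl (λ _ → refl) (λ _ → refl) (λ _ → refl) (λ _ → refl) (λ _ → refl) refl refl refl refl)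
      ( exp-η 5 (10272 / 25) 51360 (1 ↑ -2 ∷ 2 ↑ 6 ∷ 7 ↑ 6 ∷ 14 ↑ -2 ∷ []) 1 refl (λ _ → refl) refl
      ⟨+⟩ exp-η 6 (-4608 / 25) -23040 (1 ↑ 2 ∷ 2 ↑ 2 ∷ 7 ↑ 2 ∷ 14 ↑ 2 ∷ []) 2 refl (λ _ → refl) refl
      ⟨+⟩ exp-η 7 (672 / 25) 3360 (1 ↑ 6 ∷ 2 ↑ -2 ∷ 7 ↑ -2 ∷ 14 ↑ 6 ∷ []) 3 refl (λ _ → refl) refl )
      refl

    identity-1-3∙5 = by-relation level30 relation-1-3∙5 649 holds-1-3∙5
      (exp-C₃ 2 4 575 75 75 575 3 5 refl refl (λ _ → refl) (λ _ → refl) (λ _ → refl) (λ _ → refl) (λ _ → refl) refl refl refl refl)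
      ( exp-η 5 (5976 / 13) 298800 (1 ↑ 11 ∷ 2 ↑ -5 ∷ 3 ↑ -5 ∷ 5 ↑ -5 ∷ 6 ↑ 3 ∷ 10 ↑ 3 ∷ 15 ↑ 11 ∷ 30 ↑ -5 ∷ []) 1 refl (λ _ → refl) refl
      ⟨+⟩ exp-η 6 (74592 / 13) 3729600 (1 ↑ 2 ∷ 2 ↑ -3 ∷ 3 ↑ -4 ∷ 5 ↑ -3 ∷ 6 ↑ 9 ∷ 10 ↑ 4 ∷ 15 ↑ 7 ∷ 30 ↑ -4 ∷ []) 2 refl (λ _ → refl) refl
      ⟨+⟩ exp-η 7 (-137808 / 13) -6890400 (1 ↑ 4 ∷ 2 ↑ -3 ∷ 3 ↑ -2 ∷ 5 ↑ 2 ∷ 6 ↑ 5 ∷ 10 ↑ 1 ∷ 15 ↑ 0 ∷ 30 ↑ 1 ∷ []) 3 refl (λ _ → refl) refl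
      ⟨+⟩ exp-η 8 (-85968 / 13) -4298400 (1 ↑ 1 ∷ 2 ↑ -2 ∷ 3 ↑ -3 ∷ 5 ↑ 2 ∷ 6 ↑ 8 ∷ 10 ↑ -1 ∷ 15 ↑ 2 ∷ 30 ↑ 1 ∷ []) 4 refl (λ _ → refl) refl
      ⟨+⟩ exp-η 9 (153072 / 13) 7653600 (1 ↑ 2 ∷ 2 ↑ -2 ∷ 3 ↑ 0 ∷ 5 ↑ -2 ∷ 6 ↑ 2 ∷ 10 ↑ 6 ∷ 15 ↑ 0 ∷ 30 ↑ 2 ∷ []) 5 refl (λ _ → refl) refl
      ⟨+⟩ exp-η 10 (-617184 / 13) -30859200 (1 ↑ 1 ∷ 2 ↑ 2 ∷ 3 ↑ 4 ∷ 5 ↑ 3 ∷ 6 ↑ -3 ∷ 10 ↑ -2 ∷ 15 ↑ -4 ∷ 30 ↑ 7 ∷ []) 6 refl (λ _ → refl) refl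
      ⟨+⟩ exp-η 11 (1513728 / 13) 75686400 (1 ↑ 1 ∷ 2 ↑ 0 ∷ 3 ↑ -1 ∷ 5 ↑ -3 ∷ 6 ↑ 0 ∷ 10 ↑ 2 ∷ 15 ↑ 7 ∷ 30 ↑ 2 ∷ []) 7 refl (λ _ → refl) refl
      ⟨+⟩ exp-η 12 (-2807424 / 13) -140371200 (1 ↑ 1 ∷ 2 ↑ -1 ∷ 3 ↑ -2 ∷ 5 ↑ 1 ∷ 6 ↑ 4 ∷ 10 ↑ -1 ∷ 15 ↑ 0 ∷ 30 ↑ 6 ∷ []) 8 refl (λ _ → refl) refl
      ⟨+⟩ exp-η 13 (-943200 / 13) -47160000 (1 ↑ 0 ∷ 2 ↑ 1 ∷ 3 ↑ 0 ∷ 5 ↑ 2 ∷ 6 ↑ -1 ∷ 10 ↑ -3 ∷ 15 ↑ 2 ∷ 30 ↑ 7 ∷ []) 9 refl (λ _ → refl) refl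
      ⟨+⟩ exp-η 14 (135504 / 1) 88077600 (1 ↑ -2 ∷ 2 ↑ 3 ∷ 3 ↑ 5 ∷ 5 ↑ 3 ∷ 6 ↑ -4 ∷ 10 ↑ -4 ∷ 15 ↑ -4 ∷ 30 ↑ 11 ∷ []) 10 refl (λ _ → refl) refl
      ⟨+⟩ exp-η 15 (3255696 / 13) 162784800 (1 ↑ 1 ∷ 2 ↑ 0 ∷ 3 ↑ 1 ∷ 5 ↑ 3 ∷ 6 ↑ 0 ∷ 10 ↑ -4 ∷ 15 ↑ -5 ∷ 30 ↑ 12 ∷ []) 11 refl (λ _ → refl) refl
      ⟨+⟩ exp-η 16 (-3409344 / 13) -170467200 (1 ↑ 0 ∷ 2 ↑ 1 ∷ 3 ↑ 1 ∷ 5 ↑ 2 ∷ 6 ↑ -2 ∷ 10 ↑ -3 ∷ 15 ↑ -3 ∷ 30 ↑ 12 ∷ []) 12 refl (λ _ → refl) refl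
      ⟨+⟩ exp-η 17 (586368 / 13) 29318400 (1 ↑ -1 ∷ 2 ↑ 3 ∷ 3 ↑ 1 ∷ 5 ↑ 3 ∷ 6 ↑ -1 ∷ 10 ↑ -5 ∷ 15 ↑ -7 ∷ 30 ↑ 15 ∷ []) 13 refl (λ _ → refl) refl
      ⟨+⟩ exp-η 18 (-10461312 / 13) -523065600 (1 ↑ 0 ∷ 2 ↑ 1 ∷ 3 ↑ 2 ∷ 5 ↑ 2 ∷ 6 ↑ -3 ∷ 10 ↑ -3 ∷ 15 ↑ -8 ∷ 30 ↑ 17 ∷ []) 15 refl (λ _ → refl) refl )
      refl

  module Final (F : ModularFunctions) (z : ℍ) where
    open Convergence F z
    open Instantiation F z
    open Identities F z R _ qExpansions public

open Identification

theorem5p1 : (F : ModularFunctions) → let open Forms F in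
    (z : ℍ) →
    (C[1, 2 ] z ≈ 0ℂ)
    × (C[1, 3 ] z ≈ 0ℂ)
    × (C[1, 5 ] z ≈
    (576 / 13) · η[ 1 ↑ 4 ∷ 5 ↑ 4 ∷ [] ] z)
    × (C[1, 7 ] z ≈
    (576 / 5) · η[ 1 ↑ 5 ∷ 2 ↑ -1 ∷ 7 ↑ 5 ∷ 14 ↑ -1 ∷ [] ] z
    + (2304 / 5) · η[ 1 ↑ 2 ∷ 2 ↑ 2 ∷ 7 ↑ 2 ∷ 14 ↑ 2 ∷ [] ] z)
    × (C[1, 11 ] z ≈
    (17280 / 61) · η[ 1 ↑ 6 ∷ 2 ↑ -2 ∷ 11 ↑ 6 ∷ 22 ↑ -2 ∷ [] ] z
    + (118656 / 61) · η[ 1 ↑ 4 ∷ 11 ↑ 4 ∷ [] ] z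
    + (276480 / 61) · η[ 1 ↑ 2 ∷ 2 ↑ 2 ∷ 11 ↑ 2 ∷ 22 ↑ 2 ∷ [] ] z
    + (276480 / 61) · η[ 2 ↑ 4 ∷ 22 ↑ 4 ∷ [] ] z)
    × (C[ 2 , 3 ] z ≈
    (-144 / 5) · η[ 1 ↑ 2 ∷ 2 ↑ 2 ∷ 3 ↑ 2 ∷ 6 ↑ 2 ∷ [] ] z)
    × (C[ 2 , 5 ] z ≈
    (48 / 13) · η[ 1 ↑ -2 ∷ 2 ↑ 8 ∷ 5 ↑ 2 ∷ [] ] z
    + (-6000 / 13) · η[ 1 ↑ 2 ∷ 5 ↑ -2 ∷ 10 ↑ 8 ∷ [] ] z)
    × (C[ 2 , 7 ] z ≈
    (288 / 5) · η[ 1 ↑ 5 ∷ 2 ↑ -1 ∷ 7 ↑ 5 ∷ 14 ↑ -1 ∷ [] ] z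
    + (-336 / 25) · η[ 1 ↑ -2 ∷ 2 ↑ 6 ∷ 7 ↑ 6 ∷ 14 ↑ -2 ∷ [] ] z
    + (8064 / 25) · η[ 1 ↑ 2 ∷ 2 ↑ 2 ∷ 7 ↑ 2 ∷ 14 ↑ 2 ∷ [] ] z
    + (-5136 / 25) · η[ 1 ↑ 6 ∷ 2 ↑ -2 ∷ 7 ↑ -2 ∷ 14 ↑ 6 ∷ [] ] z)
    × (C[ 3 , 5 ] z ≈
    (108 / 13) · η[ 1 ↑ 11 ∷ 2 ↑ -5 ∷ 3 ↑ -5 ∷ 5 ↑ -5 ∷ 6 ↑ 3 ∷ 10 ↑ 3 ∷ 15 ↑ 11 ∷ 30 ↑ -5 ∷ [] ] z
    + (-1584 / 13) · η[ 1 ↑ 2 ∷ 2 ↑ -3 ∷ 3 ↑ -4 ∷ 5 ↑ -3 ∷ 6 ↑ 9 ∷ 10 ↑ 4 ∷ 15 ↑ 7 ∷ 30 ↑ -4 ∷ [] ] z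
    + (-2376 / 13) · η[ 1 ↑ 4 ∷ 2 ↑ -3 ∷ 3 ↑ -2 ∷ 5 ↑ 2 ∷ 6 ↑ 5 ∷ 10 ↑ 1 ∷ 15 ↑ 0 ∷ 30 ↑ 1 ∷ [] ] z
    + (-5832 / 13) · η[ 1 ↑ 1 ∷ 2 ↑ -2 ∷ 3 ↑ -3 ∷ 5 ↑ 2 ∷ 6 ↑ 8 ∷ 10 ↑ -1 ∷ 15 ↑ 2 ∷ 30 ↑ 1 ∷ [] ] z
    + (11448 / 13) · η[ 1 ↑ 2 ∷ 2 ↑ -2 ∷ 3 ↑ 0 ∷ 5 ↑ -2 ∷ 6 ↑ 2 ∷ 10 ↑ 6 ∷ 15 ↑ 0 ∷ 30 ↑ 2 ∷ [] ] z
    + (33264 / 13) · η[ 1 ↑ 1 ∷ 2 ↑ 2 ∷ 3 ↑ 4 ∷ 5 ↑ 3 ∷ 6 ↑ -3 ∷ 10 ↑ -2 ∷ 15 ↑ -4 ∷ 30 ↑ 7 ∷ [] ] z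
    + (10080 / 13) · η[ 1 ↑ 1 ∷ 2 ↑ 0 ∷ 3 ↑ -1 ∷ 5 ↑ -3 ∷ 6 ↑ 0 ∷ 10 ↑ 2 ∷ 15 ↑ 7 ∷ 30 ↑ 2 ∷ [] ] z
    + (83520 / 13) · η[ 1 ↑ 1 ∷ 2 ↑ -1 ∷ 3 ↑ -2 ∷ 5 ↑ 1 ∷ 6 ↑ 4 ∷ 10 ↑ -1 ∷ 15 ↑ 0 ∷ 30 ↑ 6 ∷ [] ] z
    + (145584 / 13) · η[ 1 ↑ 0 ∷ 2 ↑ 1 ∷ 3 ↑ 0 ∷ 5 ↑ 2 ∷ 6 ↑ -1 ∷ 10 ↑ -3 ∷ 15 ↑ 2 ∷ 30 ↑ 7 ∷ [] ] z
    + (-117720 / 13) · η[ 1 ↑ -2 ∷ 2 ↑ 3 ∷ 3 ↑ 5 ∷ 5 ↑ 3 ∷ 6 ↑ -4 ∷ 10 ↑ -4 ∷ 15 ↑ -4 ∷ 30 ↑ 11 ∷ [] ] z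
    + (-1944 / 1) · η[ 1 ↑ 1 ∷ 2 ↑ 0 ∷ 3 ↑ 1 ∷ 5 ↑ 3 ∷ 6 ↑ 0 ∷ 10 ↑ -4 ∷ 15 ↑ -5 ∷ 30 ↑ 12 ∷ [] ] z
    + (158688 / 13) · η[ 1 ↑ 0 ∷ 2 ↑ 1 ∷ 3 ↑ 1 ∷ 5 ↑ 2 ∷ 6 ↑ -2 ∷ 10 ↑ -3 ∷ 15 ↑ -3 ∷ 30 ↑ 12 ∷ [] ] z
    + (216000 / 13) · η[ 1 ↑ -1 ∷ 2 ↑ 3 ∷ 3 ↑ 1 ∷ 5 ↑ 3 ∷ 6 ↑ -1 ∷ 10 ↑ -5 ∷ 15 ↑ -7 ∷ 30 ↑ 15 ∷ [] ] z
    + (316224 / 13) · η[ 1 ↑ 0 ∷ 2 ↑ 1 ∷ 3 ↑ 2 ∷ 5 ↑ 2 ∷ 6 ↑ -3 ∷ 10 ↑ -3 ∷ 15 ↑ -8 ∷ 30 ↑ 17 ∷ [] ] z)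
    × (C[1, 2 ∙ 3 ] z ≈
    (288 / 5) · η[ 1 ↑ 2 ∷ 2 ↑ 2 ∷ 3 ↑ 2 ∷ 6 ↑ 2 ∷ [] ] z)
    × (C[1, 2 ∙ 5 ] z ≈
    (2976 / 13) · η[ 1 ↑ -1 ∷ 2 ↑ 5 ∷ 5 ↑ 5 ∷ 10 ↑ -1 ∷ [] ] z
    + (-480 / 13) · η[ 1 ↑ 5 ∷ 2 ↑ -1 ∷ 5 ↑ -1 ∷ 10 ↑ 5 ∷ [] ] z)
    × (C[1, 2 ∙ 7 ] z ≈
    (10272 / 25) · η[ 1 ↑ -2 ∷ 2 ↑ 6 ∷ 7 ↑ 6 ∷ 14 ↑ -2 ∷ [] ] z
    + (-4608 / 25) · η[ 1 ↑ 2 ∷ 2 ↑ 2 ∷ 7 ↑ 2 ∷ 14 ↑ 2 ∷ [] ] z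
    + (672 / 25) · η[ 1 ↑ 6 ∷ 2 ↑ -2 ∷ 7 ↑ -2 ∷ 14 ↑ 6 ∷ [] ] z)
    × (C[1, 3 ∙ 5 ] z ≈
    (5976 / 13) · η[ 1 ↑ 11 ∷ 2 ↑ -5 ∷ 3 ↑ -5 ∷ 5 ↑ -5 ∷ 6 ↑ 3 ∷ 10 ↑ 3 ∷ 15 ↑ 11 ∷ 30 ↑ -5 ∷ [] ] z
    + (74592 / 13) · η[ 1 ↑ 2 ∷ 2 ↑ -3 ∷ 3 ↑ -4 ∷ 5 ↑ -3 ∷ 6 ↑ 9 ∷ 10 ↑ 4 ∷ 15 ↑ 7 ∷ 30 ↑ -4 ∷ [] ] z
    + (-137808 / 13) · η[ 1 ↑ 4 ∷ 2 ↑ -3 ∷ 3 ↑ -2 ∷ 5 ↑ 2 ∷ 6 ↑ 5 ∷ 10 ↑ 1 ∷ 15 ↑ 0 ∷ 30 ↑ 1 ∷ [] ] z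
    + (-85968 / 13) · η[ 1 ↑ 1 ∷ 2 ↑ -2 ∷ 3 ↑ -3 ∷ 5 ↑ 2 ∷ 6 ↑ 8 ∷ 10 ↑ -1 ∷ 15 ↑ 2 ∷ 30 ↑ 1 ∷ [] ] z
    + (153072 / 13) · η[ 1 ↑ 2 ∷ 2 ↑ -2 ∷ 3 ↑ 0 ∷ 5 ↑ -2 ∷ 6 ↑ 2 ∷ 10 ↑ 6 ∷ 15 ↑ 0 ∷ 30 ↑ 2 ∷ [] ] z
    + (-617184 / 13) · η[ 1 ↑ 1 ∷ 2 ↑ 2 ∷ 3 ↑ 4 ∷ 5 ↑ 3 ∷ 6 ↑ -3 ∷ 10 ↑ -2 ∷ 15 ↑ -4 ∷ 30 ↑ 7 ∷ [] ] z
    + (1513728 / 13) · η[ 1 ↑ 1 ∷ 2 ↑ 0 ∷ 3 ↑ -1 ∷ 5 ↑ -3 ∷ 6 ↑ 0 ∷ 10 ↑ 2 ∷ 15 ↑ 7 ∷ 30 ↑ 2 ∷ [] ] z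
    + (-2807424 / 13) · η[ 1 ↑ 1 ∷ 2 ↑ -1 ∷ 3 ↑ -2 ∷ 5 ↑ 1 ∷ 6 ↑ 4 ∷ 10 ↑ -1 ∷ 15 ↑ 0 ∷ 30 ↑ 6 ∷ [] ] z
    + (-943200 / 13) · η[ 1 ↑ 0 ∷ 2 ↑ 1 ∷ 3 ↑ 0 ∷ 5 ↑ 2 ∷ 6 ↑ -1 ∷ 10 ↑ -3 ∷ 15 ↑ 2 ∷ 30 ↑ 7 ∷ [] ] z
    + (135504 / 1) · η[ 1 ↑ -2 ∷ 2 ↑ 3 ∷ 3 ↑ 5 ∷ 5 ↑ 3 ∷ 6 ↑ -4 ∷ 10 ↑ -4 ∷ 15 ↑ -4 ∷ 30 ↑ 11 ∷ [] ] z
    + (3255696 / 13) · η[ 1 ↑ 1 ∷ 2 ↑ 0 ∷ 3 ↑ 1 ∷ 5 ↑ 3 ∷ 6 ↑ 0 ∷ 10 ↑ -4 ∷ 15 ↑ -5 ∷ 30 ↑ 12 ∷ [] ] z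
    + (-3409344 / 13) · η[ 1 ↑ 0 ∷ 2 ↑ 1 ∷ 3 ↑ 1 ∷ 5 ↑ 2 ∷ 6 ↑ -2 ∷ 10 ↑ -3 ∷ 15 ↑ -3 ∷ 30 ↑ 12 ∷ [] ] z
    + (586368 / 13) · η[ 1 ↑ -1 ∷ 2 ↑ 3 ∷ 3 ↑ 1 ∷ 5 ↑ 3 ∷ 6 ↑ -1 ∷ 10 ↑ -5 ∷ 15 ↑ -7 ∷ 30 ↑ 15 ∷ [] ] z
    + (-10461312 / 13) · η[ 1 ↑ 0 ∷ 2 ↑ 1 ∷ 3 ↑ 2 ∷ 5 ↑ 2 ∷ 6 ↑ -3 ∷ 10 ↑ -3 ∷ 15 ↑ -8 ∷ 30 ↑ 17 ∷ [] ] z)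
theorem5p1 F z = identity-1-2 , identity-1-3 , identity-1-5 , identity-1-7 , identity-1-11 ,
  identity-2-3 , identity-2-5 , identity-2-7 , identity-3-5 ,
  identity-1-2∙3 , identity-1-2∙5 , identity-1-2∙7 , identity-1-3∙5
  where open Final F z
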